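{- Let $q\ge 2$ be a fixed integer. For $k\ge 3$ and density $\Omega\left(\frac{1}{\mathrm{polylog}(r)}\right)\le\Delta\le 1$, suppose there exists an algorithm that runs in time $T(r)=\Omega(r)$ and solves the planted search vector $k$-SUM problem at density $\Delta$ (that is, planted search $k$-SUM over the groups $\mathbb{Z}_q^{m}$ with $m=\left\lceil\frac{k\log r}{\Delta\log q}\right\rceil$) with success probability $\gamma=\Omega\left(\frac{1}{\mathrm{polylog}(r)}\right)$. Then there is an algorithm that runs in time $\widetilde{O}\left(T\cdot(k/\gamma^2)^k\right)$ and solves the same problem with success probability $1-o\left(\frac{1}{\log r}\right)$.
   Context: All logarithms are base 2; algorithms may be randomized; $\widetilde O$ hides factors polylogarithmic in $r$; $\Delta=\Delta(r)$ may depend on $r$. Addition in $\mathbb{Z}_q^m$ is coordinatewise modulo $q$. Planted search $k$-SUM over groups $G^{(r)}$: sample $X_1,\dots,X_r$ i.i.d. uniformly from $G^{(r)}$; choose a uniformly random $S\subseteq[r]$ with $|S|=k$; let $i=\min S$ and replace $X_i$ by $-\sum_{j\in S,j\ne i}X_j$. An algorithm solves it with success probability $\epsilon$ if, on input $X=(X_1,\dots,X_r)$ so sampled, it outputs with probability at least $\epsilon$ (over $X$ and its coins) a set $S'\subseteq[r]$, $|S'|=k$, with $\sum_{i\in S'}X_i=0$. -}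

module Defs where

open import Data.Bool using (Bool; true; false; if_then_else_; _∧_)
open import Data.Fin using (Fin; zero; suc; toℕ)
import Data.Fin.Properties as Fin
open import Data.Fin.Subset using (Subset; inside; outside; ∣_∣; _-_)
open import Data.Integer using (+_)
open import Data.List using (List; []; _∷_; [_]; _++_; map; filter; length; lookup)
open import Data.Maybe using (Maybe; just; nothing)
import Data.Maybe as Maybe
open import Data.Nat using (ℕ; zero; suc; _+_; _*_; _∸_; _^_; _≤_; NonZero; _≟_)
open import Data.Nat.DivMod using (_mod_)
open import Data.Nat.Logarithm using (⌊log₂_⌋)
open import Data.Product using (∃; ∃-syntax; _×_; _,_)
open import Data.Rational as ℚ using (ℚ; 0ℚ; 1ℚ; Positive)
import Data.Rational.Properties as ℚ
open import Algebra.Definitions.RawSemiring ℚ.+-*-rawSemiring using (sum)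
  renaming (_^_ to _^ℚ_)
open import Data.Sum using (_⊎_)
open import Data.Vec using (Vec; []; _∷_; _[_]≔_; replicate; zipWith; toList)
import Data.Vec as Vec
import Data.Vec.Properties as Vec
open import Function.Bundles using (_⇔_)
open import Relation.Binary.PropositionalEquality using (_≡_)
open import Relation.Nullary using (¬_; does)

------------------------------------------------------------------------
-- Real numbers, as two-sided Dedekind cuts

record ℝ : Set₁ where
  field
    Lower Upper     : ℚ → Set
    lower-inhabited : ∃ Lower
    upper-inhabited : ∃ Upper
    lower-rounded   : ∀ {p} → Lower p ⇔ (∃[ s ] p ℚ.< s × Lower s)
    upper-rounded   : ∀ {p} → Upper p ⇔ (∃[ s ] s ℚ.< p × Upper s)
    disjoint        : ∀ {p} → ¬ (Lower p × Upper p)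
    located         : ∀ {p s} → p ℚ.< s → Lower p ⊎ Upper s

open ℝ public

infix 4 _≤ℝ_ _ℝ≤_

_≤ℝ_ : ℚ → ℝ → Set
p ≤ℝ x = ¬ Upper x p

_ℝ≤_ : ℝ → ℚ → Set
x ℝ≤ p = ¬ Lower x p

------------------------------------------------------------------------
-- Growth rates
--
-- log₂ r is replaced by ⌊log₂ r⌋ in asymptotic bounds only; for r ≥ 2 the two
-- differ by a factor of at most 2.

-- Junk value at 0.
recip : ℕ → ℚ
recip zero    = 0ℚ
recip (suc n) = + 1 ℚ./ suc n

fromℕ : ℕ → ℚ
fromℕ n = + n ℚ./ 1

Eventually : (ℕ → Set) → Set
Eventually P = ∃[ r₀ ] (∀ r → r₀ ≤ r → P r)

-- f = Ω(1 / polylog r)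
Ω[1/polylog] : (ℕ → ℝ) → Set
Ω[1/polylog] f =
  ∃[ C ] 0ℚ ℚ.< C ×
  (∃[ d ] Eventually λ r → C ℚ.* recip (⌊log₂ r ⌋ ^ d) ≤ℝ f r)

-- f = Ω(r)
Ω[r] : (ℕ → ℕ) → Set
Ω[r] f = ∃[ C ] 0ℚ ℚ.< C × (Eventually λ r → C ℚ.* fromℕ r ℚ.≤ fromℕ (f r))

-- f ≥ 1 − o(1 / log r)
1-o[1/log] : (ℕ → ℝ) → Set
1-o[1/log] f =
  ∀ C → 0ℚ ℚ.< C → Eventually λ r → 1ℚ ℚ.- C ℚ.* recip ⌊log₂ r ⌋ ≤ℝ f r

-- (k / g²)ᵏ
overhead : ℕ → (g : ℚ) .{{_ : Positive g}} → ℚ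
overhead k g = (fromℕ k ℚ.* (1/g ℚ.* 1/g)) ^ℚ k
  where 1/g = (ℚ.1/ g) {{ℚ.pos⇒nonZero g}}

-- T′ = Õ(T · (k / γ²)ᵏ).  As overhead k is continuous and decreasing, being
-- bounded by its value at γ r means being bounded by its value at every
-- positive rational g < γ r.
Õ[_·[_/_²]^k] : (ℕ → ℕ) → ℕ → (ℕ → ℝ) → (ℕ → ℕ) → Set
Õ[ T ·[ k / γ ²]^k] T′ =
  ∃[ C ] ∃[ d ] Eventually λ r →
    ∀ g .{{_ : Positive g}} → Lower (γ r) g →
    fromℕ (T′ r) ℚ.≤ fromℕ (C * ⌊log₂ r ⌋ ^ d * T r) ℚ.* overhead k g

------------------------------------------------------------------------
-- Finite randomised experiments

-- choose n f draws i uniformly from Fin n and continues as f i.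
data Rand (A : Set) : Set where
  return : A → Rand A
  choose : (n : ℕ) → (Fin n → Rand A) → Rand A

infixl 1 _>>=_

_>>=_ : {A B : Set} → Rand A → (A → Rand B) → Rand B
return a   >>= h = h a
choose n f >>= h = choose n λ i → f i >>= h

Pr : {A : Set} → (A → Bool) → Rand A → ℚ
Pr P (return a)   = if P a then 1ℚ else 0ℚ
Pr P (choose n f) = recip n ℚ.* sum (λ i → Pr P (f i))

-- P holds for every outcome of the random choices.
Surely : {A : Set} → (A → Set) → Rand A → Set
Surely P (return a)   = P a
Surely P (choose n f) = ∀ i → Surely P (f i)

-- For an empty list every event has probability 0.
uniform : {A : Set} → List A → Rand A
uniform xs = choose (length xs) λ i → return (lookup xs i)

iid : {A : Set} → Rand A → (n : ℕ) → Rand (Vec A n)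
iid D zero    = return []
iid D (suc n) = D >>= λ x → iid D n >>= λ xs → return (x ∷ xs)

------------------------------------------------------------------------
-- Algorithms: randomised WHILE programs over binary trees, i.e. over a heap
-- of immutable cons cells.  Every elementary step takes unit time.  Up to
-- factors logarithmic in the running time this is equivalent to the
-- random-access machine.

infixr 5 _∙_

data Tree : Set where
  nil : Tree
  _∙_ : Tree → Tree → Tree

head tail : Tree → Tree
head nil     = nil
head (a ∙ _) = a
tail nil     = nil
tail (_ ∙ b) = b

isCons : Tree → Bool
isCons nil     = false
isCons (_ ∙ _) = true

numeral : ℕ → Tree
numeral zero    = nil
numeral (suc n) = nil ∙ numeral n

list : List Tree → Tree
list []       = nil
list (t ∷ ts) = t ∙ list ts

data Expr (v : ℕ) : Set where
  nil       : Expr v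
  var hd tl : Fin v → Expr v
  cons      : Fin v → Fin v → Expr v

infix  7 _≔_ _≔random_
infixr 6 _⨾_

data Cmd (v : ℕ) : Set where
  _≔_               : Fin v → Expr v → Cmd v
  -- Assigns the numeral of a uniformly random element of {0, …, n − 1}.
  _≔random_         : Fin v → (n : ℕ) .{{_ : NonZero n}} → Cmd v
  _⨾_               : Cmd v → Cmd v → Cmd v
  ifCons_then_else_ : Fin v → Cmd v → Cmd v → Cmd v
  whileCons_loop_   : Fin v → Cmd v → Cmd v

Store : ℕ → Set
Store v = Vec Tree v

eval : ∀ {v} → Expr v → Store v → Tree
eval nil        σ = nil
eval (var x)    σ = Vec.lookup σ x
eval (hd x)     σ = head (Vec.lookup σ x)
eval (tl x)     σ = tail (Vec.lookup σ x)
eval (cons x y) σ = Vec.lookup σ x ∙ Vec.lookup σ y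

-- The list is the stack of commands still to be executed.
Config : ℕ → Set
Config v = List (Cmd v) × Store v

step : ∀ {v} → Config v → Rand (Config v)
step ([] , σ)                = return ([] , σ)
step ((x ≔ e) ∷ cs , σ)      = return (cs , σ [ x ]≔ eval e σ)
step ((x ≔random n) ∷ cs , σ) =
  choose n λ i → return (cs , σ [ x ]≔ numeral (toℕ i))
step ((c ⨾ c′) ∷ cs , σ)     = return (c ∷ c′ ∷ cs , σ)
step ((ifCons x then c else c′) ∷ cs , σ) =
  return ((if isCons (Vec.lookup σ x) then c else c′) ∷ cs , σ)
step ((whileCons x loop c) ∷ cs , σ) =
  return ((if isCons (Vec.lookup σ x) then c ∷ (whileCons x loop c) ∷ cs else cs) , σ)

run : ∀ {v} → ℕ → Config v → Rand (Config v)
run zero    κ = return κ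
run (suc t) κ = step κ >>= run t

Halted : ∀ {v} → Config v → Set
Halted (cs , _) = cs ≡ []

-- Variable zero holds the input initially and the output on halting; all other
-- variables are initially nil.
record Algorithm : Set where
  field
    extraVars : ℕ
    body      : Cmd (suc extraVars)

  start : Tree → Config (suc extraVars)
  start t = [ body ] , t ∷ replicate extraVars nil

  output : Config (suc extraVars) → Maybe Tree
  output ([] , σ)    = just (Vec.head σ)
  output (_ ∷ _ , _) = nothing

------------------------------------------------------------------------
-- Planted search k-SUM over ℤ_q^m

subsets : ∀ n → List (Subset n)
subsets zero    = [ [] ]
subsets (suc n) = map (outside ∷_) (subsets n) ++ map (inside ∷_) (subsets n)

min : ∀ {n} → Subset n → Maybe (Fin n)
min []            = nothing
min (inside ∷ S)  = just zero
min (outside ∷ S) = Maybe.map suc (min S)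

module VectorKSum (q : ℕ) .{{_ : NonZero q}} (m : ℕ) where

  G : Set
  G = Vec (Fin q) m

  0G : G
  0G = replicate m (0 mod q)

  _⊕_ : G → G → G
  _⊕_ = zipWith λ a b → (toℕ a + toℕ b) mod q

  ⊖_ : G → G
  ⊖_ = Vec.map λ a → (q ∸ toℕ a) mod q

  Σ[_] : ∀ {r} → Subset r → Vec G r → G
  Σ[ [] ] []                 = 0G
  Σ[ inside ∷ S ] (x ∷ X)  = x ⊕ Σ[ S ] X
  Σ[ outside ∷ S ] (x ∷ X) = Σ[ S ] X

  plant : ∀ {r} → Subset r → Vec G r → Vec G r
  plant S X with min S
  ... | just i  = X [ i ]≔ ⊖ Σ[ S - i ] X
  ... | nothing = X

  planted : (r k : ℕ) → Rand (Vec G r)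
  planted r k =
    iid (iid (choose q return) m) r >>= λ X →
    uniform (filter (λ S → ∣ S ∣ ≟ k) (subsets r)) >>= λ S →
    return (plant S X)

  isSolution : ∀ {r} → ℕ → Vec G r → Subset r → Bool
  isSolution k X S =
    does (∣ S ∣ ≟ k) ∧ does (Vec.≡-dec Fin._≟_ (Σ[ S ] X) 0G)

  -- Residues are written in unary, at constant cost since q is fixed.
  encode : ∀ {r} → Vec G r → Tree
  encode X = list (toList (Vec.map encodeG X))
    where
    encodeG : G → Tree
    encodeG x = list (toList (Vec.map (λ a → numeral (toℕ a)) x))

  -- The output is read as the list of the r membership bits of a subset.
  decode : ∀ r → Tree → Subset r
  decode zero    t = []
  decode (suc r) t = isCons (head t) ∷ decode r (tail t)

  solved : ∀ {r} → ℕ → Vec G r → Maybe Tree → Bool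
  solved k X nothing  = false
  solved k X (just t) = isSolution k X (decode _ t)

  -- Probability of halting within t steps with a correct output.
  successProbability : Algorithm → (r k t : ℕ) → ℚ
  successProbability A r k t = Pr (λ b → b) (
    planted r k >>= λ X →
    run t (start (encode X)) >>= λ κ →
    return (solved k X (output κ)))
    where open Algorithm A

------------------------------------------------------------------------
-- Density

-- k log r ≤ m Δ log q, that is, k log r ≤ m (a / b) log q for all rationals
-- a / b > Δ.
klogr≤mΔlogq : (q k r : ℕ) → ℝ → ℕ → Set
klogr≤mΔlogq q k r Δ m =
  ∀ a b .{{_ : NonZero b}} → Upper Δ (+ a ℚ./ b) → r ^ (k * b) ≤ q ^ (m * a)

-- m = ⌈ k log r / (Δ log q) ⌉, for q ≥ 2, r ≥ 1 and Δ > 0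
IsDimension : (q k r : ℕ) → ℝ → ℕ → Set
IsDimension q k r Δ m =
  klogr≤mΔlogq q k r Δ m × (∀ n → klogr≤mΔlogq q k r Δ n → m ≤ n)

module _ (q : ℕ) .{{_ : NonZero q}} (k : ℕ) (Δ : ℕ → ℝ) where

  RunsInTime : Algorithm → (ℕ → ℕ) → Set
  RunsInTime A T =
    ∀ r m → k ≤ r → IsDimension q k r (Δ r) m →
    let open VectorKSum q m in
    (X : Vec G r) → Surely Halted (run (T r) (start (encode X)))
    where open Algorithm A

  SolvesWithProbability : Algorithm → (ℕ → ℝ) → Set
  SolvesWithProbability A ε =
    ∀ r m → k ≤ r → IsDimension q k r (Δ r) m →
    let open VectorKSum q m in
    ∃[ t ] (ε r ℝ≤ successProbability A r k t)

{-# OPTIONS --safe #-}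
module Submission where

-- Before each call of A the instance X is re-randomised: every element receives
-- a random colour among k and a random label; the elements with label 0 are
-- kept, those of colour j are shifted by c_j, where c_1 + ⋯ + c_k = 0, and moved
-- by a random offset common to the colour; all other positions are filled with
-- fresh uniform elements.  A solution with one element of each colour survives,
-- so with probability 1 / polylog r the planted solution S is moved to the
-- positions of a uniformly random k-set S′, and A sees a planted instance.
--
-- For fixed coins of this kind, the instances obtained from the different values
-- of the label share no element of X outside S.  Hence the success probabilities
-- given X are pairwise uncorrelated over the q^e labels, their average has
-- variance at most q^-e, and for all but a 1 / log² r fraction of the X a single
-- attempt succeeds with probability 1 / polylog r.  Repeating polylog r times
-- and checking every answer suffices.
--
-- A may answer with a solution other than the planted one.  If X has n
-- solutions, then n (2θ - nθ²) ≤ 1 for every θ; averaged over uniform X, with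
-- the second moment of n, this bounds from below the probability of finding the
-- planted solution itself.
--
-- The algorithm is written in combinators that operate on a stack, which are
-- compiled to WHILE programs with A embedded.  Since T = Ω(r), its running time
-- is T · polylog r.

open import Defs

module Expect where

  open import Data.Bool using (Bool; true; false; if_then_else_)
  open import Data.Fin using (Fin; zero; suc)
  import Data.Integer as ℤ
  import Data.Integer.Properties as ℤ
  open import Data.List using (List; []; _∷_)
  open import Data.Nat as ℕ using (ℕ; zero; suc; NonZero)
  import Data.Nat.Properties as ℕ
  open import Data.Product using (_×_; _,_)
  open import Data.Rational as ℚ using (ℚ; 0ℚ; 1ℚ; _+_; _*_; _-_; -_; _≤_; nonNegative)
  open import Data.Rational.Properties
  import Data.Rational.Unnormalised as ℚᵘ
  open import Data.Rational.Solver using (module +-*-Solver)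
  open import Data.Vec using (Vec; []; _∷_)
  open import Data.Unit using (⊤; tt)
  open import Data.Sum using (inj₁; inj₂)
  open import Algebra.Definitions.RawSemiring +-*-rawSemiring public using (sum) renaming (_^_ to _^ℚ_)
  open import Relation.Binary.PropositionalEquality
  open import Function using (_∘_)

  *-monoˡ : ∀ {p a b} → 0ℚ ≤ p → a ≤ b → p * a ≤ p * b
  *-monoˡ {p} p≥0 = *-monoˡ-≤-nonNeg p {{nonNegative p≥0}}

  *-monoʳ : ∀ {p a b} → 0ℚ ≤ p → a ≤ b → a * p ≤ b * p
  *-monoʳ {p} p≥0 = *-monoʳ-≤-nonNeg p {{nonNegative p≥0}}

  *-nonNeg : ∀ {p a} → 0ℚ ≤ p → 0ℚ ≤ a → 0ℚ ≤ p * a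
  *-nonNeg {p} {a} p≥0 a≥0 = subst (_≤ p * a) (*-zeroʳ p) (*-monoˡ p≥0 a≥0)

  *-mono : ∀ {a b c d} → 0ℚ ≤ a → 0ℚ ≤ d → a ≤ b → c ≤ d → a * c ≤ b * d
  *-mono a≥0 d≥0 a≤b c≤d = ≤-trans (*-monoˡ a≥0 c≤d) (*-monoʳ d≥0 a≤b)

  +-nonNeg : ∀ {a b} → 0ℚ ≤ a → 0ℚ ≤ b → 0ℚ ≤ a + b
  +-nonNeg {a} {b} a≥0 b≥0 = subst (_≤ a + b) (+-identityˡ 0ℚ) (+-mono-≤ a≥0 b≥0)

  0≤1 : 0ℚ ≤ 1ℚ
  0≤1 = nonNegative⁻¹ 1ℚ

  diff≥0 : ∀ {a b} → a ≤ b → 0ℚ ≤ b - a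
  diff≥0 {a} {b} a≤b = subst (_≤ b - a) (+-inverseʳ a) (+-monoˡ-≤ (- a) a≤b)

  0≤diff : ∀ {a b} → 0ℚ ≤ b - a → a ≤ b
  0≤diff {a} {b} p = subst₂ _≤_ (+-identityˡ a) e (+-monoˡ-≤ a p)
    where
    open +-*-Solver
    e : b - a + a ≡ b
    e = solve 2 (λ a b → b :- a :+ a := b) refl a b

  neg-mono : ∀ {a b} → a ≤ b → - b ≤ - a
  neg-mono = neg-antimono-≤

  sq≥0 : ∀ a → 0ℚ ≤ a * a
  sq≥0 a with ≤-total 0ℚ a
  ... | inj₁ p = *-nonNeg p p
  ... | inj₂ p = subst (0ℚ ≤_) (solve 1 (λ a → (:- a) :* (:- a) := a :* a) refl a) (*-nonNeg {p = - a} {a = - a} q q)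
    where
    open +-*-Solver
    q : 0ℚ ≤ - a
    q = neg-mono p

  fromℕ≥0 : ∀ n → 0ℚ ≤ fromℕ n
  fromℕ≥0 n = nonNegative⁻¹ (fromℕ n) {{normalize-nonNeg n 1}}

  fromℕ-+ : ∀ a b → fromℕ (a ℕ.+ b) ≡ fromℕ a + fromℕ b
  fromℕ-+ a b = toℚᵘ-injective (ℚᵘₚ.≃-trans (toℚᵘ-fromℚᵘ (ℚᵘ.mkℚᵘ (ℤ.+ (a ℕ.+ b)) 0)) (ℚᵘₚ.≃-sym (ℚᵘₚ.≃-trans (toℚᵘ-homo-+ (fromℕ a) (fromℕ b))
     (ℚᵘₚ.≃-trans (ℚᵘₚ.+-cong (toℚᵘ-fromℚᵘ (ℚᵘ.mkℚᵘ (ℤ.+ a) 0)) (toℚᵘ-fromℚᵘ (ℚᵘ.mkℚᵘ (ℤ.+ b) 0))) (ℚᵘ.*≡* e)))))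
    where
    import Data.Rational.Unnormalised.Properties as ℚᵘₚ
    e : (ℤ.+ a ℤ.* ℤ.+ 1 ℤ.+ ℤ.+ b ℤ.* ℤ.+ 1) ℤ.* ℤ.+ 1 ≡ ℤ.+ (a ℕ.+ b) ℤ.* ℤ.+ 1
    e = cong (ℤ._* ℤ.+ 1) (cong₂ ℤ._+_ (ℤ.*-identityʳ (ℤ.+ a)) (ℤ.*-identityʳ (ℤ.+ b)))

  fromℕ-* : ∀ a b → fromℕ (a ℕ.* b) ≡ fromℕ a * fromℕ b
  fromℕ-* zero b = sym (*-zeroˡ (fromℕ b))
  fromℕ-* (suc a) b = begin
    fromℕ (b ℕ.+ a ℕ.* b)              ≡⟨ fromℕ-+ b (a ℕ.* b) ⟩
    fromℕ b + fromℕ (a ℕ.* b)          ≡⟨ cong (fromℕ b ℚ.+_) (fromℕ-* a b) ⟩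
    fromℕ b + fromℕ a * fromℕ b        ≡⟨ solve 2 (λ a b → b :+ a :* b := (con 1ℚ :+ a) :* b) refl (fromℕ a) (fromℕ b) ⟩
    (1ℚ + fromℕ a) * fromℕ b           ≡⟨ cong (_* fromℕ b) (sym (fromℕ-+ 1 a)) ⟩
    fromℕ (suc a) * fromℕ b            ∎
    where
    open ≡-Reasoning
    open +-*-Solver

  fromℕ-mono : ∀ {a b} → a ℕ.≤ b → fromℕ a ≤ fromℕ b
  fromℕ-mono {a} {b} a≤b = subst₂ _≤_ (+-identityʳ _) (trans (sym (fromℕ-+ a (b ℕ.∸ a))) (cong fromℕ (ℕ.m+[n∸m]≡n a≤b)))
    (+-monoʳ-≤ (fromℕ a) (fromℕ≥0 (b ℕ.∸ a)))

  recip≥0 : ∀ n → 0ℚ ≤ recip n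
  recip≥0 zero = ≤-refl
  recip≥0 (suc n) = nonNegative⁻¹ (recip (suc n)) {{normalize-nonNeg 1 (suc n)}}

  recip-inv : ∀ n .{{_ : NonZero n}} → recip n * fromℕ n ≡ 1ℚ
  recip-inv (suc n) = toℚᵘ-injective (ℚᵘₚ.≃-trans (toℚᵘ-homo-* (recip (suc n)) (fromℕ (suc n)))
     (ℚᵘₚ.≃-trans (ℚᵘₚ.*-cong (toℚᵘ-fromℚᵘ (ℚᵘ.mkℚᵘ (ℤ.+ 1) n)) (toℚᵘ-fromℚᵘ (ℚᵘ.mkℚᵘ (ℤ.+ (suc n)) 0))) (ℚᵘ.*≡* e)))
    where
    import Data.Rational.Unnormalised.Properties as ℚᵘₚ
    e : (ℤ.+ 1 ℤ.* ℤ.+ suc n) ℤ.* ℤ.+ 1 ≡ ℤ.+ 1 ℤ.* (ℤ.+ suc n ℤ.* ℤ.+ 1)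
    e = ℤ.*-assoc (ℤ.+ 1) (ℤ.+ suc n) (ℤ.+ 1)

  recip-unique : ∀ n .{{_ : NonZero n}} x → x * fromℕ n ≡ 1ℚ → x ≡ recip n
  recip-unique n x e = begin
    x                            ≡⟨ sym (*-identityʳ x) ⟩
    x * 1ℚ                       ≡⟨ cong (x *_) (sym (recip-inv n)) ⟩
    x * (recip n * fromℕ n)      ≡⟨ solve 3 (λ x r n → x :* (r :* n) := (x :* n) :* r) refl x (recip n) (fromℕ n) ⟩
    (x * fromℕ n) * recip n      ≡⟨ cong (_* recip n) e ⟩
    1ℚ * recip n                 ≡⟨ *-identityˡ _ ⟩
    recip n ∎
    where
    open ≡-Reasoning
    open +-*-Solver

  recip-* : ∀ a b → recip (a ℕ.* b) ≡ recip a * recip b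
  recip-* zero b = sym (*-zeroˡ (recip b))
  recip-* (suc a) zero = trans (cong recip (ℕ.*-zeroʳ a)) (sym (*-zeroʳ (recip (suc a))))
  recip-* (suc a) (suc b) = sym (recip-unique (suc a ℕ.* suc b) _ (begin
    recip (suc a) * recip (suc b) * fromℕ (suc a ℕ.* suc b)             ≡⟨ cong ((recip (suc a) * recip (suc b)) *_) (fromℕ-* (suc a) (suc b)) ⟩
    recip (suc a) * recip (suc b) * (fromℕ (suc a) * fromℕ (suc b))
      ≡⟨ solve 4 (λ a b c d → a :* b :* (c :* d) := (a :* c) :* (b :* d)) refl (recip (suc a)) (recip (suc b)) (fromℕ (suc a)) (fromℕ (suc b)) ⟩
    (recip (suc a) * fromℕ (suc a)) * (recip (suc b) * fromℕ (suc b))   ≡⟨ cong₂ _*_ (recip-inv (suc a)) (recip-inv (suc b)) ⟩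
    1ℚ * 1ℚ                                                             ≡⟨⟩
    1ℚ ∎))
    where
    open ≡-Reasoning
    open +-*-Solver

  recip-^ : ∀ a n → recip (a ℕ.^ n) ≡ recip a ^ℚ n
  recip-^ a zero = refl
  recip-^ a (suc n) = trans (recip-* a (a ℕ.^ n)) (cong (recip a *_) (recip-^ a n))

  recip-anti : ∀ {a b} .{{_ : NonZero a}} → a ℕ.≤ b → recip b ≤ recip a
  recip-anti {a} {zero} a≤b = recip≥0 a
  recip-anti {a} {b@(suc _)} a≤b = begin
    recip b                        ≡⟨ sym (*-identityʳ _) ⟩
    recip b * 1ℚ                   ≡⟨ cong (recip b *_) (sym (recip-inv a)) ⟩
    recip b * (recip a * fromℕ a)  ≤⟨ *-monoˡ (recip≥0 b) (*-monoˡ (recip≥0 a) (fromℕ-mono a≤b)) ⟩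
    recip b * (recip a * fromℕ b)  ≡⟨ solve 3 (λ b a n → b :* (a :* n) := a :* (b :* n)) refl (recip b) (recip a) (fromℕ b) ⟩
    recip a * (recip b * fromℕ b)  ≡⟨ cong (recip a *_) (recip-inv b) ⟩
    recip a * 1ℚ                   ≡⟨ *-identityʳ _ ⟩
    recip a ∎
    where
    open ≤-Reasoning
    open +-*-Solver

  ^ℚ≥0 : ∀ {x} n → 0ℚ ≤ x → 0ℚ ≤ x ^ℚ n
  ^ℚ≥0 zero x≥0 = 0≤1
  ^ℚ≥0 (suc n) x≥0 = *-nonNeg x≥0 (^ℚ≥0 n x≥0)

  sum-cong : ∀ {n} {f g : Fin n → ℚ} → (∀ i → f i ≡ g i) → sum f ≡ sum g
  sum-cong {zero} e = refl
  sum-cong {suc n} e = cong₂ _+_ (e zero) (sum-cong (e ∘ suc))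

  sum-mono : ∀ {n} {f g : Fin n → ℚ} → (∀ i → f i ≤ g i) → sum f ≤ sum g
  sum-mono {zero} e = ≤-refl
  sum-mono {suc n} e = +-mono-≤ (e zero) (sum-mono (e ∘ suc))

  sum-+ : ∀ {n} (f g : Fin n → ℚ) → sum (λ i → f i + g i) ≡ sum f + sum g
  sum-+ {zero} f g = refl
  sum-+ {suc n} f g = trans (cong ((f zero + g zero) +_) (sum-+ (f ∘ suc) (g ∘ suc)))
    (solve 4 (λ a b c d → a :+ b :+ (c :+ d) := a :+ c :+ (b :+ d)) refl (f zero) (g zero) (sum (f ∘ suc)) (sum (g ∘ suc)))
    where open +-*-Solver

  sum-* : ∀ {n} c (f : Fin n → ℚ) → sum (λ i → c * f i) ≡ c * sum f
  sum-* {zero} c f = sym (*-zeroʳ c)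
  sum-* {suc n} c f = trans (cong (c * f zero +_) (sum-* c (f ∘ suc))) (sym (*-distribˡ-+ c (f zero) (sum (f ∘ suc))))

  sum-const : ∀ n c → sum {n} (λ _ → c) ≡ fromℕ n * c
  sum-const zero c = sym (*-zeroˡ c)
  sum-const (suc n) c = trans (cong (c +_) (sum-const n c)) (trans
    (solve 2 (λ c n → c :+ n :* c := (con 1ℚ :+ n) :* c) refl c (fromℕ n)) (cong (_* c) (sym (fromℕ-+ 1 n))))
    where open +-*-Solver

  sum-nonNeg : ∀ {n} {f : Fin n → ℚ} → (∀ i → 0ℚ ≤ f i) → 0ℚ ≤ sum f
  sum-nonNeg {zero} p = ≤-refl
  sum-nonNeg {suc n} p = +-nonNeg (p zero) (sum-nonNeg (p ∘ suc))

  sum-pick : ∀ {n} {f : Fin n → ℚ} → (∀ i → 0ℚ ≤ f i) → ∀ i → f i ≤ sum f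
  sum-pick {suc n} {f} p zero = subst (_≤ sum f) (+-identityʳ _) (+-monoʳ-≤ (f zero) (sum-nonNeg (p ∘ suc)))
  sum-pick {suc n} {f} p (suc i) = subst (_≤ sum f) (+-identityˡ _) (+-mono-≤ (p zero) (sum-pick (p ∘ suc) i))

  E : {A : Set} → (A → ℚ) → Rand A → ℚ
  E f (return a)   = f a
  E f (choose n g) = recip n * sum (λ i → E f (g i))

  E-cong : ∀ {A : Set} {f g : A → ℚ} (μ : Rand A) → (∀ a → f a ≡ g a) → E f μ ≡ E g μ
  E-cong (return a) e = e a
  E-cong (choose n h) e = cong (recip n *_) (sum-cong λ i → E-cong (h i) e)

  E-mono : ∀ {A : Set} {f g : A → ℚ} (μ : Rand A) → (∀ a → f a ≤ g a) → E f μ ≤ E g μ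
  E-mono (return a) e = e a
  E-mono (choose n h) e = *-monoˡ (recip≥0 n) (sum-mono λ i → E-mono (h i) e)

  E-nonNeg : ∀ {A : Set} {f : A → ℚ} (μ : Rand A) → (∀ a → 0ℚ ≤ f a) → 0ℚ ≤ E f μ
  E-nonNeg (return a) e = e a
  E-nonNeg (choose n h) e = *-nonNeg (recip≥0 n) (sum-nonNeg λ i → E-nonNeg (h i) e)

  E-+ : ∀ {A : Set} (f g : A → ℚ) (μ : Rand A) → E (λ a → f a + g a) μ ≡ E f μ + E g μ
  E-+ f g (return a) = refl
  E-+ f g (choose n h) = trans (cong (recip n *_) (trans (sum-cong λ i → E-+ f g (h i)) (sum-+ {n} (λ i → E f (h i)) (λ i → E g (h i))))) (*-distribˡ-+ (recip n) _ _)

  E-*ˡ : ∀ {A : Set} c (f : A → ℚ) (μ : Rand A) → E (λ a → c * f a) μ ≡ c * E f μ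
  E-*ˡ c f (return a) = refl
  E-*ˡ c f (choose n h) = trans (cong (recip n *_) (trans (sum-cong λ i → E-*ˡ c f (h i)) (sum-* {n} c (λ i → E f (h i)))))
    (solve 3 (λ r c s → r :* (c :* s) := c :* (r :* s)) refl (recip n) c (sum (λ i → E f (h i))))
    where open +-*-Solver

  E-*ʳ : ∀ {A : Set} c (f : A → ℚ) (μ : Rand A) → E (λ a → f a * c) μ ≡ E f μ * c
  E-*ʳ c f μ = trans (E-cong μ λ a → *-comm (f a) c) (trans (E-*ˡ c f μ) (*-comm c _))

    where
    open +-*-Solver
    neg1 : ∀ x → - x ≡ - 1ℚ * x
    neg1 x = solve 1 (λ x → :- x := con (- 1ℚ) :* x) refl x

  E->>= : ∀ {A B : Set} (f : B → ℚ) (μ : Rand A) (ν : A → Rand B) → E f (μ >>= ν) ≡ E (λ a → E f (ν a)) μ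
  E->>= f (return a) ν = refl
  E->>= f (choose n h) ν = cong (recip n *_) (sum-cong λ i → E->>= f (h i) ν)

  E-zero : ∀ {A : Set} (μ : Rand A) → E (λ _ → 0ℚ) μ ≡ 0ℚ
  E-zero μ = trans (E-cong μ λ _ → sym (*-zeroˡ 0ℚ)) (trans (E-*ˡ 0ℚ (λ _ → 0ℚ) μ) (*-zeroˡ (E (λ _ → 0ℚ) μ)))

  E-swap : ∀ {A B : Set} (f : A → B → ℚ) (μ : Rand A) (ν : Rand B) →
    E (λ a → E (f a) ν) μ ≡ E (λ b → E (λ a → f a b) μ) ν
  E-swap f (return a) ν = refl
  E-swap f (choose n h) ν = sym (trans (E-*ˡ (recip n) _ ν) (cong (recip n *_)
    (trans (E-sum n (λ i b → E (λ a → f a b) (h i))) (sum-cong λ i → sym (E-swap f (h i) ν)))))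
    where
    E-sum : ∀ n (g : Fin n → _ → ℚ) → E (λ b → sum (λ i → g i b)) ν ≡ sum (λ i → E (g i) ν)
    E-sum zero g = E-zero ν
    E-sum (suc n) g = trans (E-+ _ _ ν) (cong (E (g zero) ν +_) (E-sum n (λ i → g (suc i))))

  Total : {A : Set} → Rand A → Set
  Total (return a)   = ⊤
  Total (choose n f) = NonZero n × (∀ i → Total (f i))

  Total->>= : ∀ {A B : Set} (μ : Rand A) {ν : A → Rand B} → Total μ → (∀ a → Total (ν a)) → Total (μ >>= ν)
  Total->>= (return a) t u = u a
  Total->>= (choose n f) (nz , t) u = nz , λ i → Total->>= (f i) (t i) u

  E-const : ∀ {A : Set} c (μ : Rand A) → Total μ → E (λ _ → c) μ ≡ c
  E-const c (return a) t = refl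
  E-const c (choose n f) (nz , t) = begin
    recip n * sum (λ i → E (λ _ → c) (f i))  ≡⟨ cong (recip n *_) (sum-cong λ i → E-const c (f i) (t i)) ⟩
    recip n * sum {n} (λ i → c)              ≡⟨ cong (recip n *_) (sum-const n c) ⟩
    recip n * (fromℕ n * c)                  ≡⟨ sym (*-assoc (recip n) (fromℕ n) c) ⟩
    recip n * fromℕ n * c                    ≡⟨ cong (_* c) (recip-inv n {{nz}}) ⟩
    1ℚ * c                                   ≡⟨ *-identityˡ c ⟩
    c ∎
    where open ≡-Reasoning

  E-≤const : ∀ {A : Set} {f : A → ℚ} {c} (μ : Rand A) → Total μ → (∀ a → f a ≤ c) → E f μ ≤ c
  E-≤const {c = c} μ t p = ≤-trans (E-mono μ p) (≤-reflexive (E-const c μ t))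

  Total-iid : ∀ {A : Set} {D : Rand A} n → Total D → Total (iid D n)
  Total-iid zero t = tt
  Total-iid {D = D} (suc n) t = Total->>= D t λ x → Total->>= (iid D n) (Total-iid n t) λ _ → tt

  E-iid : ∀ {A : Set} (D : Rand A) n (f : Vec A (suc n) → ℚ) →
    E f (iid D (suc n)) ≡ E (λ x → E (λ xs → f (x ∷ xs)) (iid D n)) D
  E-iid D n f = trans (E->>= f D _) (E-cong D λ x → E->>= f (iid D n) _)

  E-sq : ∀ {A : Set} (f : A → ℚ) (μ : Rand A) → Total μ → E f μ * E f μ ≤ E (λ a → f a * f a) μ
  E-sq f μ t = 0≤diff (subst (0ℚ ≤_) eq (E-nonNeg μ λ a → sq≥0 (f a - m)))
    where
    open +-*-Solver
    m = E f μ
    eq : E (λ a → (f a - m) * (f a - m)) μ ≡ E (λ a → f a * f a) μ - m * m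
    eq = begin
      E (λ a → (f a - m) * (f a - m)) μ
        ≡⟨ E-cong μ (λ a → solve 2 (λ x m → (x :- m) :* (x :- m) := x :* x :+ (x :* (:- (m :+ m)) :+ m :* m)) refl (f a) m) ⟩
      E (λ a → f a * f a + (f a * - (m + m) + m * m)) μ
        ≡⟨ trans (E-+ _ _ μ) (cong (E (λ a → f a * f a) μ +_) (trans (E-+ _ _ μ) (cong₂ _+_ (E-*ʳ (- (m + m)) f μ) (E-const (m * m) μ t)))) ⟩
      E (λ a → f a * f a) μ + (m * - (m + m) + m * m)
        ≡⟨ solve 2 (λ s m → s :+ (m :* (:- (m :+ m)) :+ m :* m) := s :- m :* m) refl (E (λ a → f a * f a) μ) m ⟩
      E (λ a → f a * f a) μ - m * m ∎
      where open ≡-Reasoning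

  indicator : Bool → ℚ
  indicator b = if b then 1ℚ else 0ℚ

  indicator≥0 : ∀ b → 0ℚ ≤ indicator b
  indicator≥0 false = ≤-refl
  indicator≥0 true = 0≤1

  indicator≤1 : ∀ b → indicator b ≤ 1ℚ
  indicator≤1 false = 0≤1
  indicator≤1 true = ≤-refl

  Pr≡E : ∀ {A : Set} (P : A → Bool) μ → Pr P μ ≡ E (λ a → indicator (P a)) μ
  Pr≡E P (return a) = refl
  Pr≡E P (choose n f) = cong (recip n *_) (sum-cong λ i → Pr≡E P (f i))

module Machine where

  open Expect
  open import Data.Bool using (Bool; true; false; if_then_else_)
  open import Data.Fin using (Fin; zero; suc; toℕ)
  open import Data.List using (List; []; _∷_; _++_; map)
  open import Data.Maybe using (Maybe)
  open import Data.Nat using (ℕ; zero; suc; _+_; _*_; _≤_; NonZero)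
  import Data.Nat.Properties as ℕ
  open import Data.Product using (_×_; _,_; proj₁; proj₂)
  open import Data.Rational as ℚ using (ℚ; 0ℚ)
  import Data.Rational.Properties as ℚ
  open import Data.Unit using (⊤; tt)
  open import Data.Vec using (Vec; []; _∷_; _[_]≔_; replicate)
  import Data.Vec as Vec
  open import Relation.Binary.PropositionalEquality

  Surely->>= : ∀ {A B : Set} {P : B → Set} (μ : Rand A) {ν : A → Rand B} →
    Surely (λ a → Surely P (ν a)) μ → Surely P (μ >>= ν)
  Surely->>= (return a) p = p
  Surely->>= (choose n f) p = λ i → Surely->>= (f i) (p i)

  Surely->>=⁻¹ : ∀ {A B : Set} {P : B → Set} (μ : Rand A) {ν : A → Rand B} →
    Surely P (μ >>= ν) → Surely (λ a → Surely P (ν a)) μ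
  Surely->>=⁻¹ (return a) p = p
  Surely->>=⁻¹ (choose n f) p = λ i → Surely->>=⁻¹ (f i) (p i)

  Surely-map : ∀ {A : Set} {P Q : A → Set} (μ : Rand A) → (∀ a → P a → Q a) → Surely P μ → Surely Q μ
  Surely-map (return a) h p = h a p
  Surely-map (choose n f) h p = λ i → Surely-map (f i) h (p i)

  E-cong-Surely : ∀ {A : Set} {P : A → Set} {f g : A → ℚ} (μ : Rand A) → Surely P μ →
    (∀ a → P a → f a ≡ g a) → E f μ ≡ E g μ
  E-cong-Surely (return a) p h = h a p
  E-cong-Surely (choose n k) p h = cong (recip n ℚ.*_) (sum-cong λ i → E-cong-Surely (k i) (p i) h)

  module _ {v : ℕ} where

    run-halted : ∀ n (σ : Store v) → run n ([] , σ) ≡ return ([] , σ)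
    run-halted zero σ = refl
    run-halted (suc n) σ = run-halted n σ

    Surely-Halted-suc : ∀ n (κ : Config v) → Surely Halted (run n κ) → Surely Halted (run (suc n) κ)
    Surely-Halted-suc zero ([] , σ) p = p
    Surely-Halted-suc (suc n) κ p =
      Surely->>= (step κ) (Surely-map (step κ) (Surely-Halted-suc n) (Surely->>=⁻¹ (step κ) p))

    E-run-suc : ∀ (f : Config v → ℚ) n κ → Surely Halted (run n κ) → E f (run (suc n) κ) ≡ E f (run n κ)
    E-run-suc f zero ([] , σ) p = refl
    E-run-suc f (suc n) κ p = trans (E->>= f (step κ) (run (suc n))) (trans
      (E-cong-Surely (step κ) (Surely->>=⁻¹ (step κ) p) (E-run-suc f n)) (sym (E->>= f (step κ) (run n))))

    E-run-+ : ∀ (f : Config v → ℚ) m n κ → Surely Halted (run n κ) →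
      Surely Halted (run (m + n) κ) × E f (run (m + n) κ) ≡ E f (run n κ)
    E-run-+ f zero n κ p = p , refl
    E-run-+ f (suc m) n κ p with E-run-+ f m n κ p
    ... | h , e = Surely-Halted-suc (m + n) κ h , trans (E-run-suc f (m + n) κ h) e

    E-run-mono : ∀ (f : Config v → ℚ) → (∀ κ → 0ℚ ℚ.≤ f κ) → (∀ c cs σ → f (c ∷ cs , σ) ≡ 0ℚ) →
      ∀ m n κ → E f (run n κ) ℚ.≤ E f (run (m + n) κ)
    E-run-mono f f≥0 f0 zero n κ = ℚ.≤-refl
    E-run-mono f f≥0 f0 (suc m) n κ = ℚ.≤-trans (E-run-mono f f≥0 f0 m n κ) (one (m + n) κ)
      where
      one : ∀ n κ → E f (run n κ) ℚ.≤ E f (run (suc n) κ)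
      one zero ([] , σ) = ℚ.≤-refl
      one zero κ@(c ∷ cs , σ) rewrite f0 c cs σ = E-nonNeg (run 1 κ) f≥0
      one (suc n) κ = subst₂ ℚ._≤_ (sym (E->>= f (step κ) (run n))) (sym (E->>= f (step κ) (run (suc n))))
        (E-mono (step κ) (one n))

    Total-run : ∀ n (κ : Config v) → Total (run n κ)
    Total-run zero κ = tt
    Total-run (suc n) κ = Total->>= (step κ) (total-step κ) (Total-run n)
      where
      total-step : ∀ κ → Total (step κ)
      total-step ([] , σ) = tt
      total-step ((x ≔ e) ∷ cs , σ) = tt
      total-step (_≔random_ x (suc n) ∷ cs , σ) = _ , λ _ → tt
      total-step ((c ⨾ c′) ∷ cs , σ) = tt
      total-step ((ifCons x then c else c′) ∷ cs , σ) = tt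
      total-step ((whileCons x loop c) ∷ cs , σ) = tt

  -- A stack machine on top of WHILE programs: variables 0 to 3 hold the
  -- environment, a stack, and two scratch values; the remaining ones are those of
  -- an embedded algorithm.

  infixr 5 _∙_

  data Ex : Set where
    env nil : Ex
    hd tl   : Ex → Ex
    _∙_     : Ex → Ex → Ex

  evalEx : Ex → Tree → Tree
  evalEx env      t = t
  evalEx nil      t = nil
  evalEx (hd e)   t = head (evalEx e t)
  evalEx (tl e)   t = tail (evalEx e t)
  evalEx (e ∙ e′) t = evalEx e t ∙ evalEx e′ t

  tl^ : ℕ → Ex → Ex
  tl^ zero e = e
  tl^ (suc n) e = tl^ n (tl e)

  infix 9 #_

  #_ : ℕ → Ex
  # n = hd (tl^ n env)

  literal : ℕ → Ex
  literal zero    = nil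
  literal (suc n) = nil ∙ literal n

  evalEx-literal : ∀ n t → evalEx (literal n) t ≡ numeral n
  evalEx-literal zero t = refl
  evalEx-literal (suc n) t = cong (nil ∙_) (evalEx-literal n t)

  data Len : Set where
    short long : Len

  infixr 6 _⨟_

  data Prog : Set where
    lam    : Ex → Prog
    rand   : (n : ℕ) .{{_ : NonZero n}} → Prog
    _⨟_    : Prog → Prog → Prog
    under  : Prog → Prog
    ifte   : Ex → Prog → Prog → Prog
    for    : Len → Prog → Prog
    call   : Prog

  clearAll : ∀ {n v} → (Fin n → Fin v) → Store v → Store v
  clearAll {zero}  f ω = ω
  clearAll {suc n} f ω = clearAll (λ i → f (suc i)) (ω [ f zero ]≔ nil)

  clearAll-suc : ∀ {n v} (g : Fin n → Fin v) a ω → clearAll (λ i → suc (g i)) (a ∷ ω) ≡ a ∷ clearAll g ω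
  clearAll-suc {zero}  g a ω = refl
  clearAll-suc {suc n} g a ω = clearAll-suc (λ i → g (suc i)) a (ω [ g zero ]≔ nil)

  clearAll-id : ∀ {n} (ω : Store n) → clearAll (λ i → i) ω ≡ replicate n nil
  clearAll-id []      = refl
  clearAll-id (a ∷ ω) = trans (clearAll-suc (λ i → i) nil ω) (cong (nil ∷_) (clearAll-id ω))

  module Compile (A : Algorithm) where

    open Algorithm A

    width : ℕ
    width = 5 + extraVars

    renᵉ : Expr (suc extraVars) → Expr width
    renᵉ nil        = nil
    renᵉ (var x)    = var (suc (suc (suc (suc x))))
    renᵉ (hd x)     = hd (suc (suc (suc (suc x))))
    renᵉ (tl x)     = tl (suc (suc (suc (suc x))))
    renᵉ (cons x y) = cons (suc (suc (suc (suc x)))) (suc (suc (suc (suc y))))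

    ren : Cmd (suc extraVars) → Cmd width
    ren (x ≔ e)                     = suc (suc (suc (suc x))) ≔ renᵉ e
    ren (x ≔random n)               = suc (suc (suc (suc x))) ≔random n
    ren (c ⨾ c′)                    = ren c ⨾ ren c′
    ren (ifCons x then c else c′)   = ifCons suc (suc (suc (suc x))) then ren c else ren c′
    ren (whileCons x loop c)        = whileCons suc (suc (suc (suc x))) loop ren c

    ρenv ρstk ρtmp ρflag : Fin width
    ρenv  = zero
    ρstk  = suc zero
    ρtmp  = suc (suc zero)
    ρflag = suc (suc (suc zero))

    pop push : Fin width → Cmd width
    pop x  = x ≔ hd ρstk ⨾ ρstk ≔ tl ρstk
    push x = ρstk ≔ cons x ρstk

    compEx : Ex → Cmd width
    compEx env      = push ρenv
    compEx nil      = ρtmp ≔ nil ⨾ push ρtmp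
    compEx (hd e)   = compEx e ⨾ pop ρtmp ⨾ ρtmp ≔ hd ρtmp ⨾ push ρtmp
    compEx (tl e)   = compEx e ⨾ pop ρtmp ⨾ ρtmp ≔ tl ρtmp ⨾ push ρtmp
    compEx (e ∙ e′) = compEx e ⨾ compEx e′ ⨾ pop ρtmp ⨾ pop ρflag ⨾ ρtmp ≔ cons ρflag ρtmp ⨾ push ρtmp

    clear : ∀ {n} → (Fin n → Fin width) → Cmd width
    clear {zero}  f = ρtmp ≔ nil
    clear {suc n} f = f zero ≔ nil ⨾ clear (λ i → f (suc i))

    loopBody : Cmd width → Cmd width
    loopBody c =
      ρtmp ≔ tl ρflag ⨾ push ρtmp ⨾ ρtmp ≔ hd ρflag ⨾ ρenv ≔ tl ρenv ⨾ ρenv ≔ cons ρtmp ρenv ⨾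
      c ⨾ pop ρflag ⨾ ρenv ≔ cons ρflag ρenv

    comp : Prog → Cmd width
    comp (lam e)       = compEx e ⨾ pop ρenv
    comp (rand n)      = ρtmp ≔random n ⨾ ρenv ≔ cons ρtmp ρenv
    comp (P ⨟ Q)       = comp P ⨾ comp Q
    comp (under P)     = ρtmp ≔ hd ρenv ⨾ push ρtmp ⨾ ρenv ≔ tl ρenv ⨾ comp P ⨾ pop ρtmp ⨾ ρenv ≔ cons ρtmp ρenv
    comp (ifte e P Q)  = compEx e ⨾ pop ρflag ⨾ ifCons ρflag then comp P else comp Q
    comp (for _ P)     = ρflag ≔ hd ρenv ⨾ (whileCons ρflag loop loopBody (comp P)) ⨾ ρenv ≔ tl ρenv
    comp call          = clear (λ i → suc (suc (suc (suc (suc i))))) ⨾ suc (suc (suc (suc zero))) ≔ var ρenv ⨾ ren body ⨾ ρenv ≔ var (suc (suc (suc (suc zero))))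

    costEx : Ex → ℕ
    costEx env      = 1
    costEx nil      = 3
    costEx (hd e)   = 1 + (costEx e + 7)
    costEx (tl e)   = 1 + (costEx e + 7)
    costEx (e ∙ e′) = 1 + (costEx e + (1 + (costEx e′ + 11)))

    costClear : ℕ → ℕ
    costClear zero    = 1
    costClear (suc n) = 2 + costClear n

    module Cost (S R T : ℕ) where

      bound : Len → ℕ
      bound short = S
      bound long  = R

      cost : Prog → ℕ
      cost (lam e)      = 1 + (costEx e + 3)
      cost (rand n)     = 3
      cost (P ⨟ Q)      = 1 + (cost P + cost Q)
      cost (under P)    = 7 + (cost P + 5)
      cost (ifte e P Q) = 1 + (costEx e + (5 + (cost P + cost Q)))
      cost (for l P)    = 3 + (bound l * (12 + (cost P + 5)) + 2)
      cost call         = 1 + (costClear extraVars + (3 + (T + 1)))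

    -- score reads off a configuration when the time is up.
    module Semantics (score : Config width → ℚ) where

      Good : ℕ → Config width → ℚ → Set
      Good n κ x = Surely Halted (run n κ) × x ℚ.≤ E score (run n κ)

      Good-+ : ∀ m {n κ x} → Good n κ x → Good (m + n) κ x
      Good-+ m {n} {κ} {x} (h , p) with E-run-+ score m n κ h
      ... | h′ , e = h′ , subst (x ℚ.≤_) (sym e) p

      Good-≤ : ∀ {m n κ x} → m ≤ n → Good m κ x → Good n κ x
      Good-≤ {m} {n} {κ} {x} m≤n g = subst (λ n → Good n κ x) (ℕ.m∸n+n≡m m≤n) (Good-+ (n Data.Nat.∸ m) g)

      Good-assoc : ∀ l m {n κ x} → Good (l + (m + n)) κ x → Good (l + m + n) κ x
      Good-assoc l m {n} {κ} {x} = subst (λ n → Good n κ x) (sym (ℕ.+-assoc l m n))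

      Good-choose : ∀ {A : Set} {k n} {x : A → ℚ} (f : Fin k → Rand A) {g : Fin k → Config width} →
        (∀ i → Good n (g i) (E x (f i))) →
        Surely Halted (choose k (λ i → run n (g i))) × E x (choose k f) ℚ.≤ E score (choose k (λ i → run n (g i)))
      Good-choose {k = k} f p = (λ i → proj₁ (p i)) , *-monoˡ (recip≥0 k) (sum-mono λ i → proj₂ (p i))

      -- Continuation-passing specification: whatever holds after every outcome of
      -- μ holds before, up to n steps and on average.
      Computes : {A : Set} → Cmd width → ℕ → Tree → Rand A → (A → Tree) → Set
      Computes {A} c n t μ out =
        ∀ {n′} cs stk (x : A → ℚ) →
        (∀ a tmp flag σ → Good n′ (cs , out a ∷ stk ∷ tmp ∷ flag ∷ σ) (x a)) →
        ∀ tmp flag σ → Good (n + n′) (c ∷ cs , t ∷ stk ∷ tmp ∷ flag ∷ σ) (E x μ)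

      Computes-Ex : ∀ e {n′ x} cs {t stk} →
        (∀ tmp flag σ → Good n′ (cs , t ∷ (evalEx e t ∙ stk) ∷ tmp ∷ flag ∷ σ) x) →
        ∀ tmp flag σ → Good (costEx e + n′) (compEx e ∷ cs , t ∷ stk ∷ tmp ∷ flag ∷ σ) x
      Computes-Ex env cs k tmp flag σ = k tmp flag σ
      Computes-Ex nil cs k tmp flag σ = k nil flag σ
      Computes-Ex (hd e) {n′} cs {t} {stk} k tmp flag σ =
        Good-assoc (suc (costEx e)) 7 {n′} {compEx (hd e) ∷ cs , t ∷ stk ∷ tmp ∷ flag ∷ σ}
          (Computes-Ex e {7 + n′} (pop ρtmp ⨾ ρtmp ≔ hd ρtmp ⨾ push ρtmp ∷ cs) {t} {stk} (λ tmp flag σ → k (head (evalEx e t)) flag σ) tmp flag σ)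
      Computes-Ex (tl e) {n′} cs {t} {stk} k tmp flag σ =
        Good-assoc (suc (costEx e)) 7 {n′} {compEx (tl e) ∷ cs , t ∷ stk ∷ tmp ∷ flag ∷ σ}
          (Computes-Ex e {7 + n′} (pop ρtmp ⨾ ρtmp ≔ tl ρtmp ⨾ push ρtmp ∷ cs) {t} {stk} (λ tmp flag σ → k (tail (evalEx e t)) flag σ) tmp flag σ)
      Computes-Ex (e ∙ e′) {n′} cs {t} {stk} k tmp flag σ =
        Good-assoc (suc (costEx e)) (1 + (costEx e′ + 11)) {n′} {compEx (e ∙ e′) ∷ cs , t ∷ stk ∷ tmp ∷ flag ∷ σ}
          (Computes-Ex e {1 + (costEx e′ + 11) + n′} (compEx e′ ⨾ rest ∷ cs) {t} {stk}
            (λ tmp flag σ → Good-assoc (suc (costEx e′)) 11 {n′} {compEx e′ ⨾ rest ∷ cs , t ∷ (evalEx e t ∙ stk) ∷ tmp ∷ flag ∷ σ}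
              (Computes-Ex e′ {11 + n′} (rest ∷ cs) {t} {evalEx e t ∙ stk}
                (λ tmp flag σ → k (evalEx e t ∙ evalEx e′ t) (evalEx e t) σ) tmp flag σ)) tmp flag σ)
        where
        rest : Cmd width
        rest = pop ρtmp ⨾ pop ρflag ⨾ ρtmp ≔ cons ρflag ρtmp ⨾ push ρtmp

      simulate : ∀ T csA cs (w : Vec Tree 4) {n′} (x : Config (suc extraVars) → ℚ) →
        (∀ σA → Good n′ (cs , w Vec.++ σA) (x ([] , σA))) → ∀ σA → Surely Halted (run T (csA , σA)) →
        Good (T + n′) (map ren csA ++ cs , w Vec.++ σA) (E x (run T (csA , σA)))
      simulate zero [] cs w x k σA h = k σA
      simulate (suc T) [] cs w {n′} x k σA h = Good-+ 1 {T + n′} {cs , w Vec.++ σA} (simulate T [] cs w {n′} x k σA h)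
      simulate (suc T) (y ≔ e ∷ csA) cs w@(_ ∷ _ ∷ _ ∷ _ ∷ []) {n′} x k σA h = go e h
        where
        go : ∀ e → Surely Halted (run T (csA , σA [ y ]≔ eval e σA)) →
          Good (suc T + n′) (map ren (y ≔ e ∷ csA) ++ cs , w Vec.++ σA) (E x (run (suc T) (y ≔ e ∷ csA , σA)))
        go nil        = simulate T csA cs w x k _
        go (var _)    = simulate T csA cs w x k _
        go (hd _)     = simulate T csA cs w x k _
        go (tl _)     = simulate T csA cs w x k _
        go (cons _ _) = simulate T csA cs w x k _
      simulate (suc T) (y ≔random n ∷ csA) cs w@(_ ∷ _ ∷ _ ∷ _ ∷ []) {n′} x k σA h =
        Good-choose {n = T + n′} {x = x} (λ i → run T (csA , σA [ y ]≔ numeral (toℕ i)))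
          {λ i → map ren csA ++ cs , w Vec.++ (σA [ y ]≔ numeral (toℕ i))}
          (λ i → simulate T csA cs w {n′} x k (σA [ y ]≔ numeral (toℕ i)) (h i))
      simulate (suc T) (c ⨾ c′ ∷ csA) cs w@(_ ∷ _ ∷ _ ∷ _ ∷ []) x k σA h = simulate T (c ∷ c′ ∷ csA) cs w x k σA h
      simulate (suc T) ((ifCons y then c else c′) ∷ csA) cs w@(_ ∷ _ ∷ _ ∷ _ ∷ []) x k σA h
        with isCons (Vec.lookup σA y)
      ... | true  = simulate T (c ∷ csA) cs w x k σA h
      ... | false = simulate T (c′ ∷ csA) cs w x k σA h
      simulate (suc T) (d@(whileCons y loop c) ∷ csA) cs w@(_ ∷ _ ∷ _ ∷ _ ∷ []) x k σA h
        with isCons (Vec.lookup σA y)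
      ... | true  = simulate T (c ∷ d ∷ csA) cs w x k σA h
      ... | false = simulate T csA cs w x k σA h

      Good-clear : ∀ {n} (f : Fin n → Fin width) ω {n′ cs x} →
        Good n′ (cs , clearAll f ω [ ρtmp ]≔ nil) x → Good (costClear n + n′) (clear f ∷ cs , ω) x
      Good-clear {zero}  f ω g = g
      Good-clear {suc n} f ω g = Good-clear (λ i → f (suc i)) (ω [ f zero ]≔ nil) g

      module Specs (S R T : ℕ) where

        open Cost S R T public

        record Runs {A : Set} (P : Prog) (t : Tree) (μ : Rand A) (out : A → Tree) : Set where
          constructor runs
          field computes : Computes (comp P) (cost P) t μ out
        open Runs public

        RunsD : Prog → Tree → Tree → Set
        RunsD P t t′ = Runs {⊤} P t (return tt) (λ _ → t′)

        run-lam : ∀ e {t} → RunsD (lam e) t (evalEx e t)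
        run-lam e {t} .computes {n′} cs stk x k tmp flag σ =
          Good-assoc (suc (costEx e)) 3 {n′} {comp (lam e) ∷ cs , t ∷ stk ∷ tmp ∷ flag ∷ σ} (Computes-Ex e {3 + n′} (pop ρenv ∷ cs) {t} {stk} (λ tmp flag σ → k tt tmp flag σ) tmp flag σ)

        run-rand : ∀ n .{{_ : NonZero n}} {t} → Runs (rand n) t (choose n return) (λ i → numeral (toℕ i) ∙ t)
        run-rand n {t} .computes {n′} cs stk x k tmp flag σ =
          Good-choose {n = suc n′} {x = x} return
            {λ i → ρenv ≔ cons ρtmp ρenv ∷ cs , t ∷ stk ∷ numeral (toℕ i) ∷ flag ∷ σ} (λ i → k i (numeral (toℕ i)) flag σ)

        run-⨟ : ∀ {A B : Set} {P Q t} {μ : Rand A} {out} {ν : A → Rand B} {out′} →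
          Runs P t μ out → (∀ a → Runs Q (out a) (ν a) out′) → Runs (P ⨟ Q) t (μ >>= ν) out′
        run-⨟ {P = P} {Q} {t} {μ} {out} {ν} p q .computes {n′} cs stk x k tmp flag σ =
          Good-assoc (suc (cost P)) (cost Q) {n′} {comp (P ⨟ Q) ∷ cs , t ∷ stk ∷ tmp ∷ flag ∷ σ}
            (subst (Good (cost P + (cost Q + n′)) (comp P ∷ comp Q ∷ cs , t ∷ stk ∷ tmp ∷ flag ∷ σ)) (sym (E->>= x μ ν))
              (p .computes (comp Q ∷ cs) stk (λ a → E x (ν a)) (λ a → q a .computes cs stk x k) tmp flag σ))

        run-⨟D : ∀ {A : Set} {P Q t} {μ : Rand A} {out} {out′} →
          Runs P t μ out → (∀ a → RunsD Q (out a) (out′ a)) → Runs (P ⨟ Q) t μ out′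
        run-⨟D {P = P} {Q} {t} {μ} {out} p q .computes {n′} cs stk x k tmp flag σ =
          Good-assoc (suc (cost P)) (cost Q) {n′} {comp (P ⨟ Q) ∷ cs , t ∷ stk ∷ tmp ∷ flag ∷ σ}
              (p .computes (comp Q ∷ cs) stk x (λ a → q a .computes cs stk (λ _ → x a) (λ _ → k a)) tmp flag σ)

        run-under : ∀ {A : Set} {P a t} {μ : Rand A} {out} → Runs P t μ out → Runs (under P) (a ∙ t) μ (λ z → a ∙ out z)
        run-under {P = P} {a} {t} p .computes {n′} cs stk x k tmp flag σ =
          Good-assoc (7 + cost P) 5 {n′} {comp (under P) ∷ cs , (a ∙ t) ∷ stk ∷ tmp ∷ flag ∷ σ} (p .computes (pop ρtmp ⨾ ρenv ≔ cons ρtmp ρenv ∷ cs) (a ∙ stk) x (λ z tmp flag σ → k z a flag σ) a flag σ)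

        run-ifte : ∀ {A : Set} {e P Q t} {μ : Rand A} {out} b → isCons (evalEx e t) ≡ b →
          Runs (if b then P else Q) t μ out → Runs (ifte e P Q) t μ out
        run-ifte {e = e} {P} {Q} {t} {μ} {out} b eq p .computes {n′} cs stk x k tmp flag σ =
          Good-assoc (suc (costEx e)) (5 + (cost P + cost Q)) {n′} {comp (ifte e P Q) ∷ cs , t ∷ stk ∷ tmp ∷ flag ∷ σ} (Computes-Ex e {5 + (cost P + cost Q + n′)} (pop ρflag ⨾ (ifCons ρflag then comp P else comp Q) ∷ cs) {t} {stk} (λ tmp flag σ →
            subst (λ b → Good (cost P + cost Q + n′) ((if b then comp P else comp Q) ∷ cs , t ∷ stk ∷ tmp ∷ evalEx e t ∷ σ) (E x μ))
              (sym eq) (branch b p tmp (evalEx e t) σ)) tmp flag σ)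
          where
          branch : ∀ b → Runs (if b then P else Q) t μ out → ∀ tmp flag σ →
            Good (cost P + cost Q + n′) ((if b then comp P else comp Q) ∷ cs , t ∷ stk ∷ tmp ∷ flag ∷ σ) (E x μ)
          branch true p tmp flag σ = Good-≤ (ℕ.+-monoˡ-≤ n′ (ℕ.m≤m+n (cost P) (cost Q))) (p .computes cs stk x k tmp flag σ)
          branch false p tmp flag σ = Good-≤ (ℕ.+-monoˡ-≤ n′ (ℕ.m≤n+m (cost Q) (cost P))) (p .computes cs stk x k tmp flag σ)

        run-map : ∀ {A B : Set} {P t} {μ : Rand A} {out : B → Tree} (g : A → B) →
          Runs P t μ (λ a → out (g a)) → Runs P t (μ >>= λ a → return (g a)) out
        run-map {P = P} {t} {μ = μ} g p .computes {n′} cs stk x k tmp flag σ =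
          subst (Good (cost P + n′) (comp P ∷ cs , t ∷ stk ∷ tmp ∷ flag ∷ σ)) (sym (E->>= x μ (λ a → return (g a)))) (p .computes {n′} cs stk (λ a → x (g a)) (λ a → k (g a)) tmp flag σ)

        record RunsFor {A : Set} (P : Prog) (j : ℕ) (l s : Tree) (μ : Rand A) (out : A → Tree) : Set where
          constructor runsFor
          field computesFor : ∀ {n′} cs stk (x : A → ℚ) →
                  (∀ a tmp flag σ → Good n′ (cs , (nil ∙ out a) ∷ stk ∷ tmp ∷ flag ∷ σ) (x a)) →
                  ∀ tmp σ → Good (j * (12 + (cost P + 5)) + suc n′)
                    ((whileCons ρflag loop loopBody (comp P)) ∷ cs , (l ∙ s) ∷ stk ∷ tmp ∷ l ∷ σ) (E x μ)
        open RunsFor public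

        for-[] : ∀ {A : Set} {P s} {a : A} {out : A → Tree} → out a ≡ s → RunsFor P 0 nil s (return a) out
        for-[] {a = a} refl .computesFor cs stk x k tmp σ = k a tmp nil σ

        for-∷ : ∀ {A B : Set} {P j y l s} {μ : Rand A} {out} {ν : A → Rand B} {out′} →
          Runs P (y ∙ s) μ out → (∀ a → RunsFor P j l (out a) (ν a) out′) →
          RunsFor P (suc j) (y ∙ l) s (μ >>= ν) out′
        for-∷ {P = P} {j} {y} {l} {s} {μ} {ν = ν} p q .computesFor {n′} cs stk x k tmp σ =
          subst₂ (λ n x → Good n κ x) (sym eq) (sym (E->>= x μ ν))
            (p .computes (pop ρflag ⨾ ρenv ≔ cons ρflag ρenv ∷ while ∷ cs) (l ∙ stk) (λ a → E x (ν a))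
                (λ a tmp flag σ → q a .computesFor cs stk x k tmp σ) y (y ∙ l) σ)
          where
          while : Cmd width
          while = whileCons ρflag loop loopBody (comp P)
          κ : Config width
          κ = while ∷ cs , ((y ∙ l) ∙ s) ∷ stk ∷ tmp ∷ (y ∙ l) ∷ σ
          eq : 12 + (cost P + 5) + j * (12 + (cost P + 5)) + suc n′ ≡ 12 + (cost P + (5 + (j * (12 + (cost P + 5)) + suc n′)))
          eq = trans (ℕ.+-assoc (12 + (cost P + 5)) _ _) (cong (12 +_) (ℕ.+-assoc (cost P) 5 _))

        for-map : ∀ {A B : Set} {P j l s} {μ : Rand A} {out : B → Tree} (g : A → B) →
          RunsFor P j l s μ (λ a → out (g a)) → RunsFor P j l s (μ >>= λ a → return (g a)) out
        for-map {P = P} {j} {l} {s} {μ = μ} g p .computesFor {n′} cs stk x k tmp σ =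
          subst (Good (j * (12 + (cost P + 5)) + suc n′) ((whileCons ρflag loop loopBody (comp P)) ∷ cs , (l ∙ s) ∷ stk ∷ tmp ∷ l ∷ σ))
            (sym (E->>= x μ (λ a → return (g a)))) (p .computesFor {n′} cs stk (λ a → x (g a)) (λ a → k (g a)) tmp σ)

        run-for : ∀ {A : Set} {P j s y} b {μ : Rand A} {out} → j ≤ bound b → RunsFor P j y s μ out → Runs (for b P) (y ∙ s) μ out
        run-for {P = P} {j} {s} {y} b {μ} {out} j≤ p .computes {n′} cs stk x k tmp flag σ =
          Good-≤ {κ = (whileCons ρflag loop loopBody (comp P)) ∷ ρenv ≔ tl ρenv ∷ cs , (y ∙ s) ∷ stk ∷ tmp ∷ y ∷ σ}
            (ℕ.≤-trans (ℕ.≤-reflexive (sym (ℕ.+-assoc (j * c) 2 n′))) (ℕ.+-monoˡ-≤ n′ (ℕ.+-monoˡ-≤ 2 (ℕ.*-monoˡ-≤ c j≤))))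
            (p .computesFor {suc n′} (ρenv ≔ tl ρenv ∷ cs) stk x (λ a → k a) tmp σ)
          where c = 12 + (cost P + 5)

        run-call : ∀ {t} → Surely Halted (run T (start t)) →
          Runs call t (run T (start t)) (λ κ → Vec.head (proj₂ κ))
        run-call {t} h .computes {n′} cs stk x k tmp flag (σ₀ ∷ σ) =
          Good-assoc (suc (costClear extraVars)) (3 + (T + 1)) {n′} {comp call ∷ cs , ω}
            (Good-clear (λ i → suc (suc (suc (suc (suc i))))) ω {3 + (T + 1) + n′} {rest ∷ cs}
              (subst (λ σ → Good (3 + (T + 1) + n′) (rest ∷ cs , σ [ ρtmp ]≔ nil) (E x (run T (start t)))) (sym cleared)
                (subst (λ n → Good n (ren body ∷ ρenv ≔ var ρout ∷ cs , w Vec.++ (t ∷ replicate extraVars nil)) (E x (run T (start t))))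
                  (sym (ℕ.+-assoc T 1 n′))
                  (simulate T (body ∷ []) (ρenv ≔ var ρout ∷ cs) w x
                    halted (t ∷ replicate extraVars nil) h))))
          where
          ρout : Fin width
          ρout = suc (suc (suc (suc zero)))
          rest = ρout ≔ var ρenv ⨾ ren body ⨾ ρenv ≔ var ρout
          w : Vec Tree 4
          w = t ∷ stk ∷ nil ∷ flag ∷ []
          ω : Store width
          ω = t ∷ stk ∷ tmp ∷ flag ∷ σ₀ ∷ σ
          halted : ∀ σA → Good (suc n′) (ρenv ≔ var ρout ∷ cs , w Vec.++ σA) (x ([] , σA))
          halted (a ∷ σA) = k ([] , a ∷ σA) nil flag (a ∷ σA)
          cleared : clearAll (λ i → suc (suc (suc (suc (suc i))))) (t ∷ stk ∷ tmp ∷ flag ∷ σ₀ ∷ σ) ≡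
                    t ∷ stk ∷ tmp ∷ flag ∷ σ₀ ∷ replicate extraVars nil
          cleared =
            trans (clearAll-suc (λ i → suc (suc (suc (suc i)))) t (stk ∷ tmp ∷ flag ∷ σ₀ ∷ σ)) (cong (t ∷_) (
            trans (clearAll-suc (λ i → suc (suc (suc i))) stk (tmp ∷ flag ∷ σ₀ ∷ σ)) (cong (stk ∷_) (
            trans (clearAll-suc (λ i → suc (suc i)) tmp (flag ∷ σ₀ ∷ σ)) (cong (tmp ∷_) (
            trans (clearAll-suc (λ i → suc i) flag (σ₀ ∷ σ)) (cong (flag ∷_) (
            trans (clearAll-suc (λ i → i) σ₀ σ) (cong (σ₀ ∷_) (clearAll-id σ))))))))))

module Programs where

  open Machine
  open import Data.Bool using (Bool; true; false)
  open import Data.Fin using (Fin; zero; suc)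
  open import Data.List using (List; []; _∷_)
  open import Data.Nat using (ℕ; zero; suc; _+_; _*_; _∸_; _≤_; _<?_)
  import Data.Nat.Properties as ℕ
  open import Data.Product using (_×_; _,_; proj₁; proj₂)
  open import Data.Rational using (ℚ)
  open import Data.Unit using (⊤; tt)
  open import Data.Vec using (Vec; []; _∷_)
  open import Relation.Binary.PropositionalEquality
  open import Relation.Nullary using (does)

  len : Tree → ℕ
  len nil     = 0
  len (_ ∙ t) = suc (len t)

  iter : {A : Set} → (A → A) → A → ℕ → A
  iter f s zero    = s
  iter f s (suc n) = iter f (f s) n

  iter-suc : ∀ {A : Set} (f : A → A) s n → iter f (f s) n ≡ f (iter f s n)
  iter-suc f s zero    = refl
  iter-suc f s (suc n) = iter-suc f (f s) n

  pre : ℕ → Tree → Tree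
  pre zero    t = t
  pre (suc n) t = nil ∙ pre n t

  pre-+ : ∀ m n t → pre m (pre n t) ≡ pre (m + n) t
  pre-+ zero n t = refl
  pre-+ (suc m) n t = cong (nil ∙_) (pre-+ m n t)

  pre-numeral : ∀ m n → pre m (numeral n) ≡ numeral (m + n)
  pre-numeral zero n = refl
  pre-numeral (suc m) n = cong (nil ∙_) (pre-numeral m n)

  iter-pre : ∀ c s n → iter (pre c) s n ≡ pre (n * c) s
  iter-pre c s zero = refl
  iter-pre c s (suc n) = trans (iter-suc (pre c) s n) (trans (cong (pre c) (iter-pre c s n)) (pre-+ c (n * c) s))

  len-numeral : ∀ n → len (numeral n) ≡ n
  len-numeral zero    = refl
  len-numeral (suc n) = cong suc (len-numeral n)

  tail-numeral : ∀ n j → iter tail (numeral n) j ≡ numeral (n ∸ j)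
  tail-numeral n zero = refl
  tail-numeral zero (suc j) = trans (tail-numeral zero j) (cong numeral (ℕ.0∸n≡0 j))
  tail-numeral (suc n) (suc j) = tail-numeral n j

  evalEx-tl^ : ∀ n e t → evalEx (tl^ n e) t ≡ iter tail (evalEx e t) n
  evalEx-tl^ zero e t = refl
  evalEx-tl^ (suc n) e t = evalEx-tl^ n (tl e) t

  isCons-numeral : ∀ n → isCons (numeral n) ≡ does (0 <? n)
  isCons-numeral zero = refl
  isCons-numeral (suc n) = refl

  _onto_ : Tree → Tree → Tree
  nil     onto t = t
  (a ∙ s) onto t = s onto (a ∙ t)

  _++ᵗ_ : Tree → Tree → Tree
  nil     ++ᵗ t = t
  (a ∙ s) ++ᵗ t = a ∙ (s ++ᵗ t)

  onto-onto : ∀ s t u → (s onto t) onto u ≡ t onto (s ++ᵗ u)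
  onto-onto nil t u = refl
  onto-onto (a ∙ s) t u = onto-onto s (a ∙ t) u

  ++ᵗ-nil : ∀ s → s ++ᵗ nil ≡ s
  ++ᵗ-nil nil = refl
  ++ᵗ-nil (a ∙ s) = cong (a ∙_) (++ᵗ-nil s)

  len-onto : ∀ s t → len (s onto t) ≡ len s + len t
  len-onto nil t = refl
  len-onto (a ∙ s) t = trans (len-onto s (a ∙ t)) (ℕ.+-suc (len s) (len t))

  encV : ∀ {A : Set} {n} → (A → Tree) → Vec A n → Tree
  encV f []       = nil
  encV f (x ∷ xs) = f x ∙ encV f xs

  len-encV : ∀ {A : Set} {n} (f : A → Tree) (xs : Vec A n) → len (encV f xs) ≡ n
  len-encV f [] = refl
  len-encV f (x ∷ xs) = cong suc (len-encV f xs)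

  encB : Bool → Tree
  encB false = nil
  encB true  = nil ∙ nil

  isCons-encB : ∀ b → isCons (encB b) ≡ b
  isCons-encB false = refl
  isCons-encB true  = refl

  letP : Ex → Prog → Prog
  letP e P = lam (env ∙ e) ⨟ under P ⨟ lam (tl env ∙ hd env)

  mapBody : Prog → Prog
  mapBody P = lam (hd (tl env) ∙ hd env ∙ tl (tl env)) ⨟ under P ⨟ lam ((hd (tl env) ∙ hd env) ∙ tl (tl env))

  revBody : Prog
  revBody = lam ((hd env ∙ hd (tl env)) ∙ tl (tl env))

  mapP : Len → Prog → Prog
  mapP b P =
    lam (hd env ∙ nil ∙ tl env) ⨟ for b (mapBody P) ⨟
    lam (hd env ∙ nil ∙ tl env) ⨟ for b revBody

  iidP : Len → Prog → Prog
  iidP b P = mapP b (letP (tl env) P ⨟ lam (hd env ∙ tl (tl env)))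

  consP : Len → Prog
  consP b = for b (lam (nil ∙ tl env))

  dropP : Len → Prog
  dropP b = for b (lam (tl (tl env)))

  mapS : ∀ {I O : Set} (St : ℕ → Set) → (∀ {n} → I → St (suc n) → O × St n) → ∀ {n} → Vec I n → St n → Vec O n × St 0
  mapS St f []       s = [] , s
  mapS St f (x ∷ xs) s = proj₁ (f x s) ∷ proj₁ (mapS St f xs (proj₂ (f x s))) , proj₂ (mapS St f xs (proj₂ (f x s)))

  foldS : ∀ {I : Set} (St : ℕ → Set) → (∀ {n} → I → St (suc n) → St n) → ∀ {n} → Vec I n → St n → St 0
  foldS St f []       s = s
  foldS St f (x ∷ xs) s = foldS St f xs (f x s)

  items : (t : Tree) → Vec Tree (len t)
  items nil     = []
  items (a ∙ t) = a ∷ items t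

  encV-items : ∀ t → encV (λ a → a) (items t) ≡ t
  encV-items nil = refl
  encV-items (a ∙ t) = cong (a ∙_) (encV-items t)

  module Rules (A : Algorithm) (score : Config (Compile.width A) → ℚ) (S R T : ℕ) where

    open Compile A public
    open Semantics score public
    open Specs S R T public

    run-≡ : ∀ {P t t₁ t₂} → t₁ ≡ t₂ → RunsD P t t₁ → RunsD P t t₂
    run-≡ refl p = p

    run-≡in : ∀ {A : Set} {P t₁ t₂} {μ : Rand A} {out} → t₁ ≡ t₂ → Runs P t₁ μ out → Runs P t₂ μ out
    run-≡in refl p = p

    run-let : ∀ {A : Set} {e P t} {μ : Rand A} {out} → Runs P (evalEx e t) μ out → Runs (letP e P) t μ (λ a → out a ∙ t)
    run-let {e = e} {t = t} p = run-⨟ (run-lam (env ∙ e)) λ _ → run-⨟D (run-under p) λ a → run-lam (tl env ∙ hd env)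

    run-return : ∀ {A : Set} {P t} {a : A} {out : A → Tree} → RunsD P t (out a) → Runs P t (return a) out
    run-return {a = a} p .computes cs stk x k = p .computes cs stk (λ _ → x a) (λ _ → k a)

    infixr 5 _⨟ᴰ_

    _⨟ᴰ_ : ∀ {A : Set} {P Q t t′} {μ : Rand A} {out} → RunsD P t t′ → Runs Q t′ μ out → Runs (P ⨟ Q) t μ out
    p ⨟ᴰ q = run-⨟ p λ _ → q

    run-iter : ∀ b {P} (f : Tree → Tree) → (∀ x s → RunsD P (x ∙ s) (f s)) → ∀ l s → len l ≤ bound b →
      RunsD (for b P) (l ∙ s) (iter f s (len l))
    run-iter b {P} f h l s l≤ = run-for b l≤ (go l s)
      where
      go : ∀ l s → RunsFor {⊤} P (len l) l s (return tt) (λ _ → iter f s (len l))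
      go nil s = for-[] refl
      go (x ∙ l) s = for-∷ (h x s) λ _ → go l (f s)

    run-cons : ∀ b l s → len l ≤ bound b → RunsD (consP b) (l ∙ s) (pre (len l) s)
    run-cons b l s l≤ = run-≡ (trans (iter-pre 1 s (len l)) (cong (λ n → pre n s) (ℕ.*-identityʳ (len l))))
      (run-iter b (pre 1) (λ x s → run-lam _) l s l≤)

    run-drop : ∀ b l s → len l ≤ bound b → RunsD (dropP b) (l ∙ s) (iter tail s (len l))
    run-drop b = run-iter b tail (λ x s → run-lam _)

    run-reverse : ∀ b l acc s → len l ≤ bound b →
      RunsD (for b revBody) (l ∙ acc ∙ s) ((l onto acc) ∙ s)
    run-reverse b l acc s l≤ = run-for b l≤ (go l acc)
      where
      go : ∀ l acc → RunsFor {⊤} revBody (len l) l (acc ∙ s) (return tt) (λ _ → (l onto acc) ∙ s)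
      go nil acc = for-[] refl
      go (x ∙ l) acc = for-∷ (run-lam _) λ _ → go l (x ∙ acc)

    reverse-map : ∀ {b n} l s → n ≤ bound b → len l ≡ n →
      RunsD (lam (hd env ∙ nil ∙ tl env) ⨟ for b revBody) ((l onto nil) ∙ s) (l ∙ s)
    reverse-map {b} l s n≤ refl = run-lam _ ⨟ᴰ run-≡ (cong (_∙ s) (trans (onto-onto l nil nil) (++ᵗ-nil l)))
      (run-reverse b (l onto nil) nil s (ℕ.≤-trans (ℕ.≤-reflexive (trans (len-onto l nil) (ℕ.+-identityʳ (len l)))) n≤))

    run-mapS : ∀ b {P} {I O : Set} (St : ℕ → Set) (f : ∀ {n} → I → St (suc n) → O × St n)
      (inp : I → Tree) (out : O → Tree) (code : ∀ {n} → St n → Tree) →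
      (∀ {n} x (s : St (suc n)) → RunsD P (inp x ∙ code s) (out (proj₁ (f x s)) ∙ code (proj₂ (f x s)))) →
      ∀ {n} (xs : Vec I n) (s : St n) → n ≤ bound b →
      RunsD (mapP b P) (encV inp xs ∙ code s) (encV out (proj₁ (mapS St f xs s)) ∙ code (proj₂ (mapS St f xs s)))
    run-mapS b {P} St f inp out code h xs s n≤ =
      run-lam _ ⨟ᴰ run-for b n≤ (go xs s nil) ⨟ᴰ reverse-map {b} (encV out (proj₁ (mapS St f xs s))) _ n≤ (len-encV out (proj₁ (mapS St f xs s)))
      where
      go : ∀ {n} (xs : Vec _ n) (s : St n) acc → RunsFor {⊤} (mapBody P) n (encV inp xs) (acc ∙ code s) (return tt)
        (λ _ → (encV out (proj₁ (mapS St f xs s)) onto acc) ∙ code (proj₂ (mapS St f xs s)))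
      go [] s acc = for-[] refl
      go (x ∷ xs) s acc = for-∷ (run-lam _ ⨟ᴰ run-under (h x s) ⨟ᴰ run-lam _) λ _ → go xs _ _

    run-mapI : ∀ b {P} {A : Set} (D : Rand A) (out : A → Tree) s →
      (∀ x → Runs P (x ∙ s) D (λ a → out a ∙ s)) → ∀ l {n} → len l ≡ n → n ≤ bound b →
      Runs (mapP b P) (l ∙ s) (iid D n) (λ v → encV out v ∙ s)
    run-mapI b {P} D out s h l refl l≤ =
      run-lam _ ⨟ᴰ run-⨟D (run-for b l≤ (go l nil)) λ v → reverse-map {b} (encV out v) s l≤ (len-encV out v)
      where
      go : ∀ l acc → RunsFor (mapBody P) (len l) l (acc ∙ s) (iid D (len l)) (λ v → (encV out v onto acc) ∙ s)
      go nil acc = for-[] refl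
      go (x ∙ l) acc = for-∷ (run-lam _ ⨟ᴰ run-⨟D (run-under (h x)) λ a → run-lam _) λ a →
        for-map (a ∷_) (go l (out a ∙ acc))

    run-iid : ∀ b {P} {A : Set} (D : Rand A) (out : A → Tree) s →
      Runs P s D out → ∀ l {n} → len l ≡ n → n ≤ bound b →
      Runs (iidP b P) (l ∙ s) (iid D n) (λ v → encV out v ∙ s)
    run-iid b D out s h l eq l≤ = run-mapI b D out s (λ x → run-⨟D (run-let h) λ a → run-lam _) l eq l≤

    run-foldS : ∀ b {P} {I : Set} (St : ℕ → Set) (f : ∀ {n} → I → St (suc n) → St n)
      (inp : I → Tree) (code : ∀ {n} → St n → Tree) →
      (∀ {n} x (s : St (suc n)) → RunsD P (inp x ∙ code s) (code (f x s))) →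
      ∀ {n} (xs : Vec I n) (s : St n) → n ≤ bound b →
      RunsD (for b P) (encV inp xs ∙ code s) (code (foldS St f xs s))
    run-foldS b {P} St f inp code h xs s n≤ = run-for b n≤ (go xs s)
      where
      go : ∀ {n} (xs : Vec _ n) (s : St n) → RunsFor {⊤} P n (encV inp xs) (code s) (return tt) (λ _ → code (foldS St f xs s))
      go [] s = for-[] refl
      go (x ∷ xs) s = for-∷ (h x s) λ _ → go xs (f x s)

module VectorPrograms where

  open Machine
  open Programs
  open import Data.Bool using (Bool; true; false; if_then_else_)
  open import Data.Fin using (Fin; zero; suc; toℕ)
  import Data.Fin.Properties as Fin
  open import Data.List using (List; []; _∷_)
  open import Data.Nat using (ℕ; zero; suc; _+_; _*_; _∸_; _^_; _≤_; _<_; _<?_; z≤n; s≤s; NonZero)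
  import Data.Nat.Properties as ℕ
  open import Data.Nat.DivMod using (_mod_; m≤n⇒[n∸m]%m≡n%m; m<n⇒m%n≡m; m%n<n)
  open import Data.Product using (_×_; _,_; proj₁)
  open import Data.Rational using (ℚ)
  open import Data.Unit using (⊤; tt)
  open import Data.Vec using (Vec; []; _∷_; zipWith; map)
  open import Relation.Binary.PropositionalEquality
  open import Relation.Nullary using (yes; no; does)
  open import Relation.Nullary.Decidable using (dec-true; dec-false)

  preEx : ℕ → Ex → Ex
  preEx zero    e = e
  preEx (suc n) e = nil ∙ preEx n e

  evalEx-preEx : ∀ n e t → evalEx (preEx n e) t ≡ pre n (evalEx e t)
  evalEx-preEx zero e t = refl
  evalEx-preEx (suc n) e t = cong (nil ∙_) (evalEx-preEx n e t)

  -- nil lists of length |M|·|Q| and |M|^D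
  multP : Prog
  multP =
    lam (hd env ∙ nil ∙ tl env) ⨟
    for short (letP (tl (tl env) ∙ hd (tl env)) (consP short) ⨟ lam (# 0 ∙ tl (tl (tl env)))) ⨟
    lam (hd env)

  powP : ℕ → Prog
  powP D =
    lam (literal D ∙ (nil ∙ nil) ∙ env) ⨟
    for short (letP (tl (tl env) ∙ hd (tl env)) multP ⨟ lam (# 0 ∙ tl (tl (tl env)))) ⨟
    lam (hd env)

  isZeroP : Prog
  isZeroP = lam (env ∙ nil ∙ nil) ⨟ for short (ifte (hd env) (lam nil) (lam (tl env)))

  isZero? : ∀ {q n} → Vec (Fin q) n → Bool
  isZero? []            = true
  isZero? (zero ∷ x)    = isZero? x
  isZero? (suc _ ∷ x)   = false

  module Digits (q : ℕ) .{{_ : NonZero q}} where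

    encD : Fin q → Tree
    encD a = numeral (toℕ a)

    encG : ∀ {m} → Vec (Fin q) m → Tree
    encG = encV encD

    modP addDigitP addVecP negDigitP negVecP randVecP unaryP logBody logP : Prog
    modP = ifte (tl^ (q ∸ 1) env) (lam (tl^ q env)) (lam env)
    addDigitP = consP short ⨟ modP
    addVecP = mapP short (letP (# 0 ∙ # 1) addDigitP ⨟ lam (# 0 ∙ tl (tl (tl env)))) ⨟ lam (hd env)
    negDigitP = lam (env ∙ literal q) ⨟ dropP short ⨟ modP
    negVecP = lam (env ∙ nil) ⨟ mapP short (letP (hd env) negDigitP ⨟ lam (# 0 ∙ nil)) ⨟ lam (hd env)
    randVecP = lam (env ∙ nil) ⨟ iidP short (rand q ⨟ lam (hd env)) ⨟ lam (hd env)
    unaryP = lam (env ∙ nil) ⨟ for short (lam (tl env ∙ hd env) ⨟ for long (lam (preEx q (tl env))))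
    -- state (e , q^e), where e grows until q^e exceeds the length of the given list
    logBody =
      letP (tl (tl (tl env)) ∙ hd (tl (tl env))) (dropP long) ⨟
      ifte (# 0) (lam (tl (tl env)))
        (letP (# 3 ∙ nil) (for long (lam (preEx q (tl env)))) ⨟ lam ((nil ∙ # 3) ∙ # 0 ∙ tl (tl (tl (tl (tl env))))))
    logP = lam (hd env ∙ nil ∙ (nil ∙ nil) ∙ tl env) ⨟ for short logBody ⨟ lam (hd env)

    addD : Fin q → Fin q → Fin q
    addD a b = (toℕ a + toℕ b) mod q

    negD : Fin q → Fin q
    negD a = (q ∸ toℕ a) mod q

    value : ∀ {n} → ℕ → Vec (Fin q) n → ℕ
    value v []      = v
    value v (d ∷ u) = value (v * q + toℕ d) u

    logStep : ℕ → ℕ → ℕ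
    logStep ρ e = if does (ρ <? q ^ e) then e else suc e

  module DigitRules (q : ℕ) .{{_ : NonZero q}} (A : Algorithm) (score : Config (Compile.width A) → ℚ) (S R T : ℕ) (q≤S : q ≤ S) where

    open Digits q
    open Rules A score S R T public

    run-mult : ∀ M Q → len M ≤ S → len Q ≤ S → RunsD multP (M ∙ Q) (numeral (len M * len Q))
    run-mult M Q M≤ Q≤ = run-lam _ ⨟ᴰ
      run-≡ (cong (_∙ Q) (count (items M) 0))
        (run-≡in (cong (_∙ (nil ∙ Q)) (encV-items M))
          (run-foldS short (λ _ → ℕ) (λ _ a → len Q + a) (λ a → a) (λ a → numeral a ∙ Q)
            (λ x a → run-let (run-≡ (pre-numeral (len Q) a) (run-cons short Q (numeral a) Q≤)) ⨟ᴰ run-lam _)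
            (items M) 0 M≤)) ⨟ᴰ
      run-≡ (cong numeral (ℕ.+-identityʳ (len M * len Q))) (run-lam _)
      where
      count : ∀ {n} (xs : Vec Tree n) a → numeral (foldS (λ _ → ℕ) (λ _ a → len Q + a) xs a) ≡ numeral (n * len Q + a)
      count [] a = refl
      count {suc n} (x ∷ xs) a = trans (count xs (len Q + a)) (cong numeral (trans (sym (ℕ.+-assoc (n * len Q) (len Q) a)) (cong (_+ a) (ℕ.+-comm (n * len Q) (len Q)))))

    run-pow : ∀ D M → 1 ≤ len M → D ≤ S → len M ≤ S → len M ^ D ≤ S → RunsD (powP D) M (numeral (len M ^ D))
    run-pow D M 1≤ D≤ M≤ p≤ = run-≡ (cong₂ (λ d i → d ∙ i ∙ M) (trans (evalEx-literal D M) (nils D)) refl) (run-lam _) ⨟ᴰ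
      run-foldS short St (λ {n} → times {n}) (λ a → a) (λ s → numeral (proj₁ s) ∙ M)
        (λ { {n} x (a , eq) → run-let (run-≡ (cong (λ a → numeral (len M * a)) (len-numeral a)) (run-mult M (numeral a) M≤ (ℕ.≤-trans (ℕ.≤-reflexive (len-numeral a)) (small {suc n} a eq)))) ⨟ᴰ run-lam _ })
        (items (numeral D)) start₀ (ℕ.≤-trans (ℕ.≤-reflexive (len-numeral D)) D≤) ⨟ᴰ
      run-≡ (cong numeral (final (foldS St (λ {n} → times {n}) (items (numeral D)) start₀))) (run-lam _)
      where
      St : ℕ → Set
      St n = Data.Product.Σ ℕ λ a → a * len M ^ n ≡ len M ^ D
      advance : ∀ {n} a → a * len M ^ suc n ≡ len M ^ D → len M * a * len M ^ n ≡ len M ^ D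
      advance {n} a eq = trans (cong (_* len M ^ n) (ℕ.*-comm (len M) a)) (trans (ℕ.*-assoc a (len M) (len M ^ n)) eq)
      times : ∀ {n} → Tree → St (suc n) → St n
      times {n} _ (a , eq) = len M * a , advance {n} a eq
      start₀ : St (len (numeral D))
      start₀ = 1 , trans (ℕ.*-identityˡ _) (cong (len M ^_) (len-numeral D))
      small : ∀ {n} a → a * len M ^ n ≡ len M ^ D → a ≤ S
      small {n} a eq = ℕ.≤-trans (ℕ.≤-trans (ℕ.≤-reflexive (sym (ℕ.*-identityʳ a))) (ℕ.*-monoʳ-≤ a (pos n))) (ℕ.≤-trans (ℕ.≤-reflexive eq) p≤)
        where
        pos : ∀ n → 1 ≤ len M ^ n
        pos zero = s≤s z≤n
        pos (suc n) = ℕ.*-mono-≤ 1≤ (pos n)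
      nils : ∀ n → numeral n ≡ encV (λ a → a) (items (numeral n))
      nils n = sym (encV-items (numeral n))
      final : (s : St 0) → proj₁ s ≡ len M ^ D
      final (a , eq) = trans (sym (ℕ.*-identityʳ a)) eq

    run-isZero : ∀ {n} (x : Vec (Fin q) n) → n ≤ S → RunsD isZeroP (encG x) (encB (isZero? x))
    run-isZero x n≤ = run-lam _ ⨟ᴰ run-≡ (cong encB (correct true x))
      (run-foldS short (λ _ → Bool) (λ a b → zeroAnd a b) encD encB body x true n≤)
      where
      zeroAnd : Fin q → Bool → Bool
      zeroAnd zero    b = b
      zeroAnd (suc _) b = false
      body : ∀ a b → RunsD _ (encD a ∙ encB b) (encB (zeroAnd a b))
      body zero    b = run-ifte false refl (run-lam _)
      body (suc a) b = run-ifte true refl (run-lam _)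
      correct : ∀ {n} b (x : Vec (Fin q) n) → foldS (λ _ → Bool) (λ a b → zeroAnd a b) x b ≡ (if b then isZero? x else false)
      correct false [] = refl
      correct true  [] = refl
      correct false (zero ∷ x) = correct false x
      correct false (suc a ∷ x) = correct false x
      correct true (zero ∷ x) = correct true x
      correct true (suc a ∷ x) = correct false x

    run-mod : ∀ n → n < q + q → RunsD modP (numeral n) (encD (n mod q))
    run-mod n n< with n <? q
    ... | yes n<q = run-ifte false
            (trans (cong isCons (trans (evalEx-tl^ (q ∸ 1) env (numeral n)) (tail-numeral n (q ∸ 1)))) (trans (isCons-numeral (n ∸ (q ∸ 1))) (cong (λ j → does (0 <? j)) (ℕ.m≤n⇒m∸n≡0 (ℕ.∸-monoˡ-≤ 1 n<q)))))
            (run-≡ (cong numeral (sym (trans (Fin.toℕ-fromℕ< (m%n<n n q)) (m<n⇒m%n≡m n<q)))) (run-lam env))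
    ... | no n≮q = run-ifte true
            (trans (cong isCons (trans (evalEx-tl^ (q ∸ 1) env (numeral n)) (tail-numeral n (q ∸ 1)))) (pos (n ∸ (q ∸ 1)) (ℕ.m<n⇒0<n∸m (ℕ.<-≤-trans (q-1<q q) q≤n))))
            (run-≡ (trans (evalEx-tl^ q env (numeral n)) (trans (tail-numeral n q) (cong numeral (sym (trans (Fin.toℕ-fromℕ< (m%n<n n q)) (trans (sym (m≤n⇒[n∸m]%m≡n%m q≤n)) (m<n⇒m%n≡m (ℕ.+-cancelˡ-< q (n ∸ q) q (subst (_< q + q) (sym (ℕ.m+[n∸m]≡n q≤n)) n<)))))))))
              (run-lam (tl^ q env)))
      where
      q≤n : q ≤ n
      q≤n = ℕ.≮⇒≥ n≮q
      q-1<q : ∀ q .{{_ : NonZero q}} → q ∸ 1 < q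
      q-1<q (suc q) = ℕ.n<1+n q
      pos : ∀ j → 0 < j → isCons (numeral j) ≡ true
      pos (suc j) _ = refl

    run-addDigit : ∀ a b → RunsD addDigitP (encD a ∙ encD b) (encD (addD a b))
    run-addDigit a b = run-≡ (trans (cong (λ n → pre n (encD b)) (len-numeral (toℕ a))) (pre-numeral (toℕ a) (toℕ b)))
      (run-cons short (encD a) (encD b) (ℕ.≤-trans (ℕ.≤-reflexive (len-numeral (toℕ a))) (ℕ.≤-trans (ℕ.<⇒≤ (Fin.toℕ<n a)) q≤S))) ⨟ᴰ
      run-mod (toℕ a + toℕ b) (ℕ.+-mono-< (Fin.toℕ<n a) (Fin.toℕ<n b))

    run-addVec : ∀ {n} (x y : Vec (Fin q) n) → n ≤ S → RunsD addVecP (encG x ∙ encG y) (encG (zipWith addD x y))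
    run-addVec {n} x y n≤ = run-mapS short (Vec (Fin q)) zipStep encD encD encG
      (λ { a (b ∷ y) → run-let (run-addDigit a b) ⨟ᴰ run-lam _ }) x y n≤ ⨟ᴰ run-≡ (cong encG (eq x y)) (run-lam (hd env))
      where
      zipStep : ∀ {n} → Fin q → Vec (Fin q) (suc n) → Fin q × Vec (Fin q) n
      zipStep a (b ∷ y) = addD a b , y
      eq : ∀ {n} (x y : Vec (Fin q) n) → proj₁ (mapS (Vec (Fin q)) zipStep x y) ≡ zipWith addD x y
      eq [] [] = refl
      eq (a ∷ x) (b ∷ y) = cong (addD a b ∷_) (eq x y)

    run-negDigit : ∀ a → RunsD negDigitP (encD a) (encD (negD a))
    run-negDigit a = run-≡ (cong (encD a ∙_) (evalEx-literal q (encD a))) (run-lam _) ⨟ᴰ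
      run-≡ (trans (cong (iter tail (numeral q)) (len-numeral (toℕ a))) (tail-numeral q (toℕ a)))
        (run-drop short (encD a) (numeral q) (ℕ.≤-trans (ℕ.≤-reflexive (len-numeral (toℕ a))) (ℕ.≤-trans (ℕ.<⇒≤ (Fin.toℕ<n a)) q≤S))) ⨟ᴰ
      run-mod (q ∸ toℕ a) (ℕ.≤-<-trans (ℕ.m∸n≤m q (toℕ a)) (ℕ.m<m+n q (ℕ.≤-<-trans z≤n (Fin.toℕ<n a))))

    run-negVec : ∀ {n} (x : Vec (Fin q) n) → n ≤ S → RunsD negVecP (encG x) (encG (map negD x))
    run-negVec x n≤ = run-lam _ ⨟ᴰ
      run-mapS short (λ _ → ⊤) (λ a _ → negD a , tt) encD encD (λ _ → nil)
        (λ a _ → run-let (run-negDigit a) ⨟ᴰ run-lam _) x tt n≤ ⨟ᴰ run-≡ (cong encG (eq x)) (run-lam (hd env))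
      where
      eq : ∀ {n} (x : Vec (Fin q) n) → proj₁ (mapS (λ _ → ⊤) (λ a _ → negD a , tt) x tt) ≡ map negD x
      eq [] = refl
      eq (a ∷ x) = cong (negD a ∷_) (eq x)

    run-randVec : ∀ l {n} → len l ≡ n → n ≤ S → Runs randVecP l (iid (choose q return) n) encG
    run-randVec l eq l≤ = run-lam _ ⨟ᴰ run-⨟D (run-iid short (choose q return) encD nil
      (run-⨟D (run-rand q) (λ a → run-lam (hd env))) l eq l≤) (λ v → run-lam (hd env))

    run-shift : ∀ t d → len t ≤ R → RunsD (for long (lam (preEx q (tl env)))) (t ∙ d) (pre (len t * q) d)
    run-shift t d t≤ = run-≡ (iter-pre q d (len t)) (run-iter long (pre q) (λ x s → run-≡ (evalEx-preEx q (tl env) (x ∙ s)) (run-lam _)) t d t≤)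

    run-unary : ∀ {n} (u : Vec (Fin q) n) → n ≤ S → q ^ n ≤ R → RunsD unaryP (encG u) (numeral (value 0 u))
    run-unary {n} u n≤ q^≤ = run-lam _ ⨟ᴰ run-≡ (cong numeral (eq u _))
      (run-foldS short St (λ {n} → read {n}) encD (λ s → numeral (proj₁ s))
        (λ { {n} d (v , p) → run-lam _ ⨟ᴰ
          run-≡ (trans (pre-numeral (len (numeral v) * q) (toℕ d)) (cong (λ v → numeral (v * q + toℕ d)) (len-numeral v)))
            (run-shift (numeral v) (encD d) (ℕ.≤-trans (ℕ.≤-reflexive (len-numeral v)) (small {suc n} v p))) })
        u (0 , ℕ.≤-trans (ℕ.≤-reflexive (ℕ.*-identityˡ (q ^ n))) q^≤) n≤)
      where
      St : ℕ → Set
      St n = Data.Product.Σ ℕ λ v → suc v * q ^ n ≤ R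
      pos : ∀ n → 1 ≤ q ^ n
      pos n = ℕ.m^n>0 q n
      small : ∀ {n} v → suc v * q ^ n ≤ R → v ≤ R
      small {n} v p = ℕ.≤-trans (ℕ.≤-trans (ℕ.n≤1+n v) (ℕ.≤-trans (ℕ.≤-reflexive (sym (ℕ.*-identityʳ (suc v)))) (ℕ.*-monoʳ-≤ (suc v) (pos n)))) p
      advance : ∀ {n} (d : Fin q) v → suc v * q ^ suc n ≤ R → suc (v * q + toℕ d) * q ^ n ≤ R
      advance {n} d v p = ℕ.≤-trans (ℕ.*-monoˡ-≤ (q ^ n) (ℕ.≤-trans (ℕ.≤-reflexive (sym (ℕ.+-suc (v * q) (toℕ d)))) (ℕ.≤-trans (ℕ.+-monoʳ-≤ (v * q) (Fin.toℕ<n d)) (ℕ.≤-reflexive (ℕ.+-comm (v * q) q)))))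
        (ℕ.≤-trans (ℕ.≤-reflexive (ℕ.*-assoc (suc v) q (q ^ n))) p)
      read : ∀ {n} → Fin q → St (suc n) → St n
      read {n} d (v , p) = v * q + toℕ d , advance {n} d v p
      eq : ∀ {n} (u : Vec (Fin q) n) (s : St n) → proj₁ (foldS St (λ {n} → read {n}) u s) ≡ value (proj₁ s) u
      eq [] s = refl
      eq {suc n} (d ∷ u) (v , p) = eq u (v * q + toℕ d , advance {n} d v p)

    run-log : ∀ F ρ → len F ≤ S → len ρ ≤ R → RunsD logP (F ∙ ρ) (numeral (iter (logStep (len ρ)) 0 (len F)))
    run-log F ρ F≤ ρ≤ = run-≡ (cong₂ (λ F i → F ∙ nil ∙ i ∙ ρ) (sym (encV-items F)) refl) (run-lam _) ⨟ᴰ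
      run-foldS short (λ _ → ℕ) (λ _ e → logStep (len ρ) e) (λ a → a) (λ e → numeral e ∙ numeral (q ^ e) ∙ ρ)
        (λ x e → body x e) (items F) 0 F≤ ⨟ᴰ run-≡ (cong numeral (eq (items F) 0)) (run-lam (hd env))
      where
      eq : ∀ {n} (xs : Vec Tree n) e → foldS (λ _ → ℕ) (λ _ e → logStep (len ρ) e) xs e ≡ iter (logStep (len ρ)) e n
      eq [] e = refl
      eq (x ∷ xs) e = eq xs (logStep (len ρ) e)
      body : ∀ x e → RunsD logBody (x ∙ numeral e ∙ numeral (q ^ e) ∙ ρ) (numeral (logStep (len ρ) e) ∙ numeral (q ^ logStep (len ρ) e) ∙ ρ)
      body x e = run-let (run-≡ (tail-numeral (q ^ e) (len ρ)) (run-drop long ρ (numeral (q ^ e)) ρ≤)) ⨟ᴰ branch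
        where
        result : Bool → Tree
        result b = let e′ = if b then e else suc e in numeral e′ ∙ numeral (q ^ e′) ∙ ρ
        branch : RunsD _ (numeral (q ^ e ∸ len ρ) ∙ x ∙ numeral e ∙ numeral (q ^ e) ∙ ρ) (numeral (logStep (len ρ) e) ∙ numeral (q ^ logStep (len ρ) e) ∙ ρ)
        branch with len ρ <? q ^ e
        ... | yes ρ< = run-ifte true (pos (q ^ e ∸ len ρ) (ℕ.m<n⇒0<n∸m ρ<)) (run-≡ (cong result (sym (dec-true (len ρ <? q ^ e) ρ<))) (run-lam _))
          where
          pos : ∀ j → 0 < j → isCons (numeral j) ≡ true
          pos (suc j) _ = refl
        ... | no ρ≮ = run-ifte false (cong (λ j → isCons (numeral j)) (ℕ.m≤n⇒m∸n≡0 (ℕ.≮⇒≥ ρ≮)))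
          (run-let (run-≡ (trans (pre-numeral (len (numeral (q ^ e)) * q) 0) (cong numeral (trans (ℕ.+-identityʳ _) (trans (cong (_* q) (len-numeral (q ^ e))) (ℕ.*-comm (q ^ e) q)))))
            (run-shift (numeral (q ^ e)) nil (ℕ.≤-trans (ℕ.≤-reflexive (len-numeral (q ^ e))) (ℕ.≤-trans (ℕ.≮⇒≥ ρ≮) ρ≤)))) ⨟ᴰ run-≡ (cong result (sym (dec-false (len ρ <? q ^ e) ρ≮))) (run-lam _))

module Pipeline where

  open Machine
  open Programs
  open VectorPrograms
  open import Data.Bool using (Bool; true; false; if_then_else_; _∧_)
  open import Data.Fin using (Fin; zero; suc; toℕ)
  import Data.Fin.Properties as Fin
  open import Data.List using (List; []; _∷_; length)
  open import Data.Maybe using (Maybe; just; nothing)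
  open import Data.Nat using (ℕ; zero; suc; _+_; _*_; _∸_; _^_; _≤_; _<_; _≟_; _≡ᵇ_; pred; z≤n; s≤s; NonZero)
  import Data.Nat.Properties as ℕ
  open import Data.Nat.DivMod using (_mod_; m%n<n; m<n⇒m%n≡m)
  open import Data.Product using (_×_; _,_; proj₁; proj₂)
  open import Data.Rational using (ℚ)
  open import Data.Unit using (⊤; tt)
  open import Data.Vec using (Vec; []; _∷_; zipWith; map; lookup; replicate; fromList)
  open import Relation.Binary.PropositionalEquality
  open import Relation.Nullary using (does)
  open import Relation.Nullary.Decidable using (dec-true; dec-false)
  open import Relation.Binary.Definitions using (tri<; tri≈; tri>)

  nth : Tree → ℕ → Tree
  nth t n = head (iter tail t n)

  nth-encV : ∀ {A : Set} {n} (f : A → Tree) (xs : Vec A n) i → nth (encV f xs) (toℕ i) ≡ f (lookup xs i)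
  nth-encV f (x ∷ xs) zero = refl
  nth-encV f (x ∷ xs) (suc i) = nth-encV f xs i

  nth-nil : ∀ n → nth nil n ≡ nil
  nth-nil zero = refl
  nth-nil (suc n) = nth-nil n

  iter-+ : ∀ {A : Set} (f : A → A) s m n → iter f (iter f s m) n ≡ iter f s (m + n)
  iter-+ f s zero n = refl
  iter-+ f s (suc m) n = iter-+ f (f s) m n

  nthM : ∀ {A : Set} {n} → Vec (Maybe A) n → ℕ → Maybe A
  nthM []       i       = nothing
  nthM (x ∷ xs) zero    = x
  nthM (x ∷ xs) (suc i) = nthM xs i

  padAt : ∀ {A : Set} {n} → ℕ → Vec (Maybe A) n → ℕ → Maybe A
  padAt zero    xs i       = nthM xs i
  padAt (suc t) xs zero    = nothing
  padAt (suc t) xs (suc i) = padAt t xs i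

  tagCount : Bool → ∀ {n} → Vec ℕ n → Bool
  tagCount b []       = b
  tagCount b (t ∷ ts) = tagCount (if t ≡ᵇ 1 then true else b) ts

  -- membership bits of the set {t - 1 | t ∈ ts}
  bitsOf : ∀ {t} n → Vec ℕ t → Vec Bool n
  bitsOf zero    ts = []
  bitsOf (suc n) ts = tagCount false ts ∷ bitsOf n (map pred ts)

  module _ {X : Set} where

    gatherStep : ℕ × X → Tree × ℕ × List ℕ → Tree × ℕ × List ℕ
    gatherStep (i , x) (O , β , acc) with isCons (head O) | β
    ... | true  | suc β′ = tail O , β′ , i ∷ acc
    ... | true  | zero   = tail O , zero , acc
    ... | false | β′     = tail O , β′ , acc

    gather : ∀ {n} → Vec (ℕ × X) n → Tree × ℕ × List ℕ → Tree × ℕ × List ℕ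
    gather = foldS (λ _ → Tree × ℕ × List ℕ) gatherStep

    gather-length : ∀ {n} (ps : Vec (ℕ × X) n) s →
      length (proj₂ (proj₂ (gather ps s))) ≤ proj₁ (proj₂ s) + length (proj₂ (proj₂ s))
    gather-length [] (O , β , acc) = ℕ.m≤n+m (length acc) β
    gather-length ((i , x) ∷ ps) (O , β , acc) with isCons (head O) | β
    ... | true  | suc β′ = ℕ.≤-trans (gather-length ps (tail O , β′ , i ∷ acc)) (ℕ.≤-reflexive (ℕ.+-suc β′ (length acc)))
    ... | true  | zero   = gather-length ps (tail O , zero , acc)
    ... | false | β′     = gather-length ps (tail O , β′ , acc)

  module Pipe (q : ℕ) .{{_ : NonZero q}} (k : ℕ) where

    open Digits q public

    zeroVecP sumP srcBody maskBody decBody listBody dstBody gatherBody anyBody bitsBody checkBody checkP : Prog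
    zeroVecP = lam (env ∙ nil) ⨟ mapP short (lam (nil ∙ nil)) ⨟ lam (hd env)
    sumP = for short addVecP
    srcBody = letP (hd (tl^ 3 env)) isZeroP ⨟
      ifte (# 0)
        (lam (((nil ∙ hd (# 3)) ∙ (nil ∙ # 2) ∙ # 1) ∙ (nil ∙ # 2) ∙ tl (# 3) ∙ tl (tl^ 4 env)))
        (lam ((nil ∙ (nil ∙ # 2) ∙ # 1) ∙ (nil ∙ # 2) ∙ tl (# 3) ∙ tl (tl^ 4 env)))
    maskBody = ifte (hd (# 0))
      (ifte (tl (hd (# 0))) (lam (nil ∙ tl env)) (letP (tl (tl (# 0)) ∙ tl env) addVecP ⨟ lam ((hd (tl (# 1)) ∙ # 0) ∙ tl (tl env))))
      (lam (nil ∙ tl env))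
    decBody = lam ((tl (hd (# 0)) ∙ tl (# 0)) ∙ tl env)
    listBody =
      letP (# 2 ∙ # 0) (mapP long maskBody) ⨟
      letP (hd (# 2)) unaryP ⨟
      letP (# 0 ∙ hd (# 1)) (consP long) ⨟
      letP (tl^ 6 env ∙ # 0) (dropP long) ⨟
      letP (# 6 ∙ nil) (mapP long decBody) ⨟
      lam (# 1 ∙ tl (# 6) ∙ hd (# 0) ∙ tl^ 8 env)
    dstBody =
      letP (# 0 ∙ tl (tl env)) (dropP short) ⨟
      letP (tl^ 3 env ∙ nil) (mapP short (lam (tl (hd env) ∙ tl env))) ⨟
      ifte (hd (hd (# 1))) (lam (hd (hd (# 1)) ∙ tl (# 3) ∙ hd (# 0))) (lam ((nil ∙ hd (# 3)) ∙ tl (# 3) ∙ hd (# 0)))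
    gatherBody =
      ifte (hd (# 1)) (ifte (# 2) (lam (tl (# 1) ∙ tl (# 2) ∙ hd (# 0) ∙ tl^ 3 env)) (lam (tl (# 1) ∙ # 2 ∙ tl^ 3 env)))
        (lam (tl (# 1) ∙ # 2 ∙ tl^ 3 env))
    anyBody = ifte (hd env) (ifte (tl (hd env)) (lam (tl env)) (lam (nil ∙ nil))) (lam (tl env))
    bitsBody =
      letP (tl env ∙ nil) (for short anyBody) ⨟
      letP (tl (tl env) ∙ nil) (mapP short (lam (tl (hd env) ∙ tl env))) ⨟
      lam (# 1 ∙ hd (# 0))
    checkBody = ifte (# 0)
      (letP (hd (# 1) ∙ tl^ 3 env) addVecP ⨟ lam (tl (# 2) ∙ (nil ∙ # 3) ∙ # 0))
      (lam (tl (# 1) ∙ # 2 ∙ tl^ 3 env))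
    -- input (bits ∙ X ∙ nil ∙ zero vector)
    checkP = for long checkBody ⨟
      ifte (tl^ (k ∸ 1) (# 1)) (ifte (tl^ k (# 1)) (lam nil) (lam (tl (tl env)) ⨟ isZeroP)) (lam nil)

    module _ {m : ℕ} where

      G : Set
      G = Vec (Fin q) m

      infixl 6 _⊞_
      _⊞_ : G → G → G
      _⊞_ = zipWith addD

      ⊟_ : G → G
      ⊟_ = map negD

      0V : G
      0V = replicate m (0 mod q)

      sumFrom : ∀ {n} → G → Vec G n → G
      sumFrom z []       = z
      sumFrom z (x ∷ xs) = sumFrom (x ⊞ z) xs

      Src : Set
      Src = ℕ × ℕ × G

      encSrc : Src → Tree
      encSrc (c , i , x) = numeral c ∙ numeral i ∙ encG x

      encP : ℕ × G → Tree
      encP (i , x) = numeral i ∙ encG x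

      encM : Maybe (ℕ × G) → Tree
      encM nothing  = nil
      encM (just p) = encP p

      mkSrcs : ∀ {κ e n} → ℕ → Vec (Fin κ) n → Vec (Vec (Fin q) e) n → Vec G n → Vec Src n
      mkSrcs i []       []       []       = []
      mkSrcs i (a ∷ as) (l ∷ ls) (x ∷ xs) =
        ((if isZero? l then suc (toℕ a) else 0) , suc i , x) ∷ mkSrcs (suc i) as ls xs

      maskOf : G → Src → Maybe (ℕ × G)
      maskOf c (zero        , i , x) = nothing
      maskOf c (suc zero    , i , x) = just (i , x ⊞ c)
      maskOf c (suc (suc _) , i , x) = nothing

      decSrc : Src → Src
      decSrc (c , i , x) = pred c , i , x

      Stream : Set
      Stream = ℕ → Maybe (ℕ × G)

      streams : ∀ {κ β r} → Vec G κ → Vec (Vec (Fin q) β) κ → Vec Src r → Vec Stream κ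
      streams []       []       srcs = []
      streams {r = r} (c ∷ cs) (t ∷ ts) srcs =
        (λ d → padAt (value 0 t) (map (maskOf c) srcs) (r + d)) ∷ streams cs ts (map decSrc srcs)

      pickM : Maybe (ℕ × G) → G → ℕ × G
      pickM nothing  u = 0 , u
      pickM (just p) u = p

      destinations : ∀ {κ n} → Vec Stream κ → ℕ → Vec (Fin κ) n → Vec G n → Vec (ℕ × G) n
      destinations fs i []       []       = []
      destinations fs i (b ∷ bs) (u ∷ us) = pickM (lookup fs b i) u ∷ destinations fs (suc i) bs us

      tally : ∀ {n} → Vec Bool n → Vec G n → ℕ → G → ℕ × G
      tally []           []       c s = c , s
      tally (true  ∷ bs) (x ∷ xs) c s = tally bs xs (suc c) (x ⊞ s)
      tally (false ∷ bs) (x ∷ xs) c s = tally bs xs c s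

      checks : ∀ {n} → Vec Bool n → Vec G n → Bool
      checks B X = does (proj₁ (tally B X 0 0V) ≟ k) ∧ isZero? (proj₂ (tally B X 0 0V))

      padAt-enc : ∀ {n} t (xs : Vec (Maybe (ℕ × G)) n) i → nth (pre t (encV encM xs)) i ≡ encM (padAt t xs i)
      padAt-enc zero [] i = nth-nil i
      padAt-enc zero (x ∷ xs) zero = refl
      padAt-enc zero (x ∷ xs) (suc i) = padAt-enc zero xs i
      padAt-enc (suc t) xs zero = refl
      padAt-enc (suc t) xs (suc i) = padAt-enc t xs i

  module PipeRules (q : ℕ) .{{_ : NonZero q}} (k : ℕ) (A : Algorithm) (score : Config (Compile.width A) → ℚ) (S R T : ℕ) (q≤S : q ≤ S) where

    open Pipe q k
    open DigitRules q A score S R T q≤S public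

    module _ {m : ℕ} (m≤S : m ≤ S) where

      run-zeroVec : (x : G {m}) → RunsD zeroVecP (encG x) (encG (0V {m}))
      run-zeroVec x = run-lam _ ⨟ᴰ run-mapS short (λ _ → ⊤) (λ a _ → 0 mod q , tt) encD encD (λ _ → nil)
        (λ a _ → run-≡ (cong (_∙ nil) (sym (cong numeral (trans (Fin.toℕ-fromℕ< (m%n<n 0 q)) (m<n⇒m%n≡m (ℕ.n≢0⇒n>0 (nz q))))))) (run-lam _)) x tt m≤S ⨟ᴰ
        run-≡ (cong encG (eq x)) (run-lam _)
        where
        nz : ∀ q .{{_ : NonZero q}} → q ≢ 0
        nz (suc q) ()
        eq : ∀ {n} (x : Vec (Fin q) n) → proj₁ (mapS (λ _ → ⊤) (λ a _ → 0 mod q , tt) x tt) ≡ replicate n (0 mod q)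
        eq [] = refl
        eq (a ∷ x) = cong (0 mod q ∷_) (eq x)

      run-sum : ∀ {n} (xs : Vec (G {m}) n) z → n ≤ S → RunsD sumP (encV encG xs ∙ encG z) (encG (sumFrom z xs))
      run-sum xs z n≤ = run-≡ (cong encG (eq xs z)) (run-foldS short (λ _ → G {m}) _⊞_ encG encG (λ x s → run-addVec x s m≤S) xs z n≤)
        where
        eq : ∀ {n} (xs : Vec (G {m}) n) z → foldS (λ _ → G {m}) _⊞_ xs z ≡ sumFrom z xs
        eq [] z = refl
        eq (x ∷ xs) z = eq xs (x ⊞ z)

      encF : ∀ {κ} → Fin κ → Tree
      encF a = numeral (toℕ a)

      run-srcs : ∀ {κ e n} (as : Vec (Fin κ) n) (ls : Vec (Vec (Fin q) e) n) (xs : Vec (G {m}) n) → e ≤ S → n ≤ R →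
        RunsD (mapP long srcBody ⨟ lam (hd env)) (encV encG xs ∙ nil ∙ encV encF as ∙ encV encG ls) (encV (encSrc {m}) (mkSrcs 0 as ls xs))
      run-srcs {κ} {e} as ls xs e≤ n≤ = run-mapS long St f encG (encSrc {m}) code body xs (0 , as , ls) n≤ ⨟ᴰ run-≡ (cong (encV encSrc) (eq 0 as ls xs)) (run-lam _)
        where
        St : ℕ → Set
        St n = ℕ × Vec (Fin κ) n × Vec (Vec (Fin q) e) n
        f : ∀ {n} → G {m} → St (suc n) → Src {m} × St n
        f x (i , a ∷ as , l ∷ ls) = ((if isZero? l then suc (toℕ a) else 0) , suc i , x) , suc i , as , ls
        code : ∀ {n} → St n → Tree
        code (i , as , ls) = numeral i ∙ encV encF as ∙ encV encG ls
        body : ∀ {n} x (s : St (suc n)) → RunsD srcBody (encG x ∙ code s) (encSrc {m} (proj₁ (f x s)) ∙ code (proj₂ (f x s)))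
        body x (i , a ∷ as , l ∷ ls) = run-let (run-isZero l e≤) ⨟ᴰ branch (isZero? l) refl
          where
          branch : ∀ b → isZero? l ≡ b → RunsD _ (encB (isZero? l) ∙ encG x ∙ code (i , a ∷ as , l ∷ ls))
            (encSrc {m} (proj₁ (f x (i , a ∷ as , l ∷ ls))) ∙ code (proj₂ (f x (i , a ∷ as , l ∷ ls))))
          branch true eq rewrite eq = run-ifte true refl (run-lam _)
          branch false eq rewrite eq = run-ifte false refl (run-lam _)
        eq : ∀ {n} i (as : Vec (Fin κ) n) ls xs → proj₁ (mapS St f xs (i , as , ls)) ≡ mkSrcs i as ls xs
        eq i [] [] [] = refl
        eq i (a ∷ as) (l ∷ ls) (x ∷ xs) = cong (_ ∷_) (eq (suc i) as ls xs)

      mapS-map : ∀ {I O Z : Set} (f : I → O) (z : Z) {n} (xs : Vec I n) → proj₁ (mapS (λ _ → Z) (λ x z → f x , z) xs z) ≡ map f xs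
      mapS-map f z [] = refl
      mapS-map f z (x ∷ xs) = cong (f x ∷_) (mapS-map f z xs)

      mapS-state : ∀ {I O Z : Set} (f : I → O) (z : Z) {n} (xs : Vec I n) → proj₂ (mapS (λ _ → Z) (λ x z → f x , z) xs z) ≡ z
      mapS-state f z [] = refl
      mapS-state f z (x ∷ xs) = mapS-state f z xs

      run-mapV : ∀ b {P} {I O : Set} (f : I → O) (inp : I → Tree) (out : O → Tree) s →
        (∀ x → RunsD P (inp x ∙ s) (out (f x) ∙ s)) → ∀ {n} (xs : Vec I n) → n ≤ bound b →
        RunsD (mapP b P) (encV inp xs ∙ s) (encV out (map f xs) ∙ s)
      run-mapV b f inp out s h xs n≤ = run-≡ (cong (λ v → encV out v ∙ s) (mapS-map f tt xs))
        (run-mapS b (λ _ → ⊤) (λ x z → f x , z) inp out (λ _ → s) (λ x _ → h x) xs tt n≤)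

      run-mask : (c : G {m}) (s : Src {m}) → RunsD maskBody (encSrc {m} s ∙ encG c) (encM {m} (maskOf c s) ∙ encG c)
      run-mask c (zero , i , x) = run-ifte false refl (run-lam _)
      run-mask c (suc zero , i , x) = run-ifte true refl (run-ifte false refl (run-let (run-addVec x c m≤S) ⨟ᴰ run-lam _))
      run-mask c (suc (suc n) , i , x) = run-ifte true refl (run-ifte true refl (run-lam _))

      run-dec : (s : Src {m}) → RunsD decBody (encSrc {m} s ∙ nil) (encSrc {m} (decSrc {m} s) ∙ nil)
      run-dec (zero , i , x) = run-lam _
      run-dec (suc c , i , x) = run-lam _

      shiftedTree : ∀ {r} → ℕ → G {m} → Vec (Src {m}) r → Tree
      shiftedTree {r} t c srcs = iter tail (pre t (encV (encM {m}) (map (maskOf c) srcs))) r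

      trees : ∀ {κ β r} → Vec (G {m}) κ → Vec (Vec (Fin q) β) κ → Vec (Src {m}) r → Vec Tree κ
      trees []       []       srcs = []
      trees (c ∷ cs) (t ∷ ts) srcs = shiftedTree (value 0 t) c srcs ∷ trees cs ts (map (decSrc {m}) srcs)

      value≤ : ∀ {β} (t : Vec (Fin q) β) → value 0 t ≤ q ^ β
      value≤ {β} t = ℕ.≤-trans (go 0 t) (ℕ.≤-reflexive (ℕ.+-identityʳ _))
        where
        go : ∀ {β} v (t : Vec (Fin q) β) → value v t ≤ q ^ β + v * q ^ β
        go v [] = ℕ.≤-trans (ℕ.≤-reflexive (sym (ℕ.*-identityʳ v))) (ℕ.m≤n+m (v * 1) 1)
        go {suc β} v (d ∷ t) = ℕ.≤-trans (go (v * q + toℕ d) t) (ℕ.≤-trans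
          (ℕ.*-monoˡ-≤ (q ^ β) {suc (v * q + toℕ d)} {suc v * q} (ℕ.≤-trans (ℕ.≤-reflexive (sym (ℕ.+-suc (v * q) (toℕ d)))) (ℕ.≤-trans (ℕ.+-monoʳ-≤ (v * q) (Fin.toℕ<n d)) (ℕ.≤-reflexive (ℕ.+-comm (v * q) q)))))
          (ℕ.≤-reflexive (ℕ.*-assoc (suc v) q (q ^ β))))

      run-lists : ∀ {κ β r} (cs : Vec (G {m}) κ) (ts : Vec (Vec (Fin q) β) κ) (srcs : Vec (Src {m}) r) X → len X ≡ r →
        κ ≤ S → β ≤ S → q ^ β ≤ R → r ≤ R →
        RunsD (mapP short listBody ⨟ lam (hd env)) (encV encG cs ∙ encV encG ts ∙ encV (encSrc {m}) srcs ∙ X) (encV (λ t → t) (trees cs ts srcs))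
      run-lists {κ} {β} {r} cs ts srcs X refl κ≤ β≤ q^≤ r≤ =
        run-mapS short St f encG (λ t → t) code body cs (ts , srcs) κ≤ ⨟ᴰ run-≡ (cong (encV (λ t → t)) (eq cs ts srcs)) (run-lam _)
        where
        St : ℕ → Set
        St n = Vec (Vec (Fin q) β) n × Vec (Src {m}) r
        f : ∀ {n} → G {m} → St (suc n) → Tree × St n
        f c (t ∷ ts , srcs) = shiftedTree (value 0 t) c srcs , ts , map (decSrc {m}) srcs
        code : ∀ {n} → St n → Tree
        code (ts , srcs) = encV encG ts ∙ encV (encSrc {m}) srcs ∙ X
        body : ∀ {n} c (s : St (suc n)) → RunsD listBody (encG c ∙ code s) (proj₁ (f c s) ∙ code (proj₂ (f c s)))
        body c (t ∷ ts , srcs) =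
          run-let (run-mapV long (maskOf c) (encSrc {m}) (encM {m}) (encG c) (run-mask c) srcs r≤) ⨟ᴰ
          run-let (run-unary t β≤ q^≤) ⨟ᴰ
          run-let (run-≡ (cong (λ n → pre n (encV (encM {m}) (map (maskOf c) srcs))) (len-numeral (value 0 t)))
            (run-cons long (numeral (value 0 t)) _ (ℕ.≤-trans (ℕ.≤-reflexive (len-numeral (value 0 t))) (ℕ.≤-trans (value≤ t) q^≤)))) ⨟ᴰ
          run-let (run-drop long X _ r≤) ⨟ᴰ
          run-let (run-mapV long (decSrc {m}) (encSrc {m}) (encSrc {m}) nil run-dec srcs r≤) ⨟ᴰ
          run-lam _
        eq : ∀ {n} cs (ts : Vec (Vec (Fin q) β) n) srcs → proj₁ (mapS St f cs (ts , srcs)) ≡ trees cs ts srcs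
        eq [] [] srcs = refl
        eq (c ∷ cs) (t ∷ ts) srcs = cong (_ ∷_) (eq cs ts (map (decSrc {m}) srcs))

      trees-streams : ∀ {κ β r} (cs : Vec (G {m}) κ) (ts : Vec (Vec (Fin q) β) κ) (srcs : Vec (Src {m}) r) j i →
        nth (lookup (trees cs ts srcs) j) i ≡ encM {m} (lookup (streams cs ts srcs) j i)
      trees-streams {r = r} (c ∷ cs) (t ∷ ts) srcs zero i =
        trans (cong head (iter-+ tail (pre (value 0 t) (encV (encM {m}) (map (maskOf c) srcs))) r i)) (padAt-enc (value 0 t) _ (r + i))
      trees-streams (c ∷ cs) (t ∷ ts) srcs (suc j) i = trees-streams cs ts (map (decSrc {m}) srcs) j i

      run-destinations : ∀ {κ n} (fs : Vec (Stream {m}) κ) (Ls : Vec Tree κ) (bs : Vec (Fin κ) n) (us : Vec (G {m}) n) →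
        (∀ j i → nth (lookup Ls j) i ≡ encM {m} (lookup fs j i)) → κ ≤ S → n ≤ R →
        RunsD (mapP long dstBody ⨟ lam (hd env)) (encV encF bs ∙ encV encG us ∙ encV (λ t → t) Ls) (encV encP (destinations fs 0 bs us))
      run-destinations {κ} fs Ls bs us represents κ≤ n≤ =
        run-mapS long St f encF (λ t → t) code body bs (us , Ls) n≤ ⨟ᴰ run-≡ (eq bs us Ls 0 represents) (run-lam _)
        where
        St : ℕ → Set
        St n = Vec (G {m}) n × Vec Tree κ
        pickT : Tree → G {m} → Tree
        pickT e u = if isCons e then e else nil ∙ encG u
        f : ∀ {n} → Fin κ → St (suc n) → Tree × St n
        f b (u ∷ us , Ls) = pickT (head (lookup Ls b)) u , us , map tail Ls
        code : ∀ {n} → St n → Tree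
        code (us , Ls) = encV encG us ∙ encV (λ t → t) Ls
        body : ∀ {n} b (s : St (suc n)) → RunsD dstBody (encF b ∙ code s) (proj₁ (f b s) ∙ code (proj₂ (f b s)))
        body b (u ∷ us , Ls) =
          run-let (run-drop short (encF b) _ (ℕ.≤-trans (ℕ.≤-reflexive (len-numeral (toℕ b))) (ℕ.≤-trans (ℕ.<⇒≤ (Fin.toℕ<n b)) κ≤))) ⨟ᴰ
          run-let (run-mapV short tail (λ t → t) (λ t → t) nil (λ x → run-lam _) Ls κ≤) ⨟ᴰ
          branch (isCons (head (lookup Ls b))) refl
          where
          at : head (iter tail (encV (λ t → t) Ls) (len (encF b))) ≡ lookup Ls b
          at = trans (cong (nth (encV (λ t → t) Ls)) (len-numeral (toℕ b))) (nth-encV (λ t → t) Ls b)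
          branch : ∀ β → isCons (head (lookup Ls b)) ≡ β → RunsD _
            ((encV (λ t → t) (map tail Ls) ∙ nil) ∙ iter tail (encV (λ t → t) Ls) (len (encF b)) ∙ encF b ∙ encV encG (u ∷ us) ∙ encV (λ t → t) Ls)
            (pickT (head (lookup Ls b)) u ∙ code (us , map tail Ls))
          branch true eq = run-ifte true (trans (cong (λ L → isCons (head L)) at) eq)
            (run-≡ (cong₂ (λ e e′ → e ∙ encV encG us ∙ e′) (trans (cong head at) (cong (λ β → if β then head (lookup Ls b) else nil ∙ encG u) (sym eq))) refl) (run-lam _))
          branch false eq = run-ifte false (trans (cong (λ L → isCons (head L)) at) eq)
            (run-≡ (cong (λ β → (if β then head (lookup Ls b) else nil ∙ encG u) ∙ encV encG us ∙ encV (λ t → t) (map tail Ls)) (sym eq)) (run-lam _))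
        pick-enc : ∀ p u → pickT (encM {m} p) u ≡ encP (pickM p u)
        pick-enc nothing u = refl
        pick-enc (just p) u = refl
        lookup-tail : ∀ {κ} (Ls : Vec Tree κ) j → lookup (map tail Ls) j ≡ tail (lookup Ls j)
        lookup-tail (L ∷ Ls) zero = refl
        lookup-tail (L ∷ Ls) (suc j) = lookup-tail Ls j
        eq : ∀ {n} (bs : Vec (Fin κ) n) us Ls i → (∀ j i′ → nth (lookup Ls j) i′ ≡ encM {m} (lookup fs j (i + i′))) →
          encV (λ t → t) (proj₁ (mapS St f bs (us , Ls))) ≡ encV encP (destinations fs i bs us)
        eq [] [] Ls i h = refl
        eq (b ∷ bs) (u ∷ us) Ls i h = cong₂ _∙_
          (trans (cong (λ e → pickT e u) (trans (h b 0) (cong (λ i → encM {m} (lookup fs b i)) (ℕ.+-identityʳ i)))) (pick-enc (lookup fs b i) u))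
          (eq bs us (map tail Ls) (suc i) λ j i′ → trans (cong (λ L → nth L i′) (lookup-tail Ls j)) (trans (h j (suc i′)) (cong (λ i → encM {m} (lookup fs j i)) (ℕ.+-suc i i′))))

      encTags : List ℕ → Tree
      encTags ts = encV numeral (fromList ts)

      run-gather : ∀ {n} (ps : Vec (ℕ × G {m}) n) O β → n ≤ R →
        RunsD (for long gatherBody) (encV encP ps ∙ O ∙ numeral β ∙ nil)
          (let s = gather ps (O , β , []) in proj₁ s ∙ numeral (proj₁ (proj₂ s)) ∙ encTags (proj₂ (proj₂ s)))
      run-gather ps O β n≤ = run-foldS long (λ _ → Tree × ℕ × List ℕ) gatherStep encP
        (λ s → proj₁ s ∙ numeral (proj₁ (proj₂ s)) ∙ encTags (proj₂ (proj₂ s))) body ps (O , β , []) n≤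
        where
        body : ∀ p s → RunsD gatherBody (encP p ∙ proj₁ s ∙ numeral (proj₁ (proj₂ s)) ∙ encTags (proj₂ (proj₂ s)))
          (let s′ = gatherStep p s in proj₁ s′ ∙ numeral (proj₁ (proj₂ s′)) ∙ encTags (proj₂ (proj₂ s′)))
        body (i , x) (O , β , acc) with isCons (head O) in eq | β
        ... | true  | suc β′ = run-ifte true eq (run-ifte true refl (run-lam _))
        ... | true  | zero   = run-ifte true eq (run-ifte false refl (run-lam _))
        ... | false | β′     = run-ifte false eq (run-lam _)

      run-bits : ∀ {I : Set} {n t} (inp : I → Tree) (xs : Vec I n) (ts : Vec ℕ t) → n ≤ R → t ≤ S →
        RunsD (mapP long bitsBody ⨟ lam (hd env)) (encV inp xs ∙ encV numeral ts) (encV encB (bitsOf n ts))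
      run-bits {I} {n} {t} inp xs ts n≤ t≤ = run-mapS long (λ _ → Vec ℕ t) (λ _ ts → tagCount false ts , map pred ts) inp encB (encV numeral)
        (λ x ts → run-let (run-any false ts) ⨟ᴰ run-let (run-mapV short pred numeral numeral nil tails ts t≤) ⨟ᴰ run-lam _) xs ts n≤ ⨟ᴰ
        run-≡ (cong (encV encB) (eq xs ts)) (run-lam _)
        where
        tails : ∀ x → RunsD _ (numeral x ∙ nil) (numeral (pred x) ∙ nil)
        tails zero = run-lam (tl (hd env) ∙ tl env)
        tails (suc x) = run-lam (tl (hd env) ∙ tl env)
        count : Bool → ℕ → Bool
        count b t = if t ≡ᵇ 1 then true else b
        run-any : ∀ b (ts : Vec ℕ t) → RunsD (for short anyBody) (encV numeral ts ∙ encB b) (encB (tagCount b ts))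
        run-any b ts = run-≡ (cong encB (eqA ts b)) (run-foldS short (λ _ → Bool) (λ t b → count b t) numeral encB body ts b t≤)
          where
          eqA : ∀ {t} (ts : Vec ℕ t) b → foldS (λ _ → Bool) (λ t b → count b t) ts b ≡ tagCount b ts
          eqA [] b = refl
          eqA (t ∷ ts) b = eqA ts (count b t)
          body : ∀ t b → RunsD anyBody (numeral t ∙ encB b) (encB (count b t))
          body zero b = run-ifte false refl (run-lam _)
          body (suc zero) b = run-ifte true refl (run-ifte false refl (run-lam _))
          body (suc (suc t)) b = run-ifte true refl (run-ifte true refl (run-lam _))
        eq : ∀ {n} (xs : Vec I n) ts → proj₁ (mapS (λ _ → Vec ℕ t) (λ _ ts → tagCount false ts , map pred ts) xs ts) ≡ bitsOf n ts
        eq [] ts = refl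
        eq (x ∷ xs) ts = cong (tagCount false ts ∷_) (eq xs (map pred ts))

      run-check : ∀ {n} (B : Vec Bool n) (X : Vec (G {m}) n) → n ≤ R → 1 ≤ k →
        RunsD checkP (encV encB B ∙ encV encG X ∙ nil ∙ encG (0V {m})) (encB (checks B X))
      run-check {n} B X n≤ 1≤k = run-foldS long St f encB code body B (X , 0 , 0V) n≤ ⨟ᴰ
        run-≡in (sym (cong code (eq B X 0 0V))) (last (proj₁ (tally B X 0 0V)) (proj₂ (tally B X 0 0V)))
        where
        St : ℕ → Set
        St n = Vec (G {m}) n × ℕ × G {m}
        f : ∀ {n} → Bool → St (suc n) → St n
        f true  (x ∷ X , c , s) = X , suc c , x ⊞ s
        f false (x ∷ X , c , s) = X , c , s
        code : ∀ {n} → St n → Tree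
        code (X , c , s) = encV encG X ∙ numeral c ∙ encG s
        body : ∀ {n} b (s : St (suc n)) → RunsD checkBody (encB b ∙ code s) (code (f b s))
        body true (x ∷ X , c , s) = run-ifte true refl (run-let (run-addVec x s m≤S) ⨟ᴰ run-lam _)
        body false (x ∷ X , c , s) = run-ifte false refl (run-lam _)
        eq : ∀ {n} (B : Vec Bool n) X c s → foldS St f B (X , c , s) ≡ ([] , tally B X c s)
        eq [] [] c s = refl
        eq (true ∷ B) (x ∷ X) c s = eq B X (suc c) (x ⊞ s)
        eq (false ∷ B) (x ∷ X) c s = eq B X c s
        pos : ∀ j → 0 < j → isCons (numeral j) ≡ true
        pos (suc j) _ = refl
        at : ∀ j c s → isCons (evalEx (tl^ j (# 1)) (nil ∙ numeral c ∙ encG s)) ≡ isCons (numeral (c ∸ j))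
        at j c s = cong isCons (trans (evalEx-tl^ j (# 1) _) (tail-numeral c j))
        none : ∀ c s j → c ≤ j → isCons (evalEx (tl^ j (# 1)) (nil ∙ numeral c ∙ encG s)) ≡ false
        none c s j c≤j = trans (at j c s) (cong (λ i → isCons (numeral i)) (ℕ.m≤n⇒m∸n≡0 c≤j))
        some : ∀ c s j → j < c → isCons (evalEx (tl^ j (# 1)) (nil ∙ numeral c ∙ encG s)) ≡ true
        some c s j j<c = trans (at j c s) (pos (c ∸ j) (ℕ.m<n⇒0<n∸m j<c))
        k-1<k : k ∸ 1 < k
        k-1<k = ℕ.∸-monoʳ-< (s≤s z≤n) 1≤k
        last : ∀ c s → RunsD (ifte (tl^ (k ∸ 1) (# 1)) (ifte (tl^ k (# 1)) (lam nil) (lam (tl (tl env)) ⨟ isZeroP)) (lam nil))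
          (nil ∙ numeral c ∙ encG s) (encB (does (c ≟ k) ∧ isZero? s))
        last c s with ℕ.<-cmp c k
        ... | tri< c<k c≢k _ = run-ifte false (none c s (k ∸ 1) (ℕ.∸-monoˡ-≤ 1 c<k))
          (run-≡ (sym (cong (λ b → encB (b ∧ isZero? s)) (dec-false (c ≟ k) c≢k))) (run-lam nil))
        ... | tri≈ _ refl _ = run-ifte true (some c s (k ∸ 1) k-1<k) (run-ifte false (none c s k ℕ.≤-refl)
          (run-≡ (sym (cong (λ b → encB (b ∧ isZero? s)) (dec-true (c ≟ k) refl))) (run-lam (tl (tl env)) ⨟ᴰ run-isZero s m≤S)))
        ... | tri> _ c≢k k<c = run-ifte true (some c s (k ∸ 1) (ℕ.<-trans k-1<k k<c)) (run-ifte true (some c s k k<c)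
          (run-≡ (sym (cong (λ b → encB (b ∧ isZero? s)) (dec-false (c ≟ k) c≢k))) (run-lam nil)))

module SearchProgram where

  open Machine
  open Programs
  open VectorPrograms
  open Pipeline
  open import Data.Bool using (Bool; true; false; if_then_else_)
  open import Data.Fin using (Fin; zero; suc; toℕ)
  open import Data.List using (List; []; _∷_)
  open import Data.Maybe using (Maybe; just; nothing)
  open import Data.Nat using (ℕ; zero; suc; _∸_; _^_; _≤_; _<_; z≤n; s≤s; NonZero)
  import Data.Nat.Properties as ℕ
  open import Data.Product using (_×_; _,_; proj₂)
  open import Data.Rational using (ℚ)
  open import Data.Vec using (Vec; []; _∷_; map; fromList)
  import Data.Vec as Vec
  open import Relation.Binary.PropositionalEquality

  module Program (q : ℕ) .{{_ : NonZero q}} (k′ D₁ D₂ r₀ : ℕ) where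

    k : ℕ
    k = suc k′

    open Pipe q k public

    colourP attempt setup main : Prog
    colourP = rand k ⨟ lam (hd env)
    attempt =
      letP (literal k ∙ tl^ 5 env) (iidP short randVecP) ⨟
      letP (literal k′ ∙ # 4) (iidP short randVecP) ⨟
      letP (# 4 ∙ nil) (iidP long colourP) ⨟
      letP (# 5 ∙ # 7) (iidP long randVecP) ⨟
      letP (# 6 ∙ nil) (iidP long colourP) ⨟
      letP (# 7 ∙ # 8) (iidP long randVecP) ⨟
      letP (# 9) zeroVecP ⨟
      letP (hd (# 5) ∙ # 0) sumP ⨟
      letP (# 0) negVecP ⨟
      letP (# 11 ∙ nil ∙ hd (# 6) ∙ hd (# 5)) (mapP long srcBody ⨟ lam (hd env)) ⨟
      letP ((# 1 ∙ hd (# 8)) ∙ hd (# 9) ∙ # 0 ∙ # 12) (mapP short listBody ⨟ lam (hd env)) ⨟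
      letP (hd (# 6) ∙ hd (# 5) ∙ # 0) (mapP long dstBody ⨟ lam (hd env)) ⨟
      letP (# 0 ∙ nil) (mapP long (lam (tl (hd env) ∙ tl env)) ⨟ lam (hd env) ⨟ call) ⨟
      letP (# 1 ∙ # 0 ∙ literal k ∙ nil) (for long gatherBody) ⨟
      letP (# 16 ∙ tl (tl (# 0))) (mapP long bitsBody ⨟ lam (hd env)) ⨟
      letP (# 0 ∙ # 17 ∙ nil ∙ # 8) checkP ⨟
      ifte (# 0) (lam (# 1 ∙ tl^ 18 env)) (lam (# 17 ∙ tl^ 18 env))
    setup =
      letP (nil ∙ hd env) (powP D₁) ⨟
      letP (nil ∙ hd (tl env)) (powP D₂) ⨟
      letP (# 1 ∙ # 1) logP ⨟
      letP (# 2 ∙ tl^ 3 env) logP ⨟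
      lam (# 2 ∙ nil ∙ tl^ 4 env ∙ hd (tl^ 4 env) ∙ # 1 ∙ nil ∙ # 0) ⨟
      for short attempt ⨟
      lam (hd env)
    main = ifte (tl^ (r₀ ∸ 1) env) setup (lam nil)

    iterR : ∀ {A : Set} → (A → Rand A) → ℕ → A → Rand A
    iterR f zero    a = return a
    iterR f (suc n) a = f a >>= iterR f n

    encBest : ∀ {r} → Maybe (Vec Bool r) → Tree
    encBest nothing  = nil
    encBest (just B) = encV encB B

    module _ {m r : ℕ} where

      shifts : Vec (G {m}) k′ → Vec (G {m}) k
      shifts cs = (⊟ sumFrom 0V cs) ∷ cs

      instanceOf : ∀ {β e} → Vec (G {m}) r → Vec (Vec (Fin q) β) k → Vec (G {m}) k′ → Vec (Fin k) r →
        Vec (Vec (Fin q) e) r → Vec (Fin k) r → Vec (G {m}) r → Vec (ℕ × G {m}) r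
      instanceOf X ts cs as ls bs us = destinations (streams (shifts cs) ts (mkSrcs 0 as ls X)) 0 bs us

      answer : Vec (ℕ × G {m}) r → Tree → Vec Bool r
      answer dst O = bitsOf r (fromList (proj₂ (proj₂ (gather {G {m}} dst (O , k , [])))))

      update : Vec (G {m}) r → Maybe (Vec Bool r) → Vec Bool r → Maybe (Vec Bool r)
      update X old B = if checks B X then just B else old

      module _ (A : Algorithm) (T β e : ℕ) (X : Vec (G {m}) r) where

        open Algorithm A

        digit : Rand (Fin q)
        digit = choose q return

        callOn : Vec (ℕ × G {m}) r → Rand Tree
        callOn dst = run T (start (encV encG (map proj₂ dst))) >>= λ κ → return (Vec.head (proj₂ κ))

        attempts : Maybe (Vec Bool r) → Rand (Maybe (Vec Bool r))
        attempts old =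
          iid (iid digit β) k >>= λ ts →
          iid (iid digit m) k′ >>= λ cs →
          iid (choose k return) r >>= λ as →
          iid (iid digit e) r >>= λ ls →
          iid (choose k return) r >>= λ bs →
          iid (iid digit m) r >>= λ us →
          (let dst = instanceOf X ts cs as ls bs us in
          callOn dst >>= λ O →
          return (update X old (answer dst O)))

  module SearchRules (q : ℕ) .{{_ : NonZero q}} (k′ D₁ D₂ r₀ : ℕ) (A : Algorithm) (score : Config (Compile.width A) → ℚ) (S R T : ℕ) (q≤S : q ≤ S) where

    open Program q k′ D₁ D₂ r₀
    open PipeRules q k A score S R T q≤S public
    open Algorithm A using (start)

    run-update : ∀ {r} {B : Vec Bool r} {old} b {a2 a3 a4 a5 a6 a7 a8 a9 a10 a11 a12 a13 a14 a15 a16 κ} →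
      RunsD (ifte (# 0) (lam (# 1 ∙ tl^ 18 env)) (lam (# 17 ∙ tl^ 18 env)))
        (encB b ∙ encV encB B ∙ a2 ∙ a3 ∙ a4 ∙ a5 ∙ a6 ∙ a7 ∙ a8 ∙ a9 ∙ a10 ∙ a11 ∙ a12 ∙ a13 ∙ a14 ∙ a15 ∙ a16 ∙ encBest old ∙ κ)
        (encBest (if b then just B else old) ∙ κ)
    run-update false = run-ifte false refl (run-lam (# 17 ∙ tl^ 18 env))
    run-update true  = run-ifte true refl (run-lam (# 1 ∙ tl^ 18 env))

    run-colour : ∀ {t} → Runs colourP t (choose k return) (λ a → numeral (toℕ a))
    run-colour = run-⨟D (run-rand k) λ a → run-lam (hd env)

    module _ {m r : ℕ} (m≤S : m ≤ S) (k≤S : k ≤ S) (r≤R : r ≤ R)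
             (halts : (W : Vec (G {m}) r) → Surely Halted (run T (start (encV encG W)))) where

      run-callOn : (dst : Vec (ℕ × G {m}) r) →
        Runs (mapP long (lam (tl (hd env) ∙ tl env)) ⨟ lam (hd env) ⨟ call) (encV encP dst ∙ nil) (callOn A T 0 0 (map proj₂ dst) dst) (λ t → t)
      run-callOn dst = run-mapV m≤S long proj₂ encP encG nil (λ x → run-lam _) dst r≤R ⨟ᴰ run-lam _ ⨟ᴰ
        run-map (λ κ → Vec.head (proj₂ κ)) (run-call (halts (map proj₂ dst)))

      run-attempt : ∀ {β e} (X : Vec (G {m}) r) (x₀ : G {m}) El Et t old → len Et ≡ β → len El ≡ e →
        β ≤ S → e ≤ S → q ^ β ≤ R → suc k′ ≤ S →
        Runs attempt (t ∙ encBest old ∙ encV encG X ∙ encG x₀ ∙ El ∙ Et) (attempts A T β e X old)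
          (λ best → encBest best ∙ encV encG X ∙ encG x₀ ∙ El ∙ Et)
      run-attempt {β} {e} X x₀ El Et t old Et≡ El≡ β≤ e≤ q^≤ _ =
        run-⨟ (run-let (run-iid short (iid (choose q return) β) encG Et (run-randVec Et Et≡ β≤) (evalEx (literal k) _) (litlen k) k≤S)) λ ts →
        run-⨟ (run-let (run-iid short (iid (choose q return) m) encG (encG x₀) (run-randVec (encG x₀) M≡ m≤S) (evalEx (literal k′) _) (litlen k′) k′≤)) λ cs →
        run-⨟ (run-let (run-iid long (choose k return) (encF m≤S) nil run-colour (encV encG X) X≡ r≤R)) λ as →
        run-⨟ (run-let (run-iid long (iid (choose q return) e) encG El (run-randVec El El≡ e≤) (encV encG X) X≡ r≤R)) λ ls →
        run-⨟ (run-let (run-iid long (choose k return) (encF m≤S) nil run-colour (encV encG X) X≡ r≤R)) λ bs →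
        run-⨟ (run-let (run-iid long (iid (choose q return) m) encG (encG x₀) (run-randVec (encG x₀) M≡ m≤S) (encV encG X) X≡ r≤R)) λ us →
        run-let (run-zeroVec m≤S x₀) ⨟ᴰ
        run-let (run-sum m≤S cs 0V k′≤) ⨟ᴰ
        run-let (run-negVec (sumFrom 0V cs) m≤S) ⨟ᴰ
        run-let (run-srcs m≤S as ls X e≤ r≤R) ⨟ᴰ
        run-let (run-lists m≤S (shifts {m} {r} cs) ts (mkSrcs 0 as ls X) (encV encG X) X≡ k≤S β≤ q^≤ r≤R) ⨟ᴰ
        run-let (run-destinations m≤S (streams (shifts {m} {r} cs) ts (mkSrcs 0 as ls X)) (trees m≤S (shifts {m} {r} cs) ts (mkSrcs 0 as ls X)) bs us
          (trees-streams m≤S (shifts {m} {r} cs) ts (mkSrcs 0 as ls X)) k≤S r≤R) ⨟ᴰ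
        run-⨟ (run-let (run-callOn (instanceOf X ts cs as ls bs us))) λ O →
        (let dst = instanceOf X ts cs as ls bs us
             ts′ = proj₂ (proj₂ (gather {G {m}} dst (O , k , []))) in
        run-return
          (run-let (run-≡in (cong (λ n → encV encP dst ∙ O ∙ n ∙ nil) (sym (evalEx-literal k _))) (run-gather m≤S dst O k r≤R)) ⨟ᴰ
           run-let (run-bits m≤S encG X (fromList ts′) r≤R (ℕ.≤-trans (ℕ.≤-trans (gather-length {G {m}} dst (O , k , [])) (ℕ.≤-reflexive (ℕ.+-identityʳ k))) k≤S)) ⨟ᴰ
           run-let (run-check m≤S (answer dst O) X r≤R (s≤s z≤n)) ⨟ᴰ
           run-update (checks {m} (answer dst O) X)))
        where
        M≡ : len (encG x₀) ≡ m
        M≡ = len-encV encD x₀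
        X≡ : len (encV encG X) ≡ r
        X≡ = len-encV encG X
        k′≤ : k′ ≤ S
        k′≤ = ℕ.≤-trans (ℕ.n≤1+n k′) k≤S
        litlen : ∀ n {t} → len (evalEx (literal n) t) ≡ n
        litlen n {t} = trans (cong len (evalEx-literal n t)) (len-numeral n)

      run-attempts : ∀ {β e} (X : Vec (G {m}) r) (x₀ : G {m}) El Et → len Et ≡ β → len El ≡ e →
        β ≤ S → e ≤ S → q ^ β ≤ R → ∀ Q {n} → len Q ≡ n → n ≤ S → ∀ old →
        Runs (for short attempt) (Q ∙ encBest old ∙ encV encG X ∙ encG x₀ ∙ El ∙ Et) (iterR (attempts A T β e X) n old)
          (λ best → encBest best ∙ encV encG X ∙ encG x₀ ∙ El ∙ Et)
      run-attempts {β} {e} X x₀ El Et Et≡ El≡ β≤ e≤ q^≤ Q refl n≤ old = run-for short n≤ (go Q old)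
        where
        go : ∀ Q old → RunsFor attempt (len Q) Q (encBest old ∙ encV encG X ∙ encG x₀ ∙ El ∙ Et) (iterR (attempts A T β e X) (len Q) old)
          (λ best → encBest best ∙ encV encG X ∙ encG x₀ ∙ El ∙ Et)
        go nil old = for-[] refl
        go (t ∙ Q) old = for-∷ (run-attempt X x₀ El Et t old Et≡ El≡ β≤ e≤ q^≤ k≤S) λ best → go Q best

      module _ (1≤r₀ : 1 ≤ r₀) (r₀≤r : r₀ ≤ r) (D₁≤S : D₁ ≤ S) (D₂≤S : D₂ ≤ S) (m<S : suc m ≤ S)
               (p₁ : suc m ^ D₁ ≤ S) (p₂ : suc m ^ D₂ ≤ S) (S≤R : S ≤ R) where

        labelLen shiftLen : ℕ
        labelLen = iter (logStep (suc m ^ D₁)) 0 (suc m ^ D₁)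
        shiftLen = suc (iter (logStep r) 0 (suc m ^ D₁))

        run-main : labelLen ≤ S → shiftLen ≤ S → q ^ shiftLen ≤ R → (X : Vec (G {m}) r) →
          Runs main (encV encG X) (iterR (attempts A T shiftLen labelLen X) (suc m ^ D₂) nothing) encBest
        run-main e≤ β≤ q^≤ X = run-ifte true (enough X (r₀ ∸ 1) (ℕ.<-≤-trans (ℕ.∸-monoʳ-< (s≤s z≤n) 1≤r₀) r₀≤r)) (go X refl)
          where
          enough : ∀ {r} (X : Vec (G {m}) r) j → j < r → isCons (evalEx (tl^ j env) (encV encG X)) ≡ true
          enough X j j< = trans (cong isCons (evalEx-tl^ j env (encV encG X))) (isCons-tail X j j<)
            where
            isCons-tail : ∀ {r} (X : Vec (G {m}) r) j → j < r → isCons (iter tail (encV encG X) j) ≡ true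
            isCons-tail (x ∷ X) zero j< = refl
            isCons-tail (x ∷ X) (suc j) (s≤s j<) = isCons-tail X j j<
          Q-len : ∀ n → len (numeral (suc m ^ n)) ≡ suc m ^ n
          Q-len n = len-numeral (suc m ^ n)
          powed : ∀ D (x₀ : G {m}) → D ≤ S → suc m ^ D ≤ S → RunsD (powP D) (nil ∙ encG x₀) (numeral (suc m ^ D))
          powed D x₀ D≤ p≤ = run-≡ (cong (λ n → numeral (n ^ D)) (cong suc (len-encV encD x₀)))
            (run-pow D (nil ∙ encG x₀) (s≤s z≤n) D≤ (subst (λ n → suc n ≤ S) (sym (len-encV encD x₀)) m<S)
              (subst (λ n → suc n ^ D ≤ S) (sym (len-encV encD x₀)) p≤))
          logged : ∀ ρ {n} → len ρ ≡ n → n ≤ R → RunsD logP (numeral (suc m ^ D₁) ∙ ρ) (numeral (iter (logStep n) 0 (suc m ^ D₁)))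
          logged ρ refl n≤ = run-≡ (cong (λ f → numeral (iter (logStep (len ρ)) 0 f)) (Q-len D₁))
            (run-log (numeral (suc m ^ D₁)) ρ (ℕ.≤-trans (ℕ.≤-reflexive (Q-len D₁)) p₁) n≤)
          go : ∀ (X : Vec (G {m}) r) {Y} → encV encG X ≡ Y → Runs setup Y (iterR (attempts A T shiftLen labelLen X) (suc m ^ D₂) nothing) encBest
          go [] refl with ℕ.≤-trans 1≤r₀ r₀≤r
          ... | ()
          go X@(x₀ ∷ _) refl =
            run-let (powed D₁ x₀ D₁≤S p₁) ⨟ᴰ
            run-let (powed D₂ x₀ D₂≤S p₂) ⨟ᴰ
            run-let (logged (numeral (suc m ^ D₁)) (Q-len D₁) (ℕ.≤-trans p₁ S≤R)) ⨟ᴰ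
            run-let (logged (encV encG X) (len-encV encG X) r≤R) ⨟ᴰ
            run-lam _ ⨟ᴰ
            run-⨟D (run-attempts X x₀ _ _ (cong suc (len-numeral _)) (len-numeral labelLen) β≤ e≤ q^≤ (numeral (suc m ^ D₂)) (Q-len D₂) p₂ nothing)
              (λ best → run-lam _)

module CostBound where

  open Machine
  open import Data.Nat
  open import Data.Nat.Properties
  open import Data.Nat.Tactic.RingSolver using (solve-∀)
  open import Relation.Binary.PropositionalEquality

  deg : Prog → ℕ
  deg (lam e)       = 0
  deg (rand n)      = 0
  deg (P ⨟ Q)       = deg P ⊔ deg Q
  deg (under P)     = deg P
  deg (ifte e P Q)  = deg P ⊔ deg Q
  deg (for short P) = deg P
  deg (for long P)  = suc (deg P)
  deg call          = 1

  record Polynomial (g : ℕ) (f : ℕ → ℕ → ℕ → ℕ) : Set where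
    constructor polynomial
    field
      coefficient exponent : ℕ
      bounded : ∀ S R T → 1 ≤ S → 1 ≤ R → f S R T ≤ coefficient * S ^ exponent * (R + T) ^ g

  1≤^ : ∀ {a} n → 1 ≤ a → 1 ≤ a ^ n
  1≤^ zero    1≤a = ≤-refl
  1≤^ (suc n) 1≤a = *-mono-≤ 1≤a (1≤^ n 1≤a)

  poly-weaken : ∀ {g h f} → g ≤ h → Polynomial g f → Polynomial h f
  poly-weaken {g} {h} g≤h (polynomial C d p) = polynomial C d λ S R T 1≤S 1≤R → ≤-trans (p S R T 1≤S 1≤R)
    (*-monoʳ-≤ (C * S ^ d) (^-monoʳ-≤ (R + T) {{>-nonZero (≤-trans 1≤R (m≤m+n R T))}} g≤h))

  poly-const : ∀ n → Polynomial 0 (λ _ _ _ → n)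
  poly-const n = polynomial n 0 λ S R T _ _ → ≤-reflexive (sym (trans (*-identityʳ (n * 1)) (*-identityʳ n)))

  poly-+ : ∀ {g h f f′} → Polynomial g f → Polynomial h f′ → Polynomial (g ⊔ h) (λ S R T → f S R T + f′ S R T)
  poly-+ {g} {h} p p′ with poly-weaken (m≤m⊔n g h) p | poly-weaken (m≤n⊔m g h) p′
  ... | polynomial C d b | polynomial C′ d′ b′ = polynomial (C + C′) (d + d′) λ S R T 1≤S 1≤R →
    let W = (R + T) ^ (g ⊔ h)
        instance _ = >-nonZero 1≤S
    in begin
    _                                                      ≤⟨ +-mono-≤ (b S R T 1≤S 1≤R) (b′ S R T 1≤S 1≤R) ⟩
    C * S ^ d * W + C′ * S ^ d′ * W
      ≤⟨ +-mono-≤ (*-monoˡ-≤ W (*-monoʳ-≤ C (^-monoʳ-≤ S (m≤m+n d d′)))) (*-monoˡ-≤ W (*-monoʳ-≤ C′ (^-monoʳ-≤ S (m≤n+m d′ d)))) ⟩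
    C * S ^ (d + d′) * W + C′ * S ^ (d + d′) * W           ≡⟨ distrib C C′ (S ^ (d + d′)) W ⟩
    (C + C′) * S ^ (d + d′) * W                            ∎
    where
    open ≤-Reasoning
    distrib : ∀ C C′ s w → C * s * w + C′ * s * w ≡ (C + C′) * s * w
    distrib = solve-∀

  poly-S* : ∀ {g f} → Polynomial g f → Polynomial g (λ S R T → S * f S R T)
  poly-S* {g} (polynomial C d b) = polynomial C (suc d) λ S R T 1≤S 1≤R →
    ≤-trans (*-monoʳ-≤ S (b S R T 1≤S 1≤R)) (≤-reflexive (eq S C (S ^ d) ((R + T) ^ g)))
    where
    eq : ∀ S C s w → S * (C * s * w) ≡ C * (S * s) * w
    eq = solve-∀

  poly-R* : ∀ {g f} → Polynomial g f → Polynomial (suc g) (λ S R T → R * f S R T)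
  poly-R* {g} (polynomial C d b) = polynomial C d λ S R T 1≤S 1≤R →
    ≤-trans (*-mono-≤ (m≤m+n R T) (b S R T 1≤S 1≤R)) (≤-reflexive (eq (R + T) C (S ^ d) ((R + T) ^ g)))
    where
    eq : ∀ v C s w → v * (C * s * w) ≡ C * s * (v * w)
    eq = solve-∀

  poly-T : Polynomial 1 (λ _ _ T → T)
  poly-T = polynomial 1 0 λ S R T _ _ → ≤-trans (m≤n+m T R) (≤-reflexive (eq (R + T)))
    where
    eq : ∀ v → v ≡ 1 * 1 * (v * 1)
    eq = solve-∀

  module _ (A : Algorithm) where

    open Compile A
    open Cost

    cost-polynomial : ∀ P → Polynomial (deg P) (λ S R T → cost S R T P)
    cost-polynomial (lam e) = poly-const _
    cost-polynomial (rand n) = poly-const 3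
    cost-polynomial (P ⨟ Q) = poly-+ (poly-const 1) (poly-+ (cost-polynomial P) (cost-polynomial Q))
    cost-polynomial (under P) = subst (λ g → Polynomial g (λ S R T → cost S R T (under P))) (⊔-identityʳ (deg P))
      (poly-+ (poly-const 7) (poly-+ (cost-polynomial P) (poly-const 5)))
    cost-polynomial (ifte e P Q) = poly-+ (poly-const 1) (poly-+ (poly-const (costEx e)) (poly-+ (poly-const 5) (poly-+ (cost-polynomial P) (cost-polynomial Q))))
    cost-polynomial (for short P) = poly-weaken (≤-reflexive (trans (⊔-identityʳ _) (⊔-identityʳ (deg P))))
      (poly-+ (poly-const 3) (poly-+ (poly-S* (poly-+ (poly-const 12) (poly-+ (cost-polynomial P) (poly-const 5)))) (poly-const 2)))
    cost-polynomial (for long P) = poly-weaken (≤-reflexive (trans (⊔-identityʳ _) (cong suc (⊔-identityʳ (deg P)))))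
      (poly-+ (poly-const 3) (poly-+ (poly-R* (poly-+ (poly-const 12) (poly-+ (cost-polynomial P) (poly-const 5)))) (poly-const 2)))
    cost-polynomial call = poly-+ (poly-const 1) (poly-+ (poly-const (costClear extraVars)) (poly-+ (poly-const 3) (poly-+ poly-T (poly-const 1))))
      where open Algorithm A

module Product where

  open Expect
  open import Data.Fin using (Fin; zero; suc)
  open import Data.Maybe using (Maybe; just; nothing; maybe′)
  open import Data.Nat as ℕ using (ℕ; zero; suc)
  open import Data.Rational as ℚ using (ℚ; 0ℚ; _*_; _≤_)
  open import Data.Rational.Properties
  open import Data.Vec using (Vec; []; _∷_; lookup; tabulate; _[_]≔_; map; zipWith)
  open import Data.Vec.Properties using (lookup∘update; lookup∘update′; tabulate-cong)
  open import Relation.Binary.PropositionalEquality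
  open import Function using (_∘_)

  Invariant : ∀ {A : Set} → Rand A → (A → A) → Set
  Invariant D h = ∀ f → E (f ∘ h) D ≡ E f D

  Atom : ∀ {A : Set} → Rand A → ℚ → A → Set
  Atom D p v = ∀ f → (∀ a → 0ℚ ≤ f a) → p * f v ≤ E f D

  pin : ∀ {A : Set} {n r} → Vec (Fin r) n → Vec A n → Vec A r → Vec A r
  pin []       []       a = a
  pin (s ∷ ss) (v ∷ vs) a = pin ss vs a [ s ]≔ v

  module _ {A : Set} (D : Rand A) (total : Total D) where

    E-resample : ∀ {r} (i : Fin r) (H : Vec A r → ℚ) → E H (iid D r) ≡ E (λ y → E (λ X → H (X [ i ]≔ y)) (iid D r)) D
    E-resample {suc r} zero H = begin
      E H (iid D (suc r))                                                   ≡⟨ E-iid D r H ⟩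
      E (λ y → E (λ xs → H (y ∷ xs)) (iid D r)) D
        ≡⟨ E-cong D (λ y → sym (trans (E-iid D r _) (E-const _ D total))) ⟩
      E (λ y → E (λ X → H (X [ zero ]≔ y)) (iid D (suc r))) D ∎
      where open ≡-Reasoning
    E-resample {suc r} (suc i) H = begin
      E H (iid D (suc r))                                                   ≡⟨ E-iid D r H ⟩
      E (λ x → E (λ xs → H (x ∷ xs)) (iid D r)) D                           ≡⟨ E-cong D (λ x → E-resample i (λ xs → H (x ∷ xs))) ⟩
      E (λ x → E (λ y → E (λ xs → H (x ∷ xs [ i ]≔ y)) (iid D r)) D) D       ≡⟨ E-swap _ D D ⟩
      E (λ y → E (λ x → E (λ xs → H (x ∷ xs [ i ]≔ y)) (iid D r)) D) D       ≡⟨ E-cong D (λ y → sym (E-iid D r _)) ⟩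
      E (λ y → E (λ X → H (X [ suc i ]≔ y)) (iid D (suc r))) D ∎
      where open ≡-Reasoning

    E-pin : ∀ {n r} (ss : Vec (Fin r) n) (F : Vec A r → ℚ) →
      E (λ c → E (λ w → F (pin ss c w)) (iid D r)) (iid D n) ≡ E F (iid D r)
    E-pin [] F = refl
    E-pin {suc n} {r} (s ∷ ss) F = begin
      E (λ c → E (λ w → F (pin (s ∷ ss) c w)) (iid D r)) (iid D (suc n))    ≡⟨ E-iid D n _ ⟩
      E (λ c → E (λ cs → E (λ w → F (pin ss cs w [ s ]≔ c)) (iid D r)) (iid D n)) D
        ≡⟨ E-cong D (λ c → E-pin ss (λ w → F (w [ s ]≔ c))) ⟩
      E (λ c → E (λ w → F (w [ s ]≔ c)) (iid D r)) D                        ≡⟨ sym (E-resample s F) ⟩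
      E F (iid D r) ∎
      where open ≡-Reasoning

    E-atom : ∀ {n r p} (ss : Vec (Fin r) n) (vs : Vec A n) → 0ℚ ≤ p → (∀ j → Atom D p (lookup vs j)) →
      (F : Vec A r → ℚ) → (∀ a → 0ℚ ≤ F a) → p ^ℚ n * E (λ a → F (pin ss vs a)) (iid D r) ≤ E F (iid D r)
    E-atom {r = r} [] [] p≥0 atom F F≥0 = ≤-reflexive (*-identityˡ _)
    E-atom {suc n} {r} {p} (s ∷ ss) (v ∷ vs) p≥0 atom F F≥0 = begin
      p * p ^ℚ n * E (λ a → F (pin ss vs a [ s ]≔ v)) (iid D r)
        ≡⟨ *-assoc p (p ^ℚ n) _ ⟩
      p * (p ^ℚ n * E (λ a → F (pin ss vs a [ s ]≔ v)) (iid D r))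
        ≤⟨ *-monoˡ p≥0 (E-atom ss vs p≥0 (λ j → atom (suc j)) (λ a → F (a [ s ]≔ v)) (λ a → F≥0 _)) ⟩
      p * E (λ a → F (a [ s ]≔ v)) (iid D r)
        ≤⟨ atom zero (λ v → E (λ a → F (a [ s ]≔ v)) (iid D r)) (λ v → E-nonNeg (iid D r) λ a → F≥0 _) ⟩
      E (λ v → E (λ a → F (a [ s ]≔ v)) (iid D r)) D
        ≡⟨ sym (E-resample s F) ⟩
      E F (iid D r) ∎
      where open ≤-Reasoning

    E-map : ∀ {n} (h : A → A) → Invariant D h → (F : Vec A n → ℚ) → E (λ v → F (map h v)) (iid D n) ≡ E F (iid D n)
    E-map {zero} h inv F = refl
    E-map {suc n} h inv F = trans (E-iid D n _) (trans (E-cong D λ x → E-map h inv (λ xs → F (h x ∷ xs)))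
      (trans (inv (λ x → E (λ xs → F (x ∷ xs)) (iid D n))) (sym (E-iid D n F))))

    E-zipWith : ∀ {B : Set} {n} (h : B → A → A) → (∀ b → Invariant D (h b)) → (bs : Vec B n) (F : Vec A n → ℚ) →
      E (λ v → F (zipWith h bs v)) (iid D n) ≡ E F (iid D n)
    E-zipWith h inv [] F = refl
    E-zipWith {n = suc n} h inv (b ∷ bs) F = trans (E-iid D n _) (trans (E-cong D λ x → E-zipWith h inv bs (λ xs → F (h b x ∷ xs)))
      (trans (inv b (λ x → E (λ xs → F (x ∷ xs)) (iid D n))) (sym (E-iid D n F))))

    Injective? : ∀ {n N} → (Fin n → Maybe (Fin N)) → Set
    Injective? src = ∀ {d d′ l} → src d ≡ just l → src d′ ≡ just l → d ≡ d′

    select : ∀ {n N} → (Fin n → Maybe (Fin N)) → (Fin n → A → A) → Vec A N → Vec A n → Vec A n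
    select src g Z U = tabulate λ d → maybe′ (λ l → g d (lookup Z l)) (lookup U d) (src d)

    -- A vector assembled from distinct coordinates of Z and fresh values is
    -- uniform and independent of the coordinates of Z that were not used.
    E-select : ∀ {n N} (src : Fin n → Maybe (Fin N)) (g : Fin n → A → A) → Injective? src → (∀ d → Invariant D (g d)) →
      (Φ : Vec A n → Vec A N → ℚ) → (∀ w Z d l y → src d ≡ just l → Φ w (Z [ l ]≔ y) ≡ Φ w Z) →
      E (λ Z → E (λ U → Φ (select src g Z U) Z) (iid D n)) (iid D N) ≡ E (λ w → E (Φ w) (iid D N)) (iid D n)
    E-select {zero} src g inj inv Φ indep = refl
    E-select {suc n} {N} src g inj inv Φ indep = begin
      E (λ Z → E (λ U → Φ (select src g Z U) Z) (iid D (suc n))) (iid D N)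
        ≡⟨ E-cong (iid D N) (λ Z → E-iid D n _) ⟩
      E (λ Z → E (λ u → E (λ U → Φ (maybe′ (λ l → g zero (lookup Z l)) u (src zero) ∷ select (src ∘ suc) (g ∘ suc) Z U) Z) (iid D n)) D) (iid D N)
        ≡⟨ first (src zero) refl ⟩
      E (λ x → E (λ Z → E (λ U → Φ (x ∷ select (src ∘ suc) (g ∘ suc) Z U) Z) (iid D n)) (iid D N)) D
        ≡⟨ E-cong D (λ x → E-select (src ∘ suc) (g ∘ suc) (λ p q → suc-injective (inj p q)) (λ d → inv (suc d))
            (λ w → Φ (x ∷ w)) (λ w Z d → indep (x ∷ w) Z (suc d))) ⟩
      E (λ x → E (λ w → E (Φ (x ∷ w)) (iid D N)) (iid D n)) D
        ≡⟨ sym (E-iid D n _) ⟩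
      E (λ w → E (Φ w) (iid D N)) (iid D (suc n)) ∎
      where
      open ≡-Reasoning
      open import Data.Fin.Properties using (suc-injective)
      rest : Vec A N → Vec A n → Vec A n
      rest = select (src ∘ suc) (g ∘ suc)
      first : ∀ s → src zero ≡ s →
        E (λ Z → E (λ u → E (λ U → Φ (maybe′ (λ l → g zero (lookup Z l)) u s ∷ rest Z U) Z) (iid D n)) D) (iid D N) ≡
        E (λ x → E (λ Z → E (λ U → Φ (x ∷ rest Z U) Z) (iid D n)) (iid D N)) D
      first nothing eq = E-swap _ (iid D N) D
      first (just l) eq = begin
        E (λ Z → E (λ u → E (λ U → Φ (g zero (lookup Z l) ∷ rest Z U) Z) (iid D n)) D) (iid D N)
          ≡⟨ E-cong (iid D N) (λ Z → E-const _ D total) ⟩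
        E (λ Z → E (λ U → Φ (g zero (lookup Z l) ∷ rest Z U) Z) (iid D n)) (iid D N)
          ≡⟨ E-resample l _ ⟩
        E (λ y → E (λ Z → E (λ U → Φ (g zero (lookup (Z [ l ]≔ y) l) ∷ rest (Z [ l ]≔ y) U) (Z [ l ]≔ y)) (iid D n)) (iid D N)) D
          ≡⟨ E-cong D (λ y → E-cong (iid D N) λ Z → E-cong (iid D n) λ U →
              trans (cong₂ (λ x w → Φ (g zero x ∷ w) (Z [ l ]≔ y)) (lookup∘update l Z y) (tabulate-cong λ d → unchanged d Z y U)) (indep _ Z zero l y eq)) ⟩
        E (λ y → E (λ Z → E (λ U → Φ (g zero y ∷ rest Z U) Z) (iid D n)) (iid D N)) D
          ≡⟨ inv zero (λ x → E (λ Z → E (λ U → Φ (x ∷ rest Z U) Z) (iid D n)) (iid D N)) ⟩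
        E (λ x → E (λ Z → E (λ U → Φ (x ∷ rest Z U) Z) (iid D n)) (iid D N)) D ∎
        where
        unchanged : ∀ d Z y U →
          maybe′ (λ l′ → g (suc d) (lookup (Z [ l ]≔ y) l′)) (lookup U d) (src (suc d)) ≡
          maybe′ (λ l → g (suc d) (lookup Z l)) (lookup U d) (src (suc d))
        unchanged d Z y U with src (suc d) in eq′
        ... | nothing = refl
        ... | just l′ = cong (g (suc d)) (lookup∘update′ (λ { refl → 0≢suc (inj eq eq′) }) Z y)
          where
          0≢suc : ∀ {n} {d : Fin n} → zero ≢ suc d
          0≢suc ()

module Zq where

  open Expect
  open Product
  open import Data.Bool using (Bool; true; false)
  open import Data.Fin as Fin using (Fin; zero; suc; toℕ)
  import Data.Fin.Properties as Fin
  open import Data.Fin.Permutation using (Permutation; permutation)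
  open import Data.Nat as ℕ using (ℕ; zero; suc; NonZero; _∸_)
  import Data.Nat.Properties as ℕ
  open import Data.Nat.DivMod using (_mod_; _%_; m%n<n; m<n⇒m%n≡m; %-distribˡ-+; n%n≡0; m%n%n≡m%n)
  open import Data.Product using (_,_)
  open import Data.Unit using (tt)
  open import Data.Rational as ℚ using (ℚ; 0ℚ; _*_; _+_)
  import Data.Rational.Properties as ℚ
  open import Data.Vec using (Vec; []; _∷_)
  import Data.Vec.Properties as Vec
  open import Data.Vec.Properties using (zipWith-assoc; zipWith-comm; zipWith-identityˡ; zipWith-inverseˡ)
  open import Relation.Binary.PropositionalEquality
  open import Relation.Nullary using (does)
  open import Function using (_∘_)
  import Algebra.Properties.CommutativeMonoid.Sum ℚ.+-0-commutativeMonoid as Sum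

  module ZqGroup (q : ℕ) .{{_ : NonZero q}} where

    digit : Rand (Fin q)
    digit = choose q return

    infixl 6 _+ᵈ_
    _+ᵈ_ : Fin q → Fin q → Fin q
    a +ᵈ b = (toℕ a ℕ.+ toℕ b) mod q

    -ᵈ_ : Fin q → Fin q
    -ᵈ a = (q ∸ toℕ a) mod q

    toℕ-mod : ∀ n → toℕ (n mod q) ≡ n % q
    toℕ-mod n = Fin.toℕ-fromℕ< (m%n<n n q)

    toℕ-% : (a : Fin q) → toℕ a % q ≡ toℕ a
    toℕ-% a = m<n⇒m%n≡m (Fin.toℕ<n a)

    %-+ : ∀ m n → (m % q ℕ.+ n) % q ≡ (m ℕ.+ n) % q
    %-+ m n = trans (%-distribˡ-+ (m % q) n q) (trans (cong (λ x → (x ℕ.+ n % q) % q) (m%n%n≡m%n m q)) (sym (%-distribˡ-+ m n q)))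

    +ᵈ-comm : ∀ a b → a +ᵈ b ≡ b +ᵈ a
    +ᵈ-comm a b = cong (_mod q) (ℕ.+-comm (toℕ a) (toℕ b))

    +ᵈ-assoc : ∀ a b c → (a +ᵈ b) +ᵈ c ≡ a +ᵈ (b +ᵈ c)
    +ᵈ-assoc a b c = Fin.toℕ-injective (begin
      toℕ ((a +ᵈ b) +ᵈ c)                          ≡⟨ trans (toℕ-mod _) (cong (λ x → (x ℕ.+ toℕ c) % q) (toℕ-mod _)) ⟩
      ((toℕ a ℕ.+ toℕ b) % q ℕ.+ toℕ c) % q        ≡⟨ %-+ (toℕ a ℕ.+ toℕ b) (toℕ c) ⟩
      (toℕ a ℕ.+ toℕ b ℕ.+ toℕ c) % q              ≡⟨ cong (_% q) (trans (ℕ.+-assoc (toℕ a) (toℕ b) (toℕ c)) (ℕ.+-comm (toℕ a) (toℕ b ℕ.+ toℕ c))) ⟩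
      (toℕ b ℕ.+ toℕ c ℕ.+ toℕ a) % q              ≡⟨ sym (%-+ (toℕ b ℕ.+ toℕ c) (toℕ a)) ⟩
      ((toℕ b ℕ.+ toℕ c) % q ℕ.+ toℕ a) % q        ≡⟨ cong (_% q) (ℕ.+-comm _ (toℕ a)) ⟩
      (toℕ a ℕ.+ (toℕ b ℕ.+ toℕ c) % q) % q        ≡⟨ sym (trans (toℕ-mod _) (cong (λ x → (toℕ a ℕ.+ x) % q) (toℕ-mod _))) ⟩
      toℕ (a +ᵈ (b +ᵈ c)) ∎)
      where open ≡-Reasoning

    0ᵈ : Fin q
    0ᵈ = 0 mod q

    +ᵈ-identityˡ : ∀ a → 0ᵈ +ᵈ a ≡ a
    +ᵈ-identityˡ a = Fin.toℕ-injective (trans (toℕ-mod _) (trans (cong (λ x → (x ℕ.+ toℕ a) % q) (toℕ-mod 0)) (trans (%-+ 0 (toℕ a)) (toℕ-% a))))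

    +ᵈ-inverseˡ : ∀ a → (-ᵈ a) +ᵈ a ≡ 0ᵈ
    +ᵈ-inverseˡ a = Fin.toℕ-injective (trans (toℕ-mod _) (trans (cong (λ x → (x ℕ.+ toℕ a) % q) (toℕ-mod _)) (trans (%-+ (q ∸ toℕ a) (toℕ a))
      (trans (cong (_% q) (ℕ.m∸n+n≡m (ℕ.<⇒≤ (Fin.toℕ<n a)))) (trans (n%n≡0 q) (sym (trans (toℕ-mod 0) 0%)))))))
      where
      0% : 0 % q ≡ 0
      0% = m<n⇒m%n≡m (ℕ.≤-<-trans ℕ.z≤n (Fin.toℕ<n a))

    digit-invariant : ∀ c → Invariant digit (_+ᵈ c)
    digit-invariant c f = cong (recip q *_) (sym (Sum.sum-permute f π))
      where
      cancel : ∀ a b c → c +ᵈ b ≡ 0ᵈ → (a +ᵈ c) +ᵈ b ≡ a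
      cancel a b c e = trans (+ᵈ-assoc a c b) (trans (cong (a +ᵈ_) e) (trans (+ᵈ-comm a 0ᵈ) (+ᵈ-identityˡ a)))
      π : Permutation q q
      π = permutation (_+ᵈ c) (_+ᵈ (-ᵈ c))
        (λ a → cancel a c (-ᵈ c) (+ᵈ-inverseˡ c)) (λ a → cancel a (-ᵈ c) c (trans (+ᵈ-comm c (-ᵈ c)) (+ᵈ-inverseˡ c)))

    total-digit : Total digit
    total-digit = recompute q , λ _ → tt
      where
      recompute : ∀ q .{{_ : NonZero q}} → NonZero q
      recompute (suc q) = _

    module Vectors (m : ℕ) where

      open VectorKSum q m public

      vector : Rand G
      vector = iid digit m

      total-vector : Total vector
      total-vector = Total-iid m total-digit

      ⊕-comm : ∀ x y → x ⊕ y ≡ y ⊕ x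
      ⊕-comm = zipWith-comm +ᵈ-comm

      ⊕-assoc : ∀ x y z → (x ⊕ y) ⊕ z ≡ x ⊕ (y ⊕ z)
      ⊕-assoc = zipWith-assoc +ᵈ-assoc

      ⊕-identityˡ : ∀ x → 0G ⊕ x ≡ x
      ⊕-identityˡ = zipWith-identityˡ +ᵈ-identityˡ

      ⊕-identityʳ : ∀ x → x ⊕ 0G ≡ x
      ⊕-identityʳ x = trans (⊕-comm x 0G) (⊕-identityˡ x)

      ⊖-inverseˡ : ∀ x → (⊖ x) ⊕ x ≡ 0G
      ⊖-inverseˡ = zipWith-inverseˡ +ᵈ-inverseˡ

      ⊖-inverseʳ : ∀ x → x ⊕ (⊖ x) ≡ 0G
      ⊖-inverseʳ x = trans (⊕-comm x (⊖ x)) (⊖-inverseˡ x)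

      ⊖-unique : ∀ x y → x ⊕ y ≡ 0G → x ≡ ⊖ y
      ⊖-unique x y e = trans (sym (⊕-identityʳ x)) (trans (cong (x ⊕_) (sym (⊖-inverseʳ y)))
        (trans (sym (⊕-assoc x y (⊖ y))) (trans (cong (_⊕ (⊖ y)) e) (⊕-identityˡ (⊖ y)))))

      ⊕-interchange : ∀ a b c d → (a ⊕ b) ⊕ (c ⊕ d) ≡ (a ⊕ c) ⊕ (b ⊕ d)
      ⊕-interchange a b c d = trans (⊕-assoc a b (c ⊕ d)) (trans (cong (a ⊕_)
        (trans (sym (⊕-assoc b c d)) (trans (cong (_⊕ d) (⊕-comm b c)) (⊕-assoc c b d)))) (sym (⊕-assoc a c (b ⊕ d))))

      ⊖-⊕ : ∀ a b → ⊖ (a ⊕ b) ≡ (⊖ a) ⊕ (⊖ b)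
      ⊖-⊕ a b = sym (⊖-unique _ _ (trans (⊕-interchange (⊖ a) (⊖ b) a b)
        (trans (cong₂ _⊕_ (⊖-inverseˡ a) (⊖-inverseˡ b)) (⊕-identityˡ 0G))))

      ⊕-invariantˡ : ∀ c → Invariant vector (c ⊕_)
      ⊕-invariantˡ c f = E-zipWith digit total-digit _+ᵈ_ (λ b g → trans (E-cong digit λ a → cong g (+ᵈ-comm b a)) (digit-invariant b g)) c f

      ⊕-invariantʳ : ∀ c → Invariant vector (_⊕ c)
      ⊕-invariantʳ c f = trans (E-cong vector λ x → cong f (⊕-comm x c)) (⊕-invariantˡ c f)

    sum-point : ∀ {n} (f : Fin n → ℚ) z → sum (λ i → indicator (does (i Fin.≟ z)) * f i) ≡ f z
    sum-point {suc n} f zero = trans (cong₂ _+_ (ℚ.*-identityˡ (f zero)) (trans (sum-cong {n} λ i → ℚ.*-zeroˡ (f (suc i))) (trans (sum-const n 0ℚ) (ℚ.*-zeroʳ (fromℕ n))))) (ℚ.+-identityʳ (f zero))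
    sum-point {suc n} f (suc z) = trans (cong₂ _+_ (ℚ.*-zeroˡ (f zero)) (sum-point (f ∘ suc) z)) (ℚ.+-identityˡ (f (suc z)))

    E-point : ∀ {n} (f : Vec (Fin q) n → ℚ) z →
      E (λ x → indicator (does (Vec.≡-dec Fin._≟_ x z)) * f x) (iid digit n) ≡ recip q ^ℚ n * f z
    E-point {zero} f [] = refl
    E-point {suc n} f (z ∷ zs) = begin
      E (λ x → indicator (does (Vec.≡-dec Fin._≟_ x (z ∷ zs))) * f x) (iid digit (suc n))
        ≡⟨ E-iid digit n _ ⟩
      E (λ x → E (λ xs → indicator (does (Vec.≡-dec Fin._≟_ (x ∷ xs) (z ∷ zs))) * f (x ∷ xs)) (iid digit n)) digit
        ≡⟨ E-cong digit (λ x → trans (E-cong (iid digit n) (split x)) (E-*ˡ (indicator (does (x Fin.≟ z))) (λ xs → indicator (does (Vec.≡-dec Fin._≟_ xs zs)) * f (x ∷ xs)) (iid digit n))) ⟩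
      E (λ x → indicator (does (x Fin.≟ z)) * E (λ xs → indicator (does (Vec.≡-dec Fin._≟_ xs zs)) * f (x ∷ xs)) (iid digit n)) digit
        ≡⟨ cong (recip q *_) (sum-point (λ x → E (λ xs → indicator (does (Vec.≡-dec Fin._≟_ xs zs)) * f (x ∷ xs)) (iid digit n)) z) ⟩
      recip q * E (λ xs → indicator (does (Vec.≡-dec Fin._≟_ xs zs)) * f (z ∷ xs)) (iid digit n)
        ≡⟨ cong (recip q *_) (E-point (λ xs → f (z ∷ xs)) zs) ⟩
      recip q * (recip q ^ℚ n * f (z ∷ zs))
        ≡⟨ sym (ℚ.*-assoc (recip q) (recip q ^ℚ n) _) ⟩
      recip q ^ℚ suc n * f (z ∷ zs) ∎
      where
      open ≡-Reasoning
      and : ∀ a b c → indicator (a Data.Bool.∧ b) * c ≡ indicator a * (indicator b * c)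
      and false b c = trans (ℚ.*-zeroˡ c) (sym (ℚ.*-zeroˡ (indicator b * c)))
      and true b c = sym (ℚ.*-identityˡ _)
      split : ∀ x xs → indicator (does (Vec.≡-dec Fin._≟_ (x ∷ xs) (z ∷ zs))) * f (x ∷ xs) ≡
        indicator (does (x Fin.≟ z)) * (indicator (does (Vec.≡-dec Fin._≟_ xs zs)) * f (x ∷ xs))
      split x xs = and (does (x Fin.≟ z)) (does (Vec.≡-dec Fin._≟_ xs zs)) (f (x ∷ xs))

  choose-atom : ∀ n (v : Fin n) → Atom (choose n return) (recip n) v
  choose-atom n v f f≥0 = *-monoˡ (recip≥0 n) (sum-pick f≥0 v)

  iid-atom : ∀ {A : Set} (D : Rand A) {p} → 0ℚ ℚ.≤ p → (∀ v → Atom D p v) → ∀ {n} (v : Vec A n) → Atom (iid D n) (p ^ℚ n) v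
  iid-atom D p≥0 atom [] f f≥0 = ℚ.≤-reflexive (ℚ.*-identityˡ (f []))
  iid-atom D {p} p≥0 atom {suc n} (v ∷ vs) f f≥0 = begin
    p * p ^ℚ n * f (v ∷ vs)                                ≡⟨ ℚ.*-assoc p (p ^ℚ n) _ ⟩
    p * (p ^ℚ n * f (v ∷ vs))                              ≤⟨ *-monoˡ p≥0 (iid-atom D p≥0 atom vs (λ xs → f (v ∷ xs)) (λ xs → f≥0 _)) ⟩
    p * E (λ xs → f (v ∷ xs)) (iid D n)                    ≤⟨ atom v (λ v → E (λ xs → f (v ∷ xs)) (iid D n)) (λ v → E-nonNeg (iid D n) λ xs → f≥0 _) ⟩
    E (λ v → E (λ xs → f (v ∷ xs)) (iid D n)) D            ≡⟨ sym (E-iid D n f) ⟩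
    E f (iid D (suc n)) ∎
    where open ℚ.≤-Reasoning

module Subsets where

  open Expect
  open import Data.Bool using (Bool; true; false)
  import Data.Bool.Properties as Bool
  open import Data.Fin as Fin using (Fin; zero; suc)
  import Data.Fin.Properties as Fin
  open import Data.Fin.Subset using (Subset; inside; outside; ∣_∣)
  open import Data.List as List using (List; []; _∷_; _++_; filter; length)
  open import Data.Nat as ℕ using (ℕ; zero; suc; _≟_; z≤n; s≤s; _!)
  import Data.Nat.Properties as ℕ
  open import Data.Nat.Tactic.RingSolver using (solve-∀)
  open import Data.Product using (_,_; ∃-syntax)
  open import Data.Rational as ℚ using (ℚ; 0ℚ; 1ℚ; _*_; _+_; _≤_)
  open import Data.Rational.Properties hiding (_≟_)
  open import Data.Vec as Vec using (Vec; []; _∷_; map; lookup)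
  open import Data.Vec.Properties using (lookup-map; ≡-dec)
  open import Data.Empty using (⊥-elim)
  open import Relation.Binary.PropositionalEquality
  open import Relation.Nullary using (does)
  open import Relation.Nullary.Decidable using (Dec)
  open import Relation.Unary using (Decidable)
  open import Function using (_∘_)

  sumL : {A : Set} → (A → ℚ) → List A → ℚ
  sumL f xs = sum (λ i → f (List.lookup xs i))

  sumL-++ : ∀ {A : Set} (f : A → ℚ) xs ys → sumL f (xs ++ ys) ≡ sumL f xs + sumL f ys
  sumL-++ f [] ys = sym (+-identityˡ (sumL f ys))
  sumL-++ f (x ∷ xs) ys = trans (cong (f x +_) (sumL-++ f xs ys)) (sym (+-assoc (f x) (sumL f xs) (sumL f ys)))

  sumL-map : ∀ {A B : Set} (f : B → ℚ) (g : A → B) xs → sumL f (List.map g xs) ≡ sumL (f ∘ g) xs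
  sumL-map f g [] = refl
  sumL-map f g (x ∷ xs) = cong (f (g x) +_) (sumL-map f g xs)

  sumL-filter : ∀ {A : Set} {P : A → Set} (P? : Decidable P) (f : A → ℚ) xs →
    sumL f (filter P? xs) ≡ sumL (λ x → indicator (does (P? x)) * f x) xs
  sumL-filter P? f [] = refl
  sumL-filter P? f (x ∷ xs) with does (P? x)
  ... | false = trans (sumL-filter P? f xs) (trans (sym (+-identityˡ (sumL (λ x → indicator (does (P? x)) * f x) xs))) (cong (_+ sumL (λ x → indicator (does (P? x)) * f x) xs) (sym (*-zeroˡ (f x)))))
  ... | true  = cong₂ _+_ (sym (*-identityˡ (f x))) (sumL-filter P? f xs)

  sumL-cong : ∀ {A : Set} {f g : A → ℚ} → (∀ x → f x ≡ g x) → ∀ xs → sumL f xs ≡ sumL g xs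
  sumL-cong e xs = sum-cong λ i → e (List.lookup xs i)

  sumL-0 : ∀ {A : Set} (xs : List A) → sumL (λ _ → 0ℚ) xs ≡ 0ℚ
  sumL-0 xs = trans (sum-const (length xs) 0ℚ) (*-zeroʳ (fromℕ (length xs)))

  kSubsets : ∀ r → ℕ → List (Subset r)
  kSubsets r k = filter (λ S → ∣ S ∣ ≟ k) (subsets r)

  ΣS : ∀ r k → (Subset r → ℚ) → ℚ
  ΣS r k f = sumL f (kSubsets r k)

  ΣS′ : ∀ r k → (Subset r → ℚ) → ℚ
  ΣS′ r k f = sumL (λ S → indicator (does (∣ S ∣ ≟ k)) * f S) (subsets r)

  ΣS≡ΣS′ : ∀ r k f → ΣS r k f ≡ ΣS′ r k f
  ΣS≡ΣS′ r k f = sumL-filter (λ S → ∣ S ∣ ≟ k) f (subsets r)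

  ΣS′-suc : ∀ r k f → ΣS′ (suc r) k f ≡ ΣS′ r k (λ S → f (outside ∷ S)) + sumL (λ S → indicator (does (suc ∣ S ∣ ≟ k)) * f (inside ∷ S)) (subsets r)
  ΣS′-suc r k f = trans (sumL-++ term (List.map (outside ∷_) (subsets r)) (List.map (inside ∷_) (subsets r)))
    (cong₂ _+_ (sumL-map term (outside ∷_) (subsets r)) (sumL-map term (inside ∷_) (subsets r)))
    where
    term : Subset (suc r) → ℚ
    term S = indicator (does (∣ S ∣ ≟ k)) * f S

  ΣS-suc-suc : ∀ r k f → ΣS (suc r) (suc k) f ≡ ΣS r (suc k) (λ S → f (outside ∷ S)) + ΣS r k (λ S → f (inside ∷ S))
  ΣS-suc-suc r k f = trans (ΣS≡ΣS′ (suc r) (suc k) f) (trans (ΣS′-suc r (suc k) f) (sym (cong₂ _+_ (ΣS≡ΣS′ r (suc k) (λ S → f (outside ∷ S))) (ΣS≡ΣS′ r k (λ S → f (inside ∷ S))))))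

  ΣS-suc-zero : ∀ r f → ΣS (suc r) 0 f ≡ ΣS r 0 (λ S → f (outside ∷ S))
  ΣS-suc-zero r f = trans (ΣS≡ΣS′ (suc r) 0 f) (trans (ΣS′-suc r 0 f) (trans (cong₂ _+_ (sym (ΣS≡ΣS′ r 0 (λ S → f (outside ∷ S))))
    (trans (sumL-cong (λ S → *-zeroˡ (f (inside ∷ S))) (subsets r)) (sumL-0 (subsets r)))) (+-identityʳ (ΣS r 0 (λ S → f (outside ∷ S))))))

  ΣS-cong : ∀ r k {f g : Subset r → ℚ} → (∀ S → ∣ S ∣ ≡ k → f S ≡ g S) → ΣS r k f ≡ ΣS r k g
  ΣS-cong zero zero e = cong (_+ 0ℚ) (e [] refl)
  ΣS-cong zero (suc k) e = refl
  ΣS-cong (suc r) zero {f} {g} e = trans (ΣS-suc-zero r f) (trans (ΣS-cong r 0 λ S p → e (outside ∷ S) p) (sym (ΣS-suc-zero r g)))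
  ΣS-cong (suc r) (suc k) {f} {g} e = trans (ΣS-suc-suc r k f) (trans
    (cong₂ _+_ (ΣS-cong r (suc k) λ S p → e (outside ∷ S) p) (ΣS-cong r k λ S p → e (inside ∷ S) (cong suc p))) (sym (ΣS-suc-suc r k g)))

  ΣS-mono : ∀ r k {f g : Subset r → ℚ} → (∀ S → ∣ S ∣ ≡ k → f S ≤ g S) → ΣS r k f ≤ ΣS r k g
  ΣS-mono zero zero e = +-monoˡ-≤ 0ℚ (e [] refl)
  ΣS-mono zero (suc k) e = ≤-refl
  ΣS-mono (suc r) zero {f} {g} e = subst₂ _≤_ (sym (ΣS-suc-zero r f)) (sym (ΣS-suc-zero r g)) (ΣS-mono r 0 λ S p → e (outside ∷ S) p)
  ΣS-mono (suc r) (suc k) {f} {g} e = subst₂ _≤_ (sym (ΣS-suc-suc r k f)) (sym (ΣS-suc-suc r k g))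
    (+-mono-≤ (ΣS-mono r (suc k) λ S p → e (outside ∷ S) p) (ΣS-mono r k λ S p → e (inside ∷ S) (cong suc p)))

  ΣS-+ : ∀ r k f g → ΣS r k (λ S → f S + g S) ≡ ΣS r k f + ΣS r k g
  ΣS-+ r k f g = sum-+ {length (kSubsets r k)} (λ i → f (List.lookup (kSubsets r k) i)) (λ i → g (List.lookup (kSubsets r k) i))

  ΣS-* : ∀ r k c f → ΣS r k (λ S → c * f S) ≡ c * ΣS r k f
  ΣS-* r k c f = sum-* {length (kSubsets r k)} c (λ i → f (List.lookup (kSubsets r k) i))

  ΣS-const : ∀ r k c → ΣS r k (λ _ → c) ≡ fromℕ (length (kSubsets r k)) * c
  ΣS-const r k c = sum-const (length (kSubsets r k)) c

  E-ΣS : ∀ {A : Set} r k (f : Subset r → A → ℚ) (μ : Rand A) → E (λ a → ΣS r k (λ S → f S a)) μ ≡ ΣS r k (λ S → E (f S) μ)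
  E-ΣS {A} r k f μ = go (kSubsets r k)
    where
    go : ∀ xs → E (λ a → sumL (λ S → f S a) xs) μ ≡ sumL (λ S → E (f S) μ) xs
    go [] = E-zero μ
    go (S ∷ xs) = trans (E-+ (f S) (λ a → sumL (λ S → f S a) xs) μ) (cong (E (f S) μ +_) (go xs))

  infix 4 _≟ˢ_

  _≟ˢ_ : ∀ {r} (S S′ : Subset r) → Dec (S ≡ S′)
  _≟ˢ_ = ≡-dec Bool._≟_

  ΣS-zero : ∀ r k (f : Subset r → ℚ) → (∀ S → f S ≡ 0ℚ) → ΣS r k f ≡ 0ℚ
  ΣS-zero r k f z = trans (ΣS-cong r k λ S _ → z S) (sumL-0 (kSubsets r k))

  ΣS-point : ∀ r k (S₀ : Subset r) → ∣ S₀ ∣ ≡ k → ∀ f → ΣS r k (λ S → indicator (does (S ≟ˢ S₀)) * f S) ≡ f S₀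
  ΣS-point zero k [] refl f = trans (+-identityʳ (1ℚ * f [])) (*-identityˡ (f []))
  ΣS-point (suc r) zero (outside ∷ S₀) e f =
    trans (ΣS-suc-zero r (λ S → indicator (does (S ≟ˢ outside ∷ S₀)) * f S)) (ΣS-point r 0 S₀ e (λ S → f (outside ∷ S)))
  ΣS-point (suc r) (suc k) (outside ∷ S₀) e f = trans (ΣS-suc-suc r k (λ S → indicator (does (S ≟ˢ outside ∷ S₀)) * f S)) (trans
    (cong₂ _+_ (ΣS-point r (suc k) S₀ e (λ S → f (outside ∷ S)))
      (ΣS-zero r k (λ S → indicator (does ((inside ∷ S) ≟ˢ outside ∷ S₀)) * f (inside ∷ S)) λ S → *-zeroˡ (f (inside ∷ S)))) (+-identityʳ (f (outside ∷ S₀))))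
  ΣS-point (suc r) (suc k) (inside ∷ S₀) e f = trans (ΣS-suc-suc r k (λ S → indicator (does (S ≟ˢ inside ∷ S₀)) * f S)) (trans
    (cong₂ _+_ (ΣS-zero r (suc k) (λ S → indicator (does ((outside ∷ S) ≟ˢ inside ∷ S₀)) * f (outside ∷ S)) λ S → *-zeroˡ (f (outside ∷ S)))
      (ΣS-point r k S₀ (ℕ.suc-injective e) (λ S → f (inside ∷ S)))) (+-identityˡ (f (inside ∷ S₀))))

  data Elems : ∀ {r n} → Subset r → Vec (Fin r) n → Set where
    []  : Elems [] []
    out : ∀ {r n S} {ss : Vec (Fin r) n} → Elems S ss → Elems (outside ∷ S) (map suc ss)
    ins : ∀ {r n S} {ss : Vec (Fin r) n} → Elems S ss → Elems (inside ∷ S) (zero ∷ map suc ss)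

  elems : ∀ {r} (S : Subset r) {n} → ∣ S ∣ ≡ n → ∃[ ss ] Elems {n = n} S ss
  elems [] refl = [] , []
  elems (outside ∷ S) e with elems S e
  ... | ss , p = map suc ss , out p
  elems (inside ∷ S) {suc n} e with elems S (ℕ.suc-injective e)
  ... | ss , p = zero ∷ map suc ss , ins p

  Elems-size : ∀ {r n S} {ss : Vec (Fin r) n} → Elems S ss → ∣ S ∣ ≡ n
  Elems-size []      = refl
  Elems-size (out p) = Elems-size p
  Elems-size (ins p) = cong suc (Elems-size p)

  Elems-∈ : ∀ {r n S} {ss : Vec (Fin r) n} → Elems S ss → ∀ j → lookup S (lookup ss j) ≡ inside
  Elems-∈ (out {S = S} {ss = ss} p) j = trans (cong (lookup (outside ∷ S)) (lookup-map j suc ss)) (Elems-∈ p j)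
  Elems-∈ (ins p) zero = refl
  Elems-∈ (ins {S = S} {ss = ss} p) (suc j) = trans (cong (lookup (inside ∷ S)) (lookup-map j suc ss)) (Elems-∈ p j)

  Elems-index : ∀ {r n S} {ss : Vec (Fin r) n} → Elems S ss → ∀ i → lookup S i ≡ inside → ∃[ j ] lookup ss j ≡ i
  Elems-index (out {ss = ss} p) (suc i) e with Elems-index p i e
  ... | j , f = j , trans (lookup-map j suc ss) (cong suc f)
  Elems-index (ins p) zero e = zero , refl
  Elems-index (ins {ss = ss} p) (suc i) e with Elems-index p i e
  ... | j , f = suc j , trans (lookup-map j suc ss) (cong suc f)

  Elems-injective : ∀ {r n S} {ss : Vec (Fin r) n} → Elems S ss → ∀ i j → lookup ss i ≡ lookup ss j → i ≡ j
  Elems-injective (out {ss = ss} p) i j e = Elems-injective p i j (Fin.suc-injective (trans (sym (lookup-map i suc ss)) (trans e (lookup-map j suc ss))))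
  Elems-injective (ins p) zero zero e = refl
  Elems-injective (ins {ss = ss} p) zero (suc j) e with trans e (lookup-map j suc ss)
  ... | ()
  Elems-injective (ins {ss = ss} p) (suc i) zero e with trans (sym (lookup-map i suc ss)) e
  ... | ()
  Elems-injective (ins {ss = ss} p) (suc i) (suc j) e =
    cong suc (Elems-injective p i j (Fin.suc-injective (trans (sym (lookup-map i suc ss)) (trans e (lookup-map j suc ss)))))

  sumT : ∀ r k → (Vec (Fin r) k → ℚ) → ℚ
  sumT r zero    F = F []
  sumT r (suc k) F = sum (λ d → sumT r k (F ∘ (d ∷_)))

  sumT-nonNeg : ∀ r k {F} → (∀ ds → 0ℚ ≤ F ds) → 0ℚ ≤ sumT r k F
  sumT-nonNeg r zero p = p []
  sumT-nonNeg r (suc k) p = sum-nonNeg {r} λ d → sumT-nonNeg r k (λ ds → p (d ∷ ds))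

  sumT-suc : ∀ r k (F : Vec (Fin (suc r)) k → ℚ) → (∀ ds → 0ℚ ≤ F ds) → sumT r k (F ∘ map suc) ≤ sumT (suc r) k F
  sumT-suc r zero F F≥0 = ≤-refl
  sumT-suc r (suc k) F F≥0 = ≤-trans (sum-mono {r} λ d → sumT-suc r k (λ ds → F (suc d ∷ ds)) (λ ds → F≥0 (suc d ∷ ds)))
    (≤-trans (≤-reflexive (sym (+-identityˡ (sum tails)))) (+-monoˡ-≤ (sum tails) (sumT-nonNeg (suc r) k (λ ds → F≥0 (zero ∷ ds)))))
    where
    tails : Fin r → ℚ
    tails d = sumT (suc r) k (λ ds → F (suc d ∷ ds))

  ΣS≤sumT : ∀ r k (f : Subset r → ℚ) (F : Vec (Fin r) k → ℚ) → (∀ ds → 0ℚ ≤ F ds) →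
    (∀ S ds → Elems S ds → f S ≤ F ds) → ΣS r k f ≤ sumT r k F
  ΣS≤sumT zero zero f F F≥0 h = ≤-trans (≤-reflexive (+-identityʳ _)) (h [] [] [])
  ΣS≤sumT zero (suc k) f F F≥0 h = ≤-refl
  ΣS≤sumT (suc r) zero f F F≥0 h = ≤-trans (≤-reflexive (ΣS-suc-zero r f)) (ΣS≤sumT r zero _ (λ _ → F []) (λ _ → F≥0 []) λ { S [] p → h (outside ∷ S) [] (out p) })
  ΣS≤sumT (suc r) (suc k) f F F≥0 h = begin
    ΣS (suc r) (suc k) f                                                    ≡⟨ ΣS-suc-suc r k f ⟩
    ΣS r (suc k) (λ S → f (outside ∷ S)) + ΣS r k (λ S → f (inside ∷ S))
      ≤⟨ +-mono-≤ (ΣS≤sumT r (suc k) (λ S → f (outside ∷ S)) (λ ds → F (map suc ds)) (λ ds → F≥0 (map suc ds)) (λ S ds p → h (outside ∷ S) (map suc ds) (out p)))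
                  (ΣS≤sumT r k (λ S → f (inside ∷ S)) with0 (λ ds → F≥0 (zero ∷ map suc ds)) (λ S ds p → h (inside ∷ S) (zero ∷ map suc ds) (ins p))) ⟩
    sumT r (suc k) (λ ds → F (map suc ds)) + sumT r k with0
      ≡⟨ +-comm (sumT r (suc k) (λ ds → F (map suc ds))) (sumT r k with0) ⟩
    sumT r k with0 + sumT r (suc k) (λ ds → F (map suc ds))
      ≤⟨ +-mono-≤ (sumT-suc r k (λ ds → F (zero ∷ ds)) (λ ds → F≥0 (zero ∷ ds)))
           (sum-mono {r} λ d → sumT-suc r k (λ ds → F (suc d ∷ ds)) (λ ds → F≥0 (suc d ∷ ds))) ⟩
    sumT (suc r) (suc k) F ∎
    where
    open ≤-Reasoning
    with0 : Vec (Fin r) k → ℚ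
    with0 ds = F (zero ∷ map suc ds)

  sumT-const : ∀ r k → sumT r k (λ _ → 1ℚ) ≡ fromℕ (r ℕ.^ k)
  sumT-const r zero = refl
  sumT-const r (suc k) = trans (sum-cong {r} λ _ → sumT-const r k) (trans (sum-const r (fromℕ (r ℕ.^ k))) (sym (fromℕ-* r (r ℕ.^ k))))

  count : ℕ → ℕ → ℕ
  count r       zero    = 1
  count zero    (suc k) = 0
  count (suc r) (suc k) = count r (suc k) ℕ.+ count r k

  count-fromℕ : ∀ r k → fromℕ (count r k) ≡ ΣS r k (λ _ → 1ℚ)
  count-fromℕ zero zero = refl
  count-fromℕ (suc r) zero = trans (count-fromℕ r zero) (sym (ΣS-suc-zero r (λ _ → 1ℚ)))
  count-fromℕ zero (suc k) = refl
  count-fromℕ (suc r) (suc k) = trans (fromℕ-+ (count r (suc k)) (count r k)) (trans (cong₂ _+_ (count-fromℕ r (suc k)) (count-fromℕ r k)) (sym (ΣS-suc-suc r k (λ _ → 1ℚ))))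

  fromℕ-cancel-≤ : ∀ {a b} → fromℕ a ≤ fromℕ b → a ℕ.≤ b
  fromℕ-cancel-≤ {a} {b} p = ℕ.≮⇒≥ λ b<a → <-irrefl refl (<-≤-trans (<-≤-trans (lt b) (fromℕ-mono b<a)) p)
    where
    lt : ∀ b → fromℕ b ℚ.< fromℕ (suc b)
    lt b = <-respʳ-≡ (sym (fromℕ-+ 1 b)) (≤-<-trans (≤-reflexive (sym (+-identityˡ (fromℕ b)))) (+-monoˡ-< (fromℕ b) (positive⁻¹ 1ℚ)))

  count≡length : ∀ r k → count r k ≡ length (kSubsets r k)
  count≡length r k = ℕ.≤-antisym (fromℕ-cancel-≤ (≤-reflexive e)) (fromℕ-cancel-≤ (≤-reflexive (sym e)))
    where
    e : fromℕ (count r k) ≡ fromℕ (length (kSubsets r k))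
    e = trans (count-fromℕ r k) (trans (ΣS-const r k 1ℚ) (*-identityʳ (fromℕ (length (kSubsets r k)))))

  count≤ : ∀ r k → count r k ℕ.≤ r ℕ.^ k
  count≤ r k = fromℕ-cancel-≤ (subst₂ _≤_ (sym (count-fromℕ r k)) (sumT-const r k)
    (ΣS≤sumT r k (λ _ → 1ℚ) (λ _ → 1ℚ) (λ _ → 0≤1) (λ _ _ _ → ≤-refl)))

  count-absorb : ∀ r k → suc k ℕ.* count (suc r) (suc k) ≡ suc r ℕ.* count r k
  count-absorb zero zero = refl
  count-absorb zero (suc k) = ℕ.*-zeroʳ (suc (suc k))
  count-absorb (suc r) zero = trans (cong (1 ℕ.*_) (ℕ.+-comm (count (suc r) 1) 1)) (cong suc (trans (cong (ℕ._+ 0) refl) (count-absorb r zero)))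
  count-absorb (suc r) (suc k) = begin
    suc (suc k) ℕ.* (count (suc r) (suc (suc k)) ℕ.+ count (suc r) (suc k))
      ≡⟨ e₁ (suc k) (count (suc r) (suc (suc k))) (count (suc r) (suc k)) ⟩
    suc (suc k) ℕ.* count (suc r) (suc (suc k)) ℕ.+ suc k ℕ.* count (suc r) (suc k) ℕ.+ count (suc r) (suc k)
      ≡⟨ cong₂ (λ a b → a ℕ.+ b ℕ.+ count (suc r) (suc k)) (count-absorb r (suc k)) (count-absorb r k) ⟩
    suc r ℕ.* count r (suc k) ℕ.+ suc r ℕ.* count r k ℕ.+ count (suc r) (suc k)
      ≡⟨ e₂ (suc r) (count r (suc k)) (count r k) ⟩
    suc (suc r) ℕ.* count (suc r) (suc k) ∎
    where
    open ≡-Reasoning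
    e₁ : ∀ k a b → suc k ℕ.* (a ℕ.+ b) ≡ suc k ℕ.* a ℕ.+ k ℕ.* b ℕ.+ b
    e₁ = solve-∀
    e₂ : ∀ r a b → r ℕ.* a ℕ.+ r ℕ.* b ℕ.+ (a ℕ.+ b) ≡ suc r ℕ.* (a ℕ.+ b)
    e₂ = solve-∀

  count≥ : ∀ r k a → a ℕ.+ k ℕ.≤ suc r → a ℕ.^ k ℕ.≤ k ! ℕ.* count r k
  count≥ r zero a p = ℕ.≤-refl
  count≥ zero (suc k) zero p = z≤n
  count≥ zero (suc k) (suc a) (s≤s p) = ⊥-elim (ℕ.<⇒≱ (ℕ.m≤n+m (suc k) a) (ℕ.≤-trans p z≤n))
  count≥ (suc r) (suc k) a p = begin
    a ℕ.* a ℕ.^ k                         ≤⟨ ℕ.*-mono-≤ a≤ (count≥ r k a p′) ⟩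
    suc r ℕ.* (k ! ℕ.* count r k)         ≡⟨ e₁ (suc r) (k !) (count r k) ⟩
    k ! ℕ.* (suc r ℕ.* count r k)         ≡⟨ cong (k ! ℕ.*_) (sym (count-absorb r k)) ⟩
    k ! ℕ.* (suc k ℕ.* count (suc r) (suc k)) ≡⟨ e₂ (k !) (suc k) _ ⟩
    suc k ℕ.* k ! ℕ.* count (suc r) (suc k) ∎
    where
    open ℕ.≤-Reasoning
    p′ : a ℕ.+ k ℕ.≤ suc r
    p′ = ℕ.s≤s⁻¹ (ℕ.≤-trans (ℕ.≤-reflexive (sym (ℕ.+-suc a k))) p)
    a≤ : a ℕ.≤ suc r
    a≤ = ℕ.≤-trans (ℕ.m≤m+n a k) p′
    e₁ : ∀ a b c → a ℕ.* (b ℕ.* c) ≡ b ℕ.* (a ℕ.* c)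
    e₁ = solve-∀
    e₂ : ∀ a b c → a ℕ.* (b ℕ.* c) ≡ b ℕ.* a ℕ.* c
    e₂ = solve-∀

module Planted where

  open Expect
  open Product
  open Zq
  open Subsets
  open import Data.Bool using (Bool; _∧_)
  open import Data.Fin as Fin using (Fin; zero; suc)
  import Data.Fin.Properties as Fin
  open import Data.Fin.Subset as Sub using (Subset; inside; outside; ∣_∣)
  open import Data.Fin.Subset.Properties using (p─⊥≡p)
  open import Data.List as List using (List; []; _∷_; length)
  open import Data.Maybe using (just)
  open import Data.Nat as ℕ using (ℕ; zero; suc; NonZero)
  import Data.Nat.Properties as ℕ
  open import Data.Product using (_×_; _,_; ∃-syntax; proj₂)
  open import Data.Rational as ℚ using (ℚ; 0ℚ; 1ℚ; _*_; _+_; _≤_; -_; _-_)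
  open import Data.Rational.Properties hiding (_≟_)
  open import Data.Rational.Solver using (module +-*-Solver)
  open import Data.Sum using (_⊎_; inj₁; inj₂)
  open import Data.Vec as Vec using (Vec; []; _∷_; map; lookup; _[_]≔_)
  open import Data.Vec.Properties using (≡-dec)
  open import Data.Empty using (⊥-elim)
  open import Relation.Binary.PropositionalEquality
  open import Relation.Nullary using (yes; no; does)
  open import Relation.Nullary.Decidable using (dec-true; dec-false)

  module PlantedInstances (q : ℕ) .{{_ : NonZero q}} (m : ℕ) where

    open ZqGroup q public
    open Vectors m public

    ε : ℚ
    ε = recip q ^ℚ m

    ε≥0 : 0ℚ ≤ ε
    ε≥0 = ^ℚ≥0 m (recip≥0 q)

    sumAt : ∀ {r n} → Vec (Fin r) n → Vec G r → G
    sumAt []       X = 0G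
    sumAt (s ∷ ss) X = lookup X s ⊕ sumAt ss X

    sumAt-suc : ∀ {r n} (ss : Vec (Fin r) n) x X → sumAt (map suc ss) (x ∷ X) ≡ sumAt ss X
    sumAt-suc [] x X = refl
    sumAt-suc (s ∷ ss) x X = cong (lookup X s ⊕_) (sumAt-suc ss x X)

    Σ-elems : ∀ {r n S} {ss : Vec (Fin r) n} → Elems S ss → ∀ X → Σ[ S ] X ≡ sumAt ss X
    Σ-elems [] [] = refl
    Σ-elems (out {ss = ss} p) (x ∷ X) = trans (Σ-elems p X) (sym (sumAt-suc ss x X))
    Σ-elems (ins {ss = ss} p) (x ∷ X) = cong (x ⊕_) (trans (Σ-elems p X) (sym (sumAt-suc ss x X)))

    min-elems : ∀ {r n S} {ss : Vec (Fin r) (suc n)} → Elems S ss → min S ≡ just (Vec.head ss)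
    min-elems (ins p) = refl
    min-elems (out {ss = s ∷ ss} p) = cong (Data.Maybe.map suc) (min-elems p)

    tail-elems : ∀ {r n S} {ss : Vec (Fin r) (suc n)} → Elems S ss → Elems (S Sub.- Vec.head ss) (Vec.tail ss)
    tail-elems (ins {S = S} {ss = ss} p) = out (subst (λ S → Elems S ss) (sym (p─⊥≡p S)) p)
    tail-elems (out {ss = s ∷ ss} p) = out (tail-elems p)

    plant-elems : ∀ {r n S s} {ss : Vec (Fin r) n} → Elems S (s ∷ ss) → ∀ X → plant S X ≡ X [ s ]≔ ⊖ sumAt ss X
    plant-elems {S = S} {s} {ss} p X with min S | min-elems p
    ... | just .s | refl = cong (λ z → X [ s ]≔ ⊖ z) (Σ-elems (tail-elems p) X)

    sumExcept : ∀ {r} → Subset r → Fin r → Vec G r → G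
    sumExcept (_ ∷ S)       zero    (x ∷ X) = Σ[ S ] X
    sumExcept (outside ∷ S) (suc i) (x ∷ X) = sumExcept S i X
    sumExcept (inside ∷ S)  (suc i) (x ∷ X) = x ⊕ sumExcept S i X

    Σ-update : ∀ {r} (S : Subset r) i → lookup S i ≡ inside → ∀ X y → Σ[ S ] (X [ i ]≔ y) ≡ y ⊕ sumExcept S i X
    Σ-update (inside ∷ S) zero refl (x ∷ X) y = refl
    Σ-update (outside ∷ S) (suc i) e (x ∷ X) y = Σ-update S i e X y
    Σ-update (inside ∷ S) (suc i) e (x ∷ X) y = trans (cong (x ⊕_) (Σ-update S i e X y)) (trans (sym (⊕-assoc x y (sumExcept S i X)))
      (trans (cong (_⊕ sumExcept S i X) (⊕-comm x y)) (⊕-assoc y x (sumExcept S i X))))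

    Σ-fixed : ∀ {r} (S : Subset r) i → lookup S i ≡ outside → ∀ X y → Σ[ S ] (X [ i ]≔ y) ≡ Σ[ S ] X
    Σ-fixed (outside ∷ S) zero e (x ∷ X) y = refl
    Σ-fixed (outside ∷ S) (suc i) e (x ∷ X) y = Σ-fixed S i e X y
    Σ-fixed (inside ∷ S) (suc i) e (x ∷ X) y = cong (x ⊕_) (Σ-fixed S i e X y)

    sols : ∀ {r} → Subset r → Vec G r → ℚ
    sols S X = indicator (does (≡-dec Fin._≟_ (Σ[ S ] X) 0G))

    sols≥0 : ∀ {r} (S : Subset r) X → 0ℚ ≤ sols S X
    sols≥0 S X = indicator≥0 _

    shift-zero : ∀ y z → does (≡-dec Fin._≟_ (y ⊕ z) 0G) ≡ does (≡-dec Fin._≟_ y (⊖ z))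
    shift-zero y z with ≡-dec Fin._≟_ y (⊖ z)
    ... | yes refl = dec-true (≡-dec Fin._≟_ ((⊖ z) ⊕ z) 0G) (⊖-inverseˡ z)
    ... | no ne = dec-false (≡-dec Fin._≟_ (y ⊕ z) 0G) (λ e → ne (⊖-unique y z e))

    samples : ∀ r → Rand (Vec G r)
    samples r = iid vector r

    total-samples : ∀ r → Total (samples r)
    total-samples r = Total-iid r total-vector

    E-hit : ∀ {r} (S : Subset r) i (ρ : Vec G r → G) → (∀ X y → Σ[ S ] (X [ i ]≔ y) ≡ y ⊕ ρ X) → (f : Vec G r → ℚ) →
      E (λ X → sols S X * f X) (samples r) ≡ ε * E (λ X → f (X [ i ]≔ ⊖ ρ X)) (samples r)
    E-hit {r} S i ρ h f = begin
      E (λ X → sols S X * f X) (samples r)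
        ≡⟨ E-resample vector total-vector i _ ⟩
      E (λ y → E (λ X → sols S (X [ i ]≔ y) * f (X [ i ]≔ y)) (samples r)) vector
        ≡⟨ E-swap _ vector (samples r) ⟩
      E (λ X → E (λ y → sols S (X [ i ]≔ y) * f (X [ i ]≔ y)) vector) (samples r)
        ≡⟨ E-cong (samples r) (λ X → trans (E-cong vector λ y → cong (λ b → indicator b * f (X [ i ]≔ y))
             (trans (cong (λ z → does (≡-dec Fin._≟_ z 0G)) (h X y)) (shift-zero y (ρ X)))) (E-point (λ y → f (X [ i ]≔ y)) (⊖ ρ X))) ⟩
      E (λ X → ε * f (X [ i ]≔ ⊖ ρ X)) (samples r)
        ≡⟨ E-*ˡ ε _ (samples r) ⟩
      ε * E (λ X → f (X [ i ]≔ ⊖ ρ X)) (samples r) ∎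
      where open ≡-Reasoning

    sumAt-update : ∀ {r n} (ss : Vec (Fin r) n) i X y → (∀ j → lookup ss j ≢ i) → sumAt ss (X [ i ]≔ y) ≡ sumAt ss X
    sumAt-update [] i X y h = refl
    sumAt-update (s ∷ ss) i X y h = cong₂ _⊕_ (lookup∘update′ (h zero) X y) (sumAt-update ss i X y (λ j → h (suc j)))
      where open import Data.Vec.Properties using (lookup∘update′)

    head∉tail : ∀ {r n S s} {ss : Vec (Fin r) n} → Elems S (s ∷ ss) → ∀ j → lookup ss j ≢ s
    head∉tail p j e with Elems-injective p (suc j) zero e
    ... | ()

    exchange : ∀ {r n S s} {ss : Vec (Fin r) n} → Elems S (s ∷ ss) → (f : Vec G r → ℚ) →
      E (λ X → sols S X * f X) (samples r) ≡ ε * E (λ X → f (plant S X)) (samples r)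
    exchange {r} {S = S} {s} {ss} p f = trans
      (E-hit S s (sumAt ss) (λ X y → trans (Σ-elems p (X [ s ]≔ y))
        (cong₂ _⊕_ (lookup∘update s X y) (sumAt-update ss s X y (head∉tail p)))) f)
      (cong (ε *_) (E-cong (samples r) λ X → cong f (sym (plant-elems p X))))
      where open import Data.Vec.Properties using (lookup∘update)

    E-sols : ∀ {r n S s} {ss : Vec (Fin r) n} → Elems S (s ∷ ss) → E (sols S) (samples r) ≡ ε
    E-sols {r} {S = S} p = trans (E-cong (samples r) λ X → sym (*-identityʳ (sols S X))) (trans (exchange p (λ _ → 1ℚ))
      (trans (cong (ε *_) (E-const 1ℚ (samples r) (total-samples r))) (*-identityʳ ε)))

    E-sols-pair : ∀ {r n S s S′} {ss : Vec (Fin r) n} → Elems S (s ∷ ss) → ∀ i → lookup S′ i ≡ inside → lookup S i ≡ outside →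
      E (λ X → sols S′ X * sols S X) (samples r) ≡ ε * ε
    E-sols-pair {r} {S = S} {S′ = S′} p i i∈ i∉ =
      trans (E-hit S′ i (sumExcept S′ i) (Σ-update S′ i i∈) (sols S)) (cong (ε *_) (trans (E-cong (samples r) λ X →
        cong (λ z → indicator (does (≡-dec Fin._≟_ z 0G))) (Σ-fixed S i i∉ X (⊖ sumExcept S′ i X))) (E-sols p)))

    differ : ∀ {r} (S S′ : Subset r) → ∣ S ∣ ≡ ∣ S′ ∣ → S ≡ S′ ⊎ (∃[ i ] lookup S′ i ≡ inside × lookup S i ≡ outside)
    differ S S′ e = go S S′ (ℕ.≤-reflexive e)
      where
      go : ∀ {r} (S S′ : Subset r) → ∣ S ∣ ℕ.≤ ∣ S′ ∣ → S ≡ S′ ⊎ (∃[ i ] lookup S′ i ≡ inside × lookup S i ≡ outside)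
      suc′ : ∀ {r b b′} {S S′ : Subset r} → (∃[ i ] lookup S′ i ≡ inside × lookup S i ≡ outside) →
        ∃[ i ] lookup (b′ ∷ S′) i ≡ inside × lookup (b ∷ S) i ≡ outside
      suc′ (i , p , q) = suc i , p , q
      go [] [] _ = inj₁ refl
      go (outside ∷ S) (inside ∷ S′) le = inj₂ (zero , refl , refl)
      go (outside ∷ S) (outside ∷ S′) le with go S S′ le
      ... | inj₁ refl = inj₁ refl
      ... | inj₂ d = inj₂ (suc′ d)
      go (inside ∷ S) (inside ∷ S′) le with go S S′ (ℕ.s≤s⁻¹ le)
      ... | inj₁ refl = inj₁ refl
      ... | inj₂ d = inj₂ (suc′ d)
      go (inside ∷ S) (outside ∷ S′) le with go S S′ (ℕ.≤-trans (ℕ.n≤1+n _) le)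
      ... | inj₁ refl = ⊥-elim (ℕ.<-irrefl refl le)
      ... | inj₂ d = inj₂ (suc′ d)

    module Mean (r k′ : ℕ) (guess : Vec G r → Rand (Subset r)) (total-guess : ∀ X → Total (guess X)) where

      k : ℕ
      k = suc k′

      Λ : ℚ
      Λ = fromℕ (length (kSubsets r k))

      find : Subset r → Vec G r → ℚ
      find S X = E (λ S′ → indicator (does (S ≟ˢ S′))) (guess X)

      solve? : Vec G r → ℚ
      solve? X = E (λ S′ → indicator (isSolution k X S′)) (guess X)

      solutions : Vec G r → ℚ
      solutions X = ΣS r k (λ S → sols S X)

      solve?≥0 : ∀ X → 0ℚ ≤ solve? X
      solve?≥0 X = E-nonNeg (guess X) (λ S′ → indicator≥0 _)

      solve?≤1 : ∀ X → solve? X ≤ 1ℚ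
      solve?≤1 X = E-≤const (guess X) (total-guess X) (λ S′ → indicator≤1 (isSolution k X S′))

      find-sum : ∀ X → ΣS r k (λ S → sols S X * find S X) ≡ solve? X
      find-sum X = trans (ΣS-cong r k (λ S _ → sym (E-*ˡ (sols S X) (λ S′ → indicator (does (S ≟ˢ S′))) (guess X)))) (trans (sym (E-ΣS r k (λ S S′ → sols S X * indicator (does (S ≟ˢ S′))) (guess X)))
        (E-cong (guess X) pointwise))
        where
        pointwise : ∀ S′ → ΣS r k (λ S → sols S X * indicator (does (S ≟ˢ S′))) ≡ indicator (isSolution k X S′)
        pointwise S′ with ∣ S′ ∣ ℕ.≟ k
        ... | yes e = trans (ΣS-cong r k λ S _ → *-comm (sols S X) (indicator (does (S ≟ˢ S′)))) (trans (ΣS-point r k S′ e (λ S → sols S X))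
          (cong (λ b → indicator (b ∧ does (≡-dec Fin._≟_ (Σ[ S′ ] X) 0G))) (sym (dec-true (∣ S′ ∣ ℕ.≟ k) e))))
        ... | no ne = trans (ΣS-cong r k λ S e → trans (cong (λ b → sols S X * indicator b)
            (dec-false (S ≟ˢ S′) λ { refl → ne e })) (*-zeroʳ (sols S X)))
            (trans (ΣS-zero r k (λ _ → 0ℚ) (λ _ → refl))
            (cong (λ b → indicator (b ∧ does (≡-dec Fin._≟_ (Σ[ S′ ] X) 0G))) (sym (dec-false (∣ S′ ∣ ℕ.≟ k) ne))))

      elems-suc : ∀ S → ∣ S ∣ ≡ k → ∃[ s ] ∃[ ss ] Elems {r} {k} S (s ∷ ss)
      elems-suc S e with elems S e
      ... | s ∷ ss , p = s , ss , p

      second-moment : E (λ X → solutions X * solutions X) (samples r) ≤ Λ * (ε + Λ * (ε * ε))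
      second-moment = begin
        E (λ X → solutions X * solutions X) (samples r)
          ≡⟨ E-cong (samples r) (λ X → sym (trans (ΣS-cong r k λ S _ → *-comm (sols S X) (solutions X)) (ΣS-* r k (solutions X) (λ S → sols S X)))) ⟩
        E (λ X → ΣS r k (λ S → sols S X * solutions X)) (samples r)
          ≡⟨ E-ΣS r k (λ S X → sols S X * solutions X) (samples r) ⟩
        ΣS r k (λ S → E (λ X → sols S X * solutions X) (samples r))
          ≤⟨ ΣS-mono r k row ⟩
        ΣS r k (λ S → ε + Λ * (ε * ε))
          ≡⟨ ΣS-const r k _ ⟩
        Λ * (ε + Λ * (ε * ε)) ∎
        where
        open ≤-Reasoning
        pair : ∀ S S′ → ∣ S ∣ ≡ k → ∣ S′ ∣ ≡ k → E (λ X → sols S X * sols S′ X) (samples r) ≤ indicator (does (S′ ≟ˢ S)) * ε + ε * ε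
        pair S S′ e e′ with elems-suc S e | elems-suc S′ e′ | differ S′ S (trans e′ (sym e))
        ... | s , ss , p | s′ , ss′ , p′ | inj₁ refl = begin
          E (λ X → sols S X * sols S X) (samples r)
            ≤⟨ E-mono (samples r) (λ X → ≤-trans (*-monoˡ (sols≥0 S X) (indicator≤1 _)) (≤-reflexive (*-identityʳ (sols S X)))) ⟩
          E (sols S) (samples r)                      ≡⟨ E-sols p ⟩
          ε                                           ≡⟨ sym (trans (cong (_+ 0ℚ) (*-identityˡ ε)) (+-identityʳ ε)) ⟩
          1ℚ * ε + 0ℚ                                 ≤⟨ +-monoʳ-≤ (1ℚ * ε) (*-nonNeg ε≥0 ε≥0) ⟩
          1ℚ * ε + ε * ε                              ≡⟨ cong (λ b → indicator b * ε + ε * ε) (sym (dec-true (S ≟ˢ S) refl)) ⟩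
          indicator (does (S ≟ˢ S)) * ε + ε * ε ∎
        ... | s , ss , p | s′ , ss′ , p′ | inj₂ (i , i∈ , i∉) = begin
          E (λ X → sols S X * sols S′ X) (samples r)  ≡⟨ E-sols-pair {S′ = S} p′ i i∈ i∉ ⟩
          ε * ε                                       ≡⟨ sym (+-identityˡ (ε * ε)) ⟩
          0ℚ + ε * ε                                  ≤⟨ +-monoˡ-≤ (ε * ε) (*-nonNeg (indicator≥0 (does (S′ ≟ˢ S))) ε≥0) ⟩
          indicator (does (S′ ≟ˢ S)) * ε + ε * ε ∎
        row : ∀ S → ∣ S ∣ ≡ k → E (λ X → sols S X * solutions X) (samples r) ≤ ε + Λ * (ε * ε)
        row S e = begin
          E (λ X → sols S X * solutions X) (samples r)
            ≡⟨ E-cong (samples r) (λ X → sym (ΣS-* r k (sols S X) (λ S′ → sols S′ X))) ⟩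
          E (λ X → ΣS r k (λ S′ → sols S X * sols S′ X)) (samples r)
            ≡⟨ E-ΣS r k (λ S′ X → sols S X * sols S′ X) (samples r) ⟩
          ΣS r k (λ S′ → E (λ X → sols S X * sols S′ X) (samples r))
            ≤⟨ ΣS-mono r k (λ S′ e′ → pair S S′ e e′) ⟩
          ΣS r k (λ S′ → indicator (does (S′ ≟ˢ S)) * ε + ε * ε)
            ≡⟨ ΣS-+ r k (λ S′ → indicator (does (S′ ≟ˢ S)) * ε) (λ _ → ε * ε) ⟩
          ΣS r k (λ S′ → indicator (does (S′ ≟ˢ S)) * ε) + ΣS r k (λ S′ → ε * ε)
            ≡⟨ cong₂ _+_ (ΣS-point r k S e (λ _ → ε)) (ΣS-const r k (ε * ε)) ⟩
          ε + Λ * (ε * ε) ∎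

      -- Since (nθ - 1)² ≥ 0, a guess among n solutions is counted at least
      -- n (2θ - nθ²) times; averaging over uniform X compares the probability of
      -- finding some solution with that of finding the planted one.
      find-bound : ∀ θ → (θ + θ) * ΣS r k (λ S → E (λ X → solve? (plant S X)) (samples r)) * ε ≤
        ΣS r k (λ S → E (λ X → find S (plant S X)) (samples r)) * ε + θ * θ * (Λ * (ε + Λ * (ε * ε)))
      find-bound θ = begin
        (θ + θ) * ΣS r k (λ S → E (λ X → solve? (plant S X)) (samples r)) * ε
          ≡⟨ trans (*-assoc (θ + θ) _ ε) (cong ((θ + θ) *_) (planted-sum (λ S → solve?))) ⟩
        (θ + θ) * E (λ X → ΣS r k (λ S → sols S X * solve? X)) (samples r)
          ≡⟨ cong ((θ + θ) *_) (E-cong (samples r) λ X → trans (ΣS-cong r k λ S _ → *-comm (sols S X) (solve? X)) (ΣS-* r k (solve? X) (λ S → sols S X))) ⟩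
        (θ + θ) * E (λ X → solve? X * solutions X) (samples r)
          ≡⟨ sym (E-*ˡ (θ + θ) _ (samples r)) ⟩
        E (λ X → (θ + θ) * (solve? X * solutions X)) (samples r)
          ≤⟨ E-mono (samples r) pointwise ⟩
        E (λ X → solve? X + θ * θ * (solutions X * solutions X)) (samples r)
          ≡⟨ trans (E-+ _ _ (samples r)) (cong (E solve? (samples r) +_) (E-*ˡ (θ * θ) _ (samples r))) ⟩
        E solve? (samples r) + θ * θ * E (λ X → solutions X * solutions X) (samples r)
          ≤⟨ +-mono-≤ (≤-reflexive (trans (E-cong (samples r) λ X → sym (find-sum X)) (sym (planted-sum find)))) (*-monoˡ (sq≥0 θ) second-moment) ⟩
        ΣS r k (λ S → E (λ X → find S (plant S X)) (samples r)) * ε + θ * θ * (Λ * (ε + Λ * (ε * ε))) ∎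
        where
        open ≤-Reasoning
        planted-sum : (f : Subset r → Vec G r → ℚ) → ΣS r k (λ S → E (λ X → f S (plant S X)) (samples r)) * ε ≡
          E (λ X → ΣS r k (λ S → sols S X * f S X)) (samples r)
        planted-sum f = trans (*-comm _ ε) (trans (sym (ΣS-* r k ε (λ S → E (λ X → f S (plant S X)) (samples r)))) (trans (ΣS-cong r k λ S e → sym (exchange (proj₂ (proj₂ (elems-suc S e))) (f S)))
          (sym (E-ΣS r k (λ S X → sols S X * f S X) (samples r)))))
        pointwise : ∀ X → (θ + θ) * (solve? X * solutions X) ≤ solve? X + θ * θ * (solutions X * solutions X)
        pointwise X = 0≤diff (subst (0ℚ ≤_) eq (+-nonNeg (*-nonNeg (solve?≥0 X) (sq≥0 (θ * n - 1ℚ))) (*-nonNeg (diff≥0 (solve?≤1 X)) (*-nonNeg (sq≥0 θ) (sq≥0 n)))))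
          where
          n = solutions X
          s = solve? X
          eq : s * ((θ * n - 1ℚ) * (θ * n - 1ℚ)) + (1ℚ - s) * (θ * θ * (n * n)) ≡ s + θ * θ * (n * n) - (θ + θ) * (s * n)
          eq = solve 3 (λ s θ n → s :* ((θ :* n :- con 1ℚ) :* (θ :* n :- con 1ℚ)) :+ (con 1ℚ :- s) :* (θ :* θ :* (n :* n)) :=
            s :+ θ :* θ :* (n :* n) :- (θ :+ θ) :* (s :* n)) refl s θ n
            where open +-*-Solver

module Recover where

  open Machine
  open Programs
  open VectorPrograms
  open Pipeline
  open SearchProgram
  open Product
  open Zq
  open Subsets
  open Planted
  open import Data.Bool using (Bool; true; false; if_then_else_; _∧_)
  import Data.Bool.Properties as Bool
  open import Data.Fin as Fin using (Fin; zero; suc; toℕ)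
  import Data.Fin.Properties as Fin
  open import Data.Fin.Subset using (Subset; ∣_∣)
  open import Data.List as List using (List; []; _∷_)
  open import Data.Maybe as Maybe using (Maybe; just; nothing; maybe′)
  open import Data.Nat as ℕ using (ℕ; zero; suc; NonZero; _+_; _≤_; _≡ᵇ_; pred; s≤s)
  import Data.Nat.Properties as ℕ
  open import Data.Nat.DivMod using (_mod_)
  open import Data.Product using (_×_; _,_; ∃-syntax; proj₁; proj₂)
  open import Data.Sum using (_⊎_; inj₁; inj₂)
  open import Data.Vec as Vec using (Vec; []; _∷_; map; lookup; _[_]≔_; zipWith; fromList)
  open import Data.Vec.Properties using (≡-dec; lookup-map; lookup∘tabulate; lookup∘update; lookup∘update′)
  open import Data.Empty using (⊥-elim)
  open import Relation.Binary.PropositionalEquality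
  open import Relation.Nullary using (yes; no; does)
  open import Relation.Nullary.Decidable using (dec-true)
  open import Function using (_∘_)

  vec-ext : ∀ {A : Set} {n} {xs ys : Vec A n} → (∀ i → lookup xs i ≡ lookup ys i) → xs ≡ ys
  vec-ext {xs = []} {[]} h = refl
  vec-ext {xs = x ∷ xs} {y ∷ ys} h = cong₂ _∷_ (h zero) (vec-ext (h ∘ suc))

  Has : ∀ {t} → ℕ → Vec ℕ t → Set
  Has n ts = ∃[ i ] lookup ts i ≡ n

  tagCount-true : ∀ b {t} (ts : Vec ℕ t) → b ≡ true ⊎ Has 1 ts → tagCount b ts ≡ true
  tagCount-true b [] (inj₁ refl) = refl
  tagCount-true b (x ∷ ts) (inj₁ refl) with x ≡ᵇ 1
  ... | true  = tagCount-true true ts (inj₁ refl)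
  ... | false = tagCount-true true ts (inj₁ refl)
  tagCount-true b (.1 ∷ ts) (inj₂ (zero , refl)) = tagCount-true true ts (inj₁ refl)
  tagCount-true b (x ∷ ts) (inj₂ (suc i , e)) = tagCount-true (if x ≡ᵇ 1 then true else b) ts (inj₂ (i , e))

  tagCount-has : ∀ b {t} (ts : Vec ℕ t) → tagCount b ts ≡ true → b ≡ true ⊎ Has 1 ts
  tagCount-has b [] e = inj₁ e
  tagCount-has b (x ∷ ts) e with tagCount-has (if x ≡ᵇ 1 then true else b) ts e
  ... | inj₂ (i , f) = inj₂ (suc i , f)
  ... | inj₁ f = hit x f
    where
    hit : ∀ x → (if x ≡ᵇ 1 then true else b) ≡ true → b ≡ true ⊎ Has 1 (x ∷ ts)
    hit 0 f = inj₁ f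
    hit 1 f = inj₂ (zero , refl)
    hit (suc (suc x)) f = inj₁ f

  bitsOf-true : ∀ n {t} (ts : Vec ℕ t) (l : Fin n) → Has (suc (toℕ l)) ts → lookup (bitsOf n ts) l ≡ true
  bitsOf-true (suc n) ts zero h = tagCount-true false ts (inj₂ h)
  bitsOf-true (suc n) ts (suc l) (i , e) = bitsOf-true n (map pred ts) l (i , trans (lookup-map i pred ts) (cong pred e))

  bitsOf-has : ∀ n {t} (ts : Vec ℕ t) (l : Fin n) → lookup (bitsOf n ts) l ≡ true → Has (suc (toℕ l)) ts
  bitsOf-has (suc n) ts zero e with tagCount-has false ts e
  ... | inj₂ h = h
  bitsOf-has (suc n) ts (suc l) e with bitsOf-has n (map pred ts) l e
  ... | i , f = i , up (lookup ts i) (trans (sym (lookup-map i pred ts)) f)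
    where
    up : ∀ x {n} → pred x ≡ suc n → x ≡ suc (suc n)
    up (suc x) refl = refl

  revOnto : ∀ {n} → Vec ℕ n → List ℕ → List ℕ
  revOnto []       acc = acc
  revOnto (x ∷ xs) acc = revOnto xs (x ∷ acc)

  Has-revOnto : ∀ {n} (xs : Vec ℕ n) acc {a} → Has a xs ⊎ Has a (fromList acc) → Has a (fromList (revOnto xs acc))
  Has-revOnto [] acc (inj₂ h) = h
  Has-revOnto (x ∷ xs) acc (inj₁ (zero , e)) = Has-revOnto xs (x ∷ acc) (inj₂ (zero , e))
  Has-revOnto (x ∷ xs) acc (inj₁ (suc i , e)) = Has-revOnto xs (x ∷ acc) (inj₁ (i , e))
  Has-revOnto (x ∷ xs) acc (inj₂ (i , e)) = Has-revOnto xs (x ∷ acc) (inj₂ (suc i , e))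

  revOnto-Has : ∀ {n} (xs : Vec ℕ n) acc {a} → Has a (fromList (revOnto xs acc)) → Has a xs ⊎ Has a (fromList acc)
  revOnto-Has [] acc h = inj₂ h
  revOnto-Has (x ∷ xs) acc h with revOnto-Has xs (x ∷ acc) h
  ... | inj₁ (i , e) = inj₁ (suc i , e)
  ... | inj₂ (zero , e) = inj₁ (zero , e)
  ... | inj₂ (suc i , e) = inj₂ (i , e)

  pin-other : ∀ {A : Set} {n r} (ss : Vec (Fin r) n) (vs : Vec A n) a i → (∀ j → lookup ss j ≢ i) → lookup (pin ss vs a) i ≡ lookup a i
  pin-other [] [] a i h = refl
  pin-other (s ∷ ss) (v ∷ vs) a i h = trans (lookup∘update′ (λ e → h zero (sym e)) (pin ss vs a) v) (pin-other ss vs a i (λ j → h (suc j)))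

  pin-at : ∀ {A : Set} {n r} (ss : Vec (Fin r) n) (vs : Vec A n) a → (∀ i j → lookup ss i ≡ lookup ss j → i ≡ j) →
    ∀ j → lookup (pin ss vs a) (lookup ss j) ≡ lookup vs j
  pin-at (s ∷ ss) (v ∷ vs) a inj zero = lookup∘update s (pin ss vs a) v
  pin-at (s ∷ ss) (v ∷ vs) a inj (suc j) = trans (lookup∘update′ ne (pin ss vs a) v)
    (pin-at ss vs a (λ i j e → Fin.suc-injective (inj (suc i) (suc j) e)) j)
    where
    ne : lookup ss j ≢ s
    ne e with inj (suc j) zero e
    ... | ()

  fin? : ∀ r → ℕ → Maybe (Fin r)
  fin? zero    n       = nothing
  fin? (suc r) zero    = just zero
  fin? (suc r) (suc n) = Maybe.map suc (fin? r n)

  locate : ∀ {r} → ℕ → ℕ → Maybe (Fin r)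
  locate zero    n       = fin? _ n
  locate (suc t) zero    = nothing
  locate (suc t) (suc n) = locate t n

  fin?-just : ∀ r n {l} → fin? r n ≡ just l → toℕ l ≡ n
  fin?-just (suc r) zero refl = refl
  fin?-just (suc r) (suc n) e with fin? r n in eq
  fin?-just (suc r) (suc n) refl | just l = cong suc (fin?-just r n eq)

  fin?-toℕ : ∀ {r} (l : Fin r) → fin? r (toℕ l) ≡ just l
  fin?-toℕ zero = refl
  fin?-toℕ (suc l) = cong (Maybe.map suc) (fin?-toℕ l)

  locate-just : ∀ {r} t n {l : Fin r} → locate t n ≡ just l → t + toℕ l ≡ n
  locate-just zero n e = fin?-just _ n e
  locate-just (suc t) (suc n) e = cong suc (locate-just t n e)

  locate-+ : ∀ {r} t (l : Fin r) → locate t (t + toℕ l) ≡ just l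
  locate-+ zero l = fin?-toℕ l
  locate-+ (suc t) l = locate-+ t l

  nthM-lookup : ∀ {A : Set} {r} (xs : Vec (Maybe A) r) n → nthM xs n ≡ maybe′ (lookup xs) nothing (fin? r n)
  nthM-lookup [] n = refl
  nthM-lookup (x ∷ xs) zero = refl
  nthM-lookup {r = suc r} (x ∷ xs) (suc n) with fin? r n | nthM-lookup xs n
  ... | nothing | e = e
  ... | just l  | e = e

  padAt-lookup : ∀ {A : Set} {r} t (xs : Vec (Maybe A) r) n → padAt t xs n ≡ maybe′ (lookup xs) nothing (locate t n)
  padAt-lookup zero xs n = nthM-lookup xs n
  padAt-lookup (suc t) xs zero = refl
  padAt-lookup (suc t) xs (suc n) = padAt-lookup t xs n

  module Recovery (q : ℕ) .{{_ : NonZero q}} (k′ D₁ D₂ r₀ m : ℕ) where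

    open Program q k′ D₁ D₂ r₀ using (k; shifts; instanceOf; answer)
    open Pipe q k using (streams; mkSrcs; destinations; maskOf; decSrc; pickM; tally; checks; sumFrom; 0V; value; Src; Stream)
    open PlantedInstances q m

    gather-elems : ∀ {X : Set} {n κ S} {ds : Vec (Fin n) κ} → Elems S ds → (ps : Vec (ℕ × X) n) → ∀ O β acc → decode n O ≡ S → κ ≤ β →
      proj₂ (proj₂ (gather ps (O , β , acc))) ≡ revOnto (map (λ d → proj₁ (lookup ps d)) ds) acc
    gather-elems [] [] O β acc e p = refl
    gather-elems (out {ss = ss} el) ((i , x) ∷ ps) O β acc e p with isCons (head O) | β | e
    ... | false | β | refl = trans (gather-elems el ps (tail O) β acc refl p) (cong (λ v → revOnto v acc) (map-map ss))
      where
      map-map : ∀ {κ} (ss : Vec (Fin _) κ) → map (λ d → proj₁ (lookup ps d)) ss ≡ map (λ d → proj₁ (lookup ((i , x) ∷ ps) d)) (map suc ss)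
      map-map [] = refl
      map-map (s ∷ ss) = cong (_ ∷_) (map-map ss)
    gather-elems (ins {ss = ss} el) ((i , x) ∷ ps) O β acc e p with isCons (head O) | β | e | p
    ... | true | suc β | refl | s≤s p = trans (gather-elems el ps (tail O) β (i ∷ acc) refl p) (cong (λ v → revOnto v (i ∷ acc)) (map-map ss))
      where
      map-map : ∀ {κ} (ss : Vec (Fin _) κ) → map (λ d → proj₁ (lookup ps d)) ss ≡ map (λ d → proj₁ (lookup ((i , x) ∷ ps) d)) (map suc ss)
      map-map [] = refl
      map-map (s ∷ ss) = cong (_ ∷_) (map-map ss)

    isZero?-0G : ∀ {n} (x : Vec (Fin q) n) → isZero? x ≡ does (≡-dec Fin._≟_ x (Vec.replicate n (0 mod q)))
    isZero?-0G [] = refl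
    isZero?-0G (a ∷ x) = trans (split a x) (cong₂ _∧_ (digit-zero a) (isZero?-0G x))
      where
      isZeroD : ∀ {q} → Fin q → Bool
      isZeroD zero    = true
      isZeroD (suc _) = false
      split : ∀ {q n} (a : Fin q) (x : Vec (Fin q) n) → isZero? (a ∷ x) ≡ isZeroD a ∧ isZero? x
      split zero x = refl
      split (suc a) x = refl
      digit-zero : ∀ (a : Fin q) → isZeroD a ≡ does (a Fin.≟ (0 mod q))
      digit-zero a with a Fin.≟ (0 mod q)
      ... | yes refl = toℕ-zero (0 mod q) (trans (toℕ-mod 0) (trans (cong (ℕ._% q) refl) (0%q q)))
        where
        0%q : ∀ q .{{_ : NonZero q}} → 0 ℕ.% q ≡ 0
        0%q (suc q) = refl
        toℕ-zero : ∀ {q} (a : Fin q) → toℕ a ≡ 0 → isZeroD a ≡ true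
        toℕ-zero zero e = refl
      ... | no ne = nonzero a ne
        where
        0%q : ∀ q .{{_ : NonZero q}} → 0 ℕ.% q ≡ 0
        0%q (suc q) = refl
        nonzero : ∀ a → a ≢ 0 mod q → isZeroD a ≡ false
        nonzero a ne with isZeroD a in eq
        ... | false = refl
        ... | true  = ⊥-elim (ne (Fin.toℕ-injective (trans (zero-toℕ a eq) (sym (trans (toℕ-mod 0) (0%q q))))))
          where
          zero-toℕ : ∀ {q} (a : Fin q) → isZeroD a ≡ true → toℕ a ≡ 0
          zero-toℕ zero e = refl

    tally-sum : ∀ {n} (B : Vec Bool n) (X : Vec G n) c s → tally B X c s ≡ (∣ B ∣ + c , Σ[ B ] X ⊕ s)
    tally-sum [] [] c s = cong (c ,_) (sym (⊕-identityˡ s))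
    tally-sum (true ∷ B) (x ∷ X) c s = trans (tally-sum B X (suc c) (x ⊕ s)) (cong₂ _,_ (ℕ.+-suc ∣ B ∣ c)
      (trans (sym (⊕-assoc (Σ[ B ] X) x s)) (cong (_⊕ s) (⊕-comm (Σ[ B ] X) x))))
    tally-sum (false ∷ B) (x ∷ X) c s = tally-sum B X c s

    checks-isSolution : ∀ {n} (B : Vec Bool n) (X : Vec G n) → checks B X ≡ isSolution k X B
    checks-isSolution B X = trans (cong (λ p → does (proj₁ p ℕ.≟ k) ∧ isZero? (proj₂ p)) (tally-sum B X 0 0V))
      (cong₂ _∧_ (cong (λ c → does (c ℕ.≟ k)) (ℕ.+-identityʳ ∣ B ∣))
        (trans (cong isZero? (⊕-identityʳ (Σ[ B ] X))) (isZero?-0G (Σ[ B ] X))))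

    module _ {β e r : ℕ} where

      record Coins : Set where
        constructor coins
        field
          ts : Vec (Vec (Fin q) β) k
          as : Vec (Fin k) r
          ls : Vec (Vec (Fin q) e) r
          bs : Vec (Fin k) r

      module _ (ω : Coins) where

        open Coins ω

        accept : Fin k → Fin r → Maybe (Fin r)
        accept j l = if does (lookup as l Fin.≟ j) ∧ isZero? (lookup ls l) then just l else nothing

        source : Fin r → Maybe (Fin r)
        source d = maybe′ (accept (lookup bs d)) nothing (locate (value 0 (lookup ts (lookup bs d))) (r + toℕ d))

        accept-just : ∀ {j l l′} → accept j l ≡ just l′ → l ≡ l′ × lookup as l ≡ j × isZero? (lookup ls l) ≡ true
        accept-just {j} {l} e with lookup as l Fin.≟ j | isZero? (lookup ls l)
        accept-just refl | yes p | true = refl , p , refl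

        source-just : ∀ {d l} → source d ≡ just l →
          value 0 (lookup ts (lookup bs d)) + toℕ l ≡ r + toℕ d × lookup as l ≡ lookup bs d × isZero? (lookup ls l) ≡ true
        source-just {d} {l} e = go (locate (value 0 (lookup ts (lookup bs d))) (r + toℕ d)) refl e
          where
          go : ∀ x → locate (value 0 (lookup ts (lookup bs d))) (r + toℕ d) ≡ x → maybe′ (accept (lookup bs d)) nothing x ≡ just l →
            value 0 (lookup ts (lookup bs d)) + toℕ l ≡ r + toℕ d × lookup as l ≡ lookup bs d × isZero? (lookup ls l) ≡ true
          go (just l′) eq f with accept-just {lookup bs d} {l′} f
          ... | refl , p , z = locate-just (value 0 (lookup ts (lookup bs d))) (r + toℕ d) eq , p , z

        source-injective : ∀ {d d′ l} → source d ≡ just l → source d′ ≡ just l → d ≡ d′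
        source-injective {d} {d′} {l} e e′ with source-just {d} e | source-just {d′} e′
        ... | p , a , _ | p′ , a′ , _ = Fin.toℕ-injective (ℕ.+-cancelˡ-≡ r (toℕ d) (toℕ d′)
          (trans (sym p) (trans (cong (λ j → value 0 (lookup ts j) + toℕ l) (trans (sym a) a′)) p′)))

        source-at : ∀ d l → value 0 (lookup ts (lookup bs d)) + toℕ l ≡ r + toℕ d → lookup as l ≡ lookup bs d →
          isZero? (lookup ls l) ≡ true → source d ≡ just l
        source-at d l p a z = trans
          (cong (λ n → maybe′ (accept (lookup bs d)) nothing (locate (value 0 (lookup ts (lookup bs d))) n)) (sym p))
          (trans (cong (maybe′ (accept (lookup bs d)) nothing) (locate-+ (value 0 (lookup ts (lookup bs d))) l))
            (cong₂ (λ b z → if b ∧ z then just l else nothing) (dec-true (lookup as l Fin.≟ lookup bs d) a) z))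

        module _ (cs : Vec G k) (X : Vec G r) where

          moved : Fin r → Fin r → ℕ × G
          moved d l = suc (toℕ l) , lookup X l ⊕ lookup cs (lookup bs d)

          lookup-destinations : ∀ {κ n} (fs : Vec (Stream {m}) κ) i (bs : Vec (Fin κ) n) us d →
            lookup (destinations fs i bs us) d ≡ pickM (lookup fs (lookup bs d) (i + toℕ d)) (lookup us d)
          lookup-destinations fs i (b ∷ bs) (u ∷ us) zero = cong (λ i → pickM (lookup fs b i) u) (sym (ℕ.+-identityʳ i))
          lookup-destinations fs i (b ∷ bs) (u ∷ us) (suc d) = trans (lookup-destinations fs (suc i) bs us d)
            (cong (λ i → pickM (lookup fs (lookup bs d) i) (lookup us d)) (sym (ℕ.+-suc i (toℕ d))))

          lookup-mkSrcs : ∀ {κ n} i (as : Vec (Fin κ) n) (ls : Vec (Vec (Fin q) e) n) (X : Vec G n) l →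
            lookup (mkSrcs i as ls X) l ≡ ((if isZero? (lookup ls l) then suc (toℕ (lookup as l)) else 0) , suc (i + toℕ l) , lookup X l)
          lookup-mkSrcs i (a ∷ as) (l ∷ ls) (x ∷ X) zero = cong (λ j → (if isZero? l then suc (toℕ a) else 0) , suc j , x) (sym (ℕ.+-identityʳ i))
          lookup-mkSrcs i (a ∷ as) (l ∷ ls) (x ∷ X) (suc j) = trans (lookup-mkSrcs (suc i) as ls X j)
            (cong (λ j′ → (if isZero? (lookup ls j) then suc (toℕ (lookup as j)) else 0) , suc j′ , lookup X j) (sym (ℕ.+-suc i (toℕ j))))

          lookup-streams : ∀ {κ} (cs : Vec G κ) (ts : Vec (Vec (Fin q) β) κ) (srcs : Vec (Src {m}) r) j i →
            lookup (streams cs ts srcs) j i ≡ maybe′ (λ l → maskOf (lookup cs j) (iter decSrc (lookup srcs l) (toℕ j))) nothing (locate (value 0 (lookup ts j)) (r + i))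
          lookup-streams (c ∷ cs) (t ∷ ts) srcs zero i = trans (padAt-lookup (value 0 t) (map (maskOf c) srcs) (r + i))
            (maybe-cong (λ l → lookup-map l (maskOf c) srcs) (locate (value 0 t) (r + i)))
            where
            maybe-cong : ∀ {A B : Set} {f g : A → B} {b} → (∀ a → f a ≡ g a) → ∀ x → maybe′ f b x ≡ maybe′ g b x
            maybe-cong h nothing = refl
            maybe-cong h (just a) = h a
          lookup-streams (c ∷ cs) (t ∷ ts) srcs (suc j) i = trans (lookup-streams cs ts (map (decSrc {m}) srcs) j i)
            (maybe-cong (λ l → cong (λ s → maskOf (lookup cs j) (iter decSrc s (toℕ j))) (lookup-map l (decSrc {m}) srcs)) (locate (value 0 (lookup ts j)) (r + i)))
            where
            maybe-cong : ∀ {A B : Set} {f g : A → B} {b} → (∀ a → f a ≡ g a) → ∀ x → maybe′ f b x ≡ maybe′ g b x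
            maybe-cong h nothing = refl
            maybe-cong h (just a) = h a

          mask-iter : ∀ {κ} c (a j : Fin κ) b (i : ℕ) (x : G) →
            maskOf c (iter decSrc ((if b then suc (toℕ a) else 0) , i , x) (toℕ j)) ≡ (if does (a Fin.≟ j) ∧ b then just (i , x ⊕ c) else nothing)
          mask-iter c a j false i x = trans (dead (toℕ j)) (cong (λ z → if z then just (i , x ⊕ c) else nothing) (sym (Bool.∧-zeroʳ (does (a Fin.≟ j)))))
            where
            dead : ∀ j → maskOf c (iter decSrc (0 , i , x) j) ≡ nothing
            dead zero = refl
            dead (suc j) = dead j
          mask-iter c a j true i x = trans (live a j) (cong (λ z → if z then just (i , x ⊕ c) else nothing) (sym (Bool.∧-identityʳ (does (a Fin.≟ j)))))
            where
            dead : ∀ j → maskOf c (iter decSrc (0 , i , x) j) ≡ nothing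
            dead zero = refl
            dead (suc j) = dead j
            live : ∀ {κ} (a j : Fin κ) → maskOf c (iter decSrc (suc (toℕ a) , i , x) (toℕ j)) ≡ (if does (a Fin.≟ j) then just (i , x ⊕ c) else nothing)
            live zero zero = refl
            live (suc a) zero = refl
            live zero (suc j) = dead (toℕ j)
            live (suc a) (suc j) = live a j

          lookup-instance : ∀ us d → lookup (destinations (streams cs ts (mkSrcs 0 as ls X)) 0 bs us) d ≡ maybe′ (moved d) (0 , lookup us d) (source d)
          lookup-instance us d = trans (lookup-destinations (streams cs ts (mkSrcs 0 as ls X)) 0 bs us d)
            (trans (cong (λ p → pickM p (lookup us d)) (lookup-streams cs ts (mkSrcs 0 as ls X) (lookup bs d) (toℕ d)))
              (at (locate (value 0 (lookup ts (lookup bs d))) (r + toℕ d))))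
            where
            at : ∀ x → pickM (maybe′ (λ l → maskOf (lookup cs (lookup bs d)) (iter decSrc (lookup (mkSrcs 0 as ls X) l) (toℕ (lookup bs d)))) nothing x) (lookup us d) ≡
              maybe′ (moved d) (0 , lookup us d) (maybe′ (accept (lookup bs d)) nothing x)
            at nothing = refl
            at (just l) = trans (cong (λ p → pickM p (lookup us d)) (trans
              (cong (λ s → maskOf (lookup cs (lookup bs d)) (iter decSrc s (toℕ (lookup bs d)))) (lookup-mkSrcs 0 as ls X l))
              (mask-iter (lookup cs (lookup bs d)) (lookup as l) (lookup bs d) (isZero? (lookup ls l)) (suc (toℕ l)) (lookup X l))))
              (push (does (lookup as l Fin.≟ lookup bs d) ∧ isZero? (lookup ls l)))
              where
              push : ∀ b → pickM (if b then just (moved d l) else nothing) (lookup us d) ≡ maybe′ (moved d) (0 , lookup us d) (if b then just l else nothing)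
              push true = refl
              push false = refl

      -- coins that move the j-th element of S to the j-th element of S′
      record Moves (ω : Coins) (ss ds : Vec (Fin r) k) : Set where
        open Coins ω
        field
          shift  : ∀ j → value 0 (lookup ts j) + toℕ (lookup ss j) ≡ r + toℕ (lookup ds j)
          colour : ∀ j → lookup as (lookup ss j) ≡ j
          label  : ∀ j → isZero? (lookup ls (lookup ss j)) ≡ true
          target : ∀ j → lookup bs (lookup ds j) ≡ j

      outer : Coins → Subset r → Fin r → Maybe (Fin r)
      outer ω S d = maybe′ (λ l → if lookup S l then nothing else just l) nothing (source ω d)

      module _ {ω : Coins} {S S′ : Subset r} {ss ds : Vec (Fin r) k} (el : Elems S ss) (el′ : Elems S′ ds) (moves : Moves ω ss ds)
               (Z : Vec G r) (c : Vec G k′) (us : Vec G r) where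

        open Coins ω
        open Moves moves

        X : Vec G r
        X = plant S Z

        dst : Vec (ℕ × G) r
        dst = instanceOf X ts c as ls bs us

        shiftAt : Fin r → G → G
        shiftAt d x = x ⊕ lookup (shifts {m} {r} c) (lookup bs d)

        source-move : ∀ j → source ω (lookup ds j) ≡ just (lookup ss j)
        source-move j = source-at ω (lookup ds j) (lookup ss j)
          (trans (cong (λ j′ → value 0 (lookup ts j′) + toℕ (lookup ss j)) (target j)) (shift j))
          (trans (colour j) (sym (target j))) (label j)

        dst-move : ∀ j → lookup dst (lookup ds j) ≡ (suc (toℕ (lookup ss j)) , lookup X (lookup ss j) ⊕ lookup (shifts {m} {r} c) j)
        dst-move j = trans (lookup-instance ω (shifts {m} {r} c) X us (lookup ds j)) (trans (cong (maybe′ _ _) (source-move j))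
          (cong (λ j′ → suc (toℕ (lookup ss j)) , lookup X (lookup ss j) ⊕ lookup (shifts {m} {r} c) j′) (target j)))

        answer-correct : ∀ O → decode r O ≡ S′ → answer {m} {r} dst O ≡ S
        answer-correct O e = vec-ext λ l → bit l (lookup S l) refl
          where
          tags : Vec ℕ k
          tags = map (λ d → proj₁ (lookup dst d)) ds
          lookup-tags : ∀ j → lookup tags j ≡ suc (toℕ (lookup ss j))
          lookup-tags j = trans (lookup-map j _ ds) (cong proj₁ (dst-move j))
          gathered : proj₂ (proj₂ (gather {G} dst (O , k , []))) ≡ revOnto tags []
          gathered = gather-elems el′ dst O k [] e ℕ.≤-refl
          bit : ∀ l b → lookup S l ≡ b → lookup (answer {m} {r} dst O) l ≡ lookup S l
          bit l true eq with Elems-index el l eq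
          ... | j , f = trans (bitsOf-true r _ l (subst (λ ts → Has (suc (toℕ l)) (fromList ts)) (sym gathered)
            (Has-revOnto tags [] (inj₁ (j , trans (lookup-tags j) (cong (suc ∘ toℕ) f)))))) (sym eq)
          bit l false eq with lookup (answer {m} {r} dst O) l in eq′
          ... | false = sym eq
          ... | true with revOnto-Has tags [] (subst (λ ts → Has (suc (toℕ l)) (fromList ts)) gathered (bitsOf-has r _ l eq′))
          ... | inj₁ (j , f) = ⊥-elim (true≢false (trans (sym (Elems-∈ el j)) (trans (cong (lookup S) (Fin.toℕ-injective (ℕ.suc-injective (trans (sym (lookup-tags j)) f)))) eq)))
            where
            true≢false : true ≢ false
            true≢false ()

        sumV : ∀ {n} → Vec G n → G
        sumV []       = 0G
        sumV (x ∷ xs) = x ⊕ sumV xs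

        sumFrom-sumV : ∀ {n} z (xs : Vec G n) → sumFrom z xs ≡ sumV xs ⊕ z
        sumFrom-sumV z [] = sym (⊕-identityˡ z)
        sumFrom-sumV z (x ∷ xs) = trans (sumFrom-sumV (x ⊕ z) xs) (trans (sym (⊕-assoc (sumV xs) x z)) (cong (_⊕ z) (⊕-comm (sumV xs) x)))

        sumAt-sumV : ∀ {n} (ss : Vec (Fin r) n) Z → sumAt ss Z ≡ sumV (map (lookup Z) ss)
        sumAt-sumV [] Z = refl
        sumAt-sumV (s ∷ ss) Z = cong (lookup Z s ⊕_) (sumAt-sumV ss Z)

        sumV-zip : ∀ {n} (xs ys : Vec G n) → sumV (zipWith _⊕_ xs ys) ≡ sumV xs ⊕ sumV ys
        sumV-zip [] [] = sym (⊕-identityˡ 0G)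
        sumV-zip (x ∷ xs) (y ∷ ys) = trans (cong ((x ⊕ y) ⊕_) (sumV-zip xs ys)) (⊕-interchange x y (sumV xs) (sumV ys))

        plantedValues : Vec G k′
        plantedValues = zipWith _⊕_ (map (lookup Z) (Vec.tail ss)) c

        w : Vec G r
        w = pin (Vec.tail ds) plantedValues (select vector total-vector (outer ω S) shiftAt Z us)

        instance-correct : map proj₂ dst ≡ plant S′ w
        instance-correct = go ss ds refl refl
          where
          go : ∀ ss₁ ds₁ → ss ≡ ss₁ → ds ≡ ds₁ → map proj₂ dst ≡ plant S′ w
          go (s ∷ ss₁) (d₀ ∷ ds₁) refl refl = vec-ext λ d → trans (lookup-map d proj₂ dst) (trans (coordinate d (lookup S′ d) refl) (cong (λ v → lookup v d) (sym (plant-elems el′ w))))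
            where
            inj′ : ∀ i j → lookup ds₁ i ≡ lookup ds₁ j → i ≡ j
            inj′ i j e = Fin.suc-injective (Elems-injective el′ (suc i) (suc j) e)
            lookup-w : ∀ j → lookup w (lookup ds₁ j) ≡ lookup Z (lookup ss₁ j) ⊕ lookup c j
            lookup-w j = trans (pin-at ds₁ plantedValues _ inj′ j) (trans (lookup-zipWith _⊕_ j (map (lookup Z) ss₁) c) (cong (_⊕ lookup c j) (lookup-map j (lookup Z) ss₁)))
              where open import Data.Vec.Properties using (lookup-zipWith)
            X≡ : X ≡ Z [ s ]≔ ⊖ sumAt ss₁ Z
            X≡ = plant-elems el Z
            sum-w : sumAt ds₁ w ≡ sumAt ss₁ Z ⊕ sumV c
            sum-w = trans (sumAt-sumV ds₁ w) (trans (cong sumV (vec-ext {xs = map (lookup w) ds₁} {ys = plantedValues} λ j → trans (lookup-map j (lookup w) ds₁) (pin-at ds₁ plantedValues _ inj′ j)))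
              (trans (sumV-zip (map (lookup Z) ss₁) c) (cong (_⊕ sumV c) (sym (sumAt-sumV ss₁ Z)))))
            first : lookup X s ⊕ lookup (shifts {m} {r} c) zero ≡ ⊖ sumAt ds₁ w
            first = trans (cong₂ (λ x y → x ⊕ (⊖ y)) (trans (cong (λ X → lookup X s) X≡) (lookup∘update s Z (⊖ sumAt ss₁ Z))) (trans (sumFrom-sumV 0G c) (⊕-identityʳ (sumV c))))
              (trans (sym (⊖-⊕ (sumAt ss₁ Z) (sumV c))) (cong ⊖_ (sym sum-w)))
            coordinate : ∀ d b → lookup S′ d ≡ b → proj₂ (lookup dst d) ≡ lookup (w [ d₀ ]≔ ⊖ sumAt ds₁ w) d
            coordinate d true eq with Elems-index el′ d eq
            ... | zero , refl = trans (cong proj₂ (dst-move zero)) (trans first (sym (lookup∘update d₀ w (⊖ sumAt ds₁ w))))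
            ... | suc j , refl = trans (cong proj₂ (dst-move (suc j))) (trans
              (cong (_⊕ lookup c j) (trans (cong (λ X → lookup X (lookup ss₁ j)) X≡) (lookup∘update′ (head∉tail el j) Z (⊖ sumAt ss₁ Z))))
              (trans (sym (lookup-w j)) (sym (lookup∘update′ (head∉tail el′ j) w (⊖ sumAt ds₁ w)))))
            coordinate d false eq = trans (cong proj₂ (lookup-instance ω (shifts {m} {r} c) X us d)) (trans (outside-S (source ω d) refl)
              (trans (sym (lookup∘tabulate _ d)) (trans (sym (pin-other ds₁ plantedValues _ d (λ j → notin (suc j)))) (sym (lookup∘update′ (λ e → notin zero (sym e)) w (⊖ sumAt ds₁ w))))))
              where
              true≢false : true ≢ false
              true≢false ()
              notin : ∀ j → lookup (d₀ ∷ ds₁) j ≢ d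
              notin j refl = true≢false (trans (sym (Elems-∈ el′ j)) eq)
              outside-S : ∀ x → source ω d ≡ x → proj₂ (maybe′ (moved ω (shifts {m} {r} c) X d) (0 , lookup us d) x) ≡
                maybe′ (λ l → shiftAt d (lookup Z l)) (lookup us d) (maybe′ (λ l → if lookup S l then nothing else just l) nothing x)
              outside-S nothing e = refl
              outside-S (just l) e with lookup S l in eqS
              ... | false = cong (λ x → x ⊕ lookup (shifts {m} {r} c) (lookup bs d)) (trans (cong (λ X → lookup X l) X≡) (lookup∘update′ l≢s Z (⊖ sumAt ss₁ Z)))
                where
                l≢s : l ≢ s
                l≢s refl = true≢false (trans (sym (Elems-∈ el zero)) eqS)
              ... | true with Elems-index el l eqS
              ... | j , refl = ⊥-elim (notin j (source-injective ω {l = l} (source-move j) e))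

module Moments where

  open Expect
  open Product
  open Zq
  open Planted
  open import Data.Fin as Fin using (Fin; zero; suc)
  open import Data.Maybe as Maybe using (Maybe; just; nothing; maybe′)
  open import Data.Nat as ℕ using (ℕ; zero; suc; NonZero)
  open import Data.Rational as ℚ using (ℚ; 0ℚ; 1ℚ; _*_; _≤_)
  open import Data.Rational.Properties hiding (_≟_)
  open import Data.Vec as Vec using (Vec; []; _∷_; map; lookup; _[_]≔_; zipWith)
  open import Data.Vec.Properties using (≡-dec; lookup∘update′; tabulate-cong)
  open import Relation.Binary.PropositionalEquality
  open import Relation.Nullary using (yes; no; does)
  open import Function using (_∘_)

  E-* : ∀ {A B : Set} (f : A → ℚ) (μ : Rand A) (g : B → ℚ) (ν : Rand B) → E f μ * E g ν ≡ E (λ a → E (λ b → f a * g b) ν) μ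
  E-* f μ g ν = trans (sym (E-*ʳ (E g ν) f μ)) (E-cong μ λ a → sym (E-*ˡ (f a) g ν))

  E-uncorrelated : ∀ {q} .{{_ : NonZero q}} {e} {Z : Set} (μ : Rand Z) → Total μ → (y : Vec (Fin q) e → Z → ℚ) →
    (∀ v z → y v z * y v z ≤ 1ℚ) → (∀ v v′ → v ≢ v′ → E (λ z → y v z * y v′ z) μ ≡ 0ℚ) →
    E (λ z → E (λ v → y v z) (iid (choose q return) e) * E (λ v → y v z) (iid (choose q return) e)) μ ≤ recip q ^ℚ e
  E-uncorrelated {q} {e} μ total y y²≤1 uncor = begin
    E (λ z → E (λ v → y v z) D * E (λ v → y v z) D) μ
      ≡⟨ E-cong μ (λ z → E-* (λ v → y v z) D (λ v → y v z) D) ⟩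
    E (λ z → E (λ v → E (λ v′ → y v z * y v′ z) D) D) μ
      ≡⟨ E-swap (λ z v → E (λ v′ → y v z * y v′ z) D) μ D ⟩
    E (λ v → E (λ z → E (λ v′ → y v z * y v′ z) D) μ) D
      ≡⟨ E-cong D (λ v → E-swap (λ z v′ → y v z * y v′ z) μ D) ⟩
    E (λ v → E (λ v′ → E (λ z → y v z * y v′ z) μ) D) D
      ≤⟨ E-mono D (λ v → E-mono D (λ v′ → pair v v′)) ⟩
    E (λ v → E (λ v′ → indicator (does (≡-dec Fin._≟_ v′ v)) * 1ℚ) D) D
      ≡⟨ E-cong D (λ v → trans (ZqGroup.E-point q (λ _ → 1ℚ) v) (*-identityʳ (recip q ^ℚ e))) ⟩
    E (λ v → recip q ^ℚ e) D
      ≡⟨ E-const (recip q ^ℚ e) D (Total-iid e (ZqGroup.total-digit q)) ⟩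
    recip q ^ℚ e ∎
    where
    open ≤-Reasoning
    D = iid (choose q return) e
    pair : ∀ v v′ → E (λ z → y v z * y v′ z) μ ≤ indicator (does (≡-dec Fin._≟_ v′ v)) * 1ℚ
    pair v v′ with ≡-dec Fin._≟_ v′ v
    ... | yes refl = E-≤const μ total (λ z → y²≤1 v z)
    ... | no ne    = ≤-reflexive (uncor v v′ (ne ∘ sym))

  module Decoupling (q : ℕ) .{{_ : NonZero q}} (m : ℕ) where

    open PlantedInstances q m

    map-update : ∀ {r n} (ss : Vec (Fin r) n) (Z : Vec G r) l y → (∀ j → lookup ss j ≢ l) → map (lookup (Z [ l ]≔ y)) ss ≡ map (lookup Z) ss
    map-update [] Z l y h = refl
    map-update (s ∷ ss) Z l y h = cong₂ _∷_ (lookup∘update′ (h zero) Z y) (map-update ss Z l y (λ j → h (suc j)))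

    pickOut : ∀ {r n} → (Fin n → Maybe (Fin r)) → (Fin n → G → G) → Vec G r → Vec G n → Vec G n
    pickOut = select vector total-vector

    select-update : ∀ {r n} (src : Fin n → Maybe (Fin r)) g Z U l y → (∀ d → src d ≢ just l) →
      pickOut src g (Z [ l ]≔ y) U ≡ pickOut src g Z U
    select-update src g Z U l y h = tabulate-cong λ d → at d (src d) refl
      where
      at : ∀ d x → src d ≡ x → maybe′ (λ l′ → g d (lookup (Z [ l ]≔ y) l′)) (lookup U d) x ≡ maybe′ (λ l′ → g d (lookup Z l′)) (lookup U d) x
      at d nothing e = refl
      at d (just l′) e = cong (g d) (lookup∘update′ (λ { refl → h d e }) Z y)

    module _ {r k′ : ℕ} (rs rd : Vec (Fin r) k′) where

      refill : Vec G r → Vec G k′ → Vec G r → Vec G r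
      refill Z c w = pin rd (zipWith _⊕_ (map (lookup Z) rs) c) w

      average : (Fin r → Maybe (Fin r)) → (Vec G k′ → Fin r → G → G) → (Vec G r → ℚ) → Vec G r → ℚ
      average src g f Z = E (λ c → E (λ U → f (refill Z c (pickOut src (g c) Z U))) (samples r)) (samples k′)

      decouple : (src src′ : Fin r → Maybe (Fin r)) (g g′ : Vec G k′ → Fin r → G → G) (f : Vec G r → ℚ) →
        (∀ c d → Invariant vector (g c d)) → (∀ c d → Invariant vector (g′ c d)) →
        Injective? vector total-vector src → Injective? vector total-vector src′ →
        (∀ {d d′ l} → src d ≡ just l → src′ d′ ≢ just l) →
        (∀ {d l} → src d ≡ just l → ∀ j → lookup rs j ≢ l) → (∀ {d l} → src′ d ≡ just l → ∀ j → lookup rs j ≢ l) →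
        E (λ Z → average src g f Z * average src′ g′ f Z) (samples r) ≡ E f (samples r) * E f (samples r)
      decouple src src′ g g′ f inv inv′ inj inj′ disjoint avoid avoid′ = begin
        E (λ Z → average src g f Z * average src′ g′ f Z) Sr
          ≡⟨ E-cong Sr (λ Z → E-* _ Sk _ Sk) ⟩
        E (λ Z → E (λ c → E (λ c′ → E (λ U → f (A c Z U)) Sr * E (λ U′ → f (A′ c′ Z U′)) Sr) Sk) Sk) Sr
          ≡⟨ trans (E-swap _ Sr Sk) (E-cong Sk λ c → E-swap _ Sr Sk) ⟩
        E (λ c → E (λ c′ → E (λ Z → E (λ U → f (A c Z U)) Sr * E (λ U′ → f (A′ c′ Z U′)) Sr) Sr) Sk) Sk
          ≡⟨ E-cong Sk (λ c → E-cong Sk λ c′ → fixed c c′) ⟩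
        E (λ c → E (λ c′ → E (λ w → E (λ Z → E (λ w′ → f (refill Z c w) * f (refill Z c′ w′)) Sr) Sr) Sr) Sk) Sk
          ≡⟨ E-cong Sk (λ c → E-cong Sk λ c′ → trans (E-swap _ Sr Sr) (E-cong Sr λ Z → sym (E-* (λ w → f (refill Z c w)) Sr (λ w′ → f (refill Z c′ w′)) Sr))) ⟩
        E (λ c → E (λ c′ → E (λ Z → E (λ w → f (refill Z c w)) Sr * E (λ w′ → f (refill Z c′ w′)) Sr) Sr) Sk) Sk
          ≡⟨ sym (trans (E-swap _ Sr Sk) (E-cong Sk λ c → E-swap _ Sr Sk)) ⟩
        E (λ Z → E (λ c → E (λ c′ → E (λ w → f (refill Z c w)) Sr * E (λ w′ → f (refill Z c′ w′)) Sr) Sk) Sk) Sr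
          ≡⟨ E-cong Sr (λ Z → sym (E-* (λ c → E (λ w → f (refill Z c w)) Sr) Sk (λ c′ → E (λ w′ → f (refill Z c′ w′)) Sr) Sk)) ⟩
        E (λ Z → E (λ c → E (λ w → f (refill Z c w)) Sr) Sk * E (λ c′ → E (λ w′ → f (refill Z c′ w′)) Sr) Sk) Sr
          ≡⟨ E-cong Sr (λ Z → cong₂ _*_ (refilled Z) (refilled Z)) ⟩
        E (λ Z → E f Sr * E f Sr) Sr
          ≡⟨ E-const _ Sr (total-samples r) ⟩
        E f Sr * E f Sr ∎
        where
        open ≡-Reasoning
        Sr = samples r
        Sk = samples k′
        A A′ : Vec G k′ → Vec G r → Vec G r → Vec G r
        A c Z U = refill Z c (pickOut src (g c) Z U)
        A′ c Z U = refill Z c (pickOut src′ (g′ c) Z U)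
        refilled : ∀ Z → E (λ c → E (λ w → f (refill Z c w)) Sr) Sk ≡ E f Sr
        refilled Z = trans (E-zipWith vector total-vector _⊕_ ⊕-invariantˡ (map (lookup Z) rs) (λ c → E (λ w → f (pin rd c w)) Sr))
          (E-pin vector total-vector rd f)
        refill-update : ∀ Z l y c w → (∀ j → lookup rs j ≢ l) → refill (Z [ l ]≔ y) c w ≡ refill Z c w
        refill-update Z l y c w h = cong (λ v → pin rd (zipWith _⊕_ v c) w) (map-update rs Z l y h)
        fixed : ∀ c c′ → E (λ Z → E (λ U → f (A c Z U)) Sr * E (λ U′ → f (A′ c′ Z U′)) Sr) Sr ≡
          E (λ w → E (λ Z → E (λ w′ → f (refill Z c w) * f (refill Z c′ w′)) Sr) Sr) Sr
        fixed c c′ = begin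
          E (λ Z → E (λ U → f (A c Z U)) Sr * E (λ U′ → f (A′ c′ Z U′)) Sr) Sr
            ≡⟨ E-cong Sr (λ Z → sym (E-*ʳ _ (λ U → f (A c Z U)) Sr)) ⟩
          E (λ Z → E (λ U → Φ (pickOut src (g c) Z U) Z) Sr) Sr
            ≡⟨ E-select vector total-vector src (g c) inj (inv c) Φ Φ-update ⟩
          E (λ w → E (Φ w) Sr) Sr
            ≡⟨ E-cong Sr (λ w → trans (E-cong Sr λ Z → sym (E-*ˡ (f (refill Z c w)) (λ U′ → f (A′ c′ Z U′)) Sr))
                 (trans (E-select vector total-vector src′ (g′ c′) inj′ (inv′ c′) (Φ′ w) (Φ′-update w)) (E-swap _ Sr Sr))) ⟩
          E (λ w → E (λ Z → E (λ w′ → f (refill Z c w) * f (refill Z c′ w′)) Sr) Sr) Sr ∎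
          where
          Φ : Vec G r → Vec G r → ℚ
          Φ w Z = f (refill Z c w) * E (λ U′ → f (A′ c′ Z U′)) Sr
          Φ-update : ∀ w Z d l y → src d ≡ just l → Φ w (Z [ l ]≔ y) ≡ Φ w Z
          Φ-update w Z d l y e = cong₂ _*_ (cong f (refill-update Z l y c w (avoid e)))
            (E-cong Sr λ U′ → cong f (trans (refill-update Z l y c′ _ (avoid e)) (cong (refill Z c′) (select-update src′ (g′ c′) Z U′ l y (λ d′ e′ → disjoint e e′)))))
          Φ′ : Vec G r → Vec G r → Vec G r → ℚ
          Φ′ w w′ Z = f (refill Z c w) * f (refill Z c′ w′)
          Φ′-update : ∀ w w′ Z d l y → src′ d ≡ just l → Φ′ w w′ (Z [ l ]≔ y) ≡ Φ′ w w′ Z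
          Φ′-update w w′ Z d l y e = cong₂ _*_ (cong f (refill-update Z l y c w (avoid′ e))) (cong f (refill-update Z l y c′ w′ (avoid′ e)))

module Attempt where

  open Expect
  open Machine
  open VectorPrograms
  open Pipeline
  open SearchProgram
  open Product
  open Zq
  open Subsets
  open Planted
  open Recover
  open Moments
  open import Data.Bool using (Bool; true; false; if_then_else_; _∧_)
  open import Data.Fin as Fin using (Fin; zero; suc; toℕ)
  import Data.Fin.Properties as Fin
  open import Data.Fin.Subset using (Subset; outside; ∣_∣)
  open import Data.List as List using (List; []; _∷_; length)
  open import Data.Maybe as Maybe using (Maybe; just; nothing; maybe′)
  open import Data.Nat as ℕ using (ℕ; zero; suc; NonZero)
  import Data.Nat.Properties as ℕ
  open import Data.Nat.DivMod using (_mod_; _/_; _%_; m≡m%n+[m/n]*n; m%n<n; m<n*o⇒m/o<n; m<n⇒m%n≡m)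
  open import Data.Product using (_×_; _,_; proj₁; proj₂)
  open import Data.Rational as ℚ using (ℚ; 0ℚ; 1ℚ; _*_; _+_; _≤_; -_; _-_)
  open import Data.Rational.Properties hiding (_≟_)
  open import Data.Rational.Solver using (module +-*-Solver)
  open import Data.Unit using (tt)
  open import Data.Vec as Vec using (Vec; []; _∷_; map; lookup; zipWith; allFin; replicate)
  open import Data.Vec.Properties using (≡-dec; lookup-map; lookup-allFin; lookup-replicate)
  open import Data.Empty using (⊥-elim)
  open import Relation.Binary.PropositionalEquality
  open import Relation.Nullary using (yes; no; does)
  open import Relation.Nullary.Decidable using (dec-true; dec-false)
  open import Function using (_∘_)

  module _ (q : ℕ) .{{_ : NonZero q}} where

    open ZqGroup q using (digit; E-point)
    open Digits q using (value)

    digits : ∀ β → ℕ → Vec (Fin q) β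
    digits zero    v = []
    digits (suc β) v = let instance _ = ℕ.m^n≢0 q β in (v / q ℕ.^ β) mod q ∷ digits β (v % q ℕ.^ β)

    value-digits : ∀ β a v → v ℕ.< q ℕ.^ β → value a (digits β v) ≡ a ℕ.* q ℕ.^ β ℕ.+ v
    value-digits zero a zero v< = sym (trans (ℕ.+-identityʳ (a ℕ.* 1)) (ℕ.*-identityʳ a))
    value-digits zero a (suc v) (ℕ.s≤s ())
    value-digits (suc β) a v v< = begin
      value (a ℕ.* q ℕ.+ toℕ ((v / Q) mod q)) (digits β (v % Q))
        ≡⟨ value-digits β _ (v % Q) (m%n<n v Q) ⟩
      (a ℕ.* q ℕ.+ toℕ ((v / Q) mod q)) ℕ.* Q ℕ.+ v % Q
        ≡⟨ cong (λ d → (a ℕ.* q ℕ.+ d) ℕ.* Q ℕ.+ v % Q) (trans (Fin.toℕ-fromℕ< (m%n<n (v / Q) q)) (m<n⇒m%n≡m {q} {v / Q} (m<n*o⇒m/o<n {v} {q} {Q} v<))) ⟩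
      (a ℕ.* q ℕ.+ v / Q) ℕ.* Q ℕ.+ v % Q
        ≡⟨ arith a q (v / Q) Q (v % Q) ⟩
      a ℕ.* (q ℕ.* Q) ℕ.+ (v % Q ℕ.+ v / Q ℕ.* Q)
        ≡⟨ cong (a ℕ.* (q ℕ.* Q) ℕ.+_) (sym (m≡m%n+[m/n]*n v Q)) ⟩
      a ℕ.* (q ℕ.* Q) ℕ.+ v ∎
      where
      open ≡-Reasoning
      open import Data.Nat.Tactic.RingSolver using (solve-∀)
      Q = q ℕ.^ β
      instance _ = ℕ.m^n≢0 q β
      arith : ∀ a q d Q x → (a ℕ.* q ℕ.+ d) ℕ.* Q ℕ.+ x ≡ a ℕ.* (q ℕ.* Q) ℕ.+ (x ℕ.+ d ℕ.* Q)
      arith = solve-∀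

    module _ {β : ℕ} where

      _≟ᵛ_ = ≡-dec {A = Fin q} {n = β} Fin._≟_

      sum-injective≤1 : ∀ {n} (τ : Fin n → Vec (Fin q) β) → (∀ i j → τ i ≡ τ j → i ≡ j) → ∀ x → sum (λ i → indicator (does (x ≟ᵛ τ i))) ≤ 1ℚ
      sum-injective≤1 {zero} τ inj x = 0≤1
      sum-injective≤1 {suc n} τ inj x with x ≟ᵛ τ zero
      ... | yes refl = ≤-reflexive (trans (cong (1ℚ +_) (trans (sum-cong {n} λ i → cong indicator (dec-false (τ zero ≟ᵛ τ (suc i)) (ne i)))
          (trans (sum-const n 0ℚ) (*-zeroʳ (fromℕ n))))) (+-identityʳ 1ℚ))
        where
        ne : ∀ i → τ zero ≢ τ (suc i)
        ne i e with inj zero (suc i) e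
        ... | ()
      ... | no ne = ≤-trans (≤-reflexive (+-identityˡ (sum (λ i → indicator (does (x ≟ᵛ τ (suc i)))))))
        (sum-injective≤1 (τ ∘ suc) (λ i j e → Fin.suc-injective (inj (suc i) (suc j) e)) x)

      E-≥sum : ∀ {n} (τ : Fin n → Vec (Fin q) β) → (∀ i j → τ i ≡ τ j → i ≡ j) → (f : Vec (Fin q) β → ℚ) → (∀ x → 0ℚ ≤ f x) →
        recip q ^ℚ β * sum (λ i → f (τ i)) ≤ E f (iid digit β)
      E-≥sum {n} τ inj f f≥0 = begin
        recip q ^ℚ β * sum (λ i → f (τ i))                                         ≡⟨ sym (sum-* (recip q ^ℚ β) (λ i → f (τ i))) ⟩
        sum (λ i → recip q ^ℚ β * f (τ i))                                         ≡⟨ sum-cong {n} (λ i → sym (E-point f (τ i))) ⟩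
        sum (λ i → E (λ x → indicator (does (x ≟ᵛ τ i)) * f x) (iid digit β))      ≡⟨ sym (E-sum n (λ i x → indicator (does (x ≟ᵛ τ i)) * f x)) ⟩
        E (λ x → sum (λ i → indicator (does (x ≟ᵛ τ i)) * f x)) (iid digit β)      ≤⟨ E-mono (iid digit β) bound ⟩
        E f (iid digit β) ∎
        where
        open ≤-Reasoning
        E-sum : ∀ n (g : Fin n → Vec (Fin q) β → ℚ) → E (λ x → sum (λ i → g i x)) (iid digit β) ≡ sum (λ i → E (g i) (iid digit β))
        E-sum zero g = E-zero (iid digit β)
        E-sum (suc n) g = trans (E-+ (g zero) (λ x → sum (λ i → g (suc i) x)) (iid digit β)) (cong (E (g zero) (iid digit β) +_) (E-sum n (λ i → g (suc i))))
        bound : ∀ x → sum (λ i → indicator (does (x ≟ᵛ τ i)) * f x) ≤ f x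
        bound x = begin
          sum (λ i → indicator (does (x ≟ᵛ τ i)) * f x)   ≡⟨ sum-cong {n} (λ i → *-comm (indicator (does (x ≟ᵛ τ i))) (f x)) ⟩
          sum (λ i → f x * indicator (does (x ≟ᵛ τ i)))   ≡⟨ sum-* (f x) (λ i → indicator (does (x ≟ᵛ τ i))) ⟩
          f x * sum (λ i → indicator (does (x ≟ᵛ τ i)))   ≤⟨ *-monoˡ (f≥0 x) (sum-injective≤1 τ inj x) ⟩
          f x * 1ℚ                                        ≡⟨ *-identityʳ (f x) ⟩
          f x ∎

      E-≥sumT : ∀ {r n} (τs : Vec (Fin r → Vec (Fin q) β) n) → (∀ j d d′ → lookup τs j d ≡ lookup τs j d′ → d ≡ d′) →
        (f : Vec (Vec (Fin q) β) n → ℚ) → (∀ x → 0ℚ ≤ f x) →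
        (recip q ^ℚ β) ^ℚ n * sumT r n (λ ds → f (zipWith (λ τ d → τ d) τs ds)) ≤ E f (iid (iid digit β) n)
      E-≥sumT [] inj f f≥0 = ≤-reflexive (*-identityˡ (f []))
      E-≥sumT {r} {suc n} (τ ∷ τs) inj f f≥0 = begin
        ρ * ρ ^ℚ n * sum (λ d → sumT r n (λ ds → f (τ d ∷ zipWith (λ τ d → τ d) τs ds)))
          ≡⟨ *-assoc ρ (ρ ^ℚ n) _ ⟩
        ρ * (ρ ^ℚ n * sum (λ d → sumT r n (λ ds → f (τ d ∷ zipWith (λ τ d → τ d) τs ds))))
          ≡⟨ cong (ρ *_) (sym (sum-* (ρ ^ℚ n) (λ d → sumT r n (λ ds → f (τ d ∷ zipWith (λ τ d → τ d) τs ds))))) ⟩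
        ρ * sum (λ d → ρ ^ℚ n * sumT r n (λ ds → f (τ d ∷ zipWith (λ τ d → τ d) τs ds)))
          ≤⟨ *-monoˡ ρ≥0 (sum-mono {r} λ d → E-≥sumT τs (λ j → inj (suc j)) (λ ts → f (τ d ∷ ts)) (λ ts → f≥0 (τ d ∷ ts))) ⟩
        ρ * sum (λ d → E (λ ts → f (τ d ∷ ts)) (iid (iid digit β) n))
          ≤⟨ E-≥sum τ (inj zero) (λ t → E (λ ts → f (t ∷ ts)) (iid (iid digit β) n)) (λ t → E-nonNeg (iid (iid digit β) n) (λ ts → f≥0 (t ∷ ts))) ⟩
        E (λ t → E (λ ts → f (t ∷ ts)) (iid (iid digit β) n)) (iid digit β)
          ≡⟨ sym (E-iid (iid digit β) n f) ⟩
        E f (iid (iid digit β) (suc n)) ∎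
        where
        open ≤-Reasoning
        ρ = recip q ^ℚ β
        ρ≥0 = ^ℚ≥0 β (recip≥0 q)

  ΣS-sq : ∀ r k {{_ : NonZero (length (kSubsets r k))}} (f : Subset r → ℚ) →
    (recip (length (kSubsets r k)) * ΣS r k f) * (recip (length (kSubsets r k)) * ΣS r k f) ≤ recip (length (kSubsets r k)) * ΣS r k (λ S → f S * f S)
  ΣS-sq r k {{nz}} f = E-sq f (uniform (kSubsets r k)) (nz , λ i → tt)

  module Attempts (q : ℕ) .{{_ : NonZero q}} (k′ D₁ D₂ r₀ m β e r : ℕ)
    (respond : Vec (Vec (Fin q) m) r → Rand Tree) (total-respond : ∀ W → Total (respond W)) where

    open Program q k′ D₁ D₂ r₀ using (k; shifts; instanceOf; answer)
    open Pipe q k using (checks; value)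
    open PlantedInstances q m
    open Recovery q k′ D₁ D₂ r₀ m
    open Decoupling q m

    guess : Vec G r → Rand (Subset r)
    guess W = respond W >>= λ O → return (decode r O)

    total-guess : ∀ W → Total (guess W)
    total-guess W = Total->>= (respond W) (total-respond W) (λ _ → tt)

    open Mean r k′ guess total-guess hiding (k)

    module Label = ZqGroup.Vectors q e

    colours : Rand (Fin k)
    colours = choose k return

    total-colours : Total colours
    total-colours = _ , λ _ → tt

    labels : Rand Label.G
    labels = Label.vector

    hit : Vec G r → Vec (Vec (Fin q) β) k → Vec G k′ → Vec (Fin k) r → Vec Label.G r → Vec (Fin k) r → Vec G r → ℚ
    hit X ts cs as ls bs us = E (λ O → indicator (checks (answer (instanceOf X ts cs as ls bs us) O) X)) (respond (map proj₂ (instanceOf X ts cs as ls bs us)))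

    hit≥0 : ∀ X ts cs as ls bs us → 0ℚ ≤ hit X ts cs as ls bs us
    hit≥0 X ts cs as ls bs us = E-nonNeg (respond (map proj₂ (instanceOf X ts cs as ls bs us))) (λ O → indicator≥0 _)

    Vs = iid (iid digit β) k
    Ks = samples k′
    Cs = iid colours r
    Ls = iid labels r
    Us = samples r

    attemptSuccess : Vec G r → ℚ
    attemptSuccess X = E (λ ts → E (λ cs → E (λ as → E (λ ls → E (λ bs → E (λ us → hit X ts cs as ls bs us) Us) Cs) Ls) Cs) Ks) Vs

    find-guess : ∀ S W → find S W ≡ E (λ O → indicator (does (S ≟ˢ decode r O))) (respond W)
    find-guess S W = E->>= _ (respond W) _

    find≥0 : ∀ S W → 0ℚ ≤ find S W
    find≥0 S W = E-nonNeg (guess W) (λ S′ → indicator≥0 _)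

    find≤1 : ∀ S W → find S W ≤ 1ℚ
    find≤1 S W = E-≤const (guess W) (total-guess W) (λ S′ → indicator≤1 (does (S ≟ˢ S′)))

    planted-isSolution : ∀ {S} {ss : Vec (Fin r) k} → Elems S ss → ∀ Z → isSolution k (plant S Z) S ≡ true
    planted-isSolution {S} {s ∷ ss} el Z = cong₂ _∧_ (dec-true (∣ S ∣ ℕ.≟ k) (Elems-size el)) (dec-true (≡-dec Fin._≟_ (Σ[ S ] (plant S Z)) 0G) zero-sum)
      where
      zero-sum : Σ[ S ] (plant S Z) ≡ 0G
      zero-sum = trans (cong Σ[ S ] (plant-elems el Z)) (trans (Σ-elems el _) (trans
        (cong₂ _⊕_ (Data.Vec.Properties.lookup∘update s Z (⊖ sumAt ss Z)) (sumAt-update ss s Z (⊖ sumAt ss Z) (head∉tail el))) (⊖-inverseˡ (sumAt ss Z))))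
        where import Data.Vec.Properties

    hit-bound : ∀ {ω : Coins {β} {e} {r}} {S S′} {ss ds : Vec (Fin r) k} (el : Elems S ss) (el′ : Elems S′ ds) (moves : Moves ω ss ds) Z c us →
      find S′ (plant S′ (w el el′ moves Z c us)) ≤ hit (plant S Z) (Coins.ts ω) c (Coins.as ω) (Coins.ls ω) (Coins.bs ω) us
    hit-bound {ω} {S} {S′} el el′ moves Z c us = begin
      find S′ (plant S′ (w el el′ moves Z c us))
        ≡⟨ cong (find S′) (sym (instance-correct el el′ moves Z c us)) ⟩
      find S′ (map proj₂ (dst el el′ moves Z c us))
        ≡⟨ find-guess S′ (map proj₂ (dst el el′ moves Z c us)) ⟩
      E (λ O → indicator (does (S′ ≟ˢ decode r O))) (respond (map proj₂ (dst el el′ moves Z c us)))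
        ≤⟨ E-mono (respond (map proj₂ (dst el el′ moves Z c us))) pointwise ⟩
      hit (plant S Z) (Coins.ts ω) c (Coins.as ω) (Coins.ls ω) (Coins.bs ω) us ∎
      where
      open ≤-Reasoning
      pointwise : ∀ O → indicator (does (S′ ≟ˢ decode r O)) ≤ indicator (checks (answer {m} {r} (dst el el′ moves Z c us) O) (plant S Z))
      pointwise O with S′ ≟ˢ decode r O
      ... | no _  = indicator≥0 (checks (answer {m} {r} (dst el el′ moves Z c us) O) (plant S Z))
      ... | yes eq = ≤-reflexive (sym (cong indicator (trans (cong (λ B → checks B (plant S Z)) (answer-correct el el′ moves Z c us O (sym eq)))
          (trans (checks-isSolution S (plant S Z)) (planted-isSolution el Z)))))

    Structure : Set
    Structure = Vec (Fin k) r × Vec Label.G r × Vec (Fin k) r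

    structures : Rand Structure
    structures = Cs >>= λ as → Ls >>= λ ls → Cs >>= λ bs → return (as , ls , bs)

    total-structures : Total structures
    total-structures = Total->>= Cs (Total-iid r total-colours) λ as → Total->>= Ls (Total-iid r Label.total-vector) λ ls →
      Total->>= Cs (Total-iid r total-colours) λ bs → tt

    E-structures : ∀ (F : Structure → ℚ) → E F structures ≡ E (λ as → E (λ ls → E (λ bs → F (as , ls , bs)) Cs) Ls) Cs
    E-structures F = trans (E->>= F Cs _) (E-cong Cs λ as → trans (E->>= F Ls _) (E-cong Ls λ ls → E->>= F Cs _))

    shiftTo : Fin r → Fin r → Vec (Fin q) β
    shiftTo s d = digits q β (r ℕ.+ toℕ d ℕ.∸ toℕ s)

    shiftDigits : Vec (Fin r) k → Vec (Fin r) k → Vec (Vec (Fin q) β) k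
    shiftDigits ss ds = zipWith (λ τ d → τ d) (map shiftTo ss) ds

    lookup-shiftDigits : ∀ ss ds j → lookup (shiftDigits ss ds) j ≡ shiftTo (lookup ss j) (lookup ds j)
    lookup-shiftDigits ss ds j = trans (lookup-zipWith (λ τ d → τ d) j (map shiftTo ss) ds) (cong (λ τ → τ (lookup ds j)) (lookup-map j shiftTo ss))
      where open import Data.Vec.Properties using (lookup-zipWith)

    pinned : Vec (Fin r) k → Vec (Fin r) k → Label.G → Structure → Coins {β} {e} {r}
    pinned ss ds v (as , ls , bs) =
      coins (shiftDigits ss ds) (pin ss (allFin k) as) (pin ss (replicate k Label.0G) (map (Label._⊕ v) ls)) (pin ds (allFin k) bs)

    module _ (2r≤ : r ℕ.+ r ℕ.≤ q ℕ.^ β) where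

      value-shift : ∀ (s d : Fin r) → value 0 (shiftTo s d) ℕ.+ toℕ s ≡ r ℕ.+ toℕ d
      value-shift s d = trans (cong (ℕ._+ toℕ s) (value-digits q β 0 (r ℕ.+ toℕ d ℕ.∸ toℕ s)
        (ℕ.<-≤-trans (ℕ.≤-<-trans (ℕ.m∸n≤m (r ℕ.+ toℕ d) (toℕ s)) (ℕ.+-monoʳ-< r (Fin.toℕ<n d))) 2r≤)))
        (ℕ.m∸n+n≡m (ℕ.≤-trans (ℕ.<⇒≤ (Fin.toℕ<n s)) (ℕ.m≤m+n r (toℕ d))))

      moves-pinned : ∀ {S S′} {ss ds : Vec (Fin r) k} → Elems S ss → Elems S′ ds → ∀ v θ → Moves (pinned ss ds v θ) ss ds
      moves-pinned {ss = ss} {ds} el el′ v (as , ls , bs) = record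
        { shift  = λ j → trans (cong (λ t → value 0 t ℕ.+ toℕ (lookup ss j)) (lookup-shiftDigits ss ds j)) (value-shift (lookup ss j) (lookup ds j))
        ; colour = λ j → trans (pin-at ss (allFin k) as (Elems-injective el) j) (lookup-allFin j)
        ; label  = λ j → trans (cong isZero? (trans (pin-at ss (replicate k Label.0G) _ (Elems-injective el) j) (lookup-replicate j Label.0G)))
                     (trans (isZero?-0G Label.0G) (dec-true (≡-dec Fin._≟_ Label.0G Label.0G) refl))
        ; target = λ j → trans (pin-at ds (allFin k) bs (Elems-injective el′) j) (lookup-allFin j)
        }

      κ λᵉ ρ c₁ : ℚ
      κ  = recip k
      λᵉ = recip q ^ℚ e
      ρ  = recip q ^ℚ β
      c₁ = κ ^ℚ k * (λᵉ ^ℚ k * κ ^ℚ k)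

      κ≥0 : 0ℚ ≤ κ
      κ≥0 = recip≥0 k

      λ≥0 : 0ℚ ≤ λᵉ
      λ≥0 = ^ℚ≥0 e (recip≥0 q)

      c₁≥0 : 0ℚ ≤ c₁
      c₁≥0 = *-nonNeg (^ℚ≥0 k κ≥0) (*-nonNeg (^ℚ≥0 k λ≥0) (^ℚ≥0 k κ≥0))

      module _ {S S′ : Subset r} {ss ds : Vec (Fin r) k} (el : Elems S ss) (el′ : Elems S′ ds) where

        target′ : Vec G r → ℚ
        target′ W = find S′ (plant S′ W)

        shiftBy : Structure → Vec G k′ → Fin r → G → G
        shiftBy (as , ls , bs) c d x = x ⊕ lookup (shifts {m} {r} c) (lookup (pin ds (allFin k) bs) d)

        averaged : (Vec G r → ℚ) → Structure → Label.G → Vec G r → ℚ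
        averaged f θ v = average (Vec.tail ss) (Vec.tail ds) (outer (pinned ss ds v θ) S) (shiftBy θ) f

        Ψ : (Vec G r → ℚ) → Vec G r → ℚ
        Ψ f Z = E (λ θ → E (λ v → averaged f θ v Z) labels) structures

        structured : Vec G r → (Coins {β} {e} {r}) → ℚ
        structured Z ω = E (λ cs → E (λ us → hit (plant S Z) (Coins.ts ω) cs (Coins.as ω) (Coins.ls ω) (Coins.bs ω) us) Us) Ks

        structured≥0 : ∀ Z ω → 0ℚ ≤ structured Z ω
        structured≥0 Z ω = E-nonNeg Ks λ cs → E-nonNeg Us λ us → hit≥0 (plant S Z) (Coins.ts ω) cs (Coins.as ω) (Coins.ls ω) (Coins.bs ω) us

        pin-bound : ∀ (H : Vec (Fin k) r → Vec Label.G r → Vec (Fin k) r → ℚ) → (∀ as ls bs → 0ℚ ≤ H as ls bs) →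
          c₁ * E (λ as → E (λ ls → E (λ bs → H (pin ss (allFin k) as) (pin ss (replicate k Label.0G) ls) (pin ds (allFin k) bs)) Cs) Ls) Cs ≤
          E (λ as → E (λ ls → E (λ bs → H as ls bs) Cs) Ls) Cs
        pin-bound H H≥0 = begin
          c₁ * E (λ as → E (λ ls → E (λ bs → H (pas as) (pls ls) (pbs bs)) Cs) Ls) Cs
            ≡⟨ *-assoc (κ ^ℚ k) (λᵉ ^ℚ k * κ ^ℚ k) _ ⟩
          κ ^ℚ k * (λᵉ ^ℚ k * κ ^ℚ k * E (λ as → E (λ ls → E (λ bs → H (pas as) (pls ls) (pbs bs)) Cs) Ls) Cs)
            ≡⟨ cong (κ ^ℚ k *_) (trans (*-assoc (λᵉ ^ℚ k) (κ ^ℚ k) _) (trans (cong (λᵉ ^ℚ k *_) (sym (trans (E-cong Cs (λ as → E-*ˡ (κ ^ℚ k) _ Ls)) (E-*ˡ (κ ^ℚ k) _ Cs)))) (sym (E-*ˡ (λᵉ ^ℚ k) _ Cs)))) ⟩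
          κ ^ℚ k * E (λ as → λᵉ ^ℚ k * E (λ ls → κ ^ℚ k * E (λ bs → H (pas as) (pls ls) (pbs bs)) Cs) Ls) Cs
            ≤⟨ *-monoˡ (^ℚ≥0 k κ≥0) (E-mono Cs λ as → *-monoˡ (^ℚ≥0 k λ≥0) (E-mono Ls λ ls →
                 E-atom colours total-colours ds (allFin k) κ≥0 (λ j → choose-atom k _) (H (pas as) (pls ls)) (H≥0 (pas as) (pls ls)))) ⟩
          κ ^ℚ k * E (λ as → λᵉ ^ℚ k * E (λ ls → E (λ bs → H (pas as) (pls ls) bs) Cs) Ls) Cs
            ≤⟨ *-monoˡ (^ℚ≥0 k κ≥0) (E-mono Cs λ as →
                 E-atom labels Label.total-vector ss (replicate k Label.0G) λ≥0 (λ j → iid-atom digit (recip≥0 q) (choose-atom q) _)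
                   (λ ls → E (λ bs → H (pas as) ls bs) Cs) (λ ls → E-nonNeg Cs (H≥0 (pas as) ls))) ⟩
          κ ^ℚ k * E (λ as → E (λ ls → E (λ bs → H (pas as) ls bs) Cs) Ls) Cs
            ≤⟨ E-atom colours total-colours ss (allFin k) κ≥0 (λ j → choose-atom k _)
                 (λ as → E (λ ls → E (λ bs → H as ls bs) Cs) Ls) (λ as → E-nonNeg Ls λ ls → E-nonNeg Cs (H≥0 as ls)) ⟩
          E (λ as → E (λ ls → E (λ bs → H as ls bs) Cs) Ls) Cs ∎
          where
          open ≤-Reasoning
          pas = pin {r = r} ss (allFin k)
          pls = pin {r = r} ss (replicate k Label.0G)
          pbs = pin {r = r} ds (allFin k)

        Ψ-bound : ∀ Z → c₁ * Ψ target′ Z ≤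
          E (λ cs → E (λ as → E (λ ls → E (λ bs → E (λ us → hit (plant S Z) (shiftDigits ss ds) cs as ls bs us) Us) Cs) Ls) Cs) Ks
        Ψ-bound Z = begin
          c₁ * Ψ target′ Z
            ≤⟨ *-monoˡ c₁≥0 (E-mono structures λ θ → E-mono labels λ v → E-mono Ks λ c → E-mono Us λ us →
                 hit-bound el el′ (moves-pinned el el′ v θ) Z c us) ⟩
          c₁ * E (λ θ → E (λ v → structured Z (pinned ss ds v θ)) labels) structures
            ≡⟨ cong (c₁ *_) (trans (E-structures _) (E-cong Cs λ as → trans (E-cong Ls λ ls → E-swap _ Cs labels)
                 (trans (E-swap _ Ls labels) (trans (E-cong labels λ v → E-map labels Label.total-vector (Label._⊕ v) (Label.⊕-invariantʳ v)
                   (λ ls → E (λ bs → H (pin ss (allFin k) as) (pin ss (replicate k Label.0G) ls) (pin ds (allFin k) bs)) Cs)) (E-const _ labels Label.total-vector))))) ⟩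
          c₁ * E (λ as → E (λ ls → E (λ bs → H (pin ss (allFin k) as) (pin ss (replicate k Label.0G) ls) (pin ds (allFin k) bs)) Cs) Ls) Cs
            ≤⟨ pin-bound H (λ as ls bs → structured≥0 Z (coins (shiftDigits ss ds) as ls bs)) ⟩
          E (λ as → E (λ ls → E (λ bs → H as ls bs) Cs) Ls) Cs
            ≡⟨ trans (E-cong Cs λ as → trans (E-cong Ls λ ls → E-swap _ Cs Ks) (E-swap _ Ls Ks)) (E-swap _ Cs Ks) ⟩
          E (λ cs → E (λ as → E (λ ls → E (λ bs → E (λ us → hit (plant S Z) (shiftDigits ss ds) cs as ls bs us) Us) Cs) Ls) Cs) Ks ∎
          where
          open ≤-Reasoning
          H : Vec (Fin k) r → Vec Label.G r → Vec (Fin k) r → ℚ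
          H as ls bs = structured Z (coins (shiftDigits ss ds) as ls bs)

        mean : ℚ
        mean = E target′ Us

        centred : Vec G r → ℚ
        centred W = target′ W - mean

        E-minus : ∀ {A : Set} (f : A → ℚ) c (μ : Rand A) → Total μ → E (λ a → f a - c) μ ≡ E f μ - c
        E-minus f c μ t = trans (E-+ f (λ _ → - c) μ) (cong (E f μ +_) (E-const (- c) μ t))

        Ψ-centred : ∀ Z → Ψ centred Z ≡ Ψ target′ Z - mean
        Ψ-centred Z = trans (E-cong structures λ θ → trans (E-cong labels λ v → trans (E-cong Ks λ c → E-minus (λ us → target′ (W θ v c us)) mean Us (total-samples r))
            (E-minus (λ c → E (λ us → target′ (W θ v c us)) Us) mean Ks (total-samples k′)))
            (E-minus (λ v → averaged target′ θ v Z) mean labels Label.total-vector))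
            (E-minus (λ θ → E (λ v → averaged target′ θ v Z) labels) mean structures total-structures)
          where
          W : Structure → Label.G → Vec G k′ → Vec G r → Vec G r
          W θ v c us = refill (Vec.tail ss) (Vec.tail ds) Z c (pickOut (outer (pinned ss ds v θ) S) (shiftBy θ c) Z us)

        centred²≤1 : ∀ W → centred W * centred W ≤ 1ℚ
        centred²≤1 W = 0≤diff (subst (0ℚ ≤_) eq (+-nonNeg (+-nonNeg (*-nonNeg a≥0 1-a≥0) (*-nonNeg b≥0 1-b≥0)) (+-nonNeg (*-nonNeg a≥0 b≥0) (*-nonNeg 1-a≥0 1-b≥0))))
          where
          open +-*-Solver
          a = target′ W
          b = mean
          a≥0 = find≥0 S′ (plant S′ W)
          1-a≥0 = diff≥0 (find≤1 S′ (plant S′ W))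
          b≥0 = E-nonNeg Us (λ W → find≥0 S′ (plant S′ W))
          1-b≥0 = diff≥0 (E-≤const Us (total-samples r) (λ W → find≤1 S′ (plant S′ W)))
          eq : a * (1ℚ - a) + b * (1ℚ - b) + (a * b + (1ℚ - a) * (1ℚ - b)) ≡ 1ℚ - (a - b) * (a - b)
          eq = solve 2 (λ a b → a :* (con 1ℚ :- a) :+ b :* (con 1ℚ :- b) :+ (a :* b :+ (con 1ℚ :- a) :* (con 1ℚ :- b)) :=
            con 1ℚ :- (a :- b) :* (a :- b)) refl a b

        outer-just : ∀ (ω : Coins {β} {e} {r}) {d l} → outer ω S d ≡ just l → source ω d ≡ just l × lookup S l ≡ outside
        outer-just ω {d} {l} e = go (source ω d) refl e
          where
          go : ∀ x → source ω d ≡ x → maybe′ (λ l → if lookup S l then nothing else just l) nothing x ≡ just l → source ω d ≡ just l × lookup S l ≡ outside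
          go (just l′) eq f with lookup S l′ in eq′
          go (just l′) eq refl | false = eq , eq′

        outside-elems : ∀ {l} → lookup S l ≡ outside → ∀ j → lookup ss j ≢ l
        outside-elems e j refl with trans (sym (Elems-∈ el j)) e
        ... | ()

        isZero-label : ∀ θ v {l} → lookup S l ≡ outside → isZero? (lookup (Coins.ls (pinned ss ds v θ)) l) ≡ true → lookup (proj₁ (proj₂ θ)) l Label.⊕ v ≡ Label.0G
        isZero-label (as , ls , bs) v {l} l∉ z with ≡-dec Fin._≟_ (lookup ls l Label.⊕ v) Label.0G
        ... | yes e = e
        ... | no ne = ⊥-elim (true≢false (trans (sym z) (trans (cong isZero? (trans (pin-other ss (replicate k Label.0G) _ l (outside-elems l∉)) (lookup-map l _ ls)))
            (trans (isZero?-0G (lookup ls l Label.⊕ v)) (dec-false (≡-dec Fin._≟_ (lookup ls l Label.⊕ v) Label.0G) ne)))))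
          where
          true≢false : true ≢ false
          true≢false ()

        variance : E (λ Z → (Ψ target′ Z - mean) * (Ψ target′ Z - mean)) Us ≤ λᵉ
        variance = begin
          E (λ Z → (Ψ target′ Z - mean) * (Ψ target′ Z - mean)) Us
            ≡⟨ E-cong Us (λ Z → cong₂ _*_ (sym (Ψ-centred Z)) (sym (Ψ-centred Z))) ⟩
          E (λ Z → Ψ centred Z * Ψ centred Z) Us
            ≤⟨ E-mono Us (λ Z → E-sq (λ θ → E (λ v → averaged centred θ v Z) labels) structures total-structures) ⟩
          E (λ Z → E (λ θ → E (λ v → averaged centred θ v Z) labels * E (λ v → averaged centred θ v Z) labels) structures) Us
            ≡⟨ E-swap _ Us structures ⟩
          E (λ θ → E (λ Z → E (λ v → averaged centred θ v Z) labels * E (λ v → averaged centred θ v Z) labels) Us) structures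
            ≤⟨ E-≤const structures total-structures (λ θ → E-uncorrelated Us (total-samples r) (averaged centred θ) (small θ) (uncorrelated θ)) ⟩
          λᵉ ∎
          where
          open ≤-Reasoning
          small : ∀ θ v Z → averaged centred θ v Z * averaged centred θ v Z ≤ 1ℚ
          small θ v Z = ≤-trans (E-sq (λ c → E (λ us → centred (W c us)) Us) Ks (total-samples k′))
            (E-≤const Ks (total-samples k′) (λ c → ≤-trans (E-sq (λ us → centred (W c us)) Us (total-samples r)) (E-≤const Us (total-samples r) (λ us → centred²≤1 (W c us)))))
            where
            W : Vec G k′ → Vec G r → Vec G r
            W c us = refill (Vec.tail ss) (Vec.tail ds) Z c (pickOut (outer (pinned ss ds v θ) S) (shiftBy θ c) Z us)
          tail-elem : ∀ {l} → lookup S l ≡ outside → ∀ j → lookup (Vec.tail ss) j ≢ l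
          tail-elem e j f = outside-elems e (suc j) (trans (lookup-tail ss j) f)
            where
            lookup-tail : ∀ {A : Set} {n} (xs : Vec A (suc n)) j → lookup xs (suc j) ≡ lookup (Vec.tail xs) j
            lookup-tail (x ∷ xs) j = refl
          injective : ∀ θ v → Injective? vector total-vector (outer (pinned ss ds v θ) S)
          injective θ v {d} {d′} {l} e e′ = source-injective (pinned ss ds v θ) {d} {d′} {l}
            (proj₁ (outer-just (pinned ss ds v θ) {d} {l} e)) (proj₁ (outer-just (pinned ss ds v θ) {d′} {l} e′))
          uncorrelated : ∀ θ v v′ → v ≢ v′ → E (λ Z → averaged centred θ v Z * averaged centred θ v′ Z) Us ≡ 0ℚ
          uncorrelated θ@(as , ls , bs) v v′ v≢v′ = trans (decouple (Vec.tail ss) (Vec.tail ds)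
              (outer (pinned ss ds v θ) S) (outer (pinned ss ds v′ θ) S) (shiftBy θ) (shiftBy θ) centred
              (λ c d → ⊕-invariantʳ _) (λ c d → ⊕-invariantʳ _) (injective θ v) (injective θ v′)
              (λ {d} {d′} {l} → separate {d} {d′} {l}) (λ {d} {l} e → tail-elem (proj₂ (outer-just (pinned ss ds v θ) {d} {l} e))) (λ {d} {l} e → tail-elem (proj₂ (outer-just (pinned ss ds v′ θ) {d} {l} e))))
            (trans (cong (λ x → x * x) (trans (E-minus target′ mean Us (total-samples r)) (+-inverseʳ mean))) refl)
            where
            label-of : ∀ u {d l} → outer (pinned ss ds u θ) S d ≡ just l → lookup ls l Label.⊕ u ≡ Label.0G
            label-of u {d} {l} e with outer-just (pinned ss ds u θ) {d} {l} e
            ... | f , l∉ = isZero-label θ u {l} l∉ (proj₂ (proj₂ (source-just (pinned ss ds u θ) {d} {l} f)))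
            separate : ∀ {d d′ l} → outer (pinned ss ds v θ) S d ≡ just l → outer (pinned ss ds v′ θ) S d′ ≢ just l
            separate {d} {d′} {l} e e′ = v≢v′ (trans (Label.⊖-unique v (lookup ls l) (trans (Label.⊕-comm v (lookup ls l)) (label-of v {d} e)))
              (sym (Label.⊖-unique v′ (lookup ls l) (trans (Label.⊕-comm v′ (lookup ls l)) (label-of v′ {d′} e′)))))

module Success where

  open Expect
  open Pipeline
  open SearchProgram
  open Zq
  open Subsets
  open Planted
  open Attempt
  open import Data.Bool using (Bool; true; false)
  open import Data.Fin as Fin using (Fin; zero; suc; toℕ)
  import Data.Fin.Properties as Fin
  open import Data.Fin.Subset using (Subset; ∣_∣)
  open import Data.List as List using (List; []; _∷_; length)
  open import Data.Maybe as Maybe using (Maybe; just; nothing)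
  open import Data.Nat as ℕ using (ℕ; zero; suc; NonZero)
  import Data.Nat.Properties as ℕ
  open import Data.Product using (_,_; proj₂)
  open import Data.Rational as ℚ using (ℚ; 0ℚ; 1ℚ; _*_; _+_; _≤_; -_; _-_)
  open import Data.Rational.Properties hiding (_≟_)
  open import Data.Rational.Solver using (module +-*-Solver)
  open import Data.Sum using (inj₁; inj₂)
  open import Data.Unit using (tt)
  open import Data.Vec as Vec using (Vec; []; _∷_; map; lookup)
  open import Data.Vec.Properties using (lookup-map)
  open import Data.Empty using (⊥-elim)
  open import Relation.Binary.PropositionalEquality
  open import Relation.Nullary using (yes; no)

  E-affine : ∀ {A : Set} a b (f g : A → ℚ) (μ : Rand A) → Total μ → (∀ x → f x ≡ a + b * g x) → E f μ ≡ a + b * E g μ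
  E-affine a b f g μ t h = trans (E-cong μ h) (trans (E-+ (λ _ → a) (λ x → b * g x) μ) (cong₂ _+_ (E-const a μ t) (E-*ˡ b g μ)))

  ^ℚ≤1 : ∀ {x} n → 0ℚ ≤ x → x ≤ 1ℚ → x ^ℚ n ≤ 1ℚ
  ^ℚ≤1 zero x≥0 x≤1 = ≤-refl
  ^ℚ≤1 (suc n) x≥0 x≤1 = ≤-trans (*-mono x≥0 0≤1 x≤1 (^ℚ≤1 n x≥0 x≤1)) ≤-refl

  bernoulli : ∀ p n → 0ℚ ≤ p → p ≤ 1ℚ → (1ℚ - p) ^ℚ n * (1ℚ + fromℕ n * p) ≤ 1ℚ
  bernoulli p zero p≥0 p≤1 = ≤-reflexive (trans (*-identityˡ (1ℚ + 0ℚ * p)) (trans (cong (1ℚ +_) (*-zeroˡ p)) (+-identityʳ 1ℚ)))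
  bernoulli p (suc n) p≥0 p≤1 = ≤-trans (subst (λ M → (1ℚ - p) * x * (1ℚ + M * p) ≤ x * (1ℚ + N * p)) (sym (fromℕ-+ 1 n))
    (0≤diff (subst (0ℚ ≤_) eq (*-nonNeg (^ℚ≥0 n (diff≥0 p≤1)) (*-nonNeg (*-nonNeg p≥0 p≥0) (+-nonNeg 0≤1 (fromℕ≥0 n))))))) (bernoulli p n p≥0 p≤1)
    where
    open +-*-Solver
    N x : ℚ
    N = fromℕ n
    x = (1ℚ - p) ^ℚ n
    eq : x * (p * p * (1ℚ + N)) ≡ x * (1ℚ + N * p) - (1ℚ - p) * x * (1ℚ + (1ℚ + N) * p)
    eq = solve 3 (λ N x p → x :* (p :* p :* (con 1ℚ :+ N)) := x :* (con 1ℚ :+ N :* p) :- (con 1ℚ :- p) :* x :* (con 1ℚ :+ (con 1ℚ :+ N) :* p)) refl N x p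

  2ℚ : ℚ
  2ℚ = 1ℚ + 1ℚ

  halve : ∀ {a} → 2ℚ ≤ 2ℚ * a → 1ℚ ≤ a
  halve {a} h = *-cancelˡ-≤-pos 2ℚ h

  -- Either y is at least half of μ, and many trials succeed, or y deviates from μ.
  trials-bound : ∀ n {p c y μ α b} → 0ℚ ≤ p → p ≤ 1ℚ → 0ℚ ≤ c → 0ℚ ≤ α → 0ℚ ≤ b → 0ℚ ≤ μ → c * y ≤ p →
    2ℚ ≤ α * (fromℕ n * (c * μ)) → 2ℚ * 2ℚ ≤ b * (μ * μ) →
    (1ℚ - p) ^ℚ n ≤ α + b * ((y - μ) * (y - μ))
  trials-bound n {p} {c} {y} {μ} {α} {b} p≥0 p≤1 c≥0 α≥0 b≥0 μ≥0 cy≤p h₁ h₂ with ≤-total μ (y + y)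
  ... | inj₁ μ≤ = begin
    X                                    ≡⟨ sym (*-identityʳ X) ⟩
    X * 1ℚ                               ≤⟨ *-monoˡ X≥0 enough ⟩
    X * (α * (N * p))                    ≡⟨ solve 3 (λ x a t → x :* (a :* t) := a :* (x :* t)) refl X α (N * p) ⟩
    α * (X * (N * p))                    ≤⟨ *-monoˡ α≥0 (≤-trans (*-monoˡ X≥0 (≤-trans (≤-reflexive (sym (+-identityˡ (N * p)))) (+-monoˡ-≤ (N * p) 0≤1))) (bernoulli p n p≥0 p≤1)) ⟩
    α * 1ℚ                               ≡⟨ trans (*-identityʳ α) (sym (+-identityʳ α)) ⟩
    α + 0ℚ                               ≤⟨ +-monoʳ-≤ α (*-nonNeg b≥0 (sq≥0 (y - μ))) ⟩
    α + b * ((y - μ) * (y - μ)) ∎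
    where
    open ≤-Reasoning
    open +-*-Solver
    X N : ℚ
    X = (1ℚ - p) ^ℚ n
    N = fromℕ n
    X≥0 = ^ℚ≥0 n (diff≥0 p≤1)
    enough : 1ℚ ≤ α * (N * p)
    enough = halve (begin
      2ℚ                                 ≤⟨ h₁ ⟩
      α * (N * (c * μ))                  ≤⟨ *-monoˡ α≥0 (*-monoˡ (fromℕ≥0 n) (*-monoˡ c≥0 μ≤)) ⟩
      α * (N * (c * (y + y)))            ≡⟨ solve 4 (λ a N c y → a :* (N :* (c :* (y :+ y))) := (con 1ℚ :+ con 1ℚ) :* (a :* (N :* (c :* y)))) refl α N c y ⟩
      2ℚ * (α * (N * (c * y)))           ≤⟨ *-monoˡ (+-nonNeg 0≤1 0≤1) (*-monoˡ α≥0 (*-monoˡ (fromℕ≥0 n) cy≤p)) ⟩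
      2ℚ * (α * (N * p)) ∎)
  ... | inj₂ ≤μ = begin
    (1ℚ - p) ^ℚ n                        ≤⟨ ^ℚ≤1 n (diff≥0 p≤1) (0≤diff (subst (0ℚ ≤_) (solve 1 (λ p → p := con 1ℚ :- (con 1ℚ :- p)) refl p) p≥0)) ⟩
    1ℚ                                   ≤⟨ halve (halve′ (begin
      2ℚ * 2ℚ                              ≤⟨ h₂ ⟩
      b * (μ * μ)                          ≤⟨ *-monoˡ b≥0 (≤-trans (*-mono μ≥0 d≥0 μ≤d μ≤d) ≤-refl) ⟩
      b * ((μ - y + (μ - y)) * (μ - y + (μ - y)))
        ≡⟨ solve 3 (λ b m y → b :* ((m :- y :+ (m :- y)) :* (m :- y :+ (m :- y))) := (con 1ℚ :+ con 1ℚ) :* ((con 1ℚ :+ con 1ℚ) :* (b :* ((y :- m) :* (y :- m))))) refl b μ y ⟩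
      2ℚ * (2ℚ * (b * ((y - μ) * (y - μ)))) ∎)) ⟩
    b * ((y - μ) * (y - μ))              ≡⟨ sym (+-identityˡ (b * ((y - μ) * (y - μ)))) ⟩
    0ℚ + b * ((y - μ) * (y - μ))         ≤⟨ +-monoˡ-≤ (b * ((y - μ) * (y - μ))) α≥0 ⟩
    α + b * ((y - μ) * (y - μ)) ∎
    where
    open ≤-Reasoning
    open +-*-Solver
    halve′ : ∀ {a} → 2ℚ * 2ℚ ≤ 2ℚ * a → 2ℚ ≤ a
    halve′ h = *-cancelˡ-≤-pos 2ℚ h
    μ≤d : μ ≤ μ - y + (μ - y)
    μ≤d = 0≤diff (subst (0ℚ ≤_) (solve 2 (λ m y → m :- (y :+ y) := m :- y :+ (m :- y) :- m) refl μ y) (diff≥0 ≤μ))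
    d≥0 : 0ℚ ≤ μ - y + (μ - y)
    d≥0 = ≤-trans μ≥0 μ≤d

  module Amplification (q : ℕ) .{{_ : NonZero q}} (k′ D₁ D₂ r₀ m β e r : ℕ)
    (respond : Vec (Vec (Fin q) m) r → Rand Tree) (total-respond : ∀ W → Total (respond W)) (2r≤ : r ℕ.+ r ℕ.≤ q ℕ.^ β) where

    open Program q k′ D₁ D₂ r₀ using (k; instanceOf; answer; iterR)
    open Pipe q k using (checks; value)
    open PlantedInstances q m
    open Attempts q k′ D₁ D₂ r₀ m β e r respond total-respond
    open Mean r k′ guess total-guess hiding (k)

    Ψ? : ∀ {S} {ss : Vec (Fin r) k} → Elems S ss → Subset r → Vec G r → ℚ
    Ψ? el S′ Z with ∣ S′ ∣ ℕ.≟ k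
    ... | yes eq = Ψ 2r≤ el (proj₂ (elems S′ eq)) (target′ 2r≤ el (proj₂ (elems S′ eq))) Z
    ... | no _   = 0ℚ

    meanOf : Subset r → ℚ
    meanOf S′ = E (λ W → find S′ (plant S′ W)) Us

    elems-unique : ∀ {r n S} {ds ds′ : Vec (Fin r) n} → Elems S ds → Elems S ds′ → ds ≡ ds′
    elems-unique [] [] = refl
    elems-unique (out a) (out b) = cong (map suc) (elems-unique a b)
    elems-unique (ins a) (ins b) = cong (λ ds → zero ∷ map suc ds) (elems-unique a b)

    Ψ?-elems : ∀ {S} {ss : Vec (Fin r) k} (el : Elems S ss) {S′ ds} (el′ : Elems S′ ds) Z → Ψ? el S′ Z ≡ Ψ 2r≤ el el′ (target′ 2r≤ el el′) Z
    Ψ?-elems el {S′} el′ Z with ∣ S′ ∣ ℕ.≟ k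
    ... | no ne = ⊥-elim (ne (Elems-size el′))
    ... | yes eq with elems S′ eq
    ... | ds₀ , el₀ with elems-unique el₀ el′
    ... | refl = refl

    ℓ : ℕ
    ℓ = length (kSubsets r k)

    c₂ : ℚ
    c₂ = (recip q ^ℚ β) ^ℚ k * c₁ 2r≤ * fromℕ ℓ

    c₂≥0 : 0ℚ ≤ c₂
    c₂≥0 = *-nonNeg (*-nonNeg (^ℚ≥0 k (^ℚ≥0 β (recip≥0 q))) (c₁≥0 2r≤)) (fromℕ≥0 ℓ)

    mean-find : ℚ
    mean-find = recip ℓ * ΣS r k meanOf

    module _ .{{ℓ≢0 : NonZero ℓ}} {S : Subset r} {ss : Vec (Fin r) k} (el : Elems S ss) where

      density : Vec G r → ℚ
      density Z = recip ℓ * ΣS r k (λ S′ → Ψ? el S′ Z)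

      density-variance : E (λ Z → (density Z - mean-find) * (density Z - mean-find)) Us ≤ λᵉ 2r≤
      density-variance = begin
        E (λ Z → (density Z - mean-find) * (density Z - mean-find)) Us
          ≡⟨ E-cong Us (λ Z → cong₂ _*_ (centre Z) (centre Z)) ⟩
        E (λ Z → (recip ℓ * ΣS r k (dev Z)) * (recip ℓ * ΣS r k (dev Z))) Us
          ≤⟨ E-mono Us (λ Z → ΣS-sq r k {{nz}} (dev Z)) ⟩
        E (λ Z → recip ℓ * ΣS r k (λ S′ → dev Z S′ * dev Z S′)) Us
          ≡⟨ trans (E-*ˡ (recip ℓ) (λ Z → ΣS r k (λ S′ → dev Z S′ * dev Z S′)) Us) (cong (recip ℓ *_) (E-ΣS r k (λ S′ Z → dev Z S′ * dev Z S′) Us)) ⟩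
        recip ℓ * ΣS r k (λ S′ → E (λ Z → dev Z S′ * dev Z S′) Us)
          ≤⟨ *-monoˡ (recip≥0 ℓ) (ΣS-mono r k each) ⟩
        recip ℓ * ΣS r k (λ S′ → λᵉ 2r≤)
          ≡⟨ cong (recip ℓ *_) (ΣS-const r k (λᵉ 2r≤)) ⟩
        recip ℓ * (fromℕ ℓ * λᵉ 2r≤)
          ≡⟨ trans (sym (*-assoc (recip ℓ) (fromℕ ℓ) (λᵉ 2r≤))) (trans (cong (_* λᵉ 2r≤) (recip-inv ℓ)) (*-identityˡ (λᵉ 2r≤))) ⟩
        λᵉ 2r≤ ∎
        where
        open ≤-Reasoning
        nz : NonZero ℓ
        nz = recompute ℓ
          where
          recompute : ∀ n .{{_ : NonZero n}} → NonZero n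
          recompute (suc n) = _
        dev : Vec G r → Subset r → ℚ
        dev Z S′ = Ψ? el S′ Z - meanOf S′
        centre : ∀ Z → density Z - mean-find ≡ recip ℓ * ΣS r k (dev Z)
        centre Z = trans (solve 3 (λ r a b → r :* a :- r :* b := r :* (a :+ con (- 1ℚ) :* b)) refl (recip ℓ) (ΣS r k (λ S′ → Ψ? el S′ Z)) (ΣS r k meanOf))
          (cong (recip ℓ *_) (trans (cong (ΣS r k (λ S′ → Ψ? el S′ Z) +_) (sym (ΣS-* r k (- 1ℚ) meanOf)))
            (trans (sym (ΣS-+ r k (λ S′ → Ψ? el S′ Z) (λ S′ → - 1ℚ * meanOf S′))) (ΣS-cong r k λ S′ _ → cong (Ψ? el S′ Z +_) (neg1 (meanOf S′))))))
          where
          open +-*-Solver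
          neg1 : ∀ x → - 1ℚ * x ≡ - x
          neg1 x = solve 1 (λ x → con (- 1ℚ) :* x := :- x) refl x
        each : ∀ S′ → ∣ S′ ∣ ≡ k → E (λ Z → dev Z S′ * dev Z S′) Us ≤ λᵉ 2r≤
        each S′ eq = ≤-trans (≤-reflexive (E-cong Us λ Z → cong₂ _*_ (cong (_- meanOf S′) (Ψ?-elems el el′ Z)) (cong (_- meanOf S′) (Ψ?-elems el el′ Z))))
          (variance 2r≤ el el′)
          where el′ = proj₂ (elems S′ eq)

      attempt-bound : ∀ Z → c₂ * density Z ≤ attemptSuccess (plant S Z)
      attempt-bound Z = begin
        ρᵏ * c₁ 2r≤ * fromℕ ℓ * (recip ℓ * ΣS r k (λ S′ → Ψ? el S′ Z))
          ≡⟨ solve 5 (λ a b l i s → a :* b :* l :* (i :* s) := (i :* l) :* (a :* (b :* s))) refl ρᵏ (c₁ 2r≤) (fromℕ ℓ) (recip ℓ) (ΣS r k (λ S′ → Ψ? el S′ Z)) ⟩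
        recip ℓ * fromℕ ℓ * (ρᵏ * (c₁ 2r≤ * ΣS r k (λ S′ → Ψ? el S′ Z)))
          ≡⟨ trans (cong (_* (ρᵏ * (c₁ 2r≤ * ΣS r k (λ S′ → Ψ? el S′ Z)))) (recip-inv ℓ)) (*-identityˡ _) ⟩
        ρᵏ * (c₁ 2r≤ * ΣS r k (λ S′ → Ψ? el S′ Z))
          ≡⟨ cong (ρᵏ *_) (sym (ΣS-* r k (c₁ 2r≤) (λ S′ → Ψ? el S′ Z))) ⟩
        ρᵏ * ΣS r k (λ S′ → c₁ 2r≤ * Ψ? el S′ Z)
          ≤⟨ *-monoˡ ρᵏ≥0 (ΣS≤sumT r k (λ S′ → c₁ 2r≤ * Ψ? el S′ Z) (λ ds → φ (shiftDigits ss ds)) (λ ds → φ≥0 (shiftDigits ss ds))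
               (λ S′ ds el′ → ≤-trans (≤-reflexive (cong (c₁ 2r≤ *_) (Ψ?-elems el el′ Z))) (Ψ-bound 2r≤ el el′ Z))) ⟩
        ρᵏ * sumT r k (λ ds → φ (shiftDigits ss ds))
          ≤⟨ E-≥sumT q (map shiftTo ss) injective φ φ≥0 ⟩
        attemptSuccess (plant S Z) ∎
        where
        open ≤-Reasoning
        open +-*-Solver
        ρᵏ : ℚ
        ρᵏ = (recip q ^ℚ β) ^ℚ k
        ρᵏ≥0 = ^ℚ≥0 k (^ℚ≥0 β (recip≥0 q))
        φ : Vec (Vec (Fin q) β) k → ℚ
        φ ts = E (λ cs → E (λ as → E (λ ls → E (λ bs → E (λ us → hit (plant S Z) ts cs as ls bs us) Us) Cs) Ls) Cs) Ks
        φ≥0 : ∀ ts → 0ℚ ≤ φ ts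
        φ≥0 ts = E-nonNeg Ks λ cs → E-nonNeg Cs λ as → E-nonNeg Ls λ ls → E-nonNeg Cs λ bs → E-nonNeg Us λ us → hit≥0 (plant S Z) ts cs as ls bs us
        injective : ∀ j d d′ → lookup (map shiftTo ss) j d ≡ lookup (map shiftTo ss) j d′ → d ≡ d′
        injective j d d′ e = Fin.toℕ-injective (ℕ.+-cancelˡ-≡ r (toℕ d) (toℕ d′)
          (trans (sym (value-shift 2r≤ s d)) (trans (cong (λ t → value 0 t ℕ.+ toℕ s) e′) (value-shift 2r≤ s d′))))
          where
          s = lookup ss j
          e′ : shiftTo s d ≡ shiftTo s d′
          e′ = trans (cong (λ τ → τ d) (sym (lookup-map j shiftTo ss))) (trans e (cong (λ τ → τ d′) (lookup-map j shiftTo ss)))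

    attemptSuccess≥0 : ∀ X → 0ℚ ≤ attemptSuccess X
    attemptSuccess≥0 X = E-nonNeg Vs λ ts → E-nonNeg Ks λ cs → E-nonNeg Cs λ as → E-nonNeg Ls λ ls → E-nonNeg Cs λ bs → E-nonNeg Us λ us → hit≥0 X ts cs as ls bs us

    total-Vs : Total Vs
    total-Vs = Total-iid k (Total-iid β total-digit)

    total-Cs : Total Cs
    total-Cs = Total-iid r total-colours

    total-Ls : Total Ls
    total-Ls = Total-iid r Label.total-vector

    attemptSuccess≤1 : ∀ X → attemptSuccess X ≤ 1ℚ
    attemptSuccess≤1 X = E-≤const Vs total-Vs λ ts → E-≤const Ks (total-samples k′) λ cs → E-≤const Cs total-Cs λ as → E-≤const Ls total-Ls λ ls →
      E-≤const Cs total-Cs λ bs → E-≤const Us (total-samples r) λ us →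
      E-≤const (respond _) (total-respond _) λ O → indicator≤1 (checks (answer (instanceOf X ts cs as ls bs us) O) X)

    valid : Vec G r → Maybe (Vec Bool r) → ℚ
    valid X nothing  = 0ℚ
    valid X (just B) = indicator (isSolution k X B)

    open Program q k′ D₁ D₂ r₀ using (update)
    open Recover
    open Recovery q k′ D₁ D₂ r₀ m using (checks-isSolution)

    attemptsR : Vec G r → Maybe (Vec Bool r) → Rand (Maybe (Vec Bool r))
    attemptsR X old =
      Vs >>= λ ts → Ks >>= λ cs → Cs >>= λ as → Ls >>= λ ls → Cs >>= λ bs → Us >>= λ us →
      (let dst = instanceOf X ts cs as ls bs us in
      respond (map proj₂ dst) >>= λ O → return (update X old (answer dst O)))

    total-attemptsR : ∀ X old → Total (attemptsR X old)
    total-attemptsR X old = Total->>= Vs total-Vs λ ts → Total->>= Ks (total-samples k′) λ cs → Total->>= Cs total-Cs λ as →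
      Total->>= Ls total-Ls λ ls → Total->>= Cs total-Cs λ bs → Total->>= Us (total-samples r) λ us →
      Total->>= (respond _) (total-respond _) λ O → tt

    total-iterR : ∀ {A : Set} (f : A → Rand A) → (∀ a → Total (f a)) → ∀ n a → Total (iterR f n a)
    total-iterR f t zero a = tt
    total-iterR f t (suc n) a = Total->>= (f a) (t a) (total-iterR f t n)

    failure : Vec G r → Maybe (Vec Bool r) → ℚ
    failure X s = 1ℚ - valid X s

    attempts-failure : ∀ X old → E (failure X) (attemptsR X old) ≡ (1ℚ - attemptSuccess X) * failure X old
    attempts-failure X old = trans
      (trans (E->>= F Vs _) (E-affine a b _ _ Vs total-Vs λ ts →
       trans (E->>= F Ks _) (E-affine a b _ _ Ks (total-samples k′) λ cs →
       trans (E->>= F Cs _) (E-affine a b _ _ Cs total-Cs λ as →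
       trans (E->>= F Ls _) (E-affine a b _ _ Ls total-Ls λ ls →
       trans (E->>= F Cs _) (E-affine a b _ _ Cs total-Cs λ bs →
       trans (E->>= F Us _) (E-affine a b _ (λ us → hit X ts cs as ls bs us) Us (total-samples r) λ us →
       trans (E->>= F (respond _) _) (E-affine a b _ (λ O → indicator (checks (answer (instanceOf X ts cs as ls bs us) O) X)) (respond _) (total-respond _) λ O →
       leaf (answer (instanceOf X ts cs as ls bs us) O)))))))))
      (solve 2 (λ a p → a :+ (:- a) :* p := (con 1ℚ :- p) :* a) refl a (attemptSuccess X))
      where
      open +-*-Solver
      F = failure X
      a b : ℚ
      a = failure X old
      b = - a
      leaf : ∀ B → failure X (update X old B) ≡ a + b * indicator (checks B X)
      leaf B with checks B X in eq
      ... | false = sym (trans (cong (a +_) (*-zeroʳ b)) (+-identityʳ a))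
      ... | true  = trans (cong (λ c → 1ℚ - indicator c) (trans (sym (checks-isSolution B X)) eq)) (sym (trans (cong (a +_) (*-identityʳ b)) (+-inverseʳ a)))

    iterated-failure : ∀ X n s → E (failure X) (iterR (attemptsR X) n s) ≡ (1ℚ - attemptSuccess X) ^ℚ n * failure X s
    iterated-failure X zero s = sym (*-identityˡ (failure X s))
    iterated-failure X (suc n) s = trans (E->>= (failure X) (attemptsR X s) (iterR (attemptsR X) n)) (trans (E-cong (attemptsR X s) (iterated-failure X n))
      (trans (E-*ˡ ((1ℚ - attemptSuccess X) ^ℚ n) (failure X) (attemptsR X s)) (trans (cong ((1ℚ - attemptSuccess X) ^ℚ n *_) (attempts-failure X s))
        (solve 3 (λ x y z → x :* (y :* z) := y :* x :* z) refl ((1ℚ - attemptSuccess X) ^ℚ n) (1ℚ - attemptSuccess X) (failure X s)))))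
      where open +-*-Solver

    search-success : .{{_ : NonZero ℓ}} → ∀ {S} {ss : Vec (Fin r) k} (el : Elems S ss) n {α b} → 0ℚ ≤ α → 0ℚ ≤ b → 
      2ℚ ≤ α * (fromℕ n * (c₂ * mean-find)) → 2ℚ * 2ℚ ≤ b * (mean-find * mean-find) →
      1ℚ - (α + b * λᵉ 2r≤) ≤ E (λ Z → E (valid (plant S Z)) (iterR (attemptsR (plant S Z)) n nothing)) Us
    search-success {S} el n {α} {b} α≥0 b≥0 h₁ h₂ = begin
      1ℚ - (α + b * λᵉ 2r≤)
        ≤⟨ +-monoʳ-≤ 1ℚ (neg-mono bound) ⟩
      1ℚ - E (λ Z → (1ℚ - attemptSuccess (plant S Z)) ^ℚ n) Us
        ≡⟨ sym (trans (E-affine 1ℚ (- 1ℚ) _ (λ Z → (1ℚ - attemptSuccess (plant S Z)) ^ℚ n) Us (total-samples r) each)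
             (cong (1ℚ +_) (solve 1 (λ x → con (- 1ℚ) :* x := :- x) refl (E (λ Z → (1ℚ - attemptSuccess (plant S Z)) ^ℚ n) Us)))) ⟩
      E (λ Z → E (valid (plant S Z)) (iterR (attemptsR (plant S Z)) n nothing)) Us ∎
      where
      open ≤-Reasoning
      open +-*-Solver
      μ≥0 : 0ℚ ≤ mean-find
      μ≥0 = *-nonNeg (recip≥0 ℓ) (sum-nonNeg {ℓ} λ i → E-nonNeg Us λ W → find≥0 (List.lookup (kSubsets r k) i) _)
      bound : E (λ Z → (1ℚ - attemptSuccess (plant S Z)) ^ℚ n) Us ≤ α + b * λᵉ 2r≤
      bound = begin
        E (λ Z → (1ℚ - attemptSuccess (plant S Z)) ^ℚ n) Us
          ≤⟨ E-mono Us (λ Z → trials-bound n {c = c₂} {y = density el Z} (attemptSuccess≥0 (plant S Z)) (attemptSuccess≤1 (plant S Z)) c₂≥0 α≥0 b≥0 μ≥0 (attempt-bound el Z) h₁ h₂) ⟩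
        E (λ Z → α + b * ((density el Z - mean-find) * (density el Z - mean-find))) Us
          ≡⟨ E-affine α b _ (λ Z → (density el Z - mean-find) * (density el Z - mean-find)) Us (total-samples r) (λ Z → refl) ⟩
        α + b * E (λ Z → (density el Z - mean-find) * (density el Z - mean-find)) Us
          ≤⟨ +-monoʳ-≤ α (*-monoˡ b≥0 (density-variance el)) ⟩
        α + b * λᵉ 2r≤ ∎
      each : ∀ Z → E (valid (plant S Z)) (iterR (attemptsR (plant S Z)) n nothing) ≡ 1ℚ + - 1ℚ * (1ℚ - attemptSuccess (plant S Z)) ^ℚ n
      each Z = trans (E-affine 1ℚ (- 1ℚ) (valid X) (failure X) search (total-iterR (attemptsR X) (total-attemptsR X) n nothing)
          (λ s → solve 1 (λ x → x := con 1ℚ :+ con (- 1ℚ) :* (con 1ℚ :- x)) refl (valid X s)))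
        (cong (λ x → 1ℚ + - 1ℚ * x) (trans (iterated-failure X n nothing) (*-identityʳ ((1ℚ - attemptSuccess X) ^ℚ n))))
        where
        X = plant S Z
        search = iterR (attemptsR X) n nothing

module Reals where

  open Expect
  open VectorPrograms
  open Subsets using (fromℕ-cancel-≤)
  open import Data.Bool using (Bool; if_then_else_)
  open import Data.Integer as ℤ using (ℤ)
  import Data.Integer.Properties as ℤ
  open import Data.Nat as ℕ using (ℕ; zero; suc; NonZero; z≤n; s≤s; _≤_; _<_; _*_; _+_; _^_)
  import Data.Nat.Properties as ℕ
  open import Data.Nat.Induction using (<-rec)
  open import Data.Nat.Logarithm
  open import Data.Nat.Tactic.RingSolver using (solve-∀)
  open import Data.Product using (_×_; _,_; ∃-syntax)
  open import Data.Rational as ℚ using (ℚ; mkℚ; 0ℚ; 1ℚ)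
  import Data.Rational.Properties as ℚ
  open import Data.Sum using (inj₁; inj₂; [_,_]′; _⊎_)
  open import Data.Empty using (⊥; ⊥-elim)
  open import Function.Bundles using (Equivalence; mk⇔)
  open import Relation.Binary.PropositionalEquality
  open import Relation.Nullary using (yes; no; ¬_)
  open import Relation.Nullary.Decidable using (dec-true; dec-false)

  fraction : ∀ a b .{{_ : NonZero b}} → ℤ.+ a ℚ./ b ≡ fromℕ a ℚ.* recip b
  fraction a b@(suc _) = ℚ.toℚᵘ-injective (ℚᵘₚ.≃-trans (ℚ.toℚᵘ-fromℚᵘ (ℚᵘ.mkℚᵘ (ℤ.+ a) (ℕ.pred b))) (ℚᵘₚ.≃-sym (ℚᵘₚ.≃-trans (ℚ.toℚᵘ-homo-* (fromℕ a) (recip b))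
    (ℚᵘₚ.≃-trans (ℚᵘₚ.*-cong (ℚ.toℚᵘ-fromℚᵘ (ℚᵘ.mkℚᵘ (ℤ.+ a) 0)) (ℚ.toℚᵘ-fromℚᵘ (ℚᵘ.mkℚᵘ (ℤ.+ 1) (ℕ.pred b)))) (ℚᵘ.*≡* e)))))
    where
    import Data.Rational.Unnormalised as ℚᵘ
    import Data.Rational.Unnormalised.Properties as ℚᵘₚ
    e : (ℤ.+ a ℤ.* ℤ.+ 1) ℤ.* ℤ.+ b ≡ ℤ.+ a ℤ.* ℤ.+ (1 * b)
    e = cong₂ ℤ._*_ (ℤ.*-identityʳ (ℤ.+ a)) (cong ℤ.+_ (sym (ℕ.*-identityˡ b)))

  archimedean : ∀ C → 0ℚ ℚ.< C → ∃[ c ] NonZero c × recip c ℚ.≤ C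
  archimedean C@(mkℚ (ℤ.+ zero) d _) 0<C = ⊥-elim (ℚ.<-irrefl (sym C≡0) 0<C)
    where
    C≡0 : C ≡ 0ℚ
    C≡0 = ℚ.↥p≡0⇒p≡0 C refl
  archimedean C@(mkℚ ℤ.-[1+ n ] d _) 0<C = ⊥-elim (ℚ.<-asym 0<C (ℚ.negative⁻¹ C))
  archimedean C@(mkℚ (ℤ.+ suc n) d _) 0<C = suc d , _ , (begin
    recip (suc d)                          ≡⟨ sym (ℚ.*-identityˡ (recip (suc d))) ⟩
    1ℚ ℚ.* recip (suc d)                   ≤⟨ *-monoʳ (recip≥0 (suc d)) (fromℕ-mono {1} {suc n} (s≤s z≤n)) ⟩
    fromℕ (suc n) ℚ.* recip (suc d)        ≡⟨ sym (fraction (suc n) (suc d)) ⟩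
    ℤ.+ suc n ℚ./ suc d                    ≡⟨ ℚ.↥p/↧p≡p C ⟩
    C ∎)
    where open ℚ.≤-Reasoning

  ≤recip : ∀ a b .{{_ : NonZero b}} → fromℕ a ℚ.* recip b ℚ.≤ 1ℚ → a ≤ b
  ≤recip a b h = fromℕ-cancel-≤ (begin
    fromℕ a                              ≡⟨ sym (trans (ℚ.*-assoc (fromℕ a) (recip b) (fromℕ b)) (trans (cong (fromℕ a ℚ.*_) (recip-inv b)) (ℚ.*-identityʳ (fromℕ a)))) ⟩
    fromℕ a ℚ.* recip b ℚ.* fromℕ b      ≤⟨ *-monoʳ (fromℕ≥0 b) h ⟩
    1ℚ ℚ.* fromℕ b                       ≡⟨ ℚ.*-identityˡ (fromℕ b) ⟩
    fromℕ b ∎)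
    where open ℚ.≤-Reasoning

  embed : ℚ → ℝ
  embed x = record
    { Lower = λ p → p ℚ.< x
    ; Upper = λ p → x ℚ.< p
    ; lower-inhabited = x ℚ.- 1ℚ , subst (x ℚ.- 1ℚ ℚ.<_) (ℚ.+-identityʳ x) (ℚ.+-monoʳ-< x (ℚ.negative⁻¹ (ℚ.- 1ℚ)))
    ; upper-inhabited = x ℚ.+ 1ℚ , subst (ℚ._< x ℚ.+ 1ℚ) (ℚ.+-identityʳ x) (ℚ.+-monoʳ-< x (ℚ.positive⁻¹ 1ℚ))
    ; lower-rounded = mk⇔ ℚ.<-dense (λ (s , p<s , s<x) → ℚ.<-trans p<s s<x)
    ; upper-rounded = mk⇔ (λ x<p → let s , x<s , s<p = ℚ.<-dense x<p in s , s<p , x<s) (λ (s , s<p , x<s) → ℚ.<-trans x<s s<p)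
    ; disjoint = λ (p<x , x<p) → ℚ.<-asym p<x x<p
    ; located = λ {p} {s} p<s → locate p s p<s
    }
    where
    locate : ∀ p s → p ℚ.< s → _
    locate p s p<s with p ℚ.<? x
    ... | yes p<x = inj₁ p<x
    ... | no p≮x  = inj₂ (ℚ.≤-<-trans (ℚ.≮⇒≥ p≮x) p<s)

  upper-up : ∀ (x : ℝ) {p s} → Upper x p → p ℚ.< s → Upper x s
  upper-up x u p<s = Equivalence.from (upper-rounded x) (_ , p<s , u)

  lower-down : ∀ (x : ℝ) {p s} → Lower x s → p ℚ.< s → Lower x p
  lower-down x l p<s = Equivalence.from (lower-rounded x) (_ , p<s , l)

  ≤ℝ-ℝ≤ : ∀ (x : ℝ) {p s} → p ≤ℝ x → x ℝ≤ s → p ℚ.≤ s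
  ≤ℝ-ℝ≤ x {p} {s} p≤x x≤s = ℚ.≮⇒≥ λ s<p → contra (located x s<p)
    where
    contra : _ → ⊥
    contra (inj₁ l) = x≤s l
    contra (inj₂ u) = p≤x u

  <upper : ∀ (x : ℝ) {p s} → p ≤ℝ x → Upper x s → p ℚ.≤ s
  <upper x {p} {s} p≤x u = ℚ.≮⇒≥ λ s<p → p≤x (upper-up x u s<p)

  lower≤ : ∀ (x : ℝ) {p s} → x ℝ≤ s → Lower x p → p ℚ.≤ s
  lower≤ x x≤s l = ℚ.≮⇒≥ λ s<p → x≤s (lower-down x l s<p)

  log-large : ∀ n {r} → 2 ^ n ≤ r → n ≤ ⌊log₂ r ⌋
  log-large n le = subst (_≤ _) (⌊log₂[2^n]⌋≡n n) (⌊log₂⌋-mono-≤ le)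

  log-small : ∀ n {r} → r ≤ 2 ^ n → ⌊log₂ r ⌋ ≤ n
  log-small n le = subst (_ ≤_) (⌊log₂[2^n]⌋≡n n) (⌊log₂⌋-mono-≤ le)

  <2^log : ∀ r → r < 2 ^ suc ⌊log₂ r ⌋
  <2^log r = ℕ.≰⇒> λ le → ℕ.1+n≰n (log-large (suc ⌊log₂ r ⌋) le)

  n<2^n : ∀ n → n < 2 ^ n
  n<2^n zero = s≤s z≤n
  n<2^n (suc n) = ℕ.≤-trans (s≤s (n<2^n n)) (ℕ.≤-trans (ℕ.+-monoˡ-≤ (2 ^ n) (ℕ.m^n>0 2 n)) (ℕ.≤-reflexive (cong (2 ^ n +_) (sym (ℕ.+-identityʳ (2 ^ n))))))

  ^-cancel-≤ : ∀ n {a b} → a ^ suc n ≤ b ^ suc n → a ≤ b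
  ^-cancel-≤ n {a} {b} h = ℕ.≮⇒≥ λ b<a → ℕ.<⇒≱ (ℕ.^-monoˡ-< (suc n) b<a) h

  module Logs (q : ℕ) .{{_ : NonZero q}} (2≤q : 2 ≤ q) where

    open Digits q using (logStep)
    open Programs using (iter)

    logStep-cases : ∀ ρ e → (ρ < q ^ e × logStep ρ e ≡ e) ⊎ (q ^ e ≤ ρ × logStep ρ e ≡ suc e)
    logStep-cases ρ e with ρ ℕ.<? q ^ e
    ... | yes p = inj₁ (p , cong (λ b → if b then e else suc e) (dec-true (ρ ℕ.<? q ^ e) p))
    ... | no p  = inj₂ (ℕ.≮⇒≥ p , cong (λ b → if b then e else suc e) (dec-false (ρ ℕ.<? q ^ e) p))

    log-≤ : ∀ ρ n e → iter (logStep ρ) e n ≤ n + e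
    log-≤ ρ zero e = ℕ.≤-refl
    log-≤ ρ (suc n) e = ℕ.≤-trans (log-≤ ρ n (logStep ρ e)) (ℕ.≤-trans (ℕ.+-monoʳ-≤ n one) (ℕ.≤-reflexive (ℕ.+-suc n e)))
      where
      one : logStep ρ e ≤ suc e
      one with logStep-cases ρ e
      ... | inj₁ (_ , eq) = ℕ.≤-trans (ℕ.≤-reflexive eq) (ℕ.n≤1+n e)
      ... | inj₂ (_ , eq) = ℕ.≤-reflexive eq

    log-upper : ∀ ρ n e → q ^ e ≤ q * ρ → q ^ iter (logStep ρ) e n ≤ q * ρ
    log-upper ρ zero e h = h
    log-upper ρ (suc n) e h with logStep-cases ρ e
    ... | inj₁ (_ , eq) rewrite eq = log-upper ρ n e h
    ... | inj₂ (p , eq) rewrite eq = log-upper ρ n (suc e) (ℕ.*-monoʳ-≤ q p)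

    log-lower : ∀ ρ n e → ρ < q ^ (n + e) → ρ < q ^ iter (logStep ρ) e n
    log-lower ρ zero e h = h
    log-lower ρ (suc n) e h with logStep-cases ρ e
    ... | inj₂ (_ , eq) rewrite eq = log-lower ρ n (suc e) (subst (λ x → ρ < q ^ x) (sym (ℕ.+-suc n e)) h)
    ... | inj₁ (p , eq) rewrite eq = log-lower ρ n e (ℕ.<-≤-trans p (ℕ.^-monoʳ-≤ q (ℕ.m≤n+m e n)))

    log-reaches : ∀ ρ n → ρ < 2 ^ n → ρ < q ^ iter (logStep ρ) 0 n
    log-reaches ρ n h = log-lower ρ n 0 (subst (λ x → ρ < q ^ x) (sym (ℕ.+-identityʳ n)) (ℕ.<-≤-trans h (ℕ.^-monoˡ-≤ n 2≤q)))

    module Dimension (k r : ℕ) (Δ : ℝ) (Δ≤1 : Δ ℝ≤ 1ℚ) where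

      dimension-lower : ∀ {m} → klogr≤mΔlogq q k r Δ m → r ^ k ≤ q ^ suc m
      dimension-lower {m} h = ^-cancel-≤ m (begin
        (r ^ k) ^ suc m              ≡⟨ ℕ.^-*-assoc r k (suc m) ⟩
        r ^ (k * suc m)              ≤⟨ h (suc (suc m)) (suc m) up ⟩
        q ^ (m * suc (suc m))        ≤⟨ ℕ.^-monoʳ-≤ q (ℕ.≤-trans (ℕ.n≤1+n (m * suc (suc m))) (ℕ.≤-reflexive (eq m))) ⟩
        q ^ (suc m * suc m)          ≡⟨ sym (ℕ.^-*-assoc q (suc m) (suc m)) ⟩
        (q ^ suc m) ^ suc m ∎)
        where
        open ℕ.≤-Reasoning
        eq : ∀ m → suc (m * suc (suc m)) ≡ suc m * suc m
        eq = solve-∀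
        above : 1ℚ ℚ.< ℤ.+ suc (suc m) ℚ./ suc m
        above = ℚ.≰⇒> λ le → ℕ.1+n≰n (≤recip (suc (suc m)) (suc m) (subst (ℚ._≤ 1ℚ) (fraction (suc (suc m)) (suc m)) le))
        up : Upper Δ (ℤ.+ suc (suc m) ℚ./ suc m)
        up = [ (λ l → ⊥-elim (Δ≤1 l)) , (λ u → u) ]′ (located Δ above)

      dimension-upper : ∀ D .{{_ : NonZero D}} → recip D ≤ℝ Δ → klogr≤mΔlogq q k r Δ (suc ⌊log₂ r ⌋ * k * D)
      dimension-upper D D≤Δ a b u = begin
        r ^ (k * b)                                      ≤⟨ ℕ.^-monoˡ-≤ (k * b) (ℕ.<⇒≤ (<2^log r)) ⟩
        (2 ^ suc ⌊log₂ r ⌋) ^ (k * b)                    ≡⟨ ℕ.^-*-assoc 2 (suc ⌊log₂ r ⌋) (k * b) ⟩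
        2 ^ (suc ⌊log₂ r ⌋ * (k * b))                    ≤⟨ ℕ.^-monoʳ-≤ 2 (ℕ.*-monoʳ-≤ (suc ⌊log₂ r ⌋) (ℕ.*-monoʳ-≤ k b≤)) ⟩
        2 ^ (suc ⌊log₂ r ⌋ * (k * (D * a)))              ≡⟨ cong (2 ^_) (eq (suc ⌊log₂ r ⌋) k D a) ⟩
        2 ^ (suc ⌊log₂ r ⌋ * k * D * a)                  ≤⟨ ℕ.^-monoˡ-≤ (suc ⌊log₂ r ⌋ * k * D * a) 2≤q ⟩
        q ^ (suc ⌊log₂ r ⌋ * k * D * a) ∎
        where
        open ℕ.≤-Reasoning
        eq : ∀ l k D a → l * (k * (D * a)) ≡ l * k * D * a
        eq = solve-∀
        b≤ : b ≤ D * a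
        b≤ = fromℕ-cancel-≤ (ℚ.≤-trans (ℚ.≤-reflexive (sym (ℚ.*-identityˡ (fromℕ b)))) (ℚ.≤-trans (ℚ.≤-reflexive (cong (ℚ._* fromℕ b) (sym (trans (ℚ.*-comm (fromℕ D) (recip D)) (recip-inv D)))))
          (ℚ.≤-trans (*-monoʳ (fromℕ≥0 b) (*-monoˡ (fromℕ≥0 D) (<upper Δ D≤Δ u))) (ℚ.≤-reflexive (trans (ℚ.*-assoc (fromℕ D) _ (fromℕ b)) (trans (cong (fromℕ D ℚ.*_)
            (trans (cong (ℚ._* fromℕ b) (fraction a b)) (trans (ℚ.*-assoc (fromℕ a) (recip b) (fromℕ b)) (trans (cong (fromℕ a ℚ.*_) (recip-inv b)) (ℚ.*-identityʳ (fromℕ a)))))) (sym (fromℕ-* D a))))))))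

      ¬¬dimension : ∀ {n} → klogr≤mΔlogq q k r Δ n → ¬ ¬ (∃[ m ] IsDimension q k r Δ m)
      ¬¬dimension {n} h none = <-rec (λ n → ¬ klogr≤mΔlogq q k r Δ n) least n h
        where
        least : ∀ n → (∀ {n′} → n′ < n → ¬ klogr≤mΔlogq q k r Δ n′) → ¬ klogr≤mΔlogq q k r Δ n
        least n rec h = none (n , h , λ n′ h′ → ℕ.≮⇒≥ λ n′<n → rec n′<n h′)

module Glue where

  open Expect
  open Machine
  open Programs
  open VectorPrograms
  open SearchProgram
  open CostBound
  open Subsets
  open import Data.Bool using (Bool; false)
  open import Data.Fin as Fin using (Fin; zero; suc; toℕ)
  open import Data.Fin.Subset using (Subset)
  open import Data.List as List using (List; []; _∷_; length)
  open import Data.Maybe as Maybe using (Maybe; just; nothing)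
  open import Data.Nat as ℕ using (ℕ; zero; suc; NonZero; _≤_; _<_; _*_; _+_; _^_; _∸_; s≤s)
  import Data.Nat.Properties as ℕ
  open import Data.Product using (_×_; _,_; proj₁; proj₂)
  open import Data.Rational as ℚ using (ℚ; 0ℚ)
  import Data.Rational.Properties as ℚ
  open import Data.Unit using (tt)
  open import Data.Vec as Vec using (Vec; []; _∷_; map; toList; replicate)
  open import Relation.Binary.PropositionalEquality

  module Encodings (q : ℕ) .{{_ : NonZero q}} {m : ℕ} where

    open Digits q using (encG)
    open VectorKSum q m using (encode; decode)

    encode≡ : ∀ {r} (X : Vec (Vec (Fin q) m) r) → encode X ≡ encV encG X
    encode≡ X = go _ (λ x → inner x) X
      where
      inner : ∀ {n} (x : Vec (Fin q) n) → list (toList (map (λ a → numeral (toℕ a)) x)) ≡ encG x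
      inner [] = refl
      inner (a ∷ x) = cong (numeral (toℕ a) ∙_) (inner x)
      go : ∀ (f : Vec (Fin q) m → Tree) → (∀ x → f x ≡ encG x) → ∀ {r} (X : Vec (Vec (Fin q) m) r) → list (toList (map f X)) ≡ encV encG X
      go f h [] = refl
      go f h (x ∷ X) = cong₂ _∙_ (h x) (go f h X)

    decode-enc : ∀ {r} (B : Vec Bool r) → decode r (encV encB B) ≡ B
    decode-enc [] = refl
    decode-enc (b ∷ B) = cong₂ _∷_ (isCons-encB b) (decode-enc B)

  module Response (q : ℕ) .{{_ : NonZero q}} (A : Algorithm) {m : ℕ} (r T : ℕ) where

    open Digits q using (encG)

    respond : Vec (Vec (Fin q) m) r → Rand Tree
    respond W = run T (Algorithm.start A (encV encG W)) >>= λ κ → return (Vec.head (proj₂ κ))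

    total-respond : ∀ W → Total (respond W)
    total-respond W = Total->>= (run T (Algorithm.start A (encV encG W))) (Total-run T _) (λ _ → tt)

  module Reduction (q : ℕ) .{{_ : NonZero q}} (k′ D₁ D₂ r₀ : ℕ) (A : Algorithm) where

    open Program q k′ D₁ D₂ r₀
    open Compile A

    compiled : Algorithm
    compiled = record { extraVars = 4 + Algorithm.extraVars A ; body = comp main }

    module _ {m : ℕ} where

      open VectorKSum q m using (encode; decode; isSolution; solved)
      open Encodings q {m}

      validity : ∀ {r} → Vec (G {m}) r → Maybe (Vec Bool r) → ℚ
      validity X nothing = 0ℚ
      validity X (just B) = indicator (isSolution k X B)

      module _ {r : ℕ} (T S R : ℕ) (q≤S : q ≤ S) (1≤r₀ : 1 ≤ r₀) (X : Vec (G {m}) r) where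

        score : Config width → ℚ
        score κ = indicator (solved k X (Algorithm.output compiled κ))

        open SearchRules q k′ D₁ D₂ r₀ A score S R T q≤S

        small-halts : r < r₀ → Surely Halted (run (cost main) (Algorithm.start compiled (encode X)))
        small-halts r<r₀ = subst₂ (λ n t → Surely Halted (run n (Algorithm.start compiled t))) (ℕ.+-identityʳ (cost main)) (sym (encode≡ X))
          (proj₁ (halt .computes {0} [] nil (λ _ → 0ℚ) (λ _ tmp flag σ → refl , indicator≥0 _) nil nil (replicate _ nil)))
          where
          halt : RunsD main (encV encG X) nil
          halt = run-ifte false (trans (cong isCons (evalEx-tl^ (r₀ ∸ 1) env (encV encG X))) (ended X (r₀ ∸ 1) (ℕ.∸-monoˡ-≤ 1 r<r₀))) (run-lam nil)
            where
            nil-tail : ∀ j → isCons (iter tail nil j) ≡ false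
            nil-tail zero = refl
            nil-tail (suc j) = nil-tail j
            ended : ∀ {r} (X : Vec (G {m}) r) j → r ≤ j → isCons (iter tail (encV encG X) j) ≡ false
            ended [] j r≤j = nil-tail j
            ended (x ∷ X) (suc j) (s≤s r≤j) = ended X j r≤j

        module _ (halts : (W : Vec (G {m}) r) → Surely Halted (run T (Algorithm.start A (encode W)))) (r₀≤r : r₀ ≤ r)
                 (k≤S : k ≤ S) (r≤R : r ≤ R) (D₁≤S : D₁ ≤ S) (D₂≤S : D₂ ≤ S) (m<S : suc m ≤ S)
                 (p₁ : suc m ^ D₁ ≤ S) (p₂ : suc m ^ D₂ ≤ S) (S≤R : S ≤ R) where

          m≤S : m ≤ S
          m≤S = ℕ.≤-trans (ℕ.n≤1+n m) m<S

          halts′ : (W : Vec (G {m}) r) → Surely Halted (run T (Algorithm.start A (encV encG W)))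
          halts′ W = subst (λ t → Surely Halted (run T (Algorithm.start A t))) (encode≡ W) (halts W)

          e β : ℕ
          e = labelLen m≤S k≤S r≤R halts′ 1≤r₀ r₀≤r D₁≤S D₂≤S m<S p₁ p₂ S≤R
          β = shiftLen m≤S k≤S r≤R halts′ 1≤r₀ r₀≤r D₁≤S D₂≤S m<S p₁ p₂ S≤R

          search-good : e ≤ S → β ≤ S → q ^ β ≤ R →
            Good (cost main) (Algorithm.start compiled (encode X)) (E (validity X) (iterR (attempts A T β e X) (suc m ^ D₂) nothing))
          search-good e≤ β≤ q^≤ = subst₂ (λ n t → Good n (Algorithm.start compiled t) (E (validity X) (iterR (attempts A T β e X) (suc m ^ D₂) nothing))) (ℕ.+-identityʳ (cost main)) (sym (encode≡ X))
            (run-main m≤S k≤S r≤R halts′ 1≤r₀ r₀≤r D₁≤S D₂≤S m<S p₁ p₂ S≤R e≤ β≤ q^≤ X .computes {0} [] nil (validity X) (λ s tmp flag σ → refl , scored s tmp flag σ) nil nil (replicate _ nil))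
            where
            scored : ∀ s tmp flag σ → validity X s ℚ.≤ score ([] , encBest s ∷ nil ∷ tmp ∷ flag ∷ σ)
            scored nothing tmp flag σ = indicator≥0 _
            scored (just B) tmp flag σ = ℚ.≤-reflexive (cong (λ B → indicator (isSolution k X B)) (sym (decode-enc B)))

  -- Kept abstract because unfolding the compiled program, its cost or the degree
  -- of the cost is expensive.
  module Solver (q : ℕ) .{{_ : NonZero q}} (k′ D₁ D₂ r₀ : ℕ) (A : Algorithm) where

    open Digits q using (logStep)

    validity : ∀ {m r} → Vec (VectorKSum.G q m) r → Maybe (Vec Bool r) → ℚ
    validity = Reduction.validity q k′ D₁ D₂ r₀ A

    abstract

      A′ : Algorithm
      A′ = Reduction.compiled q k′ D₁ D₂ r₀ A

      time : ℕ → ℕ → ℕ → ℕ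
      time S R T = Compile.Cost.cost A S R T (Program.main q k′ D₁ D₂ r₀)

      time-polynomial : Polynomial 1 time
      time-polynomial = polynomial coefficient exponent bounded
        where open Polynomial (cost-polynomial A (Program.main q k′ D₁ D₂ r₀))

      small-halts : ∀ {m r} T S R → q ≤ S → 1 ≤ r₀ → (X : Vec (VectorKSum.G q m) r) → r < r₀ →
        Surely Halted (run (time S R T) (Algorithm.start A′ (VectorKSum.encode q m X)))
      small-halts = Reduction.small-halts q k′ D₁ D₂ r₀ A

      search-good : ∀ {m r} T S R → q ≤ S → 1 ≤ r₀ → (X : Vec (VectorKSum.G q m) r) →
        ((W : Vec (VectorKSum.G q m) r) → Surely Halted (run T (Algorithm.start A (VectorKSum.encode q m W)))) → r₀ ≤ r →
        suc k′ ≤ S → r ≤ R → D₁ ≤ S → D₂ ≤ S → suc m ≤ S → suc m ^ D₁ ≤ S → suc m ^ D₂ ≤ S → S ≤ R →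
        let e = iter (logStep (suc m ^ D₁)) 0 (suc m ^ D₁)
            β = suc (iter (logStep r) 0 (suc m ^ D₁))
        in e ≤ S → β ≤ S → q ^ β ≤ R →
        Surely Halted (run (time S R T) (Algorithm.start A′ (VectorKSum.encode q m X))) ×
        E (validity X) (Program.iterR q k′ D₁ D₂ r₀ (Program.attempts q k′ D₁ D₂ r₀ A T β e X) (suc m ^ D₂) nothing) ℚ.≤
        E (λ κ → indicator (VectorKSum.solved q m (suc k′) X (Algorithm.output A′ κ))) (run (time S R T) (Algorithm.start A′ (VectorKSum.encode q m X)))
      search-good = Reduction.search-good q k′ D₁ D₂ r₀ A

  module Outcomes (q : ℕ) .{{_ : NonZero q}} (k : ℕ) {m : ℕ} where

    open VectorKSum q m using (G; encode; decode; isSolution; solved; successProbability; planted; plant)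
    open Digits q using (encG)
    open Encodings q {m} using (encode≡)

    successProbability≡ : ∀ (B : Algorithm) r t → successProbability B r k t ≡
      E (λ Z → recip (length (kSubsets r k)) ℚ.* ΣS r k (λ S → E (λ κ → indicator (solved k (plant S Z) (Algorithm.output B κ))) (run t (Algorithm.start B (encode (plant S Z)))))) (iid (iid (choose q return) m) r)
    successProbability≡ B r t = begin
      successProbability B r k t                        ≡⟨ Pr≡E (λ b → b) (planted r k >>= body) ⟩
      E indicator (planted r k >>= body)                ≡⟨ E->>= indicator (planted r k) body ⟩
      E F (planted r k)                                 ≡⟨ E->>= F (iid (iid (choose q return) m) r) (λ Z → uniform (kSubsets r k) >>= λ S → return (plant S Z)) ⟩
      E (λ Z → E F (uniform (kSubsets r k) >>= λ S → return (plant S Z))) (iid (iid (choose q return) m) r)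
        ≡⟨ E-cong (iid (iid (choose q return) m) r) (λ Z → trans (E->>= F (uniform (kSubsets r k)) (λ S → return (plant S Z)))
             (cong (recip (length (kSubsets r k)) ℚ.*_) (ΣS-cong r k {λ S → F (plant S Z)} {λ S → E (scoreOf (plant S Z)) (final (plant S Z))}
               λ S _ → E->>= indicator (final (plant S Z)) (λ κ → return (solved k (plant S Z) (Algorithm.output B κ)))))) ⟩
      _ ∎
      where
      open ≡-Reasoning
      final : Vec G r → Rand (Config (suc (Algorithm.extraVars B)))
      final X = run t (Algorithm.start B (encode X))
      scoreOf : Vec G r → Config (suc (Algorithm.extraVars B)) → ℚ
      scoreOf X κ = indicator (solved k X (Algorithm.output B κ))
      body : Vec G r → Rand Bool
      body X = final X >>= λ κ → return (solved k X (Algorithm.output B κ))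
      F : Vec G r → ℚ
      F X = E indicator (body X)

    module _ (A : Algorithm) (r T : ℕ) where

      open Response q A {m} r T

      guess′ : Vec G r → Rand (Subset r)
      guess′ W = respond W >>= λ O → return (decode r O)

      answers-at-halt : ((W : Vec G r) → Surely Halted (run T (Algorithm.start A (encode W)))) → ∀ t X →
        E (λ κ → indicator (solved k X (Algorithm.output A κ))) (run t (Algorithm.start A (encode X))) ℚ.≤ E (λ S → indicator (isSolution k X S)) (guess′ X)
      answers-at-halt halts t X = begin
        E sc (run t κ₀)              ≤⟨ E-run-mono sc (λ κ → indicator≥0 _) (λ c cs σ → refl) T t κ₀ ⟩
        E sc (run (T + t) κ₀)        ≡⟨ cong (λ n → E sc (run n κ₀)) (ℕ.+-comm T t) ⟩
        E sc (run (t + T) κ₀)        ≡⟨ proj₂ (E-run-+ sc t T κ₀ (halts X)) ⟩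
        E sc (run T κ₀)              ≤⟨ E-mono (run T κ₀) pointwise ⟩
        E (λ κ → indicator (isSolution k X (decode r (Vec.head (proj₂ κ))))) (run T κ₀)
          ≡⟨ cong (λ t → E (λ κ → indicator (isSolution k X (decode r (Vec.head (proj₂ κ))))) (run T (Algorithm.start A t))) (encode≡ X) ⟩
        E (λ κ → indicator (isSolution k X (decode r (Vec.head (proj₂ κ))))) (run T (Algorithm.start A (encV encG X)))
          ≡⟨ sym (trans (E->>= (λ S → indicator (isSolution k X S)) (respond X) (λ O → return (decode r O))) (E->>= (λ O → indicator (isSolution k X (decode r O))) (run T (Algorithm.start A (encV encG X))) (λ κ → return (Vec.head (proj₂ κ))))) ⟩
        E (λ S → indicator (isSolution k X S)) (guess′ X) ∎
        where
        open ℚ.≤-Reasoning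
        κ₀ = Algorithm.start A (encode X)
        sc : Config (suc (Algorithm.extraVars A)) → ℚ
        sc κ = indicator (solved k X (Algorithm.output A κ))
        pointwise : ∀ κ → sc κ ℚ.≤ indicator (isSolution k X (decode r (Vec.head (proj₂ κ))))
        pointwise ([] , σ) = ℚ.≤-refl
        pointwise (_ ∷ _ , σ) = indicator≥0 _

module Numbers where

  open Expect
  open Subsets using (count; count≥)
  open import Data.Nat
  open import Data.Nat.Properties
  open import Data.Nat.Tactic.RingSolver using (solve-∀)
  open import Data.Product using (_,_)
  open import Data.Rational as ℚ using (ℚ; 1ℚ)
  import Data.Rational.Properties as ℚ
  open import Data.Rational.Solver using (module +-*-Solver)
  open import Relation.Binary.PropositionalEquality

  ^-distribʳ-* : ∀ k a b → (a * b) ^ k ≡ a ^ k * b ^ k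
  ^-distribʳ-* zero a b = refl
  ^-distribʳ-* (suc k) a b = trans (cong ((a * b) *_) (^-distribʳ-* k a b)) (e a b (a ^ k) (b ^ k))
    where
    e : ∀ a b x y → a * b * (x * y) ≡ a * x * (b * y)
    e = solve-∀

  ≤-*ʳ : ∀ a {b} → 1 ≤ b → a ≤ a * b
  ≤-*ʳ a 1≤b = ≤-trans (≤-reflexive (sym (*-identityʳ a))) (*-monoʳ-≤ a 1≤b)

  power-≤-count : ∀ r k → k + k ≤ r → r ^ k ≤ 2 ^ k * k ! * count r k
  power-≤-count r k 2k≤r with m≤n⇒∃[o]m+o≡n 2k≤r
  ... | x , refl = begin
    (k + k + x) ^ k                              ≤⟨ ^-monoˡ-≤ k (≤-trans (m≤m+n (k + k + x) (x + 2)) (≤-reflexive (e₁ k x))) ⟩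
    (2 * suc (k + x)) ^ k                        ≡⟨ ^-distribʳ-* k 2 (suc (k + x)) ⟩
    2 ^ k * suc (k + x) ^ k                      ≤⟨ *-monoʳ-≤ (2 ^ k) (count≥ (k + k + x) k (suc (k + x)) (≤-reflexive (e₂ k x))) ⟩
    2 ^ k * (k ! * count (k + k + x) k)          ≡⟨ sym (*-assoc (2 ^ k) (k !) (count (k + k + x) k)) ⟩
    2 ^ k * k ! * count (k + k + x) k ∎
    where
    open ≤-Reasoning
    e₁ : ∀ k x → k + k + x + (x + 2) ≡ 2 * suc (k + x)
    e₁ = solve-∀
    e₂ : ∀ k x → suc (k + x) + k ≡ suc (k + k + x)
    e₂ = solve-∀

  -- (2r choose k choices, colours and labels all correct) happens with
  -- probability at least 1 / (K₀ Fᵏ)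
  K₀ : ℕ → ℕ → ℕ
  K₀ q k = (q * q) ^ k * (2 ^ k * k !) * (k ^ k * (q ^ k * k ^ k))

  chance-bound : ∀ {q k r F ℓ qβ qe} → qβ ≤ q * (q * r) → qe ≤ q * F → r ^ k ≤ 2 ^ k * k ! * ℓ →
    qβ ^ k * (k ^ k * (qe ^ k * k ^ k)) ≤ ℓ * (K₀ q k * F ^ k)
  chance-bound {q} {k} {r} {F} {ℓ} {qβ} {qe} h₁ h₂ h₃ = begin
    qβ ^ k * (k ^ k * (qe ^ k * k ^ k))
      ≤⟨ *-mono-≤ (^-monoˡ-≤ k h₁) (*-monoʳ-≤ (k ^ k) (*-monoˡ-≤ (k ^ k) (^-monoˡ-≤ k h₂))) ⟩
    (q * (q * r)) ^ k * (k ^ k * ((q * F) ^ k * k ^ k))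
      ≡⟨ cong₂ (λ a b → a * (k ^ k * (b * k ^ k))) (trans (cong (_^ k) (sym (*-assoc q q r))) (^-distribʳ-* k (q * q) r)) (^-distribʳ-* k q F) ⟩
    (q * q) ^ k * r ^ k * (k ^ k * (q ^ k * F ^ k * k ^ k))
      ≤⟨ *-monoˡ-≤ (k ^ k * (q ^ k * F ^ k * k ^ k)) (*-monoʳ-≤ ((q * q) ^ k) h₃) ⟩
    (q * q) ^ k * (2 ^ k * k ! * ℓ) * (k ^ k * (q ^ k * F ^ k * k ^ k))
      ≡⟨ e ((q * q) ^ k) (2 ^ k * k !) ℓ (k ^ k) (q ^ k) (F ^ k) ⟩
    ℓ * (K₀ q k * F ^ k) ∎
    where
    open ≤-Reasoning
    e : ∀ a b l c d f → a * (b * l) * (c * (d * f * c)) ≡ l * (a * b * (c * (d * c)) * f)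
    e = solve-∀

  -- D₁, and the constant in front of the power of log r that F has to exceed
  module Parameters (q k c d : ℕ) where

    D₁ D₂ H : ℕ
    D₁ = suc (4 * d + 2)
    D₂ = D₁ * k + D₁
    H = 4 * (c * suc q * c * (c * suc q * c)) + 2 * (K₀ q k * (c * suc q * c))

    w u : ℕ → ℕ
    w L = c * L ^ d
    u L = w L * suc q * w L

    module _ {L ℓm : ℕ} .{{_ : NonZero q}} (1≤L : 1 ≤ L) (L≤ : L ≤ q * ℓm) (large : q ^ D₁ * H ≤ L) where

      F : ℕ
      F = ℓm ^ D₁

      H-bound : H * L ^ (4 * d + 2) ≤ F
      H-bound = *-cancelˡ-≤ (q ^ D₁) {{m^n≢0 q D₁}} (begin
        q ^ D₁ * (H * L ^ (4 * d + 2))   ≡⟨ sym (*-assoc (q ^ D₁) H (L ^ (4 * d + 2))) ⟩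
        q ^ D₁ * H * L ^ (4 * d + 2)     ≤⟨ *-monoˡ-≤ (L ^ (4 * d + 2)) large ⟩
        L ^ D₁                           ≤⟨ ^-monoˡ-≤ D₁ L≤ ⟩
        (q * ℓm) ^ D₁                    ≡⟨ ^-distribʳ-* D₁ q ℓm ⟩
        q ^ D₁ * F ∎)
        where open ≤-Reasoning

      variance-small : 4 * (u L * u L) * (L * L) ≤ F
      variance-small = ≤-trans (≤-trans (≤-reflexive (eq c (suc q) (L ^ d) (L * L)))
        (*-monoˡ-≤ (L ^ d * L ^ d * (L ^ d * L ^ d) * (L * L)) (m≤m+n (4 * (c * suc q * c * (c * suc q * c))) (2 * (K₀ q k * (c * suc q * c))))))
        (≤-trans (≤-reflexive (cong (H *_) powers)) H-bound)
        where
        eq : ∀ c q x y → 4 * (c * x * q * (c * x) * (c * x * q * (c * x))) * y ≡ 4 * (c * q * c * (c * q * c)) * (x * x * (x * x) * y)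
        eq = solve-∀
        powers : L ^ d * L ^ d * (L ^ d * L ^ d) * (L * L) ≡ L ^ (4 * d + 2)
        powers = trans (cong₂ _*_ (trans (cong (λ x → x * x) (sym (^-distribˡ-+-* L d d))) (sym (^-distribˡ-+-* L (d + d) (d + d)))) (cong (L *_) (sym (*-identityʳ L))))
          (trans (sym (^-distribˡ-+-* L (d + d + (d + d)) 2)) (cong (λ n → L ^ (n + 2)) (e d)))
          where
          e : ∀ d → d + d + (d + d) ≡ 4 * d
          e = solve-∀

      trials-many : 2 * (L * L * (K₀ q k * F ^ k) * u L) ≤ ℓm ^ D₂
      trials-many = begin
        2 * (L * L * (K₀ q k * F ^ k) * u L)
          ≡⟨ eq (L * L) (K₀ q k) (F ^ k) c (suc q) (L ^ d) ⟩
        2 * (K₀ q k * (c * suc q * c)) * (L ^ d * L ^ d * (L * L)) * F ^ k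
          ≤⟨ *-monoˡ-≤ (F ^ k) (*-mono-≤ (m≤n+m (2 * (K₀ q k * (c * suc q * c))) (4 * (c * suc q * c * (c * suc q * c)))) powers) ⟩
        H * L ^ (4 * d + 2) * F ^ k
          ≤⟨ *-monoˡ-≤ (F ^ k) H-bound ⟩
        F * F ^ k
          ≡⟨ *-comm F (F ^ k) ⟩
        F ^ k * F
          ≡⟨ cong (_* F) (^-*-assoc ℓm D₁ k) ⟩
        ℓm ^ (D₁ * k) * ℓm ^ D₁
          ≡⟨ sym (^-distribˡ-+-* ℓm (D₁ * k) D₁) ⟩
        ℓm ^ D₂ ∎
        where
        open ≤-Reasoning
        eq : ∀ y K f c q x → 2 * (y * (K * f) * (c * x * q * (c * x))) ≡ 2 * (K * (c * q * c)) * (x * x * y) * f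
        eq = solve-∀
        powers : L ^ d * L ^ d * (L * L) ≤ L ^ (4 * d + 2)
        powers = ≤-trans (≤-reflexive (trans (cong₂ _*_ (sym (^-distribˡ-+-* L d d)) (cong (L *_) (sym (*-identityʳ L)))) (sym (^-distribˡ-+-* L (d + d) 2))))
          (^-monoʳ-≤ L {{>-nonZero 1≤L}} (+-monoˡ-≤ 2 (≤-trans (m≤m+n (d + d) (d + d)) (≤-reflexive (e d)))))
          where
          e : ∀ d → d + d + (d + d) ≡ 4 * d
          e = solve-∀

  fromℕ*recip-≥ : ∀ {a b c} .{{_ : NonZero b}} → a * b ≤ c → fromℕ a ℚ.≤ fromℕ c ℚ.* recip b
  fromℕ*recip-≥ {a} {b} {c} h = begin
    fromℕ a                                ≡⟨ sym (ℚ.*-identityʳ (fromℕ a)) ⟩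
    fromℕ a ℚ.* 1ℚ                         ≡⟨ cong (fromℕ a ℚ.*_) (sym (trans (ℚ.*-comm (fromℕ b) (recip b)) (recip-inv b))) ⟩
    fromℕ a ℚ.* (fromℕ b ℚ.* recip b)      ≡⟨ trans (sym (ℚ.*-assoc (fromℕ a) (fromℕ b) (recip b))) (cong (ℚ._* recip b) (sym (fromℕ-* a b))) ⟩
    fromℕ (a * b) ℚ.* recip b              ≤⟨ *-monoʳ (recip≥0 b) (fromℕ-mono h) ⟩
    fromℕ c ℚ.* recip b ∎
    where open ℚ.≤-Reasoning

  fromℕ*recip-≤ : ∀ {a b c} .{{_ : NonZero b}} → c ≤ a * b → fromℕ c ℚ.* recip b ℚ.≤ fromℕ a
  fromℕ*recip-≤ {a} {b} {c} h = begin
    fromℕ c ℚ.* recip b                    ≤⟨ *-monoʳ (recip≥0 b) (fromℕ-mono h) ⟩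
    fromℕ (a * b) ℚ.* recip b              ≡⟨ trans (cong (ℚ._* recip b) (fromℕ-* a b)) (ℚ.*-assoc (fromℕ a) (fromℕ b) (recip b)) ⟩
    fromℕ a ℚ.* (fromℕ b ℚ.* recip b)      ≡⟨ cong (fromℕ a ℚ.*_) (trans (ℚ.*-comm (fromℕ b) (recip b)) (recip-inv b)) ⟩
    fromℕ a ℚ.* 1ℚ                         ≡⟨ ℚ.*-identityʳ (fromℕ a) ⟩
    fromℕ a ∎
    where open ℚ.≤-Reasoning

  recip-ratio : ∀ {M ℓ K} .{{_ : NonZero M}} .{{_ : NonZero K}} → M ≤ ℓ * K → recip K ℚ.≤ recip M ℚ.* fromℕ ℓ
  recip-ratio {M} {ℓ} {K} h = begin
    recip K                                ≡⟨ sym (ℚ.*-identityʳ (recip K)) ⟩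
    recip K ℚ.* 1ℚ                         ≤⟨ *-monoˡ (recip≥0 K) (fromℕ*recip-≥ {1} {M} (≤-trans (≤-reflexive (*-identityˡ M)) h)) ⟩
    recip K ℚ.* (fromℕ (ℓ * K) ℚ.* recip M)
      ≡⟨ cong (λ x → recip K ℚ.* (x ℚ.* recip M)) (fromℕ-* ℓ K) ⟩
    recip K ℚ.* (fromℕ ℓ ℚ.* fromℕ K ℚ.* recip M)
      ≡⟨ solve 4 (λ i l c m → i :* (l :* c :* m) := (i :* c) :* (m :* l)) refl (recip K) (fromℕ ℓ) (fromℕ K) (recip M) ⟩
    recip K ℚ.* fromℕ K ℚ.* (recip M ℚ.* fromℕ ℓ)
      ≡⟨ trans (cong (ℚ._* (recip M ℚ.* fromℕ ℓ)) (recip-inv K)) (ℚ.*-identityˡ _) ⟩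
    recip M ℚ.* fromℕ ℓ ∎
    where
    open ℚ.≤-Reasoning
    open +-*-Solver

module AtSizes where

  open Expect
  open SearchProgram
  open Subsets
  open Planted
  open Attempt
  open Success
  open Glue
  open Numbers
  open import Data.Bool using (Bool)
  open import Data.Fin as Fin using (Fin; zero; suc)
  open import Data.Fin.Subset using (Subset)
  open import Data.List as List using (List)
  open import Data.Maybe using (Maybe; nothing)
  open import Data.Nat as ℕ using (ℕ; zero; suc; NonZero; _≤_; _<_; _+_; _*_; _^_; _!)
  import Data.Nat.Properties as ℕ
  open import Data.Rational as ℚ using (ℚ; 0ℚ; 1ℚ)
  import Data.Rational.Properties as ℚ
  open import Data.Rational.Solver using (module +-*-Solver)
  open import Data.Vec as Vec using (Vec)
  open import Relation.Binary.PropositionalEquality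

  module AtSize (q : ℕ) .{{_ : NonZero q}} (k′ c d r₀ : ℕ) (A : Algorithm) (T r m β e : ℕ) (2r≤ : r + r ≤ q ^ β) where

    k : ℕ
    k = suc k′

    open Parameters q k c d public
    open Response q A using (respond; total-respond)
    open PlantedInstances q m
    open Amplification q k′ D₁ D₂ r₀ m β e r (respond r T) (total-respond r T) 2r≤
    open Attempts q k′ D₁ D₂ r₀ m β e r (respond r T) (total-respond r T)
    open Mean r k′ guess total-guess hiding (k)
    open Program q k′ D₁ D₂ r₀ using (iterR; attempts)

    mean-bound : .{{_ : NonZero ℓ}} → ∀ w .{{_ : NonZero w}} → fromℕ ℓ ℚ.* ε ℚ.≤ fromℕ q →
      recip w ℚ.≤ recip ℓ ℚ.* ΣS r k (λ S → E (λ Z → solve? (plant S Z)) Us) → recip (w * suc q * w) ℚ.≤ mean-find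
    mean-bound w few g≤ = 0≤diff (subst (0ℚ ℚ.≤_) eq₂ (+-nonNeg (diff≥0 main) (+-nonNeg (diff≥0 lower) (diff≥0 upper))))
      where
      open ℚ.≤-Reasoning
      open +-*-Solver
      instance
        _ : NonZero (w * suc q)
        _ = ℕ.m*n≢0 w (suc q)
        _ : NonZero (q ^ m)
        _ = ℕ.m^n≢0 q m
      g θ Q succ found : ℚ
      g = recip w
      θ = recip (w * suc q)
      Q = fromℕ (q ^ m)
      succ = recip ℓ ℚ.* ΣS r k (λ S → E (λ Z → solve? (plant S Z)) Us)
      found = mean-find
      εQ : ε ℚ.* Q ≡ 1ℚ
      εQ = trans (cong (ℚ._* Q) (sym (recip-^ q m))) (recip-inv (q ^ m))
      θ≥0 = recip≥0 (w * suc q)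
      main : (θ ℚ.+ θ) ℚ.* succ ℚ.≤ found ℚ.+ θ ℚ.* θ ℚ.* (1ℚ ℚ.+ fromℕ ℓ ℚ.* ε)
      main = begin
        (θ ℚ.+ θ) ℚ.* (recip ℓ ℚ.* s)
          ≡⟨ sym (trans (cong (λ x → (θ ℚ.+ θ) ℚ.* (recip ℓ ℚ.* s) ℚ.* x) εQ) (ℚ.*-identityʳ ((θ ℚ.+ θ) ℚ.* (recip ℓ ℚ.* s)))) ⟩
        (θ ℚ.+ θ) ℚ.* (recip ℓ ℚ.* s) ℚ.* (ε ℚ.* Q)
          ≡⟨ solve 5 (λ θ i s ε Q → (θ :+ θ) :* (i :* s) :* (ε :* Q) := (i :* Q) :* ((θ :+ θ) :* s :* ε)) refl θ (recip ℓ) s ε Q ⟩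
        recip ℓ ℚ.* Q ℚ.* ((θ ℚ.+ θ) ℚ.* s ℚ.* ε)
          ≤⟨ *-monoˡ (*-nonNeg (recip≥0 ℓ) (fromℕ≥0 (q ^ m))) (find-bound θ) ⟩
        recip ℓ ℚ.* Q ℚ.* (f ℚ.* ε ℚ.+ θ ℚ.* θ ℚ.* (Λ ℚ.* (ε ℚ.+ Λ ℚ.* (ε ℚ.* ε))))
          ≡⟨ solve 6 (λ i Q f ε θ Λ → i :* Q :* (f :* ε :+ θ :* θ :* (Λ :* (ε :+ Λ :* (ε :* ε)))) :=
               i :* f :* (ε :* Q) :+ θ :* θ :* ((i :* Λ) :* ((ε :* Q) :* (con 1ℚ :+ Λ :* ε)))) refl (recip ℓ) Q f ε θ Λ ⟩
        recip ℓ ℚ.* f ℚ.* (ε ℚ.* Q) ℚ.+ θ ℚ.* θ ℚ.* ((recip ℓ ℚ.* Λ) ℚ.* ((ε ℚ.* Q) ℚ.* (1ℚ ℚ.+ Λ ℚ.* ε)))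
          ≡⟨ cong₂ ℚ._+_ (trans (cong ((recip ℓ ℚ.* f) ℚ.*_) εQ) (ℚ.*-identityʳ (recip ℓ ℚ.* f)))
               (cong ((θ ℚ.* θ) ℚ.*_) (trans (cong₂ (λ a b → a ℚ.* (b ℚ.* (1ℚ ℚ.+ Λ ℚ.* ε))) (recip-inv ℓ) εQ) (trans (ℚ.*-identityˡ (1ℚ ℚ.* (1ℚ ℚ.+ Λ ℚ.* ε))) (ℚ.*-identityˡ (1ℚ ℚ.+ Λ ℚ.* ε))))) ⟩
        found ℚ.+ θ ℚ.* θ ℚ.* (1ℚ ℚ.+ Λ ℚ.* ε) ∎
        where
        s f : ℚ
        s = ΣS r k (λ S → E (λ Z → solve? (plant S Z)) Us)
        f = ΣS r k (λ S → E (λ Z → find S (plant S Z)) Us)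
      lower : (θ ℚ.+ θ) ℚ.* g ℚ.≤ (θ ℚ.+ θ) ℚ.* succ
      lower = *-monoˡ (+-nonNeg θ≥0 θ≥0) g≤
      θq : θ ℚ.* fromℕ (suc q) ≡ g
      θq = trans (cong (ℚ._* fromℕ (suc q)) (recip-* w (suc q))) (trans (ℚ.*-assoc (recip w) (recip (suc q)) (fromℕ (suc q))) (trans (cong (recip w ℚ.*_) (recip-inv (suc q))) (ℚ.*-identityʳ (recip w))))
      upper : θ ℚ.* θ ℚ.* (1ℚ ℚ.+ fromℕ ℓ ℚ.* ε) ℚ.≤ θ ℚ.* g
      upper = begin
        θ ℚ.* θ ℚ.* (1ℚ ℚ.+ fromℕ ℓ ℚ.* ε)   ≤⟨ *-monoˡ (*-nonNeg θ≥0 θ≥0) (ℚ.+-monoʳ-≤ 1ℚ few) ⟩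
        θ ℚ.* θ ℚ.* (1ℚ ℚ.+ fromℕ q)         ≡⟨ cong ((θ ℚ.* θ) ℚ.*_) (sym (fromℕ-+ 1 q)) ⟩
        θ ℚ.* θ ℚ.* fromℕ (suc q)            ≡⟨ trans (ℚ.*-assoc θ θ (fromℕ (suc q))) (cong (θ ℚ.*_) θq) ⟩
        θ ℚ.* g ∎
      eq₂ : (found ℚ.+ θ ℚ.* θ ℚ.* (1ℚ ℚ.+ fromℕ ℓ ℚ.* ε) ℚ.- (θ ℚ.+ θ) ℚ.* succ) ℚ.+ (((θ ℚ.+ θ) ℚ.* succ ℚ.- (θ ℚ.+ θ) ℚ.* g) ℚ.+ (θ ℚ.* g ℚ.- θ ℚ.* θ ℚ.* (1ℚ ℚ.+ fromℕ ℓ ℚ.* ε))) ≡ found ℚ.- recip (w * suc q * w)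
      eq₂ = trans (solve 5 (λ f x θ s g → (f :+ x :- (θ :+ θ) :* s) :+ (((θ :+ θ) :* s :- (θ :+ θ) :* g) :+ (θ :* g :- x)) := f :- θ :* g) refl found (θ ℚ.* θ ℚ.* (1ℚ ℚ.+ fromℕ ℓ ℚ.* ε)) θ succ g)
        (cong (λ x → found ℚ.- x) (sym (recip-* (w * suc q) w)))

    c₂-bound : .{{_ : NonZero ℓ}} → ∀ {F} .{{_ : NonZero F}} → q ^ β ≤ q * (q * r) → q ^ e ≤ q * F → r ^ k ≤ 2 ^ k * k ! * ℓ → recip (K₀ q k * F ^ k) ℚ.≤ c₂
    c₂-bound {F} hβ he count≥ = ℚ.≤-trans (recip-ratio {M} {ℓ} {K₀ q k * F ^ k} (chance-bound {q} {k} {r} {F} {ℓ} hβ he count≥)) (ℚ.≤-reflexive (cong (ℚ._* fromℕ ℓ) eq))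
      where
      M : ℕ
      M = (q ^ β) ^ k * (k ^ k * ((q ^ e) ^ k * k ^ k))
      instance
        nz-β : NonZero ((q ^ β) ^ k)
        nz-β = ℕ.m^n≢0 (q ^ β) k {{ℕ.m^n≢0 q β}}
        nz-e : NonZero ((q ^ e) ^ k)
        nz-e = ℕ.m^n≢0 (q ^ e) k {{ℕ.m^n≢0 q e}}
        nz-k : NonZero (k ^ k)
        nz-k = ℕ.m^n≢0 k k
        nz-M : NonZero M
        nz-M = ℕ.m*n≢0 ((q ^ β) ^ k) (k ^ k * ((q ^ e) ^ k * k ^ k)) {{nz-β}} {{ℕ.m*n≢0 (k ^ k) ((q ^ e) ^ k * k ^ k) {{nz-k}} {{ℕ.m*n≢0 ((q ^ e) ^ k) (k ^ k)}}}}
        nz-K₀ : NonZero (K₀ q k)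
        nz-K₀ = ℕ.m*n≢0 ((q * q) ^ k * (2 ^ k * k !)) (k ^ k * (q ^ k * k ^ k))
          {{ℕ.m*n≢0 ((q * q) ^ k) (2 ^ k * k !) {{ℕ.m^n≢0 (q * q) k {{ℕ.m*n≢0 q q}}}} {{ℕ.m*n≢0 (2 ^ k) (k !) {{ℕ.m^n≢0 2 k}} {{ℕ._!≢0 k}}}}}}
          {{ℕ.m*n≢0 (k ^ k) (q ^ k * k ^ k) {{nz-k}} {{ℕ.m*n≢0 (q ^ k) (k ^ k) {{ℕ.m^n≢0 q k}}}}}}
        nz-K : NonZero (K₀ q k * F ^ k)
        nz-K = ℕ.m*n≢0 (K₀ q k) (F ^ k) {{nz-K₀}} {{ℕ.m^n≢0 F k}}
      eq : recip M ≡ (recip q ^ℚ β) ^ℚ k ℚ.* c₁ 2r≤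
      eq = trans (recip-* ((q ^ β) ^ k) _) (cong₂ ℚ._*_ (trans (recip-^ (q ^ β) k) (cong (_^ℚ k) (recip-^ q β)))
        (trans (recip-* (k ^ k) _) (cong₂ ℚ._*_ (recip-^ k k) (trans (recip-* ((q ^ e) ^ k) _) (cong₂ ℚ._*_ (trans (recip-^ (q ^ e) k) (cong (_^ℚ k) (recip-^ q e))) (recip-^ k k))))))

    module _ {L : ℕ} .{{_ : NonZero L}} .{{_ : NonZero c}} .{{ℓ≢0 : NonZero ℓ}}
      (L≤ : L ≤ q * suc m) (large : q ^ D₁ * H ≤ L)
      (hβ : q ^ β ≤ q * (q * r)) (he : q ^ e ≤ q * suc m ^ D₁) (he′ : suc m ^ D₁ < q ^ e)
      (count≥ : r ^ k ≤ 2 ^ k * k ! * ℓ) (few : fromℕ ℓ ℚ.* ε ℚ.≤ fromℕ q)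
      (works : recip (w L) ℚ.≤ recip ℓ ℚ.* ΣS r k (λ S → E (λ Z → solve? (plant S Z)) Us)) where

      private
        1≤L : 1 ≤ L
        1≤L = ℕ.>-nonZero⁻¹ L
        instance
          nz-F : NonZero (suc m ^ D₁)
          nz-F = ℕ.m^n≢0 (suc m) D₁
          nz-w : NonZero (w L)
          nz-w = ℕ.m*n≢0 c (L ^ d) {{it}} {{ℕ.m^n≢0 L d}}
            where open import Function using (it)
          nz-u : NonZero (u L)
          nz-u = ℕ.m*n≢0 (w L * suc q) (w L) {{ℕ.m*n≢0 (w L) (suc q)}}
          nz-LL : NonZero (L * L)
          nz-LL = ℕ.m*n≢0 L L

      mean≥ : recip (u L) ℚ.≤ mean-find
      mean≥ = mean-bound (w L) few works

      δ : ℚ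
      δ = recip (L * L) ℚ.+ recip (L * L)

      enough-trials : 2ℚ ℚ.≤ recip (L * L) ℚ.* (fromℕ (suc m ^ D₂) ℚ.* (c₂ ℚ.* mean-find))
      enough-trials = begin
        fromℕ 2
          ≤⟨ fromℕ*recip-≥ {2} {N} {suc m ^ D₂} {{nz-N}} (trials-many {L} {suc m} 1≤L L≤ large) ⟩
        fromℕ (suc m ^ D₂) ℚ.* recip N
          ≡⟨ cong (fromℕ (suc m ^ D₂) ℚ.*_) (trans (recip-* (L * L * K) (u L)) (cong (ℚ._* recip (u L)) (recip-* (L * L) K))) ⟩
        fromℕ (suc m ^ D₂) ℚ.* (recip (L * L) ℚ.* recip K ℚ.* recip (u L))
          ≤⟨ *-monoˡ (fromℕ≥0 (suc m ^ D₂)) (*-mono (*-nonNeg (recip≥0 (L * L)) (recip≥0 K)) (ℚ.≤-trans (recip≥0 (u L)) mean≥) (*-monoˡ (recip≥0 (L * L)) (c₂-bound hβ he count≥)) mean≥) ⟩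
        fromℕ (suc m ^ D₂) ℚ.* (recip (L * L) ℚ.* c₂ ℚ.* mean-find)
          ≡⟨ solve 4 (λ n l c μ → n :* (l :* c :* μ) := l :* (n :* (c :* μ))) refl (fromℕ (suc m ^ D₂)) (recip (L * L)) c₂ mean-find ⟩
        recip (L * L) ℚ.* (fromℕ (suc m ^ D₂) ℚ.* (c₂ ℚ.* mean-find)) ∎
        where
        open ℚ.≤-Reasoning
        open +-*-Solver
        K N : ℕ
        K = K₀ q k * (suc m ^ D₁) ^ k
        N = L * L * K * u L
        nz-K : NonZero K
        nz-K = ℕ.m*n≢0 (K₀ q k) ((suc m ^ D₁) ^ k) {{nz-K₀}} {{ℕ.m^n≢0 (suc m ^ D₁) k}}
          where
          nz-k : NonZero (k ^ k)
          nz-k = ℕ.m^n≢0 k k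
          nz-K₀ : NonZero (K₀ q k)
          nz-K₀ = ℕ.m*n≢0 ((q * q) ^ k * (2 ^ k * k !)) (k ^ k * (q ^ k * k ^ k))
            {{ℕ.m*n≢0 ((q * q) ^ k) (2 ^ k * k !) {{ℕ.m^n≢0 (q * q) k {{ℕ.m*n≢0 q q}}}} {{ℕ.m*n≢0 (2 ^ k) (k !) {{ℕ.m^n≢0 2 k}} {{ℕ._!≢0 k}}}}}}
            {{ℕ.m*n≢0 (k ^ k) (q ^ k * k ^ k) {{nz-k}} {{ℕ.m*n≢0 (q ^ k) (k ^ k) {{ℕ.m^n≢0 q k}} {{nz-k}}}}}}
        nz-N : NonZero N
        nz-N = ℕ.m*n≢0 (L * L * K) (u L) {{ℕ.m*n≢0 (L * L) K {{nz-LL}} {{nz-K}}}}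

      4u² : ℕ
      4u² = 4 * (u L * u L)

      enough-precision : 2ℚ ℚ.* 2ℚ ℚ.≤ fromℕ 4u² ℚ.* (mean-find ℚ.* mean-find)
      enough-precision = begin
        fromℕ 4
          ≤⟨ fromℕ*recip-≥ {4} {u L * u L} {4u²} {{ℕ.m*n≢0 (u L) (u L)}} ℕ.≤-refl ⟩
        fromℕ 4u² ℚ.* recip (u L * u L)
          ≡⟨ cong (fromℕ 4u² ℚ.*_) (recip-* (u L) (u L)) ⟩
        fromℕ 4u² ℚ.* (recip (u L) ℚ.* recip (u L))
          ≤⟨ *-monoˡ (fromℕ≥0 4u²) (*-mono (recip≥0 (u L)) (ℚ.≤-trans (recip≥0 (u L)) mean≥) mean≥ mean≥) ⟩
        fromℕ 4u² ℚ.* (mean-find ℚ.* mean-find) ∎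
        where open ℚ.≤-Reasoning

      small-variance : fromℕ 4u² ℚ.* λᵉ 2r≤ ℚ.≤ recip (L * L)
      small-variance = begin
        fromℕ 4u² ℚ.* recip q ^ℚ e           ≡⟨ cong (fromℕ 4u² ℚ.*_) (sym (recip-^ q e)) ⟩
        fromℕ 4u² ℚ.* recip (q ^ e)          ≤⟨ *-monoˡ (fromℕ≥0 4u²) (recip-anti {4u² * (L * L)} {{nz}} (ℕ.≤-trans (variance-small {L} {suc m} 1≤L L≤ large) (ℕ.<⇒≤ he′))) ⟩
        fromℕ 4u² ℚ.* recip (4u² * (L * L))  ≡⟨ cong (fromℕ 4u² ℚ.*_) (recip-* 4u² (L * L)) ⟩
        fromℕ 4u² ℚ.* (recip 4u² ℚ.* recip (L * L))
          ≡⟨ trans (sym (ℚ.*-assoc (fromℕ 4u²) (recip 4u²) (recip (L * L)))) (trans (cong (ℚ._* recip (L * L)) (trans (ℚ.*-comm (fromℕ 4u²) (recip 4u²)) (recip-inv 4u² {{nz₁}}))) (ℚ.*-identityˡ (recip (L * L)))) ⟩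
        recip (L * L) ∎
        where
        open ℚ.≤-Reasoning
        nz₁ : NonZero 4u²
        nz₁ = ℕ.m*n≢0 4 (u L * u L) {{_}} {{ℕ.m*n≢0 (u L) (u L)}}
        nz : NonZero (4u² * (L * L))
        nz = ℕ.m*n≢0 4u² (L * L) {{nz₁}}

      success : ∀ {S} {ss : Vec (Fin r) k} → Elems S ss →
        1ℚ ℚ.- δ ℚ.≤ E (λ Z → E (valid (plant S Z)) (iterR (attempts A T β e (plant S Z)) (suc m ^ D₂) nothing)) Us
      success el = ℚ.≤-trans (ℚ.+-monoʳ-≤ 1ℚ (neg-mono (ℚ.+-monoʳ-≤ (recip (L * L)) small-variance)))
        (search-success el (suc m ^ D₂) (recip≥0 (L * L)) (fromℕ≥0 4u²) enough-trials enough-precision)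

module Final where

  open Expect
  open Machine
  open Programs
  open VectorPrograms
  open SearchProgram
  open Subsets
  open Planted
  open Attempt
  open Success
  open Glue
  open Numbers
  open Reals
  open CostBound
  open AtSizes
  open import Data.Bool using (Bool; if_then_else_)
  open import Data.Fin as Fin using (Fin; zero; suc)
  open import Data.Fin.Subset using (Subset; ∣_∣)
  open import Data.List as List using (List; length)
  open import Data.Maybe using (Maybe; just; nothing)
  open import Data.Nat as ℕ using (ℕ; zero; suc; NonZero; _≤_; _<_; _+_; _*_; _^_; z≤n; s≤s; _!)
  import Data.Nat.Properties as ℕ
  open import Data.Nat.Logarithm using (⌊log₂_⌋)
  open import Data.Nat.Tactic.RingSolver using (solve-∀)
  open import Data.Product using (_,_; proj₁; proj₂)
  open import Data.Rational as ℚ using (ℚ; 0ℚ; 1ℚ; Positive)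
  import Data.Rational.Properties as ℚ
  open import Data.Vec as Vec using (Vec)
  open import Data.Sum using ([_,_]′)
  open import Function.Bundles using (Equivalence)
  open import Relation.Binary.PropositionalEquality
  open import Relation.Nullary using (does; ¬_)
  open import Relation.Nullary.Decidable using (decidable-stable; dec-true; dec-false)

  ≤ℝ-mono : ∀ (x : ℝ) {p s} → p ℚ.≤ s → s ≤ℝ x → p ≤ℝ x
  ≤ℝ-mono x p≤s s≤x u with Equivalence.to (upper-rounded x) u
  ... | t , t<p , ut = s≤x (upper-up x ut (ℚ.<-≤-trans t<p p≤s))

  ^ℚ≥1 : ∀ {x} n → 1ℚ ℚ.≤ x → 1ℚ ℚ.≤ x ^ℚ n
  ^ℚ≥1 zero h = ℚ.≤-refl
  ^ℚ≥1 (suc n) h = ℚ.≤-trans h (ℚ.≤-trans (ℚ.≤-reflexive (sym (ℚ.*-identityʳ _))) (*-monoˡ (ℚ.≤-trans 0≤1 h) (^ℚ≥1 n h)))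

  overhead≥1 : ∀ k g .{{_ : Positive g}} → 1 ≤ k → g ℚ.≤ 1ℚ → 1ℚ ℚ.≤ overhead k g
  overhead≥1 k g 1≤k g≤1 = ^ℚ≥1 k (≥1-* (fromℕ-mono {1} {k} 1≤k) (≥1-* inv≥1 inv≥1))
    where
    g⁻¹ = (ℚ.1/ g) {{ℚ.pos⇒nonZero g}}
    ≥1-* : ∀ {x y} → 1ℚ ℚ.≤ x → 1ℚ ℚ.≤ y → 1ℚ ℚ.≤ x ℚ.* y
    ≥1-* hx hy = *-mono {1ℚ} {_} {1ℚ} 0≤1 (ℚ.≤-trans 0≤1 hy) hx hy
    inv≥1 : 1ℚ ℚ.≤ g⁻¹
    inv≥1 = begin
      1ℚ             ≡⟨ sym (ℚ.*-inverseˡ g {{ℚ.pos⇒nonZero g}}) ⟩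
      g⁻¹ ℚ.* g      ≤⟨ *-monoˡ (ℚ.<⇒≤ (ℚ.positive⁻¹ g⁻¹ {{ℚ.1/pos⇒pos g}})) g≤1 ⟩
      g⁻¹ ℚ.* 1ℚ     ≡⟨ ℚ.*-identityʳ g⁻¹ ⟩
      g⁻¹ ∎
      where open ℚ.≤-Reasoning

  Pr≤1 : ∀ {A : Set} (P : A → Bool) (μ : Rand A) → Pr P μ ℚ.≤ 1ℚ
  Pr≤1 P μ = ℚ.≤-trans (ℚ.≤-reflexive (Pr≡E P μ)) (go μ)
    where
    go : ∀ μ → E (λ a → indicator (P a)) μ ℚ.≤ 1ℚ
    go (return a) = indicator≤1 (P a)
    go (choose zero f) = ℚ.≤-trans (ℚ.≤-reflexive (ℚ.*-zeroˡ (sum {zero} (λ i → E (λ a → indicator (P a)) (f i))))) 0≤1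
    go (choose n@(suc _) f) = ℚ.≤-trans (*-monoˡ (recip≥0 n) (ℚ.≤-trans (sum-mono {n} λ i → go (f i)) (ℚ.≤-reflexive (trans (sum-const n 1ℚ) (ℚ.*-identityʳ (fromℕ n))))))
      (ℚ.≤-reflexive (recip-inv n))

  Pr≥0 : ∀ {A : Set} (P : A → Bool) (μ : Rand A) → 0ℚ ℚ.≤ Pr P μ
  Pr≥0 P μ = ℚ.≤-trans (E-nonNeg μ λ a → indicator≥0 (P a)) (ℚ.≤-reflexive (sym (Pr≡E P μ)))

  ≤⇒≯ : ∀ {p s} → p ℚ.≤ s → ¬ (s ℚ.< p)
  ≤⇒≯ h lt = ℚ.<-irrefl refl (ℚ.<-≤-trans lt h)

  module _ (q : ℕ) .{{_ : NonZero q}} (m : ℕ) (B : Algorithm) (r k t : ℕ) where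

    open VectorKSum q m

    private
      experiment : Rand Bool
      experiment = planted r k >>= λ X → run t (Algorithm.start B (encode X)) >>= λ κ → return (solved k X (Algorithm.output B κ))

    successProbability≥0 : 0ℚ ℚ.≤ successProbability B r k t
    successProbability≥0 = Pr≥0 (λ b → b) experiment

    successProbability≤1 : successProbability B r k t ℚ.≤ 1ℚ
    successProbability≤1 = Pr≤1 (λ b → b) experiment

  linear : ∀ {C} c r t .{{_ : NonZero c}} → recip c ℚ.≤ C → C ℚ.* fromℕ r ℚ.≤ fromℕ t → r ≤ c * t
  linear {C} c r t c⁻¹≤C h = fromℕ-cancel-≤ (begin
    fromℕ r                                    ≡⟨ sym (trans (cong (ℚ._* fromℕ r) (trans (ℚ.*-comm (fromℕ c) (recip c)) (recip-inv c))) (ℚ.*-identityˡ (fromℕ r))) ⟩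
    fromℕ c ℚ.* recip c ℚ.* fromℕ r            ≡⟨ ℚ.*-assoc (fromℕ c) (recip c) (fromℕ r) ⟩
    fromℕ c ℚ.* (recip c ℚ.* fromℕ r)          ≤⟨ *-monoˡ (fromℕ≥0 c) (ℚ.≤-trans (*-monoʳ (fromℕ≥0 r) c⁻¹≤C) h) ⟩
    fromℕ c ℚ.* fromℕ t                        ≡⟨ sym (fromℕ-* c t) ⟩
    fromℕ (c * t) ∎)
    where open ℚ.≤-Reasoning

  module Theorem (q : ℕ) .{{q≢0 : NonZero q}} (2≤q : 2 ≤ q) (k′ : ℕ) (Δ : ℕ → ℝ) (Δ≤1 : ∀ r → Δ r ℝ≤ 1ℚ)
    (A : Algorithm) (T : ℕ → ℕ) (γ : ℕ → ℝ)
    (cΔ cT cγ dΔ dγ rΔ rT rγ : ℕ) {{cΔ≢0 : NonZero cΔ}} {{cT≢0 : NonZero cT}} {{cγ≢0 : NonZero cγ}}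
    (Δ-large : ∀ r → rΔ ≤ r → recip cΔ ℚ.* recip (⌊log₂ r ⌋ ^ dΔ) ≤ℝ Δ r)
    (T-large : ∀ r → rT ≤ r → r ≤ cT * T r)
    (γ-large : ∀ r → rγ ≤ r → recip cγ ℚ.* recip (⌊log₂ r ⌋ ^ dγ) ≤ℝ γ r)
    (runs-A : RunsInTime q (suc k′) Δ A T) (solves-A : SolvesWithProbability q (suc k′) Δ A γ) where

    k : ℕ
    k = suc k′

    open Parameters q k cγ dγ using (D₁; D₂; H; w; u; variance-small)

    r₀ : ℕ
    r₀ = suc (rΔ + rT + rγ + 2 ^ suc (q ^ D₁ * H) + (k + k))

    open Solver q k′ D₁ D₂ r₀ A public
    open Outcomes q k using (successProbability≡; answers-at-halt)
    open Response q A using (respond; total-respond)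
    open Logs q 2≤q
    open Digits q using (logStep)

    log : ℕ → ℕ
    log r = ⌊log₂ r ⌋

    maxDim Sₜ Rₜ T′ : ℕ → ℕ
    maxDim r = suc (log r) * k * (cΔ * log r ^ dΔ)
    Sₜ r = suc (q + k + D₁ + D₂ + suc (maxDim r) ^ D₂)
    Rₜ r = q * (q * r) + Sₜ r
    T′ r = time (Sₜ r) (Rₜ r) (T r)

    guarantee : ℕ → ℚ
    guarantee r = if does (r ℕ.<? r₀) then 0ℚ else 1ℚ ℚ.- (recip (log r * log r) ℚ.+ recip (log r * log r))

    q≤S : ∀ r → q ≤ Sₜ r
    q≤S r = ℕ.≤-trans (ℕ.≤-trans (ℕ.≤-trans (ℕ.m≤m+n q k) (ℕ.m≤m+n (q + k) D₁)) (ℕ.m≤m+n (q + k + D₁) D₂)) (ℕ.≤-trans (ℕ.m≤m+n (q + k + D₁ + D₂) _) (ℕ.n≤1+n _))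

    1≤r₀ : 1 ≤ r₀
    1≤r₀ = s≤s z≤n

    module Eventually-r {r : ℕ} (r₀≤r : r₀ ≤ r) where

      sumʳ = rΔ + rT + rγ + 2 ^ suc (q ^ D₁ * H) + (k + k)

      below : ∀ {n} → n ≤ sumʳ → n ≤ r
      below le = ℕ.≤-trans le (ℕ.≤-trans (ℕ.n≤1+n sumʳ) r₀≤r)

      rΔ≤r : rΔ ≤ r
      rΔ≤r = below (ℕ.≤-trans (ℕ.≤-trans (ℕ.m≤m+n rΔ rT) (ℕ.m≤m+n (rΔ + rT) rγ)) (ℕ.≤-trans (ℕ.m≤m+n (rΔ + rT + rγ) _) (ℕ.m≤m+n (rΔ + rT + rγ + 2 ^ suc (q ^ D₁ * H)) (k + k))))

      rT≤r : rT ≤ r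
      rT≤r = below (ℕ.≤-trans (ℕ.≤-trans (ℕ.m≤n+m rT rΔ) (ℕ.m≤m+n (rΔ + rT) rγ)) (ℕ.≤-trans (ℕ.m≤m+n (rΔ + rT + rγ) _) (ℕ.m≤m+n (rΔ + rT + rγ + 2 ^ suc (q ^ D₁ * H)) (k + k))))

      rγ≤r : rγ ≤ r
      rγ≤r = below (ℕ.≤-trans (ℕ.m≤n+m rγ (rΔ + rT)) (ℕ.≤-trans (ℕ.m≤m+n (rΔ + rT + rγ) _) (ℕ.m≤m+n (rΔ + rT + rγ + 2 ^ suc (q ^ D₁ * H)) (k + k))))

      2k≤r : k + k ≤ r
      2k≤r = below (ℕ.m≤n+m (k + k) (rΔ + rT + rγ + 2 ^ suc (q ^ D₁ * H)))

      L-large : suc (q ^ D₁ * H) ≤ log r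
      L-large = log-large (suc (q ^ D₁ * H)) (below (ℕ.≤-trans (ℕ.m≤n+m (2 ^ suc (q ^ D₁ * H)) (rΔ + rT + rγ)) (ℕ.m≤m+n (rΔ + rT + rγ + 2 ^ suc (q ^ D₁ * H)) (k + k))))

      1≤L : 1 ≤ log r
      1≤L = ℕ.≤-trans (s≤s z≤n) L-large

      k≤r : k ≤ r
      k≤r = ℕ.≤-trans (ℕ.m≤m+n k k) 2k≤r

      1≤r : 1 ≤ r
      1≤r = ℕ.≤-trans (s≤s z≤n) k≤r

      instance
        nz-L : NonZero (log r)
        nz-L = ℕ.>-nonZero 1≤L
        nz-Δ : NonZero (cΔ * log r ^ dΔ)
        nz-Δ = ℕ.m*n≢0 cΔ (log r ^ dΔ) {{cΔ≢0}} {{ℕ.m^n≢0 (log r) dΔ}}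

      open Dimension k r (Δ r) (Δ≤1 r) public

      bounded-dimension : klogr≤mΔlogq q k r (Δ r) (maxDim r)
      bounded-dimension = dimension-upper (cΔ * log r ^ dΔ)
        (≤ℝ-mono (Δ r) (ℚ.≤-reflexive (recip-* cΔ (log r ^ dΔ))) (Δ-large r rΔ≤r))

    module Large {r m : ℕ} (r₀≤r : r₀ ≤ r) (dim : IsDimension q k r (Δ r) m) where

      open Eventually-r r₀≤r public
      open VectorKSum q m using (encode)

      L F et e β : ℕ
      L = log r
      F = suc m ^ D₁
      et = iter (logStep r) 0 F
      e = iter (logStep F) 0 F
      β = suc et

      halts : (W : Vec (VectorKSum.G q m) r) → Surely Halted (run (T r) (Algorithm.start A (encode W)))
      halts = runs-A r m k≤r dim

      m≤ : suc m ≤ suc (maxDim r)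
      m≤ = s≤s (proj₂ dim (maxDim r) bounded-dimension)

      ≤S : ∀ {n} → n ≤ suc (maxDim r) ^ D₂ → suc n ≤ Sₜ r
      ≤S le = s≤s (ℕ.≤-trans le (ℕ.m≤n+m (suc (maxDim r) ^ D₂) (q + k + D₁ + D₂)))

      D₁≤D₂ : D₁ ≤ D₂
      D₁≤D₂ = ℕ.m≤n+m D₁ (D₁ * k)

      F≤ : F ≤ suc (maxDim r) ^ D₂
      F≤ = ℕ.≤-trans (ℕ.^-monoˡ-≤ D₁ m≤) (ℕ.^-monoʳ-≤ (suc (maxDim r)) D₁≤D₂)

      k≤S : k ≤ Sₜ r
      k≤S = ℕ.≤-trans (ℕ.≤-trans (ℕ.≤-trans (ℕ.m≤n+m k q) (ℕ.m≤m+n (q + k) D₁)) (ℕ.m≤m+n (q + k + D₁) D₂)) (ℕ.≤-trans (ℕ.m≤m+n (q + k + D₁ + D₂) _) (ℕ.n≤1+n _))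

      D₁≤S : D₁ ≤ Sₜ r
      D₁≤S = ℕ.≤-trans (ℕ.≤-trans (ℕ.m≤n+m D₁ (q + k)) (ℕ.m≤m+n (q + k + D₁) D₂)) (ℕ.≤-trans (ℕ.m≤m+n (q + k + D₁ + D₂) _) (ℕ.n≤1+n _))

      D₂≤S : D₂ ≤ Sₜ r
      D₂≤S = ℕ.≤-trans (ℕ.m≤n+m D₂ (q + k + D₁)) (ℕ.≤-trans (ℕ.m≤m+n (q + k + D₁ + D₂) _) (ℕ.n≤1+n _))

      m<S : suc m ≤ Sₜ r
      m<S = ℕ.≤-trans (ℕ.≤-trans (≤-*ʳ (suc m) (1≤^ (4 * dγ + 2) (s≤s z≤n))) F≤) (ℕ.≤-trans (ℕ.n≤1+n _) (≤S ℕ.≤-refl))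

      p₁ : suc m ^ D₁ ≤ Sₜ r
      p₁ = ℕ.≤-trans (ℕ.n≤1+n _) (≤S F≤)

      p₂ : suc m ^ D₂ ≤ Sₜ r
      p₂ = ℕ.≤-trans (ℕ.n≤1+n _) (≤S (ℕ.^-monoˡ-≤ D₂ m≤))

      S≤R : Sₜ r ≤ Rₜ r
      S≤R = ℕ.m≤n+m (Sₜ r) (q * (q * r))

      1≤q : 1 ≤ q
      1≤q = ℕ.≤-trans (s≤s z≤n) 2≤q

      r≤R : r ≤ Rₜ r
      r≤R = ℕ.≤-trans (ℕ.≤-trans (ℕ.m≤n*m r q) (ℕ.m≤n*m (q * r) q)) (ℕ.m≤m+n (q * (q * r)) (Sₜ r))

      e≤S : e ≤ Sₜ r
      e≤S = ℕ.≤-trans (ℕ.≤-trans (log-≤ F F 0) (ℕ.≤-reflexive (ℕ.+-identityʳ F))) p₁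

      β≤S : β ≤ Sₜ r
      β≤S = ≤S (ℕ.≤-trans (ℕ.≤-trans (log-≤ r F 0) (ℕ.≤-reflexive (ℕ.+-identityʳ F))) F≤)

      hβ : q ^ β ≤ q * (q * r)
      hβ = ℕ.*-monoʳ-≤ q (log-upper r F 0 (ℕ.*-mono-≤ 1≤q 1≤r))

      qβ≤R : q ^ β ≤ Rₜ r
      qβ≤R = ℕ.≤-trans hβ (ℕ.m≤m+n (q * (q * r)) (Sₜ r))

      he : q ^ e ≤ q * F
      he = log-upper F F 0 (ℕ.*-mono-≤ 1≤q (1≤^ D₁ (s≤s z≤n)))

      he′ : F < q ^ e
      he′ = log-reaches F F (n<2^n F)

      rᵏ≤ : r ^ k ≤ q * q ^ m
      rᵏ≤ = dimension-lower {m} (proj₁ dim)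

      L≤ : L ≤ q * suc m
      L≤ = log-small (q * suc m) (begin
        r                  ≤⟨ ≤-*ʳ r (1≤^ k′ 1≤r) ⟩
        r ^ k              ≤⟨ rᵏ≤ ⟩
        q ^ suc m          ≤⟨ ℕ.^-monoˡ-≤ (suc m) (ℕ.<⇒≤ (n<2^n q)) ⟩
        (2 ^ q) ^ suc m    ≡⟨ ℕ.^-*-assoc 2 q (suc m) ⟩
        2 ^ (q * suc m) ∎)
        where open ℕ.≤-Reasoning

      large : q ^ D₁ * H ≤ L
      large = ℕ.≤-trans (ℕ.n≤1+n _) L-large

      1≤w : 1 ≤ w L
      1≤w = ℕ.*-mono-≤ (ℕ.>-nonZero⁻¹ cγ) (1≤^ dγ 1≤L)

      1≤u : 1 ≤ u L
      1≤u = ℕ.*-mono-≤ (ℕ.*-mono-≤ 1≤w (s≤s (z≤n {q}))) 1≤w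

      L<F : L < F
      L<F = begin
        suc L                      ≤⟨ ℕ.≤-trans (ℕ.+-monoˡ-≤ L 1≤L) (ℕ.≤-trans (ℕ.m≤m+n (L + L) (L + L)) (ℕ.≤-reflexive (e₁ L))) ⟩
        4 * 1 * L                  ≤⟨ ℕ.*-mono-≤ (ℕ.*-monoʳ-≤ 4 (ℕ.*-mono-≤ 1≤u 1≤u)) (≤-*ʳ L 1≤L) ⟩
        4 * (u L * u L) * (L * L)  ≤⟨ variance-small {L} {suc m} 1≤L L≤ large ⟩
        F ∎
        where
        open ℕ.≤-Reasoning
        e₁ : ∀ L → L + L + (L + L) ≡ 4 * 1 * L
        e₁ = solve-∀

      2r≤ : r + r ≤ q ^ β
      2r≤ = begin
        r + r         ≡⟨ cong (r +_) (sym (ℕ.+-identityʳ r)) ⟩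
        2 * r         ≤⟨ ℕ.*-mono-≤ 2≤q (ℕ.<⇒≤ (log-reaches r F (ℕ.<-≤-trans (<2^log r) (ℕ.^-monoʳ-≤ 2 L<F)))) ⟩
        q * q ^ et ∎
        where open ℕ.≤-Reasoning

      ℓ : ℕ
      ℓ = length (kSubsets r k)

      count≥′ : r ^ k ≤ 2 ^ k * k ! * ℓ
      count≥′ = subst (λ n → r ^ k ≤ 2 ^ k * k ! * n) (count≡length r k) (power-≤-count r k 2k≤r)

      nz-ℓ : NonZero ℓ
      nz-ℓ = ℕ.≢-nonZero λ ℓ≡0 → ℕ.<⇒≱ (1≤^ k 1≤r) (ℕ.≤-trans count≥′ (ℕ.≤-reflexive (trans (cong (2 ^ k * k ! *_) ℓ≡0) (ℕ.*-zeroʳ (2 ^ k * k !)))))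

      open PlantedInstances q m using (ε; samples; plant)

      few : fromℕ ℓ ℚ.* ε ℚ.≤ fromℕ q
      few = ℚ.≤-trans (ℚ.≤-reflexive (cong (fromℕ ℓ ℚ.*_) (sym (recip-^ q m))))
        (fromℕ*recip-≤ {q} {q ^ m} {ℓ} {{ℕ.m^n≢0 q m}} (ℕ.≤-trans (ℕ.≤-trans (ℕ.≤-reflexive (sym (count≡length r k))) (count≤ r k)) rᵏ≤))

      guess : Vec (VectorKSum.G q m) r → Rand (Subset r)
      guess = Attempts.guess q k′ D₁ D₂ r₀ m β e r (respond r (T r)) (total-respond r (T r))

      solve? : Vec (VectorKSum.G q m) r → ℚ
      solve? = PlantedInstances.Mean.solve? q m r k′ guess (Attempts.total-guess q k′ D₁ D₂ r₀ m β e r (respond r (T r)) (total-respond r (T r)))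

      valid : Vec (VectorKSum.G q m) r → Maybe (Vec Bool r) → ℚ
      valid = Amplification.valid q k′ D₁ D₂ r₀ m β e r (respond r (T r)) (total-respond r (T r)) 2r≤

      γ≤ : ∀ {s} → γ r ℝ≤ s → recip (w L) ℚ.≤ s
      γ≤ h = ≤ℝ-ℝ≤ (γ r) (≤ℝ-mono (γ r) (ℚ.≤-reflexive (recip-* cγ (L ^ dγ))) (γ-large r rγ≤r)) h

      average-samples : ∀ (φ : Subset r → Vec (VectorKSum.G q m) r → ℚ) →
        E (λ Z → recip ℓ ℚ.* ΣS r k (λ S → φ S Z)) (samples r) ≡ recip ℓ ℚ.* ΣS r k (λ S → E (φ S) (samples r))
      average-samples φ = trans (E-*ˡ (recip ℓ) (λ Z → ΣS r k (λ S → φ S Z)) (samples r)) (cong (recip ℓ ℚ.*_) (E-ΣS r k φ (samples r)))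

      works : recip (w L) ℚ.≤ recip ℓ ℚ.* ΣS r k (λ S → E (λ Z → solve? (plant S Z)) (samples r))
      works with solves-A r m k≤r dim
      ... | t , h = ℚ.≤-trans (γ≤ h) (begin
        VectorKSum.successProbability q m A r k t
          ≡⟨ successProbability≡ A r t ⟩
        E (λ Z → recip ℓ ℚ.* ΣS r k (λ S → E (λ κ → indicator (VectorKSum.solved q m k (plant S Z) (Algorithm.output A κ))) (run t (Algorithm.start A (encode (plant S Z)))))) (samples r)
          ≤⟨ E-mono (samples r) (λ Z → *-monoˡ (recip≥0 ℓ) (ΣS-mono r k λ S _ → answers-at-halt A r (T r) halts t (plant S Z))) ⟩
        E (λ Z → recip ℓ ℚ.* ΣS r k (λ S → solve? (plant S Z))) (samples r)
          ≡⟨ average-samples (λ S Z → solve? (plant S Z)) ⟩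
        recip ℓ ℚ.* ΣS r k (λ S → E (λ Z → solve? (plant S Z)) (samples r)) ∎)
        where open ℚ.≤-Reasoning

      open Program q k′ D₁ D₂ r₀ using (iterR; attempts)

      good = λ X → search-good (T r) (Sₜ r) (Rₜ r) (q≤S r) 1≤r₀ X halts r₀≤r k≤S r≤R D₁≤S D₂≤S m<S p₁ p₂ S≤R e≤S β≤S qβ≤R

      δ : ℚ
      δ = recip (L * L) ℚ.+ recip (L * L)

      search : Vec (VectorKSum.G q m) r → Rand (Maybe (Vec Bool r))
      search X = iterR (attempts A (T r) β e X) (suc m ^ D₂) nothing

      found output : Subset r → Vec (VectorKSum.G q m) r → ℚ
      found S Z = E (valid (plant S Z)) (search (plant S Z))
      output S Z = E (λ κ → indicator (VectorKSum.solved q m k (plant S Z) (Algorithm.output A′ κ))) (run (T′ r) (Algorithm.start A′ (encode (plant S Z))))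

      found≤output : ∀ S Z → found S Z ℚ.≤ output S Z
      found≤output S Z = ℚ.≤-trans (ℚ.≤-reflexive (E-cong (search (plant S Z)) same)) (proj₂ (good (plant S Z)))
        where
        same : ∀ s → valid (plant S Z) s ≡ validity (plant S Z) s
        same nothing  = refl
        same (just B) = refl

      found-often : ∀ S → ∣ S ∣ ≡ k → 1ℚ ℚ.- δ ℚ.≤ E (found S) (samples r)
      found-often S eq = AtSize.success q k′ cγ dγ r₀ A (T r) r m β e 2r≤ {L} {{nz-L}} {{cγ≢0}} {{nz-ℓ}} L≤ large hβ he he′ count≥′ few works (proj₂ (elems S eq))

      success-A′ : 1ℚ ℚ.- δ ℚ.≤ VectorKSum.successProbability q m A′ r k (T′ r)
      success-A′ = begin
        1ℚ ℚ.- δ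
          ≡⟨ sym (trans (cong (recip ℓ ℚ.*_) (ΣS-const r k (1ℚ ℚ.- δ))) (trans (sym (ℚ.*-assoc (recip ℓ) (fromℕ ℓ) (1ℚ ℚ.- δ)))
               (trans (cong (ℚ._* (1ℚ ℚ.- δ)) (recip-inv ℓ {{nz-ℓ}})) (ℚ.*-identityˡ (1ℚ ℚ.- δ))))) ⟩
        recip ℓ ℚ.* ΣS r k (λ S → 1ℚ ℚ.- δ)
          ≤⟨ *-monoˡ (recip≥0 ℓ) (ΣS-mono r k found-often) ⟩
        recip ℓ ℚ.* ΣS r k (λ S → E (found S) (samples r))
          ≡⟨ sym (average-samples found) ⟩
        E (λ Z → recip ℓ ℚ.* ΣS r k (λ S → found S Z)) (samples r)
          ≤⟨ E-mono (samples r) (λ Z → *-monoˡ (recip≥0 ℓ) (ΣS-mono r k λ S _ → found≤output S Z)) ⟩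
        E (λ Z → recip ℓ ℚ.* ΣS r k (λ S → output S Z)) (samples r)
          ≡⟨ sym (successProbability≡ A′ r (T′ r)) ⟩
        VectorKSum.successProbability q m A′ r k (T′ r) ∎
        where open ℚ.≤-Reasoning

    runs′ : RunsInTime q k Δ A′ T′
    runs′ r m k≤r dim X = [ small-halts (T r) (Sₜ r) (Rₜ r) (q≤S r) 1≤r₀ X , (λ r₀≤r → proj₁ (Large.good r₀≤r dim X)) ]′ (ℕ.<-≤-connex r r₀)

    guarantee-small : ∀ {r} → r < r₀ → guarantee r ≡ 0ℚ
    guarantee-small {r} h = cong (λ b → if b then 0ℚ else 1ℚ ℚ.- (recip (log r * log r) ℚ.+ recip (log r * log r))) (dec-true (r ℕ.<? r₀) h)

    guarantee-large : ∀ {r} → r₀ ≤ r → guarantee r ≡ 1ℚ ℚ.- (recip (log r * log r) ℚ.+ recip (log r * log r))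
    guarantee-large {r} h = cong (λ b → if b then 0ℚ else 1ℚ ℚ.- (recip (log r * log r) ℚ.+ recip (log r * log r))) (dec-false (r ℕ.<? r₀) (ℕ.≤⇒≯ h))

    solves′ : SolvesWithProbability q k Δ A′ (λ r → embed (guarantee r))
    solves′ r m k≤r dim = T′ r , ≤⇒≯ {guarantee r} {VectorKSum.successProbability q m A′ r k (T′ r)} ([ (λ r<r₀ → ℚ.≤-trans (ℚ.≤-reflexive (guarantee-small r<r₀)) (successProbability≥0 q m A′ r k (T′ r)))
                                       , (λ r₀≤r → ℚ.≤-trans (ℚ.≤-reflexive (guarantee-large r₀≤r)) (Large.success-A′ r₀≤r dim)) ]′ (ℕ.<-≤-connex r r₀))

    guarantee→1 : 1-o[1/log] (λ r → embed (guarantee r))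
    guarantee→1 C 0<C with archimedean C 0<C
    ... | c , c≢0 , c⁻¹≤C = r₀ + 2 ^ (2 * c) , λ r le → ≤⇒≯ (begin
      1ℚ ℚ.- C ℚ.* recip (log r)                               ≤⟨ ℚ.+-monoʳ-≤ 1ℚ (ℚ.neg-antimono-≤ (failure r (log-large (2 * c) (ℕ.≤-trans (ℕ.m≤n+m (2 ^ (2 * c)) r₀) le)))) ⟩
      1ℚ ℚ.- (recip (log r * log r) ℚ.+ recip (log r * log r)) ≡⟨ sym (guarantee-large (ℕ.≤-trans (ℕ.m≤m+n r₀ (2 ^ (2 * c))) le)) ⟩
      guarantee r ∎)
      where
      open ℚ.≤-Reasoning
      failure : ∀ r → 2 * c ≤ log r → recip (log r * log r) ℚ.+ recip (log r * log r) ℚ.≤ C ℚ.* recip (log r)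
      failure r 2c≤L = begin
        recip (L * L) ℚ.+ recip (L * L)                        ≡⟨ cong (λ x → x ℚ.+ x) (recip-* L L) ⟩
        recip L ℚ.* recip L ℚ.+ recip L ℚ.* recip L            ≡⟨ sym (ℚ.*-distribʳ-+ (recip L) (recip L) (recip L)) ⟩
        (recip L ℚ.+ recip L) ℚ.* recip L                      ≤⟨ *-monoʳ (recip≥0 L) (ℚ.+-mono-≤ half half) ⟩
        (recip 2 ℚ.* recip c ℚ.+ recip 2 ℚ.* recip c) ℚ.* recip L
          ≡⟨ cong (ℚ._* recip L) (trans (sym (ℚ.*-distribʳ-+ (recip c) (recip 2) (recip 2))) (ℚ.*-identityˡ (recip c))) ⟩
        recip c ℚ.* recip L                                    ≤⟨ *-monoʳ (recip≥0 L) c⁻¹≤C ⟩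
        C ℚ.* recip L ∎
        where
        L = log r
        half : recip L ℚ.≤ recip 2 ℚ.* recip c
        half = ℚ.≤-trans (recip-anti {2 * c} {L} {{ℕ.m*n≢0 2 c {{_}} {{c≢0}}}} 2c≤L) (ℚ.≤-reflexive (recip-* 2 c))

    open Polynomial time-polynomial renaming (coefficient to C₀; exponent to d₀)

    aₘ s₀ s₁ b₀ C′ d′ : ℕ
    aₘ = 1 + 2 * k * cΔ
    s₀ = suc (q + k + D₁ + D₂) + aₘ ^ D₂
    s₁ = suc dΔ * D₂
    b₀ = q * (q * cT) + s₀ + 1
    C′ = C₀ * s₀ ^ d₀ * b₀
    d′ = s₁ * suc d₀

    T′-bound : ∀ {r} → r₀ ≤ r → T′ r ≤ C′ * log r ^ d′ * T r
    T′-bound {r} r₀≤r = begin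
      T′ r                                                   ≤⟨ bounded (Sₜ r) (Rₜ r) t (s≤s z≤n) (ℕ.≤-trans (s≤s z≤n) (ℕ.m≤n+m (Sₜ r) (q * (q * r)))) ⟩
      C₀ * Sₜ r ^ d₀ * (Rₜ r + t) ^ 1                        ≤⟨ ℕ.*-mono-≤ (ℕ.*-monoʳ-≤ C₀ (ℕ.^-monoˡ-≤ d₀ S≤)) (ℕ.≤-trans (ℕ.≤-reflexive (ℕ.^-identityʳ (Rₜ r + t))) R+T≤) ⟩
      C₀ * (s₀ * W) ^ d₀ * (b₀ * (W * t))                    ≡⟨ cong (λ x → C₀ * x * (b₀ * (W * t))) (^-distribʳ-* d₀ s₀ W) ⟩
      C₀ * (s₀ ^ d₀ * W ^ d₀) * (b₀ * (W * t))               ≡⟨ e₁ C₀ (s₀ ^ d₀) (W ^ d₀) b₀ W t ⟩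
      C′ * W ^ suc d₀ * t                                    ≡⟨ cong (λ x → C′ * x * t) (ℕ.^-*-assoc L s₁ (suc d₀)) ⟩
      C′ * L ^ d′ * t ∎
      where
      open ℕ.≤-Reasoning
      open Eventually-r r₀≤r using (1≤L; 1≤r; rT≤r)
      L t W : ℕ
      L = log r
      t = T r
      W = L ^ s₁
      1≤W : 1 ≤ W
      1≤W = 1≤^ s₁ 1≤L
      e₁ : ∀ C s v b w t → C * (s * v) * (b * (w * t)) ≡ C * s * b * (w * v) * t
      e₁ = solve-∀
      maxDim≤ : suc (maxDim r) ≤ aₘ * L ^ suc dΔ
      maxDim≤ = begin
        1 + suc L * k * (cΔ * L ^ dΔ)                        ≤⟨ ℕ.+-mono-≤ (1≤^ (suc dΔ) 1≤L) (ℕ.*-monoˡ-≤ (cΔ * L ^ dΔ) (ℕ.*-monoˡ-≤ k (ℕ.+-monoˡ-≤ L 1≤L))) ⟩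
        L ^ suc dΔ + (L + L) * k * (cΔ * L ^ dΔ)             ≡⟨ e₂ L k cΔ (L ^ dΔ) ⟩
        aₘ * L ^ suc dΔ ∎
        where
        e₂ : ∀ L k c x → L * x + (L + L) * k * (c * x) ≡ (1 + 2 * k * c) * (L * x)
        e₂ = solve-∀
      S≤ : Sₜ r ≤ s₀ * W
      S≤ = begin
        suc (q + k + D₁ + D₂) + suc (maxDim r) ^ D₂          ≤⟨ ℕ.+-mono-≤ (≤-*ʳ (suc (q + k + D₁ + D₂)) 1≤W) (ℕ.^-monoˡ-≤ D₂ maxDim≤) ⟩
        suc (q + k + D₁ + D₂) * W + (aₘ * L ^ suc dΔ) ^ D₂   ≡⟨ cong (suc (q + k + D₁ + D₂) * W +_) (trans (^-distribʳ-* D₂ aₘ (L ^ suc dΔ)) (cong (aₘ ^ D₂ *_) (ℕ.^-*-assoc L (suc dΔ) D₂))) ⟩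
        suc (q + k + D₁ + D₂) * W + aₘ ^ D₂ * W              ≡⟨ sym (ℕ.*-distribʳ-+ W (suc (q + k + D₁ + D₂)) (aₘ ^ D₂)) ⟩
        s₀ * W ∎
      1≤t : 1 ≤ t
      1≤t = ℕ.n≢0⇒n>0 λ t≡0 → ℕ.<⇒≱ 1≤r (ℕ.≤-trans (T-large r rT≤r) (ℕ.≤-reflexive (trans (cong (cT *_) t≡0) (ℕ.*-zeroʳ cT))))
      R+T≤ : Rₜ r + t ≤ b₀ * (W * t)
      R+T≤ = begin
        q * (q * r) + Sₜ r + t                               ≤⟨ ℕ.+-mono-≤ (ℕ.+-mono-≤ (ℕ.≤-trans (ℕ.*-monoʳ-≤ q (ℕ.*-monoʳ-≤ q (T-large r rT≤r))) (≤-*ʳ _ 1≤W)) (ℕ.≤-trans S≤ (≤-*ʳ _ 1≤t))) (≤-*ʳ t 1≤W) ⟩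
        q * (q * (cT * t)) * W + s₀ * W * t + t * W          ≡⟨ e₃ q cT t W s₀ ⟩
        b₀ * (W * t) ∎
        where
        e₃ : ∀ q c t w s → q * (q * (c * t)) * w + s * w * t + t * w ≡ (q * (q * c) + s + 1) * (w * t)
        e₃ = solve-∀

    -- The density need not determine the dimension constructively, but as a
    -- comparison of rationals is decidable we may assume that it does.
    time-Õ : Õ[ T ·[ k / γ ²]^k] T′
    time-Õ = C′ , d′ , r₀ , λ r r₀≤r g g<γ → decidable-stable (_ ℚ.≤? _) λ slow →
      let open Eventually-r r₀≤r in ¬¬dimension {maxDim r} bounded-dimension λ (m , dim) → slow (bound r r₀≤r g (g≤1 r m k≤r dim g g<γ))
      where
      g≤1 : ∀ r m → k ≤ r → IsDimension q k r (Δ r) m → ∀ g → Lower (γ r) g → g ℚ.≤ 1ℚ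
      g≤1 r m k≤r dim g g<γ = let t , h = solves-A r m k≤r dim in ℚ.≤-trans (lower≤ (γ r) h g<γ) (successProbability≤1 q m A r k t)
      bound : ∀ r → r₀ ≤ r → ∀ g .{{_ : Positive g}} → g ℚ.≤ 1ℚ → fromℕ (T′ r) ℚ.≤ fromℕ (C′ * log r ^ d′ * T r) ℚ.* overhead k g
      bound r r₀≤r g g≤1 = begin
        fromℕ (T′ r)                                          ≤⟨ fromℕ-mono (T′-bound r₀≤r) ⟩
        fromℕ (C′ * log r ^ d′ * T r)                         ≡⟨ sym (ℚ.*-identityʳ _) ⟩
        fromℕ (C′ * log r ^ d′ * T r) ℚ.* 1ℚ                  ≤⟨ *-monoˡ (fromℕ≥0 (C′ * log r ^ d′ * T r)) (overhead≥1 k g (s≤s z≤n) g≤1) ⟩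
        fromℕ (C′ * log r ^ d′ * T r) ℚ.* overhead k g ∎
        where open ℚ.≤-Reasoning

open Final
open Expect using (*-monoʳ; recip≥0)
open Reals using (embed; archimedean)
open import Data.Nat using (ℕ; suc; _≤_; _^_; NonZero)
open import Data.Nat.Logarithm using (⌊log₂_⌋)
open import Data.Product using (_×_; ∃-syntax; _,_; proj₁; proj₂)
open import Data.Rational using (1ℚ)

theorem5p17 : (q : ℕ) .{{_ : NonZero q}} → 2 ≤ q →
    (k : ℕ) → 3 ≤ k →
    (Δ : ℕ → ℝ) → Ω[1/polylog] Δ → (∀ r → Δ r ℝ≤ 1ℚ) →
    (A : Algorithm) (T : ℕ → ℕ) (γ : ℕ → ℝ) →
    Ω[r] T → Ω[1/polylog] γ →
    RunsInTime q k Δ A T → SolvesWithProbability q k Δ A γ →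
    ∃[ A′ ] ∃[ T′ ] ∃[ ε ]
    (Õ[ T ·[ k / γ ²]^k] T′ × 1-o[1/log] ε ×
    RunsInTime q k Δ A′ T′ × SolvesWithProbability q k Δ A′ ε)
theorem5p17 q 2≤q (suc k′) _ Δ (CΔ , CΔ>0 , dΔ , rΔ , Δ-large) Δ≤1 A T γ (CT , CT>0 , rT , T-large) (Cγ , Cγ>0 , dγ , rγ , γ-large) runs-A solves-A =
  A′ , T′ , (λ r → embed (guarantee r)) , time-Õ , guarantee→1 , runs′ , solves′
  where
  boundΔ = archimedean CΔ CΔ>0
  boundT = archimedean CT CT>0
  boundγ = archimedean Cγ Cγ>0
  cΔ cT cγ : ℕ
  cΔ = proj₁ boundΔ
  cT = proj₁ boundT
  cγ = proj₁ boundγ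
  instance
    cΔ≢0 : NonZero cΔ
    cΔ≢0 = proj₁ (proj₂ boundΔ)
    cT≢0 : NonZero cT
    cT≢0 = proj₁ (proj₂ boundT)
    cγ≢0 : NonZero cγ
    cγ≢0 = proj₁ (proj₂ boundγ)
  open Theorem q 2≤q k′ Δ Δ≤1 A T γ cΔ cT cγ dΔ dγ rΔ rT rγ
    (λ r le → ≤ℝ-mono (Δ r) (*-monoʳ (recip≥0 (⌊log₂ r ⌋ ^ dΔ)) (proj₂ (proj₂ boundΔ))) (Δ-large r le))
    (λ r le → linear cT r (T r) (proj₂ (proj₂ boundT)) (T-large r le))
    (λ r le → ≤ℝ-mono (γ r) (*-monoʳ (recip≥0 (⌊log₂ r ⌋ ^ dγ)) (proj₂ (proj₂ boundγ))) (γ-large r le))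
    runs-A solves-A
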